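{- Let $\Lambda$ be a superpartition of fermionic degree $m$ and let $\ell\ge1$. Then $$s_\Lambda\,h_\ell=\sum_\Omega s_\Omega ,$$ where the sum runs over all superpartitions $\Omega$ of fermionic degree $m$ such that (1) $\Omega^*/\Lambda^*$ is a horizontal $\ell$-strip, and (2) for each $i=1,\dots,m$, the $i$-th circle of $\Omega$ and the $i$-th circle of $\Lambda$ (counting circles starting from the first row and going down) lie either in the same row or in the same column; and if they lie in the same row $r$ with $r\ge2$, the circle of $\Omega$ in row $r$ is not located past the end of row $r-1$ of $\Lambda$ (its column index is at most $\Lambda^*_{r-1}$).
   Context: Let $x=(x_1,x_2,\dots)$ be commuting variables and $\theta=(\theta_1,\theta_2,\dots)$ anticommuting variables ($\theta_i\theta_j=-\theta_j\theta_i$, $\theta_i^2=0$, commuting with the $x_j$); symmetric functions in superspace are formal series over $\mathbb Q$ of bounded degree invariant under simultaneous permutations $x_i\leftrightarrow x_j,\theta_i\leftrightarrow\theta_j$. A superpartition $\Lambda$ of fermionic degree $m$ is $(\Lambda^a;\Lambda^s)=(\Lambda_1,\dots,\Lambda_m;\Lambda_{m+1},\dots)$ with $\Lambda_1>\dots>\Lambda_m\ge0$ and $\Lambda^s$ a partition. $\Lambda^*$ is the partition with the parts of $\Lambda^a$ and $\Lambda^s$; $\Lambda^\circledast$ the partition with parts $\Lambda_i+1$ ($i\le m$) and those of $\Lambda^s$; $\Lambda^\circledast/\Lambda^*$ has $m$ cells, no two in a row or column. The diagram of $\Lambda$ is the Ferrers diagram of $\Lambda^*$ (English convention: rows numbered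 from the top, row $i$ occupying columns $1,\dots,\Lambda^*_i$) with a circle in each cell of $\Lambda^\circledast/\Lambda^*$. For partitions $\mu\subseteq\nu$, $\nu/\mu$ is a horizontal $\ell$-strip if $|\nu|-|\mu|=\ell$ and no two of its cells lie in the same column. Order: $\Omega\le\Lambda$ iff same fermionic degree, $|\Omega^*|=|\Lambda^*|$, $\Omega^*\le\Lambda^*$, $\Omega^\circledast\le\Lambda^\circledast$ (dominance). $m_\Lambda$ is the sum of all distinct monomials $\theta_{i_1}\cdots\theta_{i_m}x_{i_1}^{\Lambda_1}\cdots x_{i_m}^{\Lambda_m}x_{j_1}^{\Lambda_{m+1}}\cdots$ (distinct indices); $h_\ell$ is the usual complete symmetric function. $\tilde p_k=\sum_i\theta_ix_i^k$, $p_r=\sum_ix_i^r$, $p_\Lambda=\tilde p_{\Lambda_1}\cdots\tilde p_{\Lambda_m}p_{\Lambda_{m+1}}\cdots$. $P_\Lambda(q,t)$ is the unique family with $P_\Lambda=m_\Lambda+\sum_{\Omega<\Lambda}c_{\Lambda\Omega}m_\Omega$, pairwise orthogonal for $\langle\!\langle p_\Lambda,p_\Omega\rangle\!\rangle_{q,t}=\delta_{\Lambda\Omega}q^{|\Lambda^a|}z_{\Lambda^s}\prod_i\frac{1-q^{\Lambda^s_i}}{1-t^{\Lambda^s_i}}$ ($z_\lambda=\prod_ii^{n_i}n_i!$). $s_\Lambda$ is the limit of $P_\Lambda(q,t)$ as $q=t\to0$ (it exists; these form a basis). -}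

module Defs where

open import Data.Bool using (Bool; true; false; _∧_; _∨_; not; if_then_else_)
open import Data.Nat as ℕ using (ℕ; zero; suc; _∸_; _≤ᵇ_; _≡ᵇ_)
open import Data.Integer using (+_)
open import Data.Nat.ListAction using (sum)
open import Data.List using (List; []; _∷_; _++_; map; concatMap; length; take; upTo; filterᵇ; foldr)
open import Data.List.Relation.Binary.Pointwise using (Pointwise)
open import Data.Vec using (Vec; []; _∷_)
open import Data.Product using (_×_; _,_; Σ; ∃; ∃-syntax; proj₁; proj₂)
open import Data.Sum using (_⊎_)
open import Data.Empty using (⊥)
open import Data.Rational using (ℚ; 0ℚ; 1ℚ; _+_; _*_; _-_; -_; _<_; ∣_∣; _/_)
open import Relation.Binary.PropositionalEquality using (_≡_; _≢_)

at : List ℕ → ℕ → ℕ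
at []       _       = 0
at (x ∷ xs) zero    = x
at (x ∷ xs) (suc i) = at xs i

eqL : List ℕ → List ℕ → Bool
eqL []       []       = true
eqL (x ∷ xs) (y ∷ ys) = (x ≡ᵇ y) ∧ eqL xs ys
eqL _        _        = false

insertDesc : ℕ → List ℕ → List ℕ
insertDesc x []       = x ∷ []
insertDesc x (y ∷ ys) = if y ≤ᵇ x then x ∷ y ∷ ys else y ∷ insertDesc x ys

sortDesc : List ℕ → List ℕ
sortDesc = foldr insertDesc []

strictDesc : List ℕ → Bool
strictDesc []           = true
strictDesc (x ∷ [])     = true
strictDesc (x ∷ y ∷ xs) = (suc y ≤ᵇ x) ∧ strictDesc (y ∷ xs)

weakDesc : List ℕ → Bool
weakDesc []           = true
weakDesc (x ∷ [])     = true
weakDesc (x ∷ y ∷ xs) = (y ≤ᵇ x) ∧ weakDesc (y ∷ xs)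

allPos : List ℕ → Bool
allPos []       = true
allPos (x ∷ xs) = (1 ≤ᵇ x) ∧ allPos xs

-- Superpartitions  Λ = (Λ^a ; Λ^s)  represented as a pair of lists

SPart : Set
SPart = List ℕ × List ℕ

isSPart : SPart → Bool
isSPart (a , s) = strictDesc a ∧ weakDesc s ∧ allPos s

fdeg : SPart → ℕ
fdeg (a , s) = length a

bdeg : SPart → ℕ
bdeg (a , s) = sum a ℕ.+ sum s

-- Λ^* (keeping zero parts coming from Λ^a; harmless, entries past the end read as 0)
star : SPart → List ℕ
star (a , s) = sortDesc (a ++ s)

circ : SPart → List ℕ
circ (a , s) = sortDesc (map suc a ++ s)

listsLen : ℕ → ℕ → List (List ℕ)
listsLen zero    B = [] ∷ []
listsLen (suc k) B = concatMap (λ x → map (x ∷_) (listsLen k B)) (upTo (suc B))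

listsLeq : ℕ → ℕ → List (List ℕ)
listsLeq k B = concatMap (λ j → listsLen j B) (upTo (suc k))

-- enumeration (without repetition) of all superpartitions of bosonic degree n, fermionic degree m
sector : ℕ → ℕ → List SPart
sector n m = filterᵇ (λ Λ → isSPart Λ ∧ (bdeg Λ ≡ᵇ n))
  (concatMap (λ a → map (a ,_) (listsLeq n n)) (listsLen m n))

Dom : List ℕ → List ℕ → Set
Dom μ ν = (sum μ ≡ sum ν) × (∀ k → sum (take k μ) ℕ.≤ sum (take k ν))

_≤SP_ : SPart → SPart → Set
Ω ≤SP Λ = (fdeg Ω ≡ fdeg Λ) × Dom (star Ω) (star Λ) × Dom (circ Ω) (circ Λ)

-- Superpolynomials in N commuting variables x_1..x_N and N anticommuting θ_1..θ_N,
-- as coefficient functions on the normal-ordered monomials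
--   x^a θ_S  :=  x_1^{a_1}⋯x_N^{a_N} θ_{j_1}⋯θ_{j_k}   (S = {j_1 < ⋯ < j_k})

Mon : ℕ → Set
Mon N = Vec ℕ N × Vec Bool N

Poly : ℕ → Set
Poly N = Mon N → ℚ

_≐_ : ∀ {N} → Poly N → Poly N → Set
f ≐ g = ∀ μ → f μ ≡ g μ

ℕtoℚ : ℕ → ℚ
ℕtoℚ n = + n / 1

powℚ : ℚ → ℕ → ℚ
powℚ q zero    = 1ℚ
powℚ q (suc k) = q * powℚ q k

sgn : ℕ → ℚ
sgn zero    = 1ℚ
sgn (suc k) = - sgn k

sumℚ : List ℚ → ℚ
sumℚ = foldr _+_ 0ℚ

zeroP : ∀ {N} → Poly N
zeroP _ = 0ℚ

_⊕_ : ∀ {N} → Poly N → Poly N → Poly N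
(f ⊕ g) μ = f μ + g μ

_⊙_ : ∀ {N} → ℚ → Poly N → Poly N
(c ⊙ f) μ = c * f μ

ΣP : ∀ {N} {X : Set} → List X → (X → Poly N) → Poly N
ΣP xs f = foldr (λ x acc → f x ⊕ acc) zeroP xs

countT : ∀ {N} → Vec Bool N → ℕ
countT []           = 0
countT (true ∷ S)   = suc (countT S)
countT (false ∷ S)  = countT S

-- number of pairs (i ∈ T, j ∈ U) with i > j : sign of reordering θ_T θ_U into θ_{T∪U}
inv : ∀ {N} → Vec Bool N → Vec Bool N → ℕ
inv []      []      = 0
inv (t ∷ T) (u ∷ U) = (if u then countT T else 0) ℕ.+ inv T U

splitsV : ∀ {N} → Vec ℕ N → List (Vec ℕ N × Vec ℕ N)
splitsV []      = ([] , []) ∷ []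
splitsV (x ∷ a) = concatMap (λ i → map (λ p → (i ∷ proj₁ p) , ((x ∸ i) ∷ proj₂ p)) (splitsV a)) (upTo (suc x))

splitsB : ∀ {N} → Vec Bool N → List (Vec Bool N × Vec Bool N)
splitsB []          = ([] , []) ∷ []
splitsB (false ∷ S) = map (λ p → (false ∷ proj₁ p) , (false ∷ proj₂ p)) (splitsB S)
splitsB (true ∷ S)  = map (λ p → (true ∷ proj₁ p) , (false ∷ proj₂ p)) (splitsB S)
                   ++ map (λ p → (false ∷ proj₁ p) , (true ∷ proj₂ p)) (splitsB S)

_⊗_ : ∀ {N} → Poly N → Poly N → Poly N
(f ⊗ g) (a , S) = sumℚ (concatMap (λ bc → map (λ TU →
     sgn (inv (proj₁ TU) (proj₂ TU)) * f (proj₁ bc , proj₁ TU) * g (proj₂ bc , proj₂ TU))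
     (splitsB S)) (splitsV a))

oneP : ∀ {N} → Poly N
oneP (a , S) = if allZ a ∧ allF S then 1ℚ else 0ℚ
  where
  allZ : ∀ {k} → Vec ℕ k → Bool
  allZ []      = true
  allZ (x ∷ v) = (x ≡ᵇ 0) ∧ allZ v
  allF : ∀ {k} → Vec Bool k → Bool
  allF []      = true
  allF (b ∷ v) = not b ∧ allF v

bool2ℚ : Bool → ℚ
bool2ℚ b = if b then 1ℚ else 0ℚ

allZero : ∀ {k} → Vec ℕ k → Bool
allZero []      = true
allZero (x ∷ v) = (x ≡ᵇ 0) ∧ allZero v

allFalse : ∀ {k} → Vec Bool k → Bool
allFalse []      = true
allFalse (b ∷ v) = not b ∧ allFalse v

sumV : ∀ {k} → Vec ℕ k → ℕ
sumV []      = 0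
sumV (x ∷ v) = x ℕ.+ sumV v

hP : ∀ {N} → ℕ → Poly N
hP ℓ (a , S) = bool2ℚ (allFalse S ∧ (sumV a ≡ᵇ ℓ))

-- ~p_k = Σ_i θ_i x_i^k
ptC : ∀ {N} → ℕ → Vec ℕ N → Vec Bool N → Bool
ptC k []      []          = false
ptC k (x ∷ a) (true ∷ S)  = (x ≡ᵇ k) ∧ allZero a ∧ allFalse S
ptC k (x ∷ a) (false ∷ S) = (x ≡ᵇ 0) ∧ ptC k a S

ptP : ∀ {N} → ℕ → Poly N
ptP k (a , S) = bool2ℚ (ptC k a S)

-- p_r = Σ_i x_i^r  (r ≥ 1)
prC : ∀ {N} → ℕ → Vec ℕ N → Bool
prC r []      = false
prC r (x ∷ a) = ((x ≡ᵇ r) ∧ allZero a) ∨ ((x ≡ᵇ 0) ∧ prC r a)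

prP : ∀ {N} → ℕ → Poly N
prP r (a , S) = bool2ℚ (allFalse S ∧ prC r a)

pP : ∀ {N} → SPart → Poly N
pP (a , s) = foldr _⊗_ oneP (map ptP a ++ map prP s)

antiExps : ∀ {N} → Vec ℕ N → Vec Bool N → List ℕ
antiExps []      []          = []
antiExps (x ∷ a) (true ∷ S)  = x ∷ antiExps a S
antiExps (x ∷ a) (false ∷ S) = antiExps a S

symExps : ∀ {N} → Vec ℕ N → Vec Bool N → List ℕ
symExps []      []          = []
symExps (x ∷ a) (true ∷ S)  = symExps a S
symExps (x ∷ a) (false ∷ S) = if x ≡ᵇ 0 then symExps a S else x ∷ symExps a S

ascPairs : List ℕ → ℕ
ascPairs []       = 0
ascPairs (x ∷ xs) = length (filterᵇ (λ y → suc x ≤ᵇ y) xs) ℕ.+ ascPairs xs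

-- monomial m_Λ: the term θ_{i1}⋯θ_{im} x_{i1}^{Λ1}⋯ equals (−1)^{ascPairs} x^a θ_S
mP : ∀ {N} → SPart → Poly N
mP (la , ls) (a , S) =
  if eqL (sortDesc (antiExps a S)) la ∧ eqL (sortDesc (symExps a S)) ls
  then sgn (ascPairs (antiExps a S)) else 0ℚ

-- A "family" of symmetric functions in superspace is given by its m-expansion
-- coefficients  c Λ Ω  = coefficient of m_Ω in the Λ-th member; members of the
-- family indexed by Λ live in the homogeneous sector of Λ.

realize : (N : ℕ) → (SPart → SPart → ℚ) → SPart → Poly N
realize N c Λ = ΣP (sector (bdeg Λ) (fdeg Λ)) (λ Ω → c Λ Ω ⊙ mP Ω)

mult : ℕ → List ℕ → ℕ
mult i lam = length (filterᵇ (λ y → y ≡ᵇ i) lam)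

zee : List ℕ → ℕ
zee lam = foldr (λ i acc → (suc i ℕ.^ mult (suc i) lam) ℕ.* ((mult (suc i) lam) ℕ.!) ℕ.* acc) 1 (upTo (sum lam))

-- ⟨⟨p_Γ,p_Γ⟩⟩_{q,t} at t = q :  q^{|Γ^a|} z_{Γ^s}
weight : ℚ → SPart → ℚ
weight q (a , s) = powℚ q (sum a) * ℕtoℚ (zee s)

-- orthogonality of two elements of the sector (n,m), computed through p-expansions
-- in N = n + m variables (enough for the p_Γ of the sector to be linearly independent)
Orth : ℚ → (n m : ℕ) → Poly (ℕ._+_ n m) → Poly (ℕ._+_ n m) → Set
Orth q n m f g = (α β : SPart → ℚ) →
  f ≐ ΣP (sector n m) (λ Γ → α Γ ⊙ pP Γ) →
  g ≐ ΣP (sector n m) (λ Γ → β Γ ⊙ pP Γ) →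
  sumℚ (map (λ Γ → α Γ * β Γ * weight q Γ) (sector n m)) ≡ 0ℚ

_∈S_ : SPart → List SPart → Set
Λ ∈S xs = Data.List.Membership.Propositional._∈_ Λ xs
  where import Data.List.Membership.Propositional

-- c (restricted to the sector (n,m)) is the family P_Λ(q,q), Λ in the sector
IsPSector : ℚ → ℕ → ℕ → (SPart → SPart → ℚ) → Set
IsPSector q n m c =
  (∀ Λ → Λ ∈S sector n m → c Λ Λ ≡ 1ℚ) ×
  (∀ Λ Ω → Λ ∈S sector n m → Ω ∈S sector n m → Ω ≢ Λ → c Λ Ω ≢ 0ℚ → Ω ≤SP Λ) ×
  (∀ Λ Ω → Λ ∈S sector n m → Ω ∈S sector n m → Ω ≢ Λ →
     Orth q n m (realize (ℕ._+_ n m) c Λ) (realize (ℕ._+_ n m) c Ω))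

-- S is the family s_Λ = lim_{q=t→0} P_Λ(q,t) (coefficientwise limit over q ∈ ℚ)
IsSchur : (SPart → SPart → ℚ) → Set
IsSchur S = ∀ n m Λ Ω → Λ ∈S sector n m → Ω ∈S sector n m →
  ∀ ε → 0ℚ < ε → ∃[ δ ] (0ℚ < δ × (∀ q → 0ℚ < ∣ q ∣ → ∣ q ∣ < δ →
     (∃[ c ] IsPSector q n m c) ×
     (∀ c → IsPSector q n m c → ∣ c Λ Ω - S Λ Ω ∣ < ε)))

HStrip : List ℕ → List ℕ → ℕ → Set
HStrip μ ν ℓ =
  (∀ i → at μ i ℕ.≤ at ν i) × (sum ν ≡ sum μ ℕ.+ ℓ) ×
  (∀ i j c → i ℕ.< j → at μ i ℕ.≤ c → c ℕ.< at ν i → at μ j ℕ.≤ c → c ℕ.< at ν j → ⊥)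

-- circles of Λ, top to bottom, as (row, column), both 0-indexed
circles : SPart → List (ℕ × ℕ)
circles Λ = concatMap (λ r → if at (circ Λ) r ≡ᵇ suc (at (star Λ) r)
                               then (r , at (star Λ) r) ∷ [] else [])
                      (upTo (length (circ Λ)))

-- condition on a pair (circle of Ω, circle of Λ); rows/columns 0-indexed, so
-- "row r ≥ 2" is r ≥ 1 and "column ≤ Λ^*_{r-1}" is suc c ≤ at Λ^* (r ∸ 1)
CirclePair : SPart → (ℕ × ℕ) → (ℕ × ℕ) → Set
CirclePair Λ (rΩ , cΩ) (rΛ , cΛ) =
  ((rΩ ≡ rΛ) ⊎ (cΩ ≡ cΛ)) × (rΩ ≡ rΛ → 1 ℕ.≤ rΩ → suc cΩ ℕ.≤ at (star Λ) (rΩ ∸ 1))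

CircleCond : SPart → SPart → Set
CircleCond Λ Ω = Pointwise (CirclePair Λ) (circles Ω) (circles Λ)

Admissible : SPart → ℕ → SPart → Set
Admissible Λ ℓ Ω = (isSPart Ω ≡ true) × (fdeg Ω ≡ fdeg Λ) ×
  HStrip (star Λ) (star Ω) ℓ × CircleCond Λ Ω

{-# OPTIONS --safe #-}
-- The functions FS M Λ are defined one commuting variable at a time: a coefficient is a signed count of
-- chains of branching strips, ending in an alternant in the variables that carry a θ. The Pieri rule holds
-- for them by induction on the number of variables, because Pieri strips and branching strips commute: the
-- diagrams on both sides are counted by one functional Z of two diagrams, which is symmetric under u ↦ K - u.
--
-- It remains to see that s_Λ = FS M Λ. Orthogonality and triangularity make P_Λ(q,q) orthogonal to m_Ω unless
-- Λ ≤ Ω. Dividing by q^{|Ω^a|} and letting q → 0 leaves the pairing restricted to the p_Γ with |Γ^a| = |Ω^a|,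
-- and for it Cauchy's identity exhibits as dual basis of the m_Ω the products of h_{Ω^s} with the alternant of
-- exponents Ω^a. Hence s_Λ is a combination of these products with Ω ≥ Λ. By the Pieri rule each of them is a
-- combination of the FS M Γ with Γ ≥ Ω, so s_Λ involves only FS M Γ with Γ ≥ Λ. Both families are
-- unitriangular downwards in the monomials, which forces s_Λ = FS M Λ.

module Submission where

open import Defs
open import Data.Bool using (Bool; true; false; _∧_; _∨_; not; if_then_else_; T)
open import Data.Nat using (ℕ; zero; suc; _+_; _*_; _∸_; _⊔_; _⊓_; _≤_; _<_; z≤n; s≤s; _≤ᵇ_; _<ᵇ_; _≡ᵇ_; _≤?_; _<?_; _≟_)
import Data.Nat.Properties as ℕₚ
open ℕₚ using (m+n∸m≡n; m⊓n≤m; m⊓n≤n; m≤m⊔n; ⊔-lub; ⊓-glb; ≮⇒≥; ⊓-idem; +-cancelʳ-≡; +-mono-≤-<; +-monoˡ-≤; m∸n+n≡m; m+n∸n≡m; ≤⇒≯; <-trans; m∸n≤m; +-mono-<-≤; n∸n≡0; ∸-+-assoc; +-∸-assoc; *-zeroʳ; m∸n≡0⇒m≤n; ≤-trans; ≤-refl; <⇒≤; ≰⇒>; ≤-reflexive; m≤m+n; m≤n+m; ≤-pred; suc-injective; ≤-<-trans; <-≤-trans; m≤n⇒m≤1+n; +-suc; <-irrefl; +-mono-≤; m+[n∸m]≡n; n≤1+n; <⇒≱; +-monoʳ-≤; ≤∧≢⇒<; ≤-antisym; +-cancelˡ-≡; m≤n⊔m)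
open import Data.Rational using (ℚ; 0ℚ; 1ℚ) renaming (_+_ to _+ℚ_; _*_ to _*ℚ_; -_ to -ℚ_; _-_ to _-ℚ_; _<_ to _<ℚ_; _≤_ to _≤ℚ_; ∣_∣ to ∣_∣ℚ)
import Data.Rational.Properties as ℚₚ
open import Data.Rational.Solver using (module +-*-Solver)
open import Data.Nat.ListAction using (sum)
open import Data.List using (List; []; _∷_; _++_; map; concatMap; length; take; drop; upTo; applyUpTo; filterᵇ; foldr; replicate)
import Data.List.Properties as Listₚ
open import Data.List.Membership.Propositional using (_∈_)
import Data.List.Membership.Propositional.Properties as ∈ₚ
open import Data.List.Relation.Unary.Any using (here; there)
open import Data.List.Relation.Unary.All as All using (All; []; _∷_)
open import Data.List.Relation.Unary.AllPairs using ([]; _∷_)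
open import Data.List.Relation.Unary.Unique.Propositional using (Unique)
import Data.List.Relation.Unary.Unique.Propositional.Properties as Uniqueₚ
open import Data.List.Relation.Binary.Pointwise using (Pointwise; []; _∷_)
open import Data.Vec using (Vec; []; _∷_)
open import Data.Product using (_×_; _,_; ∃-syntax; proj₁; proj₂)
open import Data.Sum using (_⊎_; inj₁; inj₂)
open import Data.Empty using (⊥; ⊥-elim)
open import Data.Unit using (⊤; tt)
open import Data.Nat.Tactic.RingSolver using (solve-∀)
open import Function using (_∘_; id; case_of_)
open import Relation.Binary.Definitions using (tri<; tri≈; tri>)
open import Relation.Nullary using (¬_; Dec; yes; no)
open import Relation.Binary.PropositionalEquality using (_≡_; _≢_; refl; sym; trans; cong; cong₂; subst; subst₂; module ≡-Reasoning)
import Data.Bool.Properties as Boolₚ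
import Data.Product.Properties as Productₚ
import Data.Integer as ℤ
import Data.Integer.Properties as ℤₚ
import Data.Rational as Rat
import Data.Rational.Unnormalised as ℚᵘ
import Data.Rational.Unnormalised.Properties as ℚᵘₚ
import Data.List.Membership.DecPropositional as DecMembership
open import Relation.Nullary.Decidable using (does; dec-true; dec-false)
open ≡-Reasoning
open +-*-Solver using (solve; _:=_; _:+_; _:*_; :-_; con)

-- Without circles the symmetry of `Z` is a rowwise reflection: row r of Ω runs over an interval
-- from the longer of the two rows r to the shorter of the two rows r - 1, and each interval can be
-- reversed on its own. A circle that leaves a row constrains the next one, so the rows are no
-- longer independent. The induction is therefore strengthened to four states, according to whether
-- a circle is in transit for the Pieri strip, for the branching strip, for both or for neither. The
-- state with two circles has no symmetry of its own, only a relation shared with the state with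
-- none. The bound `M` plays the part of an infinitely long row above the diagram. It has to exceed
-- every degree in sight and is chosen anew for each monomial. At q = 0 the pairing itself
-- degenerates, since its weights contain q^{|Γ^a|}. Dividing by q^{|Ω^a|} is possible because m_Ω
-- involves only p_Γ with |Γ^a| ≥ |Ω^a|, and the pairing that survives the limit is non-degenerate.

+-exchange : ∀ p q r → p + (q + r) ≡ q + (p + r)
+-exchange = solve-∀

+-swapʳ : ∀ p q r → (p + q) + r ≡ (p + r) + q
+-swapʳ = solve-∀

+-rotate : ∀ p q r → p + (q + r) ≡ (p + r) + q
+-rotate = solve-∀

-- Trivial factors, rationals gated by Booleans, and reflection of Boolean tests

*-0ʳ : ∀ x {y} → y ≡ 0ℚ → x *ℚ y ≡ 0ℚ
*-0ʳ x refl = ℚₚ.*-zeroʳ x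

*-0ˡ : ∀ y {x} → x ≡ 0ℚ → x *ℚ y ≡ 0ℚ
*-0ˡ y refl = ℚₚ.*-zeroˡ y

*-1ˡ : ∀ y {x} → x ≡ 1ℚ → x *ℚ y ≡ y
*-1ˡ y refl = ℚₚ.*-identityˡ y

*-1ʳ : ∀ x {y} → y ≡ 1ℚ → x *ℚ y ≡ x
*-1ʳ x refl = ℚₚ.*-identityʳ x

-- Gating a summand instead of filtering the index list keeps all index lists fixed, so that sums
-- can be exchanged while their conditions are still attached.
when : Bool → ℚ → ℚ
when true  x = x
when false _ = 0ℚ

when-≡ : ∀ x {p q} → p ≡ q → when p x ≡ when q x
when-≡ x refl = refl

when-zero : ∀ b → when b 0ℚ ≡ 0ℚ
when-zero true  = refl
when-zero false = refl

when-∧ : ∀ p q x → when (p ∧ q) x ≡ when p (when q x)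
when-∧ true  q x = refl
when-∧ false q x = refl

when-comm : ∀ p q x → when p (when q x) ≡ when q (when p x)
when-comm true  q x = refl
when-comm false q x = sym (when-zero q)

when-+ : ∀ p x y → when p (x +ℚ y) ≡ when p x +ℚ when p y
when-+ true  x y = refl
when-+ false x y = refl

when-*ˡ : ∀ p x y → x *ℚ when p y ≡ when p (x *ℚ y)
when-*ˡ true  x y = refl
when-*ˡ false x y = ℚₚ.*-zeroʳ x

when-*ʳ : ∀ p x y → when p x *ℚ y ≡ when p (x *ℚ y)
when-*ʳ true  x y = refl
when-*ʳ false x y = ℚₚ.*-zeroˡ y

when-neg : ∀ p x → when p (-ℚ x) ≡ -ℚ when p x
when-neg true  x = refl
when-neg false x = refl

when-cong : ∀ p {x y} → (p ≡ true → x ≡ y) → when p x ≡ when p y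
when-cong true  h = h refl
when-cong false h = refl

T→≡ : ∀ {b} → T b → b ≡ true
T→≡ {true} _ = refl

≡→T : ∀ {b} → b ≡ true → T b
≡→T refl = tt

¬T→≡ : ∀ {b} → ¬ T b → b ≡ false
¬T→≡ {true}  h = ⊥-elim (h tt)
¬T→≡ {false} h = refl

false≢true : ∀ {b} → b ≡ false → b ≡ true → ⊥
false≢true refl ()

bool-ext : ∀ {p q} → (p ≡ true → q ≡ true) → (q ≡ true → p ≡ true) → p ≡ q
bool-ext {true}  {true}  f g = refl
bool-ext {true}  {false} f g = sym (f refl)
bool-ext {false} {true}  f g = g refl
bool-ext {false} {false} f g = refl

∧-split : ∀ {p q} → p ∧ q ≡ true → p ≡ true × q ≡ true
∧-split {true} {true} _ = refl , refl

∧-intro : ∀ {p q} → p ≡ true → q ≡ true → p ∧ q ≡ true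
∧-intro refl refl = refl

≤ᵇ→≤ : ∀ {m n} → (m ≤ᵇ n) ≡ true → m ≤ n
≤ᵇ→≤ {m} {n} h = ℕₚ.≤ᵇ⇒≤ m n (≡→T h)

≤→≤ᵇ : ∀ {m n} → m ≤ n → (m ≤ᵇ n) ≡ true
≤→≤ᵇ h = T→≡ (ℕₚ.≤⇒≤ᵇ h)

<ᵇ→< : ∀ {m n} → (m <ᵇ n) ≡ true → m < n
<ᵇ→< {m} {n} h = ℕₚ.<ᵇ⇒< m n (≡→T h)

<→<ᵇ : ∀ {m n} → m < n → (m <ᵇ n) ≡ true
<→<ᵇ h = T→≡ (ℕₚ.<⇒<ᵇ h)

≡ᵇ→≡ : ∀ {m n} → (m ≡ᵇ n) ≡ true → m ≡ n
≡ᵇ→≡ {m} {n} h = ℕₚ.≡ᵇ⇒≡ m n (≡→T h)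

≡→≡ᵇ : ∀ {m n} → m ≡ n → (m ≡ᵇ n) ≡ true
≡→≡ᵇ {m} {n} h = T→≡ (ℕₚ.≡⇒≡ᵇ m n h)

≢→≡ᵇ : ∀ {m n} → m ≢ n → (m ≡ᵇ n) ≡ false
≢→≡ᵇ {m} {n} h = ¬T→≡ (λ t → h (ℕₚ.≡ᵇ⇒≡ m n t))

≰→≤ᵇ : ∀ {m n} → ¬ m ≤ n → (m ≤ᵇ n) ≡ false
≰→≤ᵇ {m} {n} h = ¬T→≡ (λ t → h (ℕₚ.≤ᵇ⇒≤ m n t))

≮→<ᵇ : ∀ {m n} → ¬ m < n → (m <ᵇ n) ≡ false
≮→<ᵇ {m} {n} h = ¬T→≡ (λ t → h (ℕₚ.<ᵇ⇒< m n t))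

+-cancelˡℚ : ∀ x {y z} → x +ℚ y ≡ x +ℚ z → y ≡ z
+-cancelˡℚ x {y} {z} h = trans (sym (lem x y)) (trans (cong ((-ℚ x) +ℚ_) h) (lem x z))
  where
  lem : ∀ x y → (-ℚ x) +ℚ (x +ℚ y) ≡ y
  lem = solve 2 (λ x y → (:- x) :+ (x :+ y) := y) refl

+-interchange : ∀ a b c d → (a +ℚ b) +ℚ (c +ℚ d) ≡ (a +ℚ c) +ℚ (b +ℚ d)
+-interchange = solve 4 (λ a b c d → ((a :+ b) :+ (c :+ d)) := ((a :+ c) :+ (b :+ d))) refl

-- Finite sums

∑ : {A : Set} → List A → (A → ℚ) → ℚ
∑ []       f = 0ℚ
∑ (x ∷ xs) f = f x +ℚ ∑ xs f

∑< : ℕ → (ℕ → ℚ) → ℚ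
∑< zero    f = 0ℚ
∑< (suc n) f = f 0 +ℚ ∑< n (f ∘ suc)

module _ {A : Set} where

  ∑-cong : ∀ (xs : List A) {f g} → (∀ x → x ∈ xs → f x ≡ g x) → ∑ xs f ≡ ∑ xs g
  ∑-cong []       h = refl
  ∑-cong (x ∷ xs) h = cong₂ _+ℚ_ (h x (here refl)) (∑-cong xs (λ y y∈ → h y (there y∈)))

  ∑-cong′ : ∀ (xs : List A) {f g} → (∀ x → f x ≡ g x) → ∑ xs f ≡ ∑ xs g
  ∑-cong′ xs h = ∑-cong xs (λ x _ → h x)

  ∑-zero : ∀ (xs : List A) {f} → (∀ x → x ∈ xs → f x ≡ 0ℚ) → ∑ xs f ≡ 0ℚ
  ∑-zero []       h = refl
  ∑-zero (x ∷ xs) h = trans (cong₂ _+ℚ_ (h x (here refl)) (∑-zero xs (λ y y∈ → h y (there y∈)))) (ℚₚ.+-identityˡ 0ℚ)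

  ∑-+ : ∀ (xs : List A) f g → ∑ xs (λ x → f x +ℚ g x) ≡ ∑ xs f +ℚ ∑ xs g
  ∑-+ []       f g = sym (ℚₚ.+-identityˡ 0ℚ)
  ∑-+ (x ∷ xs) f g = trans (cong ((f x +ℚ g x) +ℚ_) (∑-+ xs f g)) (+-interchange (f x) (g x) _ _)

  ∑-*ˡ : ∀ c (xs : List A) f → c *ℚ ∑ xs f ≡ ∑ xs (λ x → c *ℚ f x)
  ∑-*ˡ c []       f = ℚₚ.*-zeroʳ c
  ∑-*ˡ c (x ∷ xs) f = trans (ℚₚ.*-distribˡ-+ c (f x) _) (cong ((c *ℚ f x) +ℚ_) (∑-*ˡ c xs f))

  ∑-*ʳ : ∀ c (xs : List A) f → ∑ xs f *ℚ c ≡ ∑ xs (λ x → f x *ℚ c)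
  ∑-*ʳ c []       f = ℚₚ.*-zeroˡ c
  ∑-*ʳ c (x ∷ xs) f = trans (ℚₚ.*-distribʳ-+ c (f x) _) (cong ((f x *ℚ c) +ℚ_) (∑-*ʳ c xs f))

  ∑-neg : ∀ (xs : List A) f → ∑ xs (λ x → -ℚ f x) ≡ -ℚ ∑ xs f
  ∑-neg []       f = refl
  ∑-neg (x ∷ xs) f = trans (cong ((-ℚ f x) +ℚ_) (∑-neg xs f)) (sym (ℚₚ.neg-distrib-+ (f x) (∑ xs f)))

  ∑-when : ∀ p (xs : List A) f → ∑ xs (λ x → when p (f x)) ≡ when p (∑ xs f)
  ∑-when true  xs f = refl
  ∑-when false xs f = ∑-zero xs (λ _ _ → refl)

  ∑-++ : ∀ (xs ys : List A) f → ∑ (xs ++ ys) f ≡ ∑ xs f +ℚ ∑ ys f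
  ∑-++ []       ys f = sym (ℚₚ.+-identityˡ _)
  ∑-++ (x ∷ xs) ys f = trans (cong (f x +ℚ_) (∑-++ xs ys f)) (sym (ℚₚ.+-assoc (f x) _ _))

  ∑-filter : ∀ p (xs : List A) f → ∑ (filterᵇ p xs) f ≡ ∑ xs (λ x → when (p x) (f x))
  ∑-filter p []       f = refl
  ∑-filter p (x ∷ xs) f with p x
  ... | true  = cong (f x +ℚ_) (∑-filter p xs f)
  ... | false = trans (∑-filter p xs f) (sym (ℚₚ.+-identityˡ _))

  module _ {B : Set} where

    ∑-map : ∀ (g : B → A) xs f → ∑ (map g xs) f ≡ ∑ xs (f ∘ g)
    ∑-map g []       f = refl
    ∑-map g (x ∷ xs) f = cong (f (g x) +ℚ_) (∑-map g xs f)

    ∑-concatMap : ∀ (g : B → List A) xs f → ∑ (concatMap g xs) f ≡ ∑ xs (λ x → ∑ (g x) f)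
    ∑-concatMap g []       f = refl
    ∑-concatMap g (x ∷ xs) f = trans (∑-++ (g x) (concatMap g xs) f) (cong (∑ (g x) f +ℚ_) (∑-concatMap g xs f))

  -- Entries of `xs` outside the image of `φ` are allowed as long as their summands vanish.
  -- Induction on `ys`: the image of the head is cut out of `xs`, which leaves `xs` free of
  -- duplicates.
  ∑-reindex : ∀ {B : Set} {xs : List A} {ys : List B} {f : A → ℚ} {g : B → ℚ} (φ : B → A) →
    Unique xs → Unique ys →
    (∀ y → y ∈ ys → φ y ∈ xs × g y ≡ f (φ y)) →
    (∀ y y′ → y ∈ ys → y′ ∈ ys → φ y ≡ φ y′ → y ≡ y′) →
    (∀ x → x ∈ xs → (∃[ y ] (y ∈ ys × x ≡ φ y)) ⊎ f x ≡ 0ℚ) →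
    ∑ xs f ≡ ∑ ys g
  ∑-reindex {xs = xs} {[]} φ ux uy hm hi hs = ∑-zero xs z
    where
    z : ∀ x → x ∈ xs → _
    z x x∈ with hs x x∈
    ... | inj₂ e = e
    ... | inj₁ (_ , () , _)
  ∑-reindex {xs = xs} {y ∷ ys} {f} {g} φ ux (y∉ ∷ uy) hm hi hs with ∈ₚ.∈-∃++ (proj₁ (hm y (here refl)))
  ... | as , bs , refl = begin
    ∑ (as ++ φ y ∷ bs) f              ≡⟨ ∑-++ as (φ y ∷ bs) f ⟩
    ∑ as f +ℚ (f (φ y) +ℚ ∑ bs f)     ≡⟨ mid (∑ as f) (f (φ y)) (∑ bs f) ⟩
    f (φ y) +ℚ (∑ as f +ℚ ∑ bs f)     ≡⟨ cong (f (φ y) +ℚ_) (sym (∑-++ as bs f)) ⟩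
    f (φ y) +ℚ ∑ (as ++ bs) f         ≡⟨ cong₂ _+ℚ_ (sym (proj₂ (hm y (here refl)))) rec ⟩
    g y +ℚ ∑ ys g ∎
    where
    mid : ∀ a b c → a +ℚ (b +ℚ c) ≡ b +ℚ (a +ℚ c)
    mid = solve 3 (λ a b c → a :+ (b :+ c) := b :+ (a :+ c)) refl
    rem : ∀ (as : List A) {bs x z} → z ∈ as ++ x ∷ bs → z ≢ x → z ∈ as ++ bs
    rem []       (here e)  n = ⊥-elim (n e)
    rem []       (there h) n = h
    rem (a ∷ as) (here e)  n = here e
    rem (a ∷ as) (there h) n = there (rem as h n)
    add : ∀ (as : List A) {bs x z} → z ∈ as ++ bs → z ∈ as ++ x ∷ bs
    add []       h = there h
    add (a ∷ as) (here e)  = here e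
    add (a ∷ as) (there h) = there (add as h)
    uniq-rem : ∀ (as : List A) {bs x} → Unique (as ++ x ∷ bs) → Unique (as ++ bs)
    uniq-rem []       (_ ∷ u) = u
    uniq-rem (a ∷ as) {bs} {x} (n ∷ u) = All.tabulate (λ z∈ → All.lookup n (add as z∈)) ∷ uniq-rem as u
    uniq-ne : ∀ (as : List A) {bs x z} → Unique (as ++ x ∷ bs) → z ∈ as ++ bs → z ≢ x
    uniq-ne []       (n ∷ u) h e = All.lookup n h (sym e)
    uniq-ne (a ∷ as) (n ∷ u) (here refl) e = All.lookup n (∈ₚ.∈-++⁺ʳ as (here refl)) e
    uniq-ne (a ∷ as) (n ∷ u) (there h) e = uniq-ne as u h e
    rec : ∑ (as ++ bs) f ≡ ∑ ys g
    rec = ∑-reindex φ (uniq-rem as ux) uy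
      (λ y′ y′∈ → rem as (proj₁ (hm y′ (there y′∈))) (λ e → All.lookup y∉ y′∈ (hi y y′ (here refl) (there y′∈) (sym e)))
                 , proj₂ (hm y′ (there y′∈)))
      (λ a b a∈ b∈ → hi a b (there a∈) (there b∈))
      surj
      where
      surj : ∀ x → x ∈ as ++ bs → (∃[ y′ ] (y′ ∈ ys × x ≡ φ y′)) ⊎ f x ≡ 0ℚ
      surj x x∈ with hs x (add as x∈)
      ... | inj₂ e = inj₂ e
      ... | inj₁ (_ , here refl , e) = ⊥-elim (uniq-ne as ux x∈ e)
      ... | inj₁ (y′ , there y′∈ , e) = inj₁ (y′ , y′∈ , e)

  ∑-single : ∀ {xs : List A} {f} y → Unique xs → y ∈ xs → (∀ x → x ∈ xs → x ≢ y → f x ≡ 0ℚ) →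
    (∀ x → Dec (x ≡ y)) → ∑ xs f ≡ f y
  ∑-single {xs} {f} y u y∈ h dec = trans
    (∑-reindex {ys = y ∷ []} {g = f} id u ([] ∷ [])
      (λ { _ (here refl) → y∈ , refl })
      (λ { _ _ (here refl) (here refl) _ → refl })
      s)
    (ℚₚ.+-identityʳ (f y))
    where
    s : ∀ x → x ∈ xs → (∃[ z ] (z ∈ y ∷ [] × x ≡ z)) ⊎ f x ≡ 0ℚ
    s x x∈ with dec x
    ... | yes e = inj₁ (y , here refl , e)
    ... | no ne = inj₂ (h x x∈ ne)

∑-swap : ∀ {A B : Set} (xs : List A) (ys : List B) (f : A → B → ℚ) → ∑ xs (λ x → ∑ ys (f x)) ≡ ∑ ys (λ y → ∑ xs (λ x → f x y))
∑-swap []       ys f = sym (∑-zero ys (λ _ _ → refl))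
∑-swap (x ∷ xs) ys f = trans (cong (∑ ys (f x) +ℚ_) (∑-swap xs ys f)) (sym (∑-+ ys (f x) _))

-- Associativity of the matrix product acting on a vector, the step behind every change of basis
-- below.
∑-assoc : ∀ {A B : Set} (xs : List A) (ys : List B) (a : A → ℚ) (b : A → B → ℚ) (f : B → ℚ) →
  ∑ xs (λ x → a x *ℚ ∑ ys (λ y → b x y *ℚ f y)) ≡ ∑ ys (λ y → ∑ xs (λ x → a x *ℚ b x y) *ℚ f y)
∑-assoc xs ys a b f = trans
  (∑-cong′ xs (λ x → trans (∑-*ˡ (a x) ys (λ y → b x y *ℚ f y)) (∑-cong′ ys (λ y → sym (ℚₚ.*-assoc (a x) (b x y) (f y))))))
  (trans (∑-swap xs ys (λ x y → (a x *ℚ b x y) *ℚ f y)) (∑-cong′ ys (λ y → sym (∑-*ʳ (f y) xs (λ x → a x *ℚ b x y)))))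

∑-applyUpTo : ∀ {A : Set} (h : ℕ → A) n f → ∑ (applyUpTo h n) f ≡ ∑< n (f ∘ h)
∑-applyUpTo h zero    f = refl
∑-applyUpTo h (suc n) f = cong (f (h 0) +ℚ_) (∑-applyUpTo (h ∘ suc) n f)

∑-upTo : ∀ n f → ∑ (upTo n) f ≡ ∑< n f
∑-upTo n f = ∑-applyUpTo id n f

∑<-cong : ∀ n {f g} → (∀ k → k < n → f k ≡ g k) → ∑< n f ≡ ∑< n g
∑<-cong zero    h = refl
∑<-cong (suc n) h = cong₂ _+ℚ_ (h 0 (s≤s z≤n)) (∑<-cong n (λ k k< → h (suc k) (s≤s k<)))

∑<-cong′ : ∀ n {f g} → (∀ k → f k ≡ g k) → ∑< n f ≡ ∑< n g
∑<-cong′ n h = ∑<-cong n (λ k _ → h k)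

∑<-zero : ∀ n {f} → (∀ k → k < n → f k ≡ 0ℚ) → ∑< n f ≡ 0ℚ
∑<-zero zero    h = refl
∑<-zero (suc n) h = trans (cong₂ _+ℚ_ (h 0 (s≤s z≤n)) (∑<-zero n (λ k k< → h (suc k) (s≤s k<)))) (ℚₚ.+-identityˡ 0ℚ)

∑<-+ : ∀ n f g → ∑< n (λ k → f k +ℚ g k) ≡ ∑< n f +ℚ ∑< n g
∑<-+ zero    f g = sym (ℚₚ.+-identityˡ 0ℚ)
∑<-+ (suc n) f g = trans (cong ((f 0 +ℚ g 0) +ℚ_) (∑<-+ n _ _)) (+-interchange (f 0) (g 0) _ _)

∑<-neg : ∀ n f → ∑< n (λ k → -ℚ f k) ≡ -ℚ ∑< n f
∑<-neg zero    f = refl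
∑<-neg (suc n) f = trans (cong ((-ℚ f 0) +ℚ_) (∑<-neg n (f ∘ suc))) (sym (ℚₚ.neg-distrib-+ (f 0) _))

∑<-*ˡ : ∀ c n f → c *ℚ ∑< n f ≡ ∑< n (λ k → c *ℚ f k)
∑<-*ˡ c zero    f = ℚₚ.*-zeroʳ c
∑<-*ˡ c (suc n) f = trans (ℚₚ.*-distribˡ-+ c (f 0) _) (cong ((c *ℚ f 0) +ℚ_) (∑<-*ˡ c n (f ∘ suc)))

∑<-when : ∀ p n f → ∑< n (λ x → when p (f x)) ≡ when p (∑< n f)
∑<-when true  n f = refl
∑<-when false n f = ∑<-zero n (λ _ _ → refl)

∑<-swap : ∀ m n (f : ℕ → ℕ → ℚ) → ∑< m (λ i → ∑< n (f i)) ≡ ∑< n (λ j → ∑< m (λ i → f i j))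
∑<-swap zero    n f = sym (∑<-zero n (λ _ _ → refl))
∑<-swap (suc m) n f = trans (cong (∑< n (f 0) +ℚ_) (∑<-swap m n (f ∘ suc))) (sym (∑<-+ n _ _))

∑<-∑-swap : ∀ {A : Set} m (xs : List A) (f : ℕ → A → ℚ) → ∑< m (λ i → ∑ xs (f i)) ≡ ∑ xs (λ x → ∑< m (λ i → f i x))
∑<-∑-swap zero    xs f = sym (∑-zero xs (λ _ _ → refl))
∑<-∑-swap (suc m) xs f = trans (cong (∑ xs (f 0) +ℚ_) (∑<-∑-swap m xs (f ∘ suc))) (sym (∑-+ xs _ _))

∑<-last : ∀ n f → ∑< (suc n) f ≡ ∑< n f +ℚ f n
∑<-last zero    f = trans (ℚₚ.+-identityʳ (f 0)) (sym (ℚₚ.+-identityˡ (f 0)))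
∑<-last (suc n) f = trans (cong (f 0 +ℚ_) (∑<-last n (f ∘ suc))) (sym (ℚₚ.+-assoc (f 0) _ _))

∑<-reflect : ∀ n {f g} → (∀ i j → suc (i + j) ≡ n → f i ≡ g j) → ∑< n f ≡ ∑< n g
∑<-reflect zero    h = refl
∑<-reflect (suc n) {f} {g} h = begin
  f 0 +ℚ ∑< n (f ∘ suc)  ≡⟨ cong₂ _+ℚ_ (h 0 n refl) (∑<-reflect n (λ i j e → h (suc i) j (cong suc e))) ⟩
  g n +ℚ ∑< n g          ≡⟨ ℚₚ.+-comm (g n) _ ⟩
  ∑< n g +ℚ g n          ≡⟨ sym (∑<-last n g) ⟩
  ∑< (suc n) g ∎

∑<-split : ∀ m n f → ∑< (m + n) f ≡ ∑< m f +ℚ ∑< n (λ k → f (m + k))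
∑<-split zero    n f = sym (ℚₚ.+-identityˡ _)
∑<-split (suc m) n f = trans (cong (f 0 +ℚ_) (∑<-split m n (f ∘ suc))) (sym (ℚₚ.+-assoc (f 0) _ _))

∑<-single : ∀ n j {f} → j < n → (∀ k → k < n → k ≢ j → f k ≡ 0ℚ) → ∑< n f ≡ f j
∑<-single (suc n) zero    {f} _ h =
  trans (cong (f 0 +ℚ_) (∑<-zero n (λ k k< → h (suc k) (s≤s k<) (λ ())))) (ℚₚ.+-identityʳ (f 0))
∑<-single (suc n) (suc j) {f} (s≤s j<) h =
  trans (cong₂ _+ℚ_ (h 0 (s≤s z≤n) (λ ())) (∑<-single n j j< (λ k k< ne → h (suc k) (s≤s k<) (λ e → ne (suc-injective e)))))
        (ℚₚ.+-identityˡ _)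

opaque

  -- Sum over the half-open interval from `l` to `u`, empty if `u ≤ l`. It is opaque so that the
  -- truncated difference does not unfold when the bounds are compound expressions.
  ∑I : ℕ → ℕ → (ℕ → ℚ) → ℚ
  ∑I l u g = ∑< (u ∸ l) (λ k → g (l + k))

  ∑<-interval : ∀ N l u g → u ≤ N → ∑< N (λ w → when ((l ≤ᵇ w) ∧ (w <ᵇ u)) (g w)) ≡ ∑I l u g
  ∑<-interval N zero u g u≤N = begin
    ∑< N h                                  ≡⟨ cong (λ k → ∑< k h) (sym (m+[n∸m]≡n u≤N)) ⟩
    ∑< (u + (N ∸ u)) h                      ≡⟨ ∑<-split u (N ∸ u) h ⟩
    ∑< u h +ℚ ∑< (N ∸ u) (λ k → h (u + k))  ≡⟨ cong₂ _+ℚ_ (∑<-cong u (λ k k< → when-≡ (g k) (<→<ᵇ k<)))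
                                                (∑<-zero (N ∸ u) (λ k _ → when-≡ (g (u + k)) (≮→<ᵇ (ℕₚ.m+n≮m u k)))) ⟩
    ∑< u g +ℚ 0ℚ                            ≡⟨ ℚₚ.+-identityʳ _ ⟩
    ∑< u g ∎
    where
    h : ℕ → ℚ
    h w = when (w <ᵇ u) (g w)
  ∑<-interval zero (suc l) zero g z≤n = refl
  ∑<-interval (suc N) (suc l) zero g z≤n = trans (ℚₚ.+-identityˡ _) (∑<-zero N (λ k _ → when-≡ (g (suc k)) (h (l <ᵇ suc k))))
    where
    h : ∀ b → b ∧ false ≡ false
    h true = refl
    h false = refl
  ∑<-interval (suc N) (suc l) (suc u) g (s≤s u≤N) =
    trans (ℚₚ.+-identityˡ _) (trans (∑<-cong′ N (λ k → cong (λ b → when (b ∧ (k <ᵇ u)) (g (suc k))) (e l k))) (∑<-interval N l u (g ∘ suc) u≤N))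
    where
    e : ∀ l k → (l <ᵇ suc k) ≡ (l ≤ᵇ k)
    e zero k = refl
    e (suc l) k = refl

  ∑I-empty : ∀ l u {g} → u ≤ l → ∑I l u g ≡ 0ℚ
  ∑I-empty l u {g} h = cong (λ k → ∑< k (λ i → g (l + i))) (ℕₚ.m≤n⇒m∸n≡0 h)

  ∸→< : ∀ l u {k} → k < u ∸ l → l + k < u
  ∸→< zero    u       h = h
  ∸→< (suc l) (suc u) h = s≤s (∸→< l u h)

  ∸-suc : ∀ {l u} → l < u → u ∸ l ≡ suc (u ∸ suc l)
  ∸-suc {zero}  {suc u} (s≤s _) = refl
  ∸-suc {suc l} {suc u} (s≤s h) = ∸-suc h

  ∸≡suc→+ : ∀ l u {n} → u ∸ l ≡ suc n → l + suc n ≡ u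
  ∸≡suc→+ zero    u       e = sym e
  ∸≡suc→+ (suc l) (suc u) e = cong suc (∸≡suc→+ l u e)

  ∑I-cong : ∀ l u {f g} → (∀ w → l ≤ w → w < u → f w ≡ g w) → ∑I l u f ≡ ∑I l u g
  ∑I-cong l u h = ∑<-cong (u ∸ l) (λ k k< → h (l + k) (m≤m+n l k) (∸→< l u k<))

  ∑I-zero : ∀ l u {f} → (∀ w → l ≤ w → w < u → f w ≡ 0ℚ) → ∑I l u f ≡ 0ℚ
  ∑I-zero l u h = trans (∑I-cong l u h) (∑<-zero (u ∸ l) (λ _ _ → refl))

  -- w ↦ l + u - 1 - w reverses [l, u); the second interval may be shifted.
  ∑I-reflect : ∀ l u l′ u′ {f g} → u ∸ l ≡ u′ ∸ l′ →
    (∀ w w′ → l ≤ w → w < u → l′ ≤ w′ → w′ < u′ → suc (w + w′) ≡ l + u′ → f w ≡ g w′) → ∑I l u f ≡ ∑I l′ u′ g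
  ∑I-reflect l u l′ u′ {f} {g} e h = trans (∑<-reflect (u ∸ l) lem) (cong (λ n → ∑< n (λ k → g (l′ + k))) e)
    where
    ar : ∀ l i l′ j → suc ((l + i) + (l′ + j)) ≡ l + (l′ + suc (i + j))
    ar = solve-∀
    lem : ∀ i j → suc (i + j) ≡ u ∸ l → f (l + i) ≡ g (l′ + j)
    lem i j eq = h (l + i) (l′ + j)
      (m≤m+n l i) (∸→< l u (subst (i <_) eq (s≤s (m≤m+n i j))))
      (m≤m+n l′ j) (∸→< l′ u′ (subst (j <_) (trans eq e) (s≤s (m≤n+m j i))))
      (trans (ar l i l′ j) (cong (l +_) (∸≡suc→+ l′ u′ (sym (trans eq e)))))

  -- The end values are added on opposite sides, which avoids subtraction and is the form in which
  -- `q11` needs it.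
  ∑I-telescope : ∀ l u y → l ≤ u → ∑I l u (y ∘ suc) +ℚ y l ≡ ∑I l u y +ℚ y u
  ∑I-telescope l u y l≤u = begin
    ∑< n (λ k → y (suc (l + k))) +ℚ y l   ≡⟨ cong₂ _+ℚ_ (∑<-cong′ n (λ k → cong y (sym (+-suc l k)))) (cong y (sym (ℕₚ.+-identityʳ l))) ⟩
    ∑< n (z ∘ suc) +ℚ z 0                 ≡⟨ ℚₚ.+-comm (∑< n (z ∘ suc)) (z 0) ⟩
    ∑< (suc n) z                          ≡⟨ ∑<-last n z ⟩
    ∑< n z +ℚ y (l + n)                   ≡⟨ cong (λ x → ∑< n z +ℚ y x) (m+[n∸m]≡n l≤u) ⟩
    ∑< n z +ℚ y u ∎
    where
    n : ℕ
    n = u ∸ l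
    z : ℕ → ℚ
    z k = y (l + k)

  ∑I-first : ∀ l u g → l < u → ∑I l u g ≡ g l +ℚ ∑I (suc l) u g
  ∑I-first l u g l<u = begin
    ∑< (u ∸ l) (λ k → g (l + k))                     ≡⟨ cong (λ n → ∑< n (λ k → g (l + k))) (∸-suc l<u) ⟩
    g (l + 0) +ℚ ∑< (u ∸ suc l) (λ k → g (l + suc k))  ≡⟨ cong₂ _+ℚ_ (cong g (ℕₚ.+-identityʳ l)) (∑<-cong′ (u ∸ suc l) {g = λ k → g (suc l + k)} (λ k → cong g (+-suc l k))) ⟩
    g l +ℚ ∑I (suc l) u g ∎

  ∑I-one : ∀ l g → ∑I l (suc l) g ≡ g l
  ∑I-one l g = trans (∑I-first l (suc l) g ≤-refl) (trans (cong (g l +ℚ_) (∑I-empty (suc l) (suc l) {g} ≤-refl)) (ℚₚ.+-identityʳ (g l)))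

  ∑I-+ : ∀ l u (f g : ℕ → ℚ) → ∑I l u (λ w → f w +ℚ g w) ≡ ∑I l u f +ℚ ∑I l u g
  ∑I-+ l u f g = ∑<-+ (u ∸ l) (λ k → f (l + k)) (λ k → g (l + k))

  ∑I-neg : ∀ l u (f : ℕ → ℚ) → ∑I l u (λ w → -ℚ f w) ≡ -ℚ ∑I l u f
  ∑I-neg l u f = ∑<-neg (u ∸ l) (λ k → f (l + k))

  ∑I-suc : ∀ l u (f : ℕ → ℚ) → ∑I l u (f ∘ suc) ≡ ∑I (suc l) (suc u) f
  ∑I-suc l u f = refl

  ∑I-single : ∀ l u j {f : ℕ → ℚ} → l ≤ j → j < u → (∀ w → l ≤ w → w < u → w ≢ j → f w ≡ 0ℚ) → ∑I l u f ≡ f j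
  ∑I-single l u j {f} l≤j j<u h = trans (∑<-single (u ∸ l) (j ∸ l) (ℕₚ.∸-monoˡ-< j<u l≤j) z) (cong f (m+[n∸m]≡n l≤j))
    where
    z : ∀ k → k < u ∸ l → k ≢ j ∸ l → f (l + k) ≡ 0ℚ
    z k k< ne = h (l + k) (m≤m+n l k) (∸→< l u k<) (λ e → ne (trans (sym (m+n∸m≡n l k)) (cong (_∸ l) e)))

  ∑I-∑-swap : ∀ {A : Set} l u (xs : List A) (f : ℕ → A → ℚ) → ∑I l u (λ w → ∑ xs (f w)) ≡ ∑ xs (λ x → ∑I l u (λ w → f w x))
  ∑I-∑-swap l u xs f = ∑<-∑-swap (u ∸ l) xs (λ k → f (l + k))

-- Rows of a superpartition and the two strip relations

Row : Set
Row = ℕ × Bool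

size : List Row → ℕ
size []            = 0
size ((a , _) ∷ Λ) = a + size Λ

-- A circle in a row (flag f) either stays in that row or drops to the next one.
-- With carry D (a circle drops into this row from above), the new flag h is
-- possible iff okc f D h, and nextc f D h tells whether the circle of this row drops.
okc : Bool → Bool → Bool → Bool
okc false false false = true
okc false true  true  = true
okc true  false _     = true
okc true  true  true  = true
okc _     _     _     = false

nextc : Bool → Bool → Bool → Bool
nextc true  D h = D ∨ not h
nextc false _ _ = false

-- A circle that drops keeps its column, so with carry the row has length exactly `A`. A row whose
-- own circle drops must grow past it, hence `suc a`. A circle that stays in its row may not lie
-- past the end of the row above, hence the bound `A` in `upP` where the other cases have `suc A`.
lowP : ℕ → ℕ → Bool → Bool → Bool → ℕ
lowP A a _     true  _     = A
lowP A a true  false false = suc a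
lowP A a true  false true  = a
lowP A a false false _     = a

upP : ℕ → Bool → Bool → Bool → ℕ
upP A true  false true  = A
upP A true  false false = suc A
upP A true  true  _     = suc A
upP A false _     _     = suc A

-- In a branching strip a circle either stays in its cell, and then the row keeps the length `c`, or
-- drops to the next row, where it may land in any column the strip permits. For `pieri` it is the
-- other way round: a staying circle may move along its row and a dropping one has its column fixed.
lowB : ℕ → Bool → Bool → Bool → ℕ
lowB c true  true  _     = suc c
lowB c true  false false = suc c
lowB c true  false true  = c
lowB c false _     _     = c

upB : ℕ → ℕ → Bool → Bool → Bool → ℕ
upB C c true  false true  = suc c
upB C c true  false false = suc C
upB C c true  true  _     = suc C
upB C c false _     _     = suc C

-- pieri M false Λ Ω: Ω is obtained from Λ by a strip of the kind in the Pieri rule;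
-- A is the length of the preceding row of Λ.
pieri : ℕ → Bool → List Row → List Row → Bool
pieri A D []            []            = not D
pieri A D ((a , f) ∷ Λ) ((w , h) ∷ Ω) =
  okc f D h ∧ ((lowP A a f D h ≤ᵇ w) ∧ (w <ᵇ upP A f D h)) ∧ pieri a (nextc f D h) Λ Ω
pieri _ _ _             _             = false

-- branch M false Γ Ω: Ω is obtained from Γ by the strip of cells carrying one
-- additional commuting variable in the monomial expansion of s_Ω.
branch : ℕ → Bool → List Row → List Row → Bool
branch C E []            []            = not E
branch C E ((c , g) ∷ Γ) ((w , h) ∷ Ω) =
  okc g E h ∧ ((lowB c g E h ≤ᵇ w) ∧ (w <ᵇ upB C c g E h)) ∧ branch c (nextc g E h) Γ Ω
branch _ _ _             _             = false

-- The generating functional of the Ω that lie above Λ for pieri and above Γ for branch.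
Z : ℕ → Bool → ℕ → Bool → List Row → List Row → (ℕ → ℚ) → ℚ
Z A D C E []            []            φ = when (not D ∧ not E) (φ 0)
Z A D C E ((a , f) ∷ Λ) ((c , g) ∷ Γ) φ = cell false +ℚ cell true
  where
  cell : Bool → ℚ
  cell h = when (okc f D h ∧ okc g E h)
    (∑I (lowP A a f D h ⊔ lowB c g E h) (upP A f D h ⊓ upB C c g E h)
        (λ w → Z a (nextc f D h) c (nextc g E h) Λ Γ (λ u → φ (w + u))))
Z _ _ _ _ _             _             φ = 0ℚ

Z-cong : ∀ A D C E Λ Γ {φ ψ} → (∀ u → φ u ≡ ψ u) → Z A D C E Λ Γ φ ≡ Z A D C E Λ Γ ψ
Z-cong A D C E [] [] h = cong (when (not D ∧ not E)) (h 0)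
Z-cong A D C E [] (_ ∷ _) h = refl
Z-cong A D C E (_ ∷ _) [] h = refl
Z-cong A D C E ((a , f) ∷ Λ) ((c , g) ∷ Γ) {φ} {ψ} h = cong₂ _+ℚ_ (c≡ false) (c≡ true)
  where
  c≡ : ∀ b → _ ≡ _
  c≡ b = cong (when (okc f D b ∧ okc g E b))
    (∑I-cong (lowP A a f D b ⊔ lowB c g E b) (upP A f D b ⊓ upB C c g E b)
      (λ w _ _ → Z-cong a (nextc f D b) c (nextc g E b) Λ Γ {λ u → φ (w + u)} {λ u → ψ (w + u)} (λ u → h (w + u))))

-- The cell of a circle lies under a cell of the row above, so a circled row is strictly shorter
-- than its predecessor; thus a circle sits in the first row of its length.
below : ℕ → Bool → ℕ → Set
below a true  A = suc a ≤ A
below a false A = a ≤ A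

below→≤ : ∀ {a A} f → below a f A → a ≤ A
below→≤ true  h = <⇒≤ h
below→≤ false h = h

data Valid : ℕ → List Row → Set where
  []  : ∀ {A} → Valid A []
  _∷_ : ∀ {A a f Λ} → below a f A → Valid a Λ → Valid A ((a , f) ∷ Λ)

-- Two diagrams of equal length, the last row of the second one being empty.
data Paired : ℕ → ℕ → Bool → Bool → List Row → List Row → Set where
  end  : ∀ {A F} → Paired A 0 F false [] []
  cons : ∀ {A C F G a c f g Λ Γ} → below a f A → below c g C → Paired a c f g Λ Γ →
         Paired A C F G ((a , f) ∷ Λ) ((c , g) ∷ Γ)

Rel : ℕ → (ℕ → ℚ) → (ℕ → ℚ) → Set
Rel K φ ψ = ∀ u v → u + v ≡ K → φ u ≡ ψ v

-- The functional Z is invariant under u ↦ K - u up to explicit corrections that depend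
-- on the circles in transit; the relation for two dropping circles mixes with the one for none.
record Palindromic (A C : ℕ) (F G : Bool) (Λ Γ : List Row) : Set where
  K : ℕ
  K = (A ⊓ C) + (size Λ + size Γ)
  field
    p00 : ∀ {φ ψ} → Rel K φ ψ → Z A false C false Λ Γ φ ≡ Z A false C false Λ Γ ψ
    p10 : ∀ {φ ψ} → A < C → Rel K φ ψ → Z A true C false Λ Γ φ ≡ Z A true C false Λ Γ ψ
    z10 : ∀ φ → C ≤ A → Z A true C false Λ Γ φ ≡ 0ℚ
    p01 : ∀ {φ ψ} → C < A → Rel K φ ψ → Z A false C true Λ Γ φ ≡ Z A false C true Λ Γ ψ
    q01 : ∀ {φ ψ} → A ≤ C → Rel K φ ψ → Z A false C true Λ Γ φ ≡ Z A false C true Λ Γ (ψ ∘ suc)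
    z11 : ∀ φ → C < A → Z A true C true Λ Γ φ ≡ 0ℚ
    -- For two empty diagrams this relation fails. The condition on `G` excludes that case, because
    -- the last row of the second diagram carries no circle.
    q11 : ∀ {φ ψ} → F ≡ true → G ≡ true → A ≤ C → Rel K φ ψ →
          Z A true C true Λ Γ φ +ℚ Z A false C false Λ Γ (ψ ∘ suc) ≡
          Z A false C false Λ Γ ψ +ℚ Z A true C true Λ Γ (ψ ∘ suc)

suc⊓≤ˡ : ∀ A C → suc A ⊓ suc C ≤ suc A
suc⊓≤ˡ A C = m⊓n≤m (suc A) (suc C)

suc⊓≤ʳ : ∀ A C → suc A ⊓ suc C ≤ suc C
suc⊓≤ʳ A C = m⊓n≤n (suc A) (suc C)

module Cell (A C a c : ℕ) (f g : Bool) (Λ Γ : List Row)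
            (bf : below a f A) (bg : below c g C) (ih : Palindromic a c f g Λ Γ) where

  module I = Palindromic ih

  a≤A : a ≤ A
  a≤A = below→≤ f bf

  c≤C : c ≤ C
  c≤C = below→≤ g bg

  K : ℕ
  K = (A ⊓ C) + ((a + size Λ) + (c + size Γ))

  z : Bool → Bool → (ℕ → ℚ) → ℕ → ℚ
  z D E φ w = Z a D c E Λ Γ (λ u → φ (w + u))

  max+min : ∀ m n → (m ⊔ n) + (m ⊓ n) ≡ m + n
  max+min zero    n       = ℕₚ.+-identityʳ n
  max+min (suc m) zero    = refl
  max+min (suc m) (suc n) = cong suc (trans (+-suc (m ⊔ n) (m ⊓ n)) (trans (cong suc (max+min m n)) (sym (+-suc m n))))

  -- This is where `K` comes from. The two ends of the interval for one row are max a c and min A C,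
  -- and max a c + min a c = a + c; summed over all rows, the ends add up to both sizes and the
  -- outermost min A C.
  relStep : ∀ {φ ψ w w′} → Rel K φ ψ → w + w′ ≡ (a ⊔ c) + (A ⊓ C) → Rel I.K (λ u → φ (w + u)) (λ u → ψ (w′ + u))
  relStep {φ} {ψ} {w} {w′} r e u v e′ = r (w + u) (w′ + v) (begin
    (w + u) + (w′ + v)                                       ≡⟨ l1 w u w′ v ⟩
    (w + w′) + (u + v)                                       ≡⟨ cong₂ _+_ e e′ ⟩
    ((a ⊔ c) + (A ⊓ C)) + ((a ⊓ c) + (size Λ + size Γ))      ≡⟨ l2 (a ⊔ c) (A ⊓ C) (a ⊓ c) (size Λ + size Γ) ⟩
    (A ⊓ C) + (((a ⊔ c) + (a ⊓ c)) + (size Λ + size Γ))      ≡⟨ cong (λ x → (A ⊓ C) + (x + (size Λ + size Γ))) (max+min a c) ⟩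
    (A ⊓ C) + ((a + c) + (size Λ + size Γ))                  ≡⟨ l3 (A ⊓ C) a c (size Λ) (size Γ) ⟩
    K ∎)
    where
    l1 : ∀ w u w′ v → (w + u) + (w′ + v) ≡ (w + w′) + (u + v)
    l1 = solve-∀
    l2 : ∀ p q r s → (p + q) + (r + s) ≡ q + ((p + r) + s)
    l2 = solve-∀
    l3 : ∀ p a c s t → p + ((a + c) + (s + t)) ≡ p + ((a + s) + (c + t))
    l3 = solve-∀

  shift : ∀ D E ψ w → Z a D c E Λ Γ (λ u → ψ (w + suc u)) ≡ z D E ψ (suc w)
  shift D E ψ w = Z-cong a D c E Λ Γ (λ u → cong ψ (+-suc w u))

  module Step {φ ψ : ℕ → ℚ} (r : Rel K φ ψ) where

    n00 : ∀ w w′ → w + w′ ≡ (a ⊔ c) + (A ⊓ C) → z false false φ w ≡ z false false ψ w′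
    n00 w w′ e = I.p00 (relStep {w = w} {w′} r e)

    n10 : ∀ w w′ → a < c → w + w′ ≡ (a ⊔ c) + (A ⊓ C) → z true false φ w ≡ z true false ψ w′
    n10 w w′ l e = I.p10 l (relStep {w = w} {w′} r e)

    n01 : ∀ w w′ → c < a → w + w′ ≡ (a ⊔ c) + (A ⊓ C) → z false true φ w ≡ z false true ψ w′
    n01 w w′ l e = I.p01 l (relStep {w = w} {w′} r e)

    n01q : ∀ w w′ → a ≤ c → w + w′ ≡ (a ⊔ c) + (A ⊓ C) → z false true φ w ≡ z false true ψ (suc w′)
    n01q w w′ l e = trans (I.q01 l (relStep {w = w} {w′} r e)) (shift false true ψ w′)

    n11q : ∀ w w′ → f ≡ true → g ≡ true → a ≤ c → w + w′ ≡ (a ⊔ c) + (A ⊓ C) →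
           z true true φ w +ℚ z false false ψ (suc w′) ≡ z false false ψ w′ +ℚ z true true ψ (suc w′)
    n11q w w′ fe ge l e = trans (cong (z true true φ w +ℚ_) (sym (shift false false ψ w′)))
      (trans (I.q11 fe ge l (relStep {w = w} {w′} r e)) (cong (z false false ψ w′ +ℚ_) (shift true true ψ w′)))

  lohi : ∀ {lo hi s} → a ⊔ c ≡ lo → A ⊓ C ≡ hi → s ≡ lo + hi → s ≡ (a ⊔ c) + (A ⊓ C)
  lohi refl refl e = e

∑I-bounds : ∀ {l l′ u u′} g → l ≡ l′ → u ≡ u′ → ∑I l u g ≡ ∑I l′ u′ g
∑I-bounds g refl refl = refl

max≤ : ∀ {m n} → m ≤ n → m ⊔ n ≡ n
max≤ = ℕₚ.m≤n⇒m⊔n≡n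

max≥ : ∀ {m n} → n ≤ m → m ⊔ n ≡ m
max≥ = ℕₚ.m≥n⇒m⊔n≡m

min≤ : ∀ {m n} → m ≤ n → m ⊓ n ≡ m
min≤ = ℕₚ.m≤n⇒m⊓n≡m

min≥ : ∀ {m n} → n ≤ m → m ⊓ n ≡ n
min≥ = ℕₚ.m≥n⇒m⊓n≡n

∑I-above : ∀ A l C g → C < A → ∑I (A ⊔ l) (suc A ⊓ suc C) g ≡ 0ℚ
∑I-above A l C g h = ∑I-empty (A ⊔ l) _ (≤-trans (suc⊓≤ʳ A C) (≤-trans h (m≤m⊔n A l)))

∑I-top : ∀ A l C g → A ≤ C → l ≤ A → ∑I (A ⊔ l) (suc A ⊓ suc C) g ≡ g A
∑I-top A l C g h l≤ = trans (∑I-bounds g (max≥ l≤) (min≤ (s≤s h))) (∑I-one A g)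

∑I-over : ∀ k l A C g → A < l → ∑I (k ⊔ l) (suc A ⊓ suc C) g ≡ 0ℚ
∑I-over k l A C g h = ∑I-empty (k ⊔ l) _ (≤-trans (suc⊓≤ˡ A C) (≤-trans h (m≤n⊔m k l)))

0+0 : 0ℚ +ℚ 0ℚ ≡ 0ℚ
0+0 = ℚₚ.+-identityˡ 0ℚ

zero₂ : ∀ {x y} → x ≡ 0ℚ → y ≡ 0ℚ → x +ℚ y ≡ 0ℚ
zero₂ refl refl = 0+0

-- The shape of `q11` once each `Z` is reduced to an interval sum or to a single value; the cells
-- excluded by `okc` remain visible as `0ℚ`.
telescoped : ∀ {l u s t x y₀ yu} → s +ℚ y₀ ≡ t +ℚ yu → x ≡ y₀ → l ≡ x → u ≡ yu → (0ℚ +ℚ l) +ℚ (s +ℚ 0ℚ) ≡ (t +ℚ 0ℚ) +ℚ (0ℚ +ℚ u)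
telescoped {s = s} {t} {x} {y₀} {yu} e refl refl refl = trans (l1 s x) (trans e (l2 t yu))
  where
  l1 : ∀ s x → (0ℚ +ℚ x) +ℚ (s +ℚ 0ℚ) ≡ s +ℚ x
  l1 = solve 2 (λ s x → (con 0ℚ :+ x) :+ (s :+ con 0ℚ) := s :+ x) refl
  l2 : ∀ t y → t +ℚ y ≡ (t +ℚ 0ℚ) +ℚ (0ℚ +ℚ y)
  l2 = solve 2 (λ t y → t :+ y := (t :+ con 0ℚ) :+ (con 0ℚ :+ y)) refl

-- No circle starts here, so the rows below are always in state 00 and the interval reflects onto
-- itself. With both carries the row is forced to length `A`, and these single values are the end
-- terms that telescoping in state 00 leaves over.
pal-FF : ∀ {A C F G} a c Λ Γ → a ≤ A → c ≤ C → Palindromic a c false false Λ Γ →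
         Palindromic A C F G ((a , false) ∷ Λ) ((c , false) ∷ Γ)
pal-FF {A} {C} a c Λ Γ bf bg ih = record
  { p00 = λ {φ} {ψ} r → cong (_+ℚ 0ℚ) (sym-int r)
  ; p10 = λ _ _ → refl ; z10 = λ _ _ → refl ; p01 = λ _ _ → refl ; q01 = λ _ _ → refl
  ; z11 = λ φ C<A → zero₂ refl (∑I-above A c C _ C<A)
  ; q11 = λ _ _ → q }
  where
  open Cell A C a c false false Λ Γ bf bg ih
  sym-int : ∀ {φ ψ} → Rel K φ ψ → ∑I (a ⊔ c) (suc A ⊓ suc C) (z false false φ) ≡ ∑I (a ⊔ c) (suc A ⊓ suc C) (z false false ψ)
  sym-int r = ∑I-reflect (a ⊔ c) _ (a ⊔ c) _ refl
    (λ w w′ _ _ _ _ e → Step.n00 r w w′ (suc-injective (trans e (+-suc (a ⊔ c) (A ⊓ C)))))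
  q : ∀ {φ ψ} → A ≤ C → Rel K φ ψ → _ ≡ _
  q {φ} {ψ} A≤C r with c ≤? A
  ... | yes c≤A = telescoped {s = ∑I (a ⊔ c) (suc (A ⊓ C)) (z false false (ψ ∘ suc))} {t = ∑I (a ⊔ c) (suc (A ⊓ C)) (z false false ψ)} {y₀ = z false false ψ (a ⊔ c)} {yu = z false false ψ (suc A)}
        (trans (∑I-telescope (a ⊔ c) (suc (A ⊓ C)) (z false false ψ) (m≤n⇒m≤1+n (⊔-lub (⊓-glb a≤A (≤-trans a≤A A≤C)) (⊓-glb c≤A c≤C))))
               (cong (λ x → ∑I (a ⊔ c) (suc (A ⊓ C)) (z false false ψ) +ℚ z false false ψ (suc x)) (min≤ A≤C)))
        (Step.n00 r A (a ⊔ c) (trans (ℕₚ.+-comm A (a ⊔ c)) (cong ((a ⊔ c) +_) (sym (min≤ A≤C)))))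
        (∑I-top A c C (z false false φ) A≤C c≤A)
        (∑I-top A c C (z false false (ψ ∘ suc)) A≤C c≤A)
  ... | no c≰A = trans (zero₂ (zero₂ refl (∑I-over A c A C _ A<c)) (zero₂ (∑I-over a c A C _ A<c) refl))
                       (sym (zero₂ (zero₂ (∑I-over a c A C _ A<c) refl) (zero₂ refl (∑I-over A c A C _ A<c))))
    where A<c = ≰⇒> c≰A

-- With no carry the circle of Λ has to drop, which leads to state 10. By `z10` that is void unless
-- a < c, and then the bound `suc a` is absorbed in the maximum with `c`. An arriving branching
-- circle lets the circle of Λ stay, under the bound `A`; for A ≤ C this makes the interval one
-- shorter, which is the shift in `q01`.
pal-TF : ∀ {A C F G} a c Λ Γ → suc a ≤ A → c ≤ C → Palindromic a c true false Λ Γ →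
         Palindromic A C F G ((a , true) ∷ Λ) ((c , false) ∷ Γ)
pal-TF {A} {C} a c Λ Γ bf bg ih = record
  { p00 = λ r → cong (_+ℚ 0ℚ) (p r)
  ; p10 = λ _ _ → refl ; z10 = λ _ _ → refl
  ; p01 = λ C<A r → cong (0ℚ +ℚ_) (p′ C<A r)
  ; q01 = λ A≤C r → cong (0ℚ +ℚ_) (q′ A≤C r)
  ; z11 = λ φ C<A → zero₂ refl (∑I-above A c C _ C<A)
  ; q11 = λ _ _ → q }
  where
  open Cell A C a c true false Λ Γ bf bg ih
  vanish : ∀ φ l u → c ≤ a → ∑I l u (z true false φ) ≡ 0ℚ
  vanish φ l u c≤a = ∑I-zero l u (λ w _ _ → I.z10 _ c≤a)
  p : ∀ {φ ψ} → Rel K φ ψ → ∑I (suc a ⊔ c) (suc A ⊓ suc C) (z true false φ) ≡ ∑I (suc a ⊔ c) (suc A ⊓ suc C) (z true false ψ)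
  p {φ} {ψ} r with c ≤? a
  ... | yes c≤a = trans (vanish φ _ _ c≤a) (sym (vanish ψ _ _ c≤a))
  ... | no c≰a = ∑I-reflect (suc a ⊔ c) _ (suc a ⊔ c) _ refl
    (λ w w′ _ _ _ _ e → Step.n10 r w w′ (≰⇒> c≰a)
      (lohi (max≤ (<⇒≤ a<c)) refl (suc-injective (trans e (trans (+-suc _ (A ⊓ C)) (cong (λ x → suc (x + (A ⊓ C))) (max≤ a<c)))))))
    where a<c = ≰⇒> c≰a
  p′ : ∀ {φ ψ} → C < A → Rel K φ ψ → ∑I (a ⊔ c) (A ⊓ suc C) (z false false φ) ≡ ∑I (a ⊔ c) (A ⊓ suc C) (z false false ψ)
  p′ C<A r = ∑I-reflect (a ⊔ c) _ (a ⊔ c) _ refl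
    (λ w w′ _ _ _ _ e → Step.n00 r w w′ (lohi refl (min≥ (<⇒≤ C<A)) (suc-injective (trans e (trans (cong ((a ⊔ c) +_) (min≥ C<A)) (+-suc (a ⊔ c) C))))))
  q′ : ∀ {φ ψ} → A ≤ C → Rel K φ ψ → ∑I (a ⊔ c) (A ⊓ suc C) (z false false φ) ≡ ∑I (a ⊔ c) (A ⊓ suc C) (z false false (ψ ∘ suc))
  q′ A≤C r = ∑I-reflect (a ⊔ c) _ (a ⊔ c) _ refl
    (λ w w′ _ _ _ _ e → Step.n00 r w (suc w′) (lohi refl (min≤ A≤C) (trans (+-suc w w′) (trans e (cong ((a ⊔ c) +_) (min≤ (m≤n⇒m≤1+n A≤C)))))))
  q : ∀ {φ ψ} → A ≤ C → Rel K φ ψ → _ ≡ _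
  q {φ} {ψ} A≤C r with c ≤? a | c ≤? A
  ... | yes c≤a | _ = trans (zero₂ (zero₂ refl (vanish φ _ _ c≤a)) (zero₂ (vanish (ψ ∘ suc) _ _ c≤a) refl))
                            (sym (zero₂ (zero₂ (vanish ψ _ _ c≤a) refl) (zero₂ refl (vanish (ψ ∘ suc) _ _ c≤a))))
  ... | no c≰a | yes c≤A = telescoped {s = ∑I (suc a ⊔ c) (suc (A ⊓ C)) (z true false (ψ ∘ suc))} {t = ∑I (suc a ⊔ c) (suc (A ⊓ C)) (z true false ψ)} {y₀ = z true false ψ c} {yu = z true false ψ (suc A)}
        (subst₂ (λ l u → ∑I l u (z true false (ψ ∘ suc)) +ℚ z true false ψ c ≡ ∑I l u (z true false ψ) +ℚ z true false ψ (suc A))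
          (sym (max≤ a<c)) (cong suc (sym (min≤ A≤C))) (∑I-telescope c (suc A) (z true false ψ) (m≤n⇒m≤1+n c≤A)))
        (Step.n10 r A c a<c (lohi (max≤ (<⇒≤ a<c)) (min≤ A≤C) (ℕₚ.+-comm A c)))
        (∑I-top A c C (z true false φ) A≤C c≤A)
        (∑I-top A c C (z true false (ψ ∘ suc)) A≤C c≤A)
    where a<c = ≰⇒> c≰a
  ... | no _ | no c≰A = trans (zero₂ (zero₂ refl (∑I-over A c A C _ A<c)) (zero₂ (∑I-over (suc a) c A C _ A<c) refl))
                       (sym (zero₂ (zero₂ (∑I-over (suc a) c A C _ A<c) refl) (zero₂ refl (∑I-over A c A C _ A<c))))
    where A<c = ≰⇒> c≰A

-- the interval { A } ∩ { c }
∑I-meet : ∀ A c g → A ≢ c → ∑I (A ⊔ c) (suc A ⊓ suc c) g ≡ 0ℚ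
∑I-meet A c g ne with A <? c
... | yes A<c = ∑I-empty (A ⊔ c) _ (≤-trans (suc⊓≤ˡ A c) (≤-trans A<c (m≤n⊔m A c)))
... | no A≮c = ∑I-empty (A ⊔ c) _ (≤-trans (suc⊓≤ʳ A c) (≤-trans (≤∧≢⇒< (≮⇒≥ A≮c) (ne ∘ sym)) (m≤m⊔n A c)))

meet : ∀ {A c g g′} → (A ≡ c → g A ≡ g′ A) → ∑I (A ⊔ c) (suc A ⊓ suc c) g ≡ ∑I (A ⊔ c) (suc A ⊓ suc c) g′
meet {A} {c} {g} {g′} h with A ≟ c
... | yes refl = trans (∑I-top A A A g ≤-refl ≤-refl) (trans (h refl) (sym (∑I-top A A A g′ ≤-refl ≤-refl)))
... | no ne = trans (∑I-meet A c g ne) (sym (∑I-meet A c g′ ne))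

-- For a ≤ c the lower bound `suc c` is one too large for the reflection, and the shift of `q01` in
-- the rows below makes up for it. For c < a the bound is absorbed in the maximum and `p01` applies.
pal-FT : ∀ {A C F G} a c Λ Γ → a ≤ A → suc c ≤ C → Palindromic a c false true Λ Γ →
         Palindromic A C F G ((a , false) ∷ Λ) ((c , true) ∷ Γ)
pal-FT {A} {C} a c Λ Γ bf bg ih = record
  { p00 = λ r → cong (_+ℚ 0ℚ) (p r)
  ; p10 = λ {φ} {ψ} A<C r → cong (0ℚ +ℚ_) (meet {A} {c} (λ { refl → Step.n00 r A A (lohi (max≤ a≤A) (min≤ (<⇒≤ A<C)) refl) }))
  ; z10 = λ φ C≤A → zero₂ refl (∑I-meet A c _ (λ e → <-irrefl (sym e) (≤-trans bg C≤A)))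
  ; p01 = λ _ _ → refl ; q01 = λ _ _ → refl
  ; z11 = λ φ C<A → zero₂ refl (∑I-above A (suc c) C _ C<A)
  ; q11 = λ _ _ → q }
  where
  open Cell A C a c false true Λ Γ bf bg ih
  p : ∀ {φ ψ} → Rel K φ ψ → ∑I (a ⊔ suc c) (suc A ⊓ suc C) (z false true φ) ≡ ∑I (a ⊔ suc c) (suc A ⊓ suc C) (z false true ψ)
  p {φ} {ψ} r with a ≤? c
  ... | no a≰c = ∑I-reflect (a ⊔ suc c) _ (a ⊔ suc c) _ refl
    (λ w w′ _ _ _ _ e → Step.n01 r w w′ c<a
      (lohi (max≥ (<⇒≤ c<a)) refl (suc-injective (trans e (trans (+-suc _ (A ⊓ C)) (cong (λ x → suc (x + (A ⊓ C))) (max≥ c<a)))))))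
    where c<a = ≰⇒> a≰c
  ... | yes a≤c = ∑I-reflect (a ⊔ suc c) _ (a ⊔ suc c) _ refl step
    where
    step : ∀ w w′ → a ⊔ suc c ≤ w → w < suc (A ⊓ C) → a ⊔ suc c ≤ w′ → w′ < suc (A ⊓ C) → suc (w + w′) ≡ (a ⊔ suc c) + suc (A ⊓ C) →
           z false true φ w ≡ z false true ψ w′
    step w zero _ _ l _ _ = ⊥-elim (ℕₚ.n≮0 (≤-trans (m≤n⊔m a (suc c)) l))
    step w (suc w′) _ _ _ _ e = Step.n01q r w w′ a≤c (lohi (max≤ a≤c) refl
      (suc-injective (suc-injective (trans (cong suc (sym (+-suc w w′))) (trans e (trans (cong (_+ suc (A ⊓ C)) (max≤ (m≤n⇒m≤1+n a≤c))) (cong suc (+-suc c (A ⊓ C)))))))))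
  q : ∀ {φ ψ} → A ≤ C → Rel K φ ψ → _ ≡ _
  q {φ} {ψ} A≤C r with suc c ≤? A
  ... | no c≮A = trans (zero₂ (zero₂ refl (∑I-over A (suc c) A C _ A<c)) (zero₂ (∑I-over a (suc c) A C _ A<c) refl))
                       (sym (zero₂ (zero₂ (∑I-over a (suc c) A C _ A<c) refl) (zero₂ refl (∑I-over A (suc c) A C _ A<c))))
    where A<c = ≰⇒> c≮A
  ... | yes c<A with a ≤? c
  ...   | no a≰c = telescoped {s = ∑I (a ⊔ suc c) (suc (A ⊓ C)) (z false true (ψ ∘ suc))} {t = ∑I (a ⊔ suc c) (suc (A ⊓ C)) (z false true ψ)} {y₀ = z false true ψ a} {yu = z false true ψ (suc A)}
        (subst₂ (λ l u → ∑I l u (z false true (ψ ∘ suc)) +ℚ z false true ψ a ≡ ∑I l u (z false true ψ) +ℚ z false true ψ (suc A))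
          (sym (max≥ c<a)) (cong suc (sym (min≤ A≤C))) (∑I-telescope a (suc A) (z false true ψ) (m≤n⇒m≤1+n a≤A)))
        (Step.n01 r A a c<a (lohi (max≥ (<⇒≤ c<a)) (min≤ A≤C) (ℕₚ.+-comm A a)))
        (∑I-top A (suc c) C (z false true φ) A≤C c<A)
        (∑I-top A (suc c) C (z false true (ψ ∘ suc)) A≤C c<A)
    where c<a = ≰⇒> a≰c
  ...   | yes a≤c = telescoped {s = ∑I (a ⊔ suc c) (suc (A ⊓ C)) (z false true (ψ ∘ suc))} {t = ∑I (a ⊔ suc c) (suc (A ⊓ C)) (z false true ψ)} {y₀ = z false true ψ (suc c)} {yu = z false true ψ (suc A)}
        (subst₂ (λ l u → ∑I l u (z false true (ψ ∘ suc)) +ℚ z false true ψ (suc c) ≡ ∑I l u (z false true ψ) +ℚ z false true ψ (suc A))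
          (sym (max≤ (m≤n⇒m≤1+n a≤c))) (cong suc (sym (min≤ A≤C))) (∑I-telescope (suc c) (suc A) (z false true ψ) (m≤n⇒m≤1+n c<A)))
        (Step.n01q r A c a≤c (lohi (max≤ a≤c) (min≤ A≤C) (ℕₚ.+-comm A c)))
        (∑I-top A (suc c) C (z false true φ) A≤C c<A)
        (∑I-top A (suc c) C (z false true (ψ ∘ suc)) A≤C c<A)

-- With no carry the two circles drop together, leading to state 11, or stay together, leading to
-- state 00 with the row pinned to length `c`. Neither part is symmetric alone; the relation `q11`
-- of the rows below carries the defect of one over to the other.
pal-TT : ∀ {A C F G} a c Λ Γ → suc a ≤ A → suc c ≤ C → Palindromic a c true true Λ Γ →
         Palindromic A C F G ((a , true) ∷ Λ) ((c , true) ∷ Γ)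
pal-TT {A} {C} a c Λ Γ bf bg ih = record
  { p00 = p
  ; p10 = λ {φ} {ψ} A<C r → cong (0ℚ +ℚ_) (meet {A} {c} (λ { refl → Step.n10 r A A bf (lohi (max≤ a≤A) (min≤ (<⇒≤ A<C)) refl) }))
  ; z10 = λ φ C≤A → zero₂ refl (∑I-meet A c _ (λ e → <-irrefl (sym e) (≤-trans bg C≤A)))
  ; p01 = λ C<A r → cong (0ℚ +ℚ_) (p′ C<A r)
  ; q01 = λ A≤C r → cong (0ℚ +ℚ_) (q′ A≤C r)
  ; z11 = λ φ C<A → zero₂ refl (∑I-above A (suc c) C _ C<A)
  ; q11 = λ _ _ → q }
  where
  open Cell A C a c true true Λ Γ bf bg ih
  vanish : ∀ φ l u → c < a → ∑I l u (z true true φ) ≡ 0ℚ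
  vanish φ l u c<a = ∑I-zero l u (λ w _ _ → I.z11 _ c<a)
  -- the summand for no dropping circle lives on { c } and needs a ≤ c < A
  none₁ : ∀ g → c < a → ∑I (a ⊔ c) (A ⊓ suc c) g ≡ 0ℚ
  none₁ g c<a = ∑I-empty (a ⊔ c) _ (≤-trans (m⊓n≤n A (suc c)) (≤-trans c<a (m≤m⊔n a c)))
  none₂ : ∀ g → A ≤ c → ∑I (a ⊔ c) (A ⊓ suc c) g ≡ 0ℚ
  none₂ g A≤c = ∑I-empty (a ⊔ c) _ (≤-trans (m⊓n≤m A (suc c)) (≤-trans A≤c (m≤n⊔m a c)))
  one : ∀ g → a ≤ c → c < A → ∑I (a ⊔ c) (A ⊓ suc c) g ≡ g c
  one g a≤c c<A = trans (∑I-bounds g (max≤ a≤c) (min≥ c<A)) (∑I-one c g)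
  empty : ∀ g → A ≤ c → ∑I (suc (a ⊔ c)) (suc (A ⊓ C)) g ≡ 0ℚ
  empty g A≤c = ∑I-over (suc a) (suc c) A C g (s≤s A≤c)
  p : ∀ {φ ψ} → Rel K φ ψ →
      ∑I (suc (a ⊔ c)) (suc (A ⊓ C)) (z true true φ) +ℚ ∑I (a ⊔ c) (A ⊓ suc c) (z false false φ) ≡
      ∑I (suc (a ⊔ c)) (suc (A ⊓ C)) (z true true ψ) +ℚ ∑I (a ⊔ c) (A ⊓ suc c) (z false false ψ)
  p {φ} {ψ} r with a ≤? c | suc c ≤? A
  ... | no a≰c | _ = trans (zero₂ (vanish φ _ _ c<a) (none₁ _ c<a)) (sym (zero₂ (vanish ψ _ _ c<a) (none₁ _ c<a)))
    where c<a = ≰⇒> a≰c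
  ... | yes a≤c | no c≮A = trans (zero₂ (empty _ A≤c) (none₂ _ A≤c)) (sym (zero₂ (empty _ A≤c) (none₂ _ A≤c)))
    where A≤c = ≮⇒≥ c≮A
  ... | yes a≤c | yes c<A = begin
    ∑I (suc (a ⊔ c)) (suc hi) (z true true φ) +ℚ ∑I (a ⊔ c) (A ⊓ suc c) (z false false φ)
      ≡⟨ cong₂ _+ℚ_ (trans (∑I-bounds _ (cong suc (max≤ a≤c)) refl) refl-sum) (trans (one _ a≤c c<A) (Step.n00 r c hi (lohi (max≤ a≤c) refl refl))) ⟩
    ((S0 +ℚ Y) +ℚ (-ℚ S1)) +ℚ y₀ hi
      ≡⟨ alg S0 Y S1 (y₀ c) (y₀ hi) (∑I-telescope c hi y₀ (<⇒≤ c<hi)) ⟩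
    Y +ℚ y₀ c
      ≡⟨ cong₂ _+ℚ_ (∑I-bounds (z true true ψ) (cong suc (sym (max≤ a≤c))) refl) (sym (one _ a≤c c<A)) ⟩
    ∑I (suc (a ⊔ c)) (suc hi) (z true true ψ) +ℚ ∑I (a ⊔ c) (A ⊓ suc c) (z false false ψ) ∎
    where
    hi = A ⊓ C
    c<hi : c < hi
    c<hi = ⊓-glb c<A bg
    y₀ y₁ : ℕ → ℚ
    y₀ = z false false ψ
    y₁ = z true true ψ
    S0 = ∑I c hi y₀
    S1 = ∑I c hi (y₀ ∘ suc)
    Y = ∑I (suc c) (suc hi) y₁
    move : ∀ x s t y → x +ℚ s ≡ t +ℚ y → x ≡ (t +ℚ y) +ℚ (-ℚ s)
    move x s t y e = trans (solve 2 (λ x s → x := (x :+ s) :+ (:- s)) refl x s) (cong (_+ℚ (-ℚ s)) e)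
    refl-sum : ∑I (suc c) (suc hi) (z true true φ) ≡ (S0 +ℚ Y) +ℚ (-ℚ S1)
    -- `n11q` is solved for the value of state 11 and summed over the reflected interval. Of the two
    -- sums in state 00 only the end values at `c` and `hi` remain, and the second cell supplies
    -- their counterparts.
    refl-sum = begin
      ∑I (suc c) (suc hi) (z true true φ)
        ≡⟨ ∑I-reflect (suc c) (suc hi) c hi refl
             (λ w w′ _ _ _ _ e → move (z true true φ w) (y₀ (suc w′)) (y₀ w′) (y₁ (suc w′)) (Step.n11q r w w′ refl refl a≤c (lohi (max≤ a≤c) refl (suc-injective e)))) ⟩
      ∑I c hi (λ w → (y₀ w +ℚ y₁ (suc w)) +ℚ (-ℚ y₀ (suc w)))
        ≡⟨ ∑I-+ c hi _ _ ⟩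
      ∑I c hi (λ w → y₀ w +ℚ y₁ (suc w)) +ℚ ∑I c hi (λ w → -ℚ y₀ (suc w))
        ≡⟨ cong₂ _+ℚ_ (trans (∑I-+ c hi y₀ (y₁ ∘ suc)) (cong (S0 +ℚ_) (∑I-suc c hi y₁))) (∑I-neg c hi (y₀ ∘ suc)) ⟩
      (S0 +ℚ Y) +ℚ (-ℚ S1) ∎
    alg : ∀ S0 Y S1 yc yh → S1 +ℚ yc ≡ S0 +ℚ yh → ((S0 +ℚ Y) +ℚ (-ℚ S1)) +ℚ yh ≡ Y +ℚ yc
    alg S0 Y S1 yc yh e = trans (solve 4 (λ S0 Y S1 yh → ((S0 :+ Y) :+ (:- S1)) :+ yh := (Y :+ (:- S1)) :+ (S0 :+ yh)) refl S0 Y S1 yh)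
      (trans (cong ((Y +ℚ (-ℚ S1)) +ℚ_) (sym e)) (solve 3 (λ Y S1 yc → (Y :+ (:- S1)) :+ (S1 :+ yc) := Y :+ yc) refl Y S1 yc))
  p′ : ∀ {φ ψ} → C < A → Rel K φ ψ → ∑I (a ⊔ suc c) (A ⊓ suc C) (z false true φ) ≡ ∑I (a ⊔ suc c) (A ⊓ suc C) (z false true ψ)
  p′ {φ} {ψ} C<A r with a ≤? c
  ... | no a≰c = ∑I-reflect (a ⊔ suc c) _ (a ⊔ suc c) _ refl
    (λ w w′ _ _ _ _ e → Step.n01 r w w′ c<a
      (lohi (max≥ (<⇒≤ c<a)) (min≥ (<⇒≤ C<A)) (suc-injective (trans e (trans (cong₂ _+_ (max≥ c<a) (min≥ C<A)) (+-suc a C))))))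
    where c<a = ≰⇒> a≰c
  ... | yes a≤c = ∑I-reflect (a ⊔ suc c) _ (a ⊔ suc c) _ refl step
    where
    step : ∀ w w′ → a ⊔ suc c ≤ w → w < A ⊓ suc C → a ⊔ suc c ≤ w′ → w′ < A ⊓ suc C → suc (w + w′) ≡ (a ⊔ suc c) + (A ⊓ suc C) →
           z false true φ w ≡ z false true ψ w′
    step w zero _ _ l _ _ = ⊥-elim (ℕₚ.n≮0 (≤-trans (m≤n⊔m a (suc c)) l))
    step w (suc w′) _ _ _ _ e = Step.n01q r w w′ a≤c (lohi (max≤ a≤c) (min≥ (<⇒≤ C<A))
      (suc-injective (suc-injective (trans (cong suc (sym (+-suc w w′))) (trans e (trans (cong₂ _+_ (max≤ (m≤n⇒m≤1+n a≤c)) (min≥ C<A)) (cong suc (+-suc c C))))))))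
  q′ : ∀ {φ ψ} → A ≤ C → Rel K φ ψ → ∑I (a ⊔ suc c) (A ⊓ suc C) (z false true φ) ≡ ∑I (a ⊔ suc c) (A ⊓ suc C) (z false true (ψ ∘ suc))
  q′ {φ} {ψ} A≤C r with a ≤? c
  ... | no a≰c = ∑I-reflect (a ⊔ suc c) _ (a ⊔ suc c) _ refl
    (λ w w′ _ _ _ _ e → Step.n01 r w (suc w′) c<a
      (lohi (max≥ (<⇒≤ c<a)) (min≤ A≤C) (trans (+-suc w w′) (trans e (cong₂ _+_ (max≥ c<a) (min≤ (m≤n⇒m≤1+n A≤C)))))))
    where c<a = ≰⇒> a≰c
  ... | yes a≤c = ∑I-reflect (a ⊔ suc c) _ (a ⊔ suc c) _ refl
    (λ w w′ _ _ _ _ e → Step.n01q r w w′ a≤c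
      (lohi (max≤ a≤c) (min≤ A≤C) (suc-injective (trans e (cong₂ _+_ (max≤ (m≤n⇒m≤1+n a≤c)) (min≤ (m≤n⇒m≤1+n A≤C)))))))
  q : ∀ {φ ψ} → A ≤ C → Rel K φ ψ →
      (0ℚ +ℚ ∑I (A ⊔ suc c) (suc A ⊓ suc C) (z true true φ)) +ℚ
        (∑I (suc (a ⊔ c)) (suc (A ⊓ C)) (z true true (ψ ∘ suc)) +ℚ ∑I (a ⊔ c) (A ⊓ suc c) (z false false (ψ ∘ suc)))
      ≡ (∑I (suc (a ⊔ c)) (suc (A ⊓ C)) (z true true ψ) +ℚ ∑I (a ⊔ c) (A ⊓ suc c) (z false false ψ)) +ℚ
        (0ℚ +ℚ ∑I (A ⊔ suc c) (suc A ⊓ suc C) (z true true (ψ ∘ suc)))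
  q {φ} {ψ} A≤C r with a ≤? c | suc c ≤? A
  ... | no a≰c | _ = trans (zero₂ (zero₂ refl (vanish φ _ _ c<a)) (zero₂ (vanish (ψ ∘ suc) _ _ c<a) (none₁ _ c<a)))
                           (sym (zero₂ (zero₂ (vanish ψ _ _ c<a) (none₁ _ c<a)) (zero₂ refl (vanish (ψ ∘ suc) _ _ c<a))))
    where c<a = ≰⇒> a≰c
  ... | yes a≤c | no c≮A = trans (zero₂ (zero₂ refl (∑I-over A (suc c) A C _ (s≤s A≤c))) (zero₂ (empty _ A≤c) (none₂ _ A≤c)))
                           (sym (zero₂ (zero₂ (empty _ A≤c) (none₂ _ A≤c)) (zero₂ refl (∑I-over A (suc c) A C _ (s≤s A≤c)))))
    where A≤c = ≮⇒≥ c≮A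
  ... | yes a≤c | yes c<A = begin
    (0ℚ +ℚ ∑I (A ⊔ suc c) (suc A ⊓ suc C) (z true true φ)) +ℚ
      (∑I (suc (a ⊔ c)) (suc (A ⊓ C)) (y₁ ∘ suc) +ℚ ∑I (a ⊔ c) (A ⊓ suc c) (y₀ ∘ suc))
      ≡⟨ cong₂ (λ s t → (0ℚ +ℚ s) +ℚ t) (∑I-top A (suc c) C (z true true φ) A≤C c<A) (cong₂ _+ℚ_ (∑I-bounds (y₁ ∘ suc) (cong suc (max≤ a≤c)) (cong suc (min≤ A≤C))) (one (y₀ ∘ suc) a≤c c<A)) ⟩
    (0ℚ +ℚ z true true φ A) +ℚ (∑I (suc c) (suc A) (y₁ ∘ suc) +ℚ y₀ (suc c))
      ≡⟨ alg (z true true φ A) (y₀ (suc c)) (y₀ c) (y₁ (suc c)) (∑I (suc c) (suc A) y₁) (∑I (suc c) (suc A) (y₁ ∘ suc)) (y₁ (suc A)) (Step.n11q r A c refl refl a≤c (lohi (max≤ a≤c) (min≤ A≤C) (ℕₚ.+-comm A c))) (∑I-telescope (suc c) (suc A) y₁ (m≤n⇒m≤1+n c<A)) ⟩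
    (∑I (suc c) (suc A) y₁ +ℚ y₀ c) +ℚ (0ℚ +ℚ y₁ (suc A))
      ≡⟨ cong₂ (λ s t → s +ℚ (0ℚ +ℚ t)) (cong₂ _+ℚ_ (∑I-bounds y₁ (cong suc (sym (max≤ a≤c))) (cong suc (sym (min≤ A≤C)))) (sym (one y₀ a≤c c<A))) (sym (∑I-top A (suc c) C (y₁ ∘ suc) A≤C c<A)) ⟩
    (∑I (suc (a ⊔ c)) (suc (A ⊓ C)) y₁ +ℚ ∑I (a ⊔ c) (A ⊓ suc c) y₀) +ℚ (0ℚ +ℚ ∑I (A ⊔ suc c) (suc A ⊓ suc C) (y₁ ∘ suc)) ∎
    where
    y₀ y₁ : ℕ → ℚ
    y₀ = z false false ψ
    y₁ = z true true ψ
    alg : ∀ x y0s y0 y1s S S′ yA → x +ℚ y0s ≡ y0 +ℚ y1s → S′ +ℚ y1s ≡ S +ℚ yA → (0ℚ +ℚ x) +ℚ (S′ +ℚ y0s) ≡ (S +ℚ y0) +ℚ (0ℚ +ℚ yA)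
    alg x y0s y0 y1s S S′ yA e₁ e₂ =
      trans (solve 3 (λ x S y → (con 0ℚ :+ x) :+ (S :+ y) := (x :+ y) :+ S) refl x S′ y0s)
      (trans (cong (_+ℚ S′) e₁)
      (trans (solve 3 (λ y0 y1s S → (y0 :+ y1s) :+ S := (S :+ y1s) :+ y0) refl y0 y1s S′)
      (trans (cong (_+ℚ y0) e₂)
      (solve 3 (λ S yA y0 → (S :+ yA) :+ y0 := (S :+ y0) :+ (con 0ℚ :+ yA)) refl S yA y0))))

palindromic : ∀ {A C F G Λ Γ} → Paired A C F G Λ Γ → Palindromic A C F G Λ Γ
palindromic (end {A}) = record
  { p00 = λ r → r 0 0 (sym (trans (ℕₚ.+-identityʳ (A ⊓ 0)) (ℕₚ.⊓-zeroʳ A)))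
  ; p10 = λ _ _ → refl ; z10 = λ _ _ → refl ; p01 = λ _ _ → refl ; q01 = λ _ _ → refl ; z11 = λ _ _ → refl
  ; q11 = λ _ () }
palindromic (cons {a = a} {c} {false} {false} {Λ} {Γ} bf bg pr) = pal-FF a c Λ Γ bf bg (palindromic pr)
palindromic (cons {a = a} {c} {true}  {false} {Λ} {Γ} bf bg pr) = pal-TF a c Λ Γ bf bg (palindromic pr)
palindromic (cons {a = a} {c} {false} {true}  {Λ} {Γ} bf bg pr) = pal-FT a c Λ Γ bf bg (palindromic pr)
palindromic (cons {a = a} {c} {true}  {true}  {Λ} {Γ} bf bg pr) = pal-TT a c Λ Γ bf bg (palindromic pr)

-- Sums over finite boxes of diagrams

rowsOf : ℕ → List Row
rowsOf M = concatMap (λ w → (w , false) ∷ (w , true) ∷ []) (upTo (suc M))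

-- All lists of `k` rows of length at most `M`, valid or not; validity is left to the summands.
box : ℕ → ℕ → List (List Row)
box M zero    = [] ∷ []
box M (suc k) = concatMap (λ r → map (r ∷_) (box M k)) (rowsOf M)

∑-box-suc : ∀ M k (f : List Row → ℚ) → ∑ (box M (suc k)) f ≡
  ∑< (suc M) (λ w → ∑ (box M k) (λ Ω → f ((w , false) ∷ Ω)) +ℚ ∑ (box M k) (λ Ω → f ((w , true) ∷ Ω)))
∑-box-suc M k f = begin
  ∑ (box M (suc k)) f                                   ≡⟨ ∑-concatMap (λ r → map (r ∷_) (box M k)) (rowsOf M) f ⟩
  ∑ (rowsOf M) (λ r → ∑ (map (r ∷_) (box M k)) f)       ≡⟨ ∑-cong′ (rowsOf M) (λ r → ∑-map (r ∷_) (box M k) f) ⟩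
  ∑ (rowsOf M) g                                        ≡⟨ ∑-concatMap (λ w → (w , false) ∷ (w , true) ∷ []) (upTo (suc M)) g ⟩
  ∑ (upTo (suc M)) (λ w → g (w , false) +ℚ (g (w , true) +ℚ 0ℚ))
    ≡⟨ ∑-upTo (suc M) (λ w → g (w , false) +ℚ (g (w , true) +ℚ 0ℚ)) ⟩
  ∑< (suc M) (λ w → g (w , false) +ℚ (g (w , true) +ℚ 0ℚ))
    ≡⟨ ∑<-cong′ (suc M) (λ w → cong (g (w , false) +ℚ_) (ℚₚ.+-identityʳ (g (w , true)))) ⟩
  ∑< (suc M) (λ w → g (w , false) +ℚ g (w , true)) ∎
  where
  g : Row → ℚ
  g r = ∑ (box M k) (λ Ω → f (r ∷ Ω))

when-shuffle : ∀ p i r p′ i′ r′ x → when ((p ∧ i ∧ r) ∧ (p′ ∧ i′ ∧ r′)) x ≡ when (p ∧ p′) (when (i ∧ i′) (when (r ∧ r′) x))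
when-shuffle false _     r     p′    i′    r′ x = refl
when-shuffle true  false r     p′    i′    r′ x = sym (when-zero p′)
when-shuffle true  true  r     true  true  r′ x = refl
when-shuffle true  true  false true  false r′ x = refl
when-shuffle true  true  true  true  false r′ x = refl
when-shuffle true  true  false false i′    r′ x = refl
when-shuffle true  true  true  false i′    r′ x = refl

⊔-≤ᵇ : ∀ l l′ w → (l ⊔ l′ ≤ᵇ w) ≡ (l ≤ᵇ w) ∧ (l′ ≤ᵇ w)
⊔-≤ᵇ l l′ w = bool-ext {l ⊔ l′ ≤ᵇ w}
  (λ h → ∧-intro (≤→≤ᵇ {l} {w} (≤-trans (m≤m⊔n l l′) (≤ᵇ→≤ {l ⊔ l′} {w} h)))
                 (≤→≤ᵇ {l′} {w} (≤-trans (m≤n⊔m l l′) (≤ᵇ→≤ {l ⊔ l′} {w} h))))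
  (λ h → let h₁ , h₂ = ∧-split {l ≤ᵇ w} h in ≤→≤ᵇ {l ⊔ l′} {w} (⊔-lub (≤ᵇ→≤ {l} h₁) (≤ᵇ→≤ {l′} h₂)))

⊓-<ᵇ : ∀ u u′ w → (w <ᵇ u ⊓ u′) ≡ (w <ᵇ u) ∧ (w <ᵇ u′)
⊓-<ᵇ u u′ w = bool-ext {w <ᵇ u ⊓ u′}
  (λ h → ∧-intro (<→<ᵇ {w} {u} (≤-trans (<ᵇ→< {w} {u ⊓ u′} h) (m⊓n≤m u u′)))
                 (<→<ᵇ {w} {u′} (≤-trans (<ᵇ→< {w} {u ⊓ u′} h) (m⊓n≤n u u′))))
  (λ h → let h₁ , h₂ = ∧-split {w <ᵇ u} h in <→<ᵇ {w} {u ⊓ u′} (⊓-glb (<ᵇ→< {w} h₁) (<ᵇ→< {w} h₂)))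

∧-interchange : ∀ p q r s → (p ∧ q) ∧ (r ∧ s) ≡ (p ∧ r) ∧ (q ∧ s)
∧-interchange true  true  r s = refl
∧-interchange true  false true  s = refl
∧-interchange true  false false s = refl
∧-interchange false q r s = refl

∑<-interval₂ : ∀ N l u l′ u′ g → u ≤ N →
  ∑< N (λ w → when (((l ≤ᵇ w) ∧ (w <ᵇ u)) ∧ ((l′ ≤ᵇ w) ∧ (w <ᵇ u′))) (g w)) ≡ ∑I (l ⊔ l′) (u ⊓ u′) g
∑<-interval₂ N l u l′ u′ g u≤N = trans
  (∑<-cong′ N (λ w → when-≡ (g w) (trans (∧-interchange (l ≤ᵇ w) (w <ᵇ u) (l′ ≤ᵇ w) (w <ᵇ u′))
    (sym (cong₂ _∧_ (⊔-≤ᵇ l l′ w) (⊓-<ᵇ u u′ w))))))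
  (∑<-interval N (l ⊔ l′) (u ⊓ u′) g (≤-trans (m⊓n≤m u u′) u≤N))

upP≤ : ∀ A f D h → upP A f D h ≤ suc A
upP≤ A true  false true  = n≤1+n A
upP≤ A true  false false = ≤-refl
upP≤ A true  true  h     = ≤-refl
upP≤ A false D     h     = ≤-refl

-- The two tests on a row are interval tests, and an intersection of intervals is an interval. The
-- box loses nothing, since `pieri` bounds each row by the preceding row of Λ and hence by `M`.
∑-above : ∀ {M} A D C E Λ Γ φ → A ≤ M → Valid A Λ → length Λ ≡ length Γ →
  ∑ (box M (length Λ)) (λ Ω → when (pieri A D Λ Ω ∧ branch C E Γ Ω) (φ (size Ω))) ≡ Z A D C E Λ Γ φ
∑-above A D C E [] [] φ _ _ _ = ℚₚ.+-identityʳ _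
∑-above {M} A D C E ((a , f) ∷ Λ) ((c , g) ∷ Γ) φ A≤M (b ∷ v) e = begin
  ∑ (box M (suc (length Λ))) F                             ≡⟨ ∑-box-suc M (length Λ) F ⟩
  ∑< (suc M) (λ w → part false w +ℚ part true w)           ≡⟨ ∑<-+ (suc M) (part false) (part true) ⟩
  ∑< (suc M) (part false) +ℚ ∑< (suc M) (part true)        ≡⟨ cong₂ _+ℚ_ (cell false) (cell true) ⟩
  Z A D C E ((a , f) ∷ Λ) ((c , g) ∷ Γ) φ ∎
  where
  F : List Row → ℚ
  F Ω = when (pieri A D ((a , f) ∷ Λ) Ω ∧ branch C E ((c , g) ∷ Γ) Ω) (φ (size Ω))
  part : Bool → ℕ → ℚ
  part h w = ∑ (box M (length Λ)) (λ Ω → F ((w , h) ∷ Ω))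
  z : Bool → ℕ → ℚ
  z h w = Z a (nextc f D h) c (nextc g E h) Λ Γ (λ u → φ (w + u))
  cell : ∀ h → ∑< (suc M) (part h) ≡ when (okc f D h ∧ okc g E h)
    (∑I (lowP A a f D h ⊔ lowB c g E h) (upP A f D h ⊓ upB C c g E h) (z h))
  cell h = trans (∑<-cong′ (suc M) (λ w → trans
      (∑-cong′ (box M (length Λ)) (λ Ω → when-shuffle (okc f D h) (i w) (pieri a (nextc f D h) Λ Ω) (okc g E h) (i′ w) (branch c (nextc g E h) Γ Ω) (φ (w + size Ω))))
      (trans (∑-when (okc f D h ∧ okc g E h) (box M (length Λ)) (λ Ω → when (i w ∧ i′ w) (rest w Ω))) (cong (when (okc f D h ∧ okc g E h)) (trans (∑-when (i w ∧ i′ w) (box M (length Λ)) (rest w))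
        (cong (when (i w ∧ i′ w)) (∑-above a (nextc f D h) c (nextc g E h) Λ Γ (λ u → φ (w + u)) (≤-trans (below→≤ f b) A≤M) v (suc-injective e))))))))
    (trans (∑<-when (okc f D h ∧ okc g E h) (suc M) (λ w → when (i w ∧ i′ w) (z h w)))
      (cong (when (okc f D h ∧ okc g E h))
        (∑<-interval₂ (suc M) (lowP A a f D h) (upP A f D h) (lowB c g E h) (upB C c g E h) (z h) (≤-trans (upP≤ A f D h) (s≤s A≤M)))))
    where
    rest : ℕ → List Row → ℚ
    rest w Ω = when (pieri a (nextc f D h) Λ Ω ∧ branch c (nextc g E h) Γ Ω) (φ (w + size Ω))
    i i′ : ℕ → Bool
    i w = (lowP A a f D h ≤ᵇ w) ∧ (w <ᵇ upP A f D h)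
    i′ w = (lowB c g E h ≤ᵇ w) ∧ (w <ᵇ upB C c g E h)

-- Diagrams lying below Λ for branch and below Γ for pieri. Their r-th row lies between
-- rows r and r + 1, so the same functional Z counts them.

_implies_ : Bool → Bool → Bool
true  implies b = b
false implies _ = true

bound : Bool → ℕ → ℕ
bound true  W = W
bound false W = suc W

validᵇ : ℕ → List Row → Bool
validᵇ W []            = true
validᵇ W ((w , h) ∷ Ω) = (w <ᵇ bound h W) ∧ validᵇ w Ω

-- The part of a row test that compares `A` only with the row `W` of the middle diagram. Once it is
-- split off, the rest compares one middle row with two consecutive rows of Λ, as a `pieri` test
-- does. `topP` plays this part for Γ, where a `branch` test is left.
topB : ℕ → ℕ → Bool → Bool → Bool
topB W A F D = (D implies F) ∧ (A <ᵇ bound (F ∧ not D) W)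

topP : ℕ → ℕ → Bool → Bool → Bool
topP W C G true  = G ∧ ((C ≤ᵇ W) ∧ (W ≤ᵇ C))
topP W C G false = C <ᵇ bound G W

module _ (W A a w : ℕ) where

  stepΛ-L stepΛ-R : Bool → Bool → Bool → Bool → Bool
  stepΛ-L D F h f = (okc h D F ∧ ((lowB w h D F ≤ᵇ A) ∧ (A <ᵇ upB W w h D F))) ∧ topB w a f (nextc h D F)
  stepΛ-R D F h f = topB W A F D ∧ (okc f (F ∧ not D) h ∧ ((lowP A a f (F ∧ not D) h ≤ᵇ w) ∧ (w <ᵇ upP A f (F ∧ not D) h)))

  private
    <s : ∀ m n → (m <ᵇ suc n) ≡ true → m ≤ n
    <s m n h = ≤-pred (<ᵇ→< {m} {suc n} h)
    c1 : ∀ m n → (m <ᵇ suc n) ≡ true → (m ≤ᵇ n) ≡ true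
    c1 m n h = ≤→≤ᵇ {m} {n} (<s m n h)
    c2 : ∀ m n → (m ≤ᵇ n) ≡ true → (m <ᵇ suc n) ≡ true
    c2 m n h = <→<ᵇ {m} {suc n} (s≤s (≤ᵇ→≤ {m} {n} h))

  -- Aligning the middle diagram with the tail of Λ exchanges staying and dropping. A circle that a
  -- branching strip leaves in row r now appears one row below its place in Λ, in the same column,
  -- like a dropped circle of a Pieri strip. Hence the carry `F ∧ not D`: a circle of Λ that did not
  -- drop into its row is in transit.
  stepΛ→ : ∀ D F h f → below a f A → (w <ᵇ bound h W) ≡ true → stepΛ-L D F h f ≡ true →
    stepΛ-R D F h f ≡ true × f ∧ not (nextc h D F) ≡ nextc f (F ∧ not D) h
  stepΛ→ false false false false b v e =
    let e₁ , e₂ = ∧-split {(w ≤ᵇ A) ∧ (A <ᵇ suc W)} e ; p , q = ∧-split {w ≤ᵇ A} e₁ in ∧-intro q (∧-intro (c1 a w e₂) (c2 w A p)) , refl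
  stepΛ→ false false false true b v e =
    let e₁ , e₂ = ∧-split {(w ≤ᵇ A) ∧ (A <ᵇ suc W)} e ; p , q = ∧-split {w ≤ᵇ A} e₁ in ∧-intro q (∧-intro e₂ (c2 w A p)) , refl
  stepΛ→ false false true false b v e with ∧-split {(w <ᵇ A) ∧ (A <ᵇ suc W)} e
  ... | e₁ , ()
  stepΛ→ false false true true b v e =
    let e₁ , e₂ = ∧-split {(w <ᵇ A) ∧ (A <ᵇ suc W)} e ; p , q = ∧-split {w <ᵇ A} e₁ in ∧-intro q (∧-intro (c1 a w e₂) p) , refl
  stepΛ→ false true true false b v e =
    let e₁ , e₂ = ∧-split {(w ≤ᵇ A) ∧ (A <ᵇ suc w)} e ; p , q = ∧-split {w ≤ᵇ A} e₁ in ∧-intro (<→<ᵇ {A} {W} (≤-<-trans (<s A w q) (<ᵇ→< {w} {W} v))) (∧-intro (c1 A w q) (c2 w A p)) , refl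
  stepΛ→ false true true true b v e =
    let e₁ , e₂ = ∧-split {(w ≤ᵇ A) ∧ (A <ᵇ suc w)} e ; p , q = ∧-split {w ≤ᵇ A} e₁ in ∧-intro (<→<ᵇ {A} {W} (≤-<-trans (<s A w q) (<ᵇ→< {w} {W} v))) (∧-intro (c1 A w q) (c2 w A p)) , refl
  stepΛ→ true true false false b v e =
    let e₁ , e₂ = ∧-split {(w ≤ᵇ A) ∧ (A <ᵇ suc W)} e ; p , q = ∧-split {w ≤ᵇ A} e₁ in ∧-intro q (∧-intro (c1 a w e₂) (c2 w A p)) , refl
  stepΛ→ true true false true b v e =
    let e₁ , e₂ = ∧-split {(w ≤ᵇ A) ∧ (A <ᵇ suc W)} e ; p , q = ∧-split {w ≤ᵇ A} e₁ in ∧-intro q (∧-intro e₂ (c2 w A p)) , refl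
  stepΛ→ true true true false b v e with ∧-split {(w <ᵇ A) ∧ (A <ᵇ suc W)} e
  ... | e₁ , ()
  stepΛ→ true true true true b v e =
    let e₁ , e₂ = ∧-split {(w <ᵇ A) ∧ (A <ᵇ suc W)} e ; p , q = ∧-split {w <ᵇ A} e₁ in ∧-intro q (∧-intro (c1 a w e₂) p) , refl

  stepΛ← : ∀ D F h f → below a f A → stepΛ-R D F h f ≡ true → stepΛ-L D F h f ≡ true × w ≤ W
  stepΛ← false false false false b e =
    let e₁ , e₂ = ∧-split {A <ᵇ suc W} e ; p , q = ∧-split {a ≤ᵇ w} e₂ in ∧-intro (∧-intro (c1 w A q) e₁) (c2 a w p) , ≤-trans (<s w A q) (<s A W e₁)
  stepΛ← false false false true b e =
    let e₁ , e₂ = ∧-split {A <ᵇ suc W} e ; p , q = ∧-split {a <ᵇ w} e₂ in ∧-intro (∧-intro (c1 w A q) e₁) p , ≤-trans (<s w A q) (<s A W e₁)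
  stepΛ← false false true false b e with ∧-split {A <ᵇ suc W} e
  ... | e₁ , ()
  stepΛ← false false true true b e =
    let e₁ , e₂ = ∧-split {A <ᵇ suc W} e ; p , q = ∧-split {a ≤ᵇ w} e₂ in ∧-intro (∧-intro q e₁) (c2 a w p) , ≤-trans (<⇒≤ (<ᵇ→< {w} {A} q)) (<s A W e₁)
  stepΛ← false true false false b e with ∧-split {A <ᵇ W} e
  ... | e₁ , ()
  stepΛ← false true false true b e with ∧-split {A <ᵇ W} e
  ... | e₁ , ()
  stepΛ← false true true false b e =
    let e₁ , e₂ = ∧-split {A <ᵇ W} e ; p , q = ∧-split {A ≤ᵇ w} e₂ in ∧-intro (∧-intro (c1 w A q) (c2 A w p)) (<→<ᵇ {a} {suc w} (s≤s (≤-trans b (≤ᵇ→≤ {A} {w} p)))) , ≤-trans (<s w A q) (<⇒≤ (<ᵇ→< {A} {W} e₁))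
  stepΛ← false true true true b e =
    let e₁ , e₂ = ∧-split {A <ᵇ W} e ; p , q = ∧-split {A ≤ᵇ w} e₂ in ∧-intro (∧-intro (c1 w A q) (c2 A w p)) (<→<ᵇ {a} {w} (≤-trans b (≤ᵇ→≤ {A} {w} p))) , ≤-trans (<s w A q) (<⇒≤ (<ᵇ→< {A} {W} e₁))
  stepΛ← true true false false b e =
    let e₁ , e₂ = ∧-split {A <ᵇ suc W} e ; p , q = ∧-split {a ≤ᵇ w} e₂ in ∧-intro (∧-intro (c1 w A q) e₁) (c2 a w p) , ≤-trans (<s w A q) (<s A W e₁)
  stepΛ← true true false true b e =
    let e₁ , e₂ = ∧-split {A <ᵇ suc W} e ; p , q = ∧-split {a <ᵇ w} e₂ in ∧-intro (∧-intro (c1 w A q) e₁) p , ≤-trans (<s w A q) (<s A W e₁)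
  stepΛ← true true true false b e with ∧-split {A <ᵇ suc W} e
  ... | e₁ , ()
  stepΛ← true true true true b e =
    let e₁ , e₂ = ∧-split {A <ᵇ suc W} e ; p , q = ∧-split {a ≤ᵇ w} e₂ in ∧-intro (∧-intro q e₁) (c2 a w p) , ≤-trans (<⇒≤ (<ᵇ→< {w} {A} q)) (<s A W e₁)

  -- here A and a are lengths of consecutive rows of Γ
  stepΓ-L stepΓ-R : Bool → Bool → Bool → Bool → Bool
  stepΓ-L E G h g = (okc h E G ∧ ((lowP W w h E G ≤ᵇ A) ∧ (A <ᵇ upP W h E G))) ∧ topP w a g (nextc h E G)
  stepΓ-R E G h g = topP W A G E ∧ (okc g (G ∧ not E) h ∧ ((lowB a g (G ∧ not E) h ≤ᵇ w) ∧ (w <ᵇ upB A a g (G ∧ not E) h)))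

  -- The same exchange for Γ. With a carry the `pieri` test does not compare `w` with `W`, so the
  -- inequality is supplied from outside: by validity of the middle diagram in this direction, by
  -- `stepΛ←` in the other.
  stepΓ→ : ∀ E G h g → below a g A → w ≤ W → stepΓ-L E G h g ≡ true →
    stepΓ-R E G h g ≡ true × g ∧ not (nextc h E G) ≡ nextc g (G ∧ not E) h
  stepΓ→ false false false false b v e =
    let e₁ , e₂ = ∧-split {(w ≤ᵇ A) ∧ (A <ᵇ suc W)} e ; p , q = ∧-split {w ≤ᵇ A} e₁ in ∧-intro q (∧-intro (c1 a w e₂) (c2 w A p)) , refl
  stepΓ→ false false false true b v e =
    let e₁ , e₂ = ∧-split {(w ≤ᵇ A) ∧ (A <ᵇ suc W)} e ; p , q = ∧-split {w ≤ᵇ A} e₁ in ∧-intro q (∧-intro e₂ (c2 w A p)) , refl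
  stepΓ→ false false true false b v e with ∧-split {(w <ᵇ A) ∧ (A <ᵇ suc W)} e
  ... | e₁ , ()
  stepΓ→ false false true true b v e with ∧-split {(w <ᵇ A) ∧ (A <ᵇ suc W)} e
  ... | e₁ , e₂ with ∧-split {w <ᵇ A} e₁ | ∧-split {a ≤ᵇ w} e₂
  ... | p , q | r , s = ∧-intro q (∧-intro r (c2 w a s)) , refl
  stepΓ→ false true true false b v e =
    let e₁ , e₂ = ∧-split {(w ≤ᵇ A) ∧ (A <ᵇ W)} e ; p , q = ∧-split {w ≤ᵇ A} e₁ in ∧-intro q (∧-intro (c1 a w e₂) (c2 w A p)) , refl
  stepΓ→ false true true true b v e =
    let e₁ , e₂ = ∧-split {(w ≤ᵇ A) ∧ (A <ᵇ W)} e ; p , q = ∧-split {w ≤ᵇ A} e₁ in ∧-intro q (∧-intro e₂ (c2 w A p)) , refl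
  stepΓ→ true true false false b v e =
    let e₁ , e₂ = ∧-split {(W ≤ᵇ A) ∧ (A <ᵇ suc W)} e ; p , q = ∧-split {W ≤ᵇ A} e₁ in ∧-intro (∧-intro (c1 A W q) p) (∧-intro (c1 a w e₂) (<→<ᵇ {w} {suc A} (s≤s (≤-trans v (≤ᵇ→≤ {W} {A} p))))) , refl
  stepΓ→ true true false true b v e =
    let e₁ , e₂ = ∧-split {(W ≤ᵇ A) ∧ (A <ᵇ suc W)} e ; p , q = ∧-split {W ≤ᵇ A} e₁ in ∧-intro (∧-intro (c1 A W q) p) (∧-intro e₂ (<→<ᵇ {w} {suc A} (s≤s (≤-trans v (≤ᵇ→≤ {W} {A} p))))) , refl
  stepΓ→ true true true false b v e with ∧-split {(W ≤ᵇ A) ∧ (A <ᵇ suc W)} e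
  ... | e₁ , ()
  stepΓ→ true true true true b v e with ∧-split {(W ≤ᵇ A) ∧ (A <ᵇ suc W)} e
  ... | e₁ , e₂ with ∧-split {W ≤ᵇ A} e₁ | ∧-split {a ≤ᵇ w} e₂
  ... | p , q | r , s = ∧-intro (∧-intro (c1 A W q) p) (∧-intro r (c2 w a s)) , refl

  stepΓ← : ∀ E G h g → below a g A → w ≤ W → stepΓ-R E G h g ≡ true → stepΓ-L E G h g ≡ true × w < bound h W
  stepΓ← false false false false b v e =
    let e₁ , e₂ = ∧-split {A <ᵇ suc W} e ; p , q = ∧-split {a ≤ᵇ w} e₂ in ∧-intro (∧-intro (c1 w A q) e₁) (c2 a w p) , s≤s v
  stepΓ← false false false true b v e =
    let e₁ , e₂ = ∧-split {A <ᵇ suc W} e ; p , q = ∧-split {a <ᵇ w} e₂ in ∧-intro (∧-intro (c1 w A q) e₁) p , s≤s v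
  stepΓ← false false true false b v e with ∧-split {A <ᵇ suc W} e
  ... | e₁ , ()
  stepΓ← false false true true b v e with ∧-split {A <ᵇ suc W} e
  ... | e₁ , e₂ with ∧-split {a ≤ᵇ w} e₂
  ... | p , q = ∧-intro (∧-intro (<→<ᵇ {w} {A} w<A) e₁) (∧-intro p (c1 w a q)) , ≤-trans w<A (<s A W e₁)
    where
    w<A : w < A
    w<A = ≤-<-trans (<s w a q) b
  stepΓ← false true false false b v e with ∧-split {A <ᵇ W} e
  ... | e₁ , ()
  stepΓ← false true false true b v e with ∧-split {A <ᵇ W} e
  ... | e₁ , ()
  stepΓ← false true true false b v e =
    let e₁ , e₂ = ∧-split {A <ᵇ W} e ; p , q = ∧-split {a ≤ᵇ w} e₂ in ∧-intro (∧-intro (c1 w A q) e₁) (c2 a w p) , ≤-<-trans (<s w A q) (<ᵇ→< {A} {W} e₁)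
  stepΓ← false true true true b v e =
    let e₁ , e₂ = ∧-split {A <ᵇ W} e ; p , q = ∧-split {a <ᵇ w} e₂ in ∧-intro (∧-intro (c1 w A q) e₁) p , ≤-<-trans (<s w A q) (<ᵇ→< {A} {W} e₁)
  stepΓ← true true false false b v e with ∧-split {(A ≤ᵇ W) ∧ (W ≤ᵇ A)} e
  ... | e₁ , e₂ with ∧-split {A ≤ᵇ W} e₁ | ∧-split {a ≤ᵇ w} e₂
  ... | r , s | p , q = ∧-intro (∧-intro s (c2 A W r)) (c2 a w p) , s≤s v
  stepΓ← true true false true b v e with ∧-split {(A ≤ᵇ W) ∧ (W ≤ᵇ A)} e
  ... | e₁ , e₂ with ∧-split {A ≤ᵇ W} e₁ | ∧-split {a <ᵇ w} e₂
  ... | r , s | p , q = ∧-intro (∧-intro s (c2 A W r)) p , s≤s v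
  stepΓ← true true true false b v e with ∧-split {(A ≤ᵇ W) ∧ (W ≤ᵇ A)} e
  ... | e₁ , ()
  stepΓ← true true true true b v e with ∧-split {(A ≤ᵇ W) ∧ (W ≤ᵇ A)} e
  ... | e₁ , e₂ with ∧-split {A ≤ᵇ W} e₁ | ∧-split {a ≤ᵇ w} e₂
  ... | r , s | p , q = ∧-intro (∧-intro s (c2 A W r)) (∧-intro p (c1 w a q)) , ≤-trans (≤-<-trans (<s w a q) b) (≤ᵇ→≤ {A} {W} r)

-- A branching strip adds a variable and with it a row, so the smaller diagram receives an empty
-- last row before the comparison.
pad : List Row → List Row
pad Γ = Γ ++ (0 , false) ∷ []

size-pad : ∀ Γ → size (pad Γ) ≡ size Γ
size-pad []            = refl
size-pad ((a , _) ∷ Γ) = cong (a +_) (size-pad Γ)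

when-shuffle₃ : ∀ v v′ p i r p′ i′ r′ x →
  when ((v ∧ v′) ∧ ((p ∧ i ∧ r) ∧ (p′ ∧ i′ ∧ r′))) x ≡ when (v ∧ ((p ∧ i) ∧ (p′ ∧ i′))) (when (v′ ∧ (r ∧ r′)) x)
when-shuffle₃ false v′    p     i     r     p′    i′    r′ x = refl
when-shuffle₃ true  v′    true  true  r     true  true  r′ x = refl
when-shuffle₃ true  false false i     r     p′    i′    r′ x = refl
when-shuffle₃ true  true  false i     r     p′    i′    r′ x = refl
when-shuffle₃ true  false true  false r     p′    i′    r′ x = refl
when-shuffle₃ true  true  true  false r     p′    i′    r′ x = refl
when-shuffle₃ true  false true  true  r     false i′    r′ x = refl
when-shuffle₃ true  true  true  true  false false i′    r′ x = refl
when-shuffle₃ true  true  true  true  true  false i′    r′ x = refl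
when-shuffle₃ true  false true  true  r     true  false r′ x = refl
when-shuffle₃ true  true  true  true  false true  false r′ x = refl
when-shuffle₃ true  true  true  true  true  true  false r′ x = refl

betweenᵇ : ℕ → Bool → Bool → List Row → List Row → List Row → Bool
betweenᵇ W D E Λ Γ Ω = validᵇ W Ω ∧ (branch W D (pad Ω) Λ ∧ pieri W E Ω Γ)

between-end : ∀ W D E A F x →
  when (true ∧ (branch W D ((0 , false) ∷ []) ((A , F) ∷ []) ∧ not E)) x ≡
  when (topB W A F D ∧ topP W 0 false E) (when (not (F ∧ not D) ∧ true) x)
between-end W false false A false x with A <ᵇ suc W
... | true  = refl
... | false = refl
between-end W false true  A false x with A <ᵇ suc W
... | true  = refl
... | false = refl
between-end W false E     A true  x = sym (when-zero (topB W A true false ∧ topP W 0 false E))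
between-end W true  E     A false x = refl
between-end W true  false A true  x with A <ᵇ suc W
... | true  = refl
... | false = refl
between-end W true  true  A true  x with A <ᵇ suc W
... | true  = refl
... | false = refl

when-bool : ∀ p q {x y} → (p ≡ true → q ≡ true) → (q ≡ true → p ≡ true) → (p ≡ true → x ≡ y) → when p x ≡ when q y
when-bool true  true  f g h = h refl
when-bool true  false f g h = case f refl of λ ()
when-bool false true  f g h = case g refl of λ ()
when-bool false false f g h = refl

when-∧₃ : ∀ t o i x → when t (when o (when i x)) ≡ when (t ∧ (o ∧ i)) x
when-∧₃ true  true  i x = refl
when-∧₃ true  false i x = refl
when-∧₃ false o     i x = refl

-- For each length and flag of the middle row the four step lemmas give equivalent tests and equal
-- carries. The carries agree only where the tests hold, which is why `when-bool` asks for equality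
-- under the test.
between-step : ∀ M k W D E A F a f Λ C G c g Γ (ψ : ℕ → ℚ) (body : ℕ → Bool → List Row → ℚ) → A ≤ M →
  below a f A → below c g C →
  (∀ w h → ∑ (box M k) (body w h) ≡
    when ((w <ᵇ bound h W) ∧ ((okc h D F ∧ ((lowB w h D F ≤ᵇ A) ∧ (A <ᵇ upB W w h D F))) ∧
                              (okc h E G ∧ ((lowP W w h E G ≤ᵇ C) ∧ (C <ᵇ upP W h E G)))))
      (when (topB w a f (nextc h D F) ∧ topP w c g (nextc h E G))
        (Z a (f ∧ not (nextc h D F)) c (g ∧ not (nextc h E G)) Λ Γ (λ u → ψ (w + u))))) →
  ∑< (suc M) (λ w → ∑ (box M k) (body w false) +ℚ ∑ (box M k) (body w true)) ≡
  when (topB W A F D ∧ topP W C G E) (Z A (F ∧ not D) C (G ∧ not E) ((a , f) ∷ Λ) ((c , g) ∷ Γ) ψ)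
between-step M k W D E A F a f Λ C G c g Γ ψ body A≤M ba bc hyp = begin
  ∑< (suc M) (λ w → ∑ (box M k) (body w false) +ℚ ∑ (box M k) (body w true))
    ≡⟨ ∑<-+ (suc M) (λ w → ∑ (box M k) (body w false)) (λ w → ∑ (box M k) (body w true)) ⟩
  ∑< (suc M) (λ w → ∑ (box M k) (body w false)) +ℚ ∑< (suc M) (λ w → ∑ (box M k) (body w true))
    ≡⟨ cong₂ _+ℚ_ (cell false) (cell true) ⟩
  when top (goal false) +ℚ when top (goal true)
    ≡⟨ sym (when-+ top (goal false) (goal true)) ⟩
  when top (goal false +ℚ goal true) ∎
  where
  D̄ = F ∧ not D
  Ē = G ∧ not E
  top = topB W A F D ∧ topP W C G E
  z : Bool → ℕ → ℚ
  z h w = Z a (nextc f D̄ h) c (nextc g Ē h) Λ Γ (λ u → ψ (w + u))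
  goal : Bool → ℚ
  goal h = when (okc f D̄ h ∧ okc g Ē h) (∑I (lowP A a f D̄ h ⊔ lowB c g Ē h) (upP A f D̄ h ⊓ upB C c g Ē h) (z h))
  ok : Bool → Bool
  ok h = okc f D̄ h ∧ okc g Ē h
  iP iB : Bool → ℕ → Bool
  iP h w = (lowP A a f D̄ h ≤ᵇ w) ∧ (w <ᵇ upP A f D̄ h)
  iB h w = (lowB c g Ē h ≤ᵇ w) ∧ (w <ᵇ upB C c g Ē h)
  point : ∀ h w → ∑ (box M k) (body w h) ≡ when top (when (ok h) (when (iP h w ∧ iB h w) (z h w)))
  point h w = trans (hyp w h) (trans (sym (when-∧ V U _)) (trans
      (when-bool (V ∧ U) (top ∧ (ok h ∧ (iP h w ∧ iB h w))) to from same)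
      (sym (when-∧₃ top (ok h) (iP h w ∧ iB h w) (z h w)))))
    where
    v = w <ᵇ bound h W
    x₁ = okc h D F ∧ ((lowB w h D F ≤ᵇ A) ∧ (A <ᵇ upB W w h D F))
    x₂ = okc h E G ∧ ((lowP W w h E G ≤ᵇ C) ∧ (C <ᵇ upP W h E G))
    t₁ = topB w a f (nextc h D F)
    t₂ = topP w c g (nextc h E G)
    V = v ∧ (x₁ ∧ x₂)
    U = t₁ ∧ t₂
    bound≤ : ∀ h → w < bound h W → w ≤ W
    bound≤ true  l = <⇒≤ l
    bound≤ false l = ≤-pred l
    parts : V ∧ U ≡ true → v ≡ true × stepΛ-L W A a w D F h f ≡ true × stepΓ-L W C c w E G h g ≡ true
    parts e = let p , q = ∧-split {V} e
                  p₁ , p₂ = ∧-split {v} p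
                  p₃ , p₄ = ∧-split {x₁} p₂
                  q₁ , q₂ = ∧-split {t₁} q
              in p₁ , ∧-intro p₃ q₁ , ∧-intro p₄ q₂
    res : V ∧ U ≡ true → _ × _
    res e = let p , q , r = parts e
                m = bound≤ h (<ᵇ→< {w} {bound h W} p)
            in stepΛ→ W A a w D F h f ba p q , stepΓ→ W C c w E G h g bc m r
    to : V ∧ U ≡ true → top ∧ (ok h ∧ (iP h w ∧ iB h w)) ≡ true
    to e = let (l , _) , (r , _) = res e
               l₁ , l₂ = ∧-split {topB W A F D} l
               l₃ , l₄ = ∧-split {okc f D̄ h} l₂
               r₁ , r₂ = ∧-split {topP W C G E} r
               r₃ , r₄ = ∧-split {okc g Ē h} r₂
           in ∧-intro (∧-intro l₁ r₁) (∧-intro (∧-intro l₃ r₃) (∧-intro l₄ r₄))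
    from : top ∧ (ok h ∧ (iP h w ∧ iB h w)) ≡ true → V ∧ U ≡ true
    from e = let p , q = ∧-split {top} e
                 p₁ , p₂ = ∧-split {topB W A F D} p
                 q₁ , q₂ = ∧-split {ok h} q
                 q₃ , q₄ = ∧-split {okc f D̄ h} q₁
                 q₅ , q₆ = ∧-split {iP h w} q₂
                 l , w≤W = stepΛ← W A a w D F h f ba (∧-intro p₁ (∧-intro q₃ q₅))
                 r , w<b = stepΓ← W C c w E G h g bc w≤W (∧-intro p₂ (∧-intro q₄ q₆))
                 l₁ , l₂ = ∧-split {x₁} l
                 r₁ , r₂ = ∧-split {x₂} r
             in ∧-intro (∧-intro (<→<ᵇ w<b) (∧-intro l₁ r₁)) (∧-intro l₂ r₂)
    same : V ∧ U ≡ true → Z a (f ∧ not (nextc h D F)) c (g ∧ not (nextc h E G)) Λ Γ (λ u → ψ (w + u)) ≡ z h w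
    same e = let (_ , l) , (_ , r) = res e in cong₂ (λ x y → Z a x c y Λ Γ (λ u → ψ (w + u))) l r
  cell : ∀ h → ∑< (suc M) (λ w → ∑ (box M k) (body w h)) ≡ when top (goal h)
  cell h = trans (∑<-cong′ (suc M) (point h))
    (trans (∑<-when top (suc M) (λ w → when (ok h) (when (iP h w ∧ iB h w) (z h w)))) (cong (when top)
    (trans (∑<-when (ok h) (suc M) (λ w → when (iP h w ∧ iB h w) (z h w))) (cong (when (ok h))
    (∑<-interval₂ (suc M) (lowP A a f D̄ h) (upP A f D̄ h) (lowB c g Ē h) (upB C c g Ē h) (z h) (≤-trans (upP≤ A f D̄ h) (s≤s A≤M)))))))

-- One row of Λ and one of the padded Γ are always held back: `(A , F)` and `(C , G)` are the upper
-- neighbours of the middle row that is summed next.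
∑-between : ∀ {M} W D E A F Λ Γ C G Γt ψ → pad Γ ≡ (C , G) ∷ Γt → length Λ ≡ length Γ → A ≤ M → Valid A Λ → Valid C Γt →
  ∑ (box M (length Γ)) (λ Ω → when (betweenᵇ W D E ((A , F) ∷ Λ) Γ Ω) (ψ (size Ω))) ≡
  when (topB W A F D ∧ topP W C G E) (Z A (F ∧ not D) C (G ∧ not E) Λ Γt ψ)
∑-between W D E A F [] [] .0 .false .[] ψ refl _ _ _ _ = trans (ℚₚ.+-identityʳ _) (between-end W D E A F (ψ 0))
∑-between {M} W D E A F ((a , f) ∷ Λ) ((C , G) ∷ Γ) C G _ ψ refl e A≤M (ba ∷ vΛ) vΓ = go Γ vΓ e
  where
  go : ∀ Γ → Valid C (pad Γ) → suc (length Λ) ≡ suc (length Γ) →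
    ∑ (box M (suc (length Γ))) (λ Ω → when (betweenᵇ W D E ((A , F) ∷ (a , f) ∷ Λ) ((C , G) ∷ Γ) Ω) (ψ (size Ω))) ≡
    when (topB W A F D ∧ topP W C G E) (Z A (F ∧ not D) C (G ∧ not E) ((a , f) ∷ Λ) (pad Γ) ψ)
  step : ∀ Γ c g Γt → pad Γ ≡ (c , g) ∷ Γt → below c g C → Valid c Γt → length Λ ≡ length Γ →
    ∑ (box M (suc (length Γ))) (λ Ω → when (betweenᵇ W D E ((A , F) ∷ (a , f) ∷ Λ) ((C , G) ∷ Γ) Ω) (ψ (size Ω))) ≡
    when (topB W A F D ∧ topP W C G E) (Z A (F ∧ not D) C (G ∧ not E) ((a , f) ∷ Λ) ((c , g) ∷ Γt) ψ)
  step Γ c g Γt pe bc vt le = trans (∑-box-suc M (length Γ) body)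
    (between-step M (length Γ) W D E A F a f Λ C G c g Γt ψ (λ w h Ω → body ((w , h) ∷ Ω)) A≤M ba bc hyp)
    where
    body : List Row → ℚ
    body Ω = when (betweenᵇ W D E ((A , F) ∷ (a , f) ∷ Λ) ((C , G) ∷ Γ) Ω) (ψ (size Ω))
    hyp : ∀ w h → ∑ (box M (length Γ)) (λ Ω → body ((w , h) ∷ Ω)) ≡ _
    hyp w h = trans (∑-cong′ (box M (length Γ)) (λ Ω → when-shuffle₃ (w <ᵇ bound h W) (validᵇ w Ω)
        (okc h D F) ((lowB w h D F ≤ᵇ A) ∧ (A <ᵇ upB W w h D F)) (branch w (nextc h D F) (pad Ω) ((a , f) ∷ Λ))
        (okc h E G) ((lowP W w h E G ≤ᵇ C) ∧ (C <ᵇ upP W h E G)) (pieri w (nextc h E G) Ω Γ) (ψ (w + size Ω))))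
      (trans (∑-when V (box M (length Γ)) (λ Ω → when (betweenᵇ w (nextc h D F) (nextc h E G) ((a , f) ∷ Λ) Γ Ω) (ψ (w + size Ω))))
        (cong (when V) (∑-between w (nextc h D F) (nextc h E G) a f Λ Γ c g Γt (λ u → ψ (w + u)) pe le (≤-trans (below→≤ f ba) A≤M) vΛ vt)))
      where
      V = (w <ᵇ bound h W) ∧ ((okc h D F ∧ ((lowB w h D F ≤ᵇ A) ∧ (A <ᵇ upB W w h D F))) ∧
                              (okc h E G ∧ ((lowP W w h E G ≤ᵇ C) ∧ (C <ᵇ upP W h E G))))
  go []            (bc ∷ vt) le = step [] 0 false [] refl bc vt (suc-injective le)
  go ((c , g) ∷ Γ) (bc ∷ vt) le = step ((c , g) ∷ Γ) c g (pad Γ) refl bc vt (suc-injective le)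

-- Row r of a counted diagram is at most row r - 1 of Λ, so no size above A + size Λ occurs.
Z-zero : ∀ A D C E Λ Γ φ → Valid A Λ → (∀ u → u ≤ A + size Λ → φ u ≡ 0ℚ) → Z A D C E Λ Γ φ ≡ 0ℚ
Z-zero A D C E [] [] φ _ h = trans (cong (when (not D ∧ not E)) (h 0 z≤n)) (when-zero (not D ∧ not E))
Z-zero A D C E [] (_ ∷ _) φ _ h = refl
Z-zero A D C E (_ ∷ _) [] φ _ h = refl
Z-zero A D C E ((a , f) ∷ Λ) ((c , g) ∷ Γ) φ (b ∷ v) h = zero₂ (cell false) (cell true)
  where
  cell : ∀ x → when (okc f D x ∧ okc g E x) (∑I (lowP A a f D x ⊔ lowB c g E x) (upP A f D x ⊓ upB C c g E x)
        (λ w → Z a (nextc f D x) c (nextc g E x) Λ Γ (λ u → φ (w + u)))) ≡ 0ℚ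
  cell x = trans (cong (when (okc f D x ∧ okc g E x)) (∑I-zero (lowP A a f D x ⊔ lowB c g E x) (upP A f D x ⊓ upB C c g E x)
    (λ w _ w< → Z-zero a (nextc f D x) c (nextc g E x) Λ Γ (λ u → φ (w + u)) v
      (λ u u≤ → h (w + u) (+-mono-≤ (≤-pred (≤-trans w< (≤-trans (m⊓n≤m (upP A f D x) (upB C c g E x)) (upP≤ A f D x)))) u≤)))))
    (when-zero (okc f D x ∧ okc g E x))

branch-size : ∀ C E Γ Ω → branch C E Γ Ω ≡ true → size Γ ≤ size Ω
branch-size C E [] [] _ = z≤n
branch-size C E [] (_ ∷ _) ()
branch-size C E (_ ∷ _) [] ()
branch-size C E ((c , g) ∷ Γ) ((w , h) ∷ Ω) e =
  let e₁ , e₂ = ∧-split {okc g E h} e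
      e₃ , e₄ = ∧-split {(lowB c g E h ≤ᵇ w) ∧ (w <ᵇ upB C c g E h)} e₂
      e₅ , _ = ∧-split {lowB c g E h ≤ᵇ w} e₃
  in +-mono-≤ (≤-trans (low g E h) (≤ᵇ→≤ {lowB c g E h} e₅)) (branch-size c (nextc g E h) Γ Ω e₄)
  where
  low : ∀ g E h → c ≤ lowB c g E h
  low true  true  _     = n≤1+n c
  low true  false false = n≤1+n c
  low true  false true  = ≤-refl
  low false _     _     = ≤-refl

lowP≥ : ∀ A a f D h → below a f A → a ≤ lowP A a f D h
lowP≥ A a f     true  h     b = below→≤ f b
lowP≥ A a true  false false b = n≤1+n a
lowP≥ A a true  false true  b = ≤-refl
lowP≥ A a false false h     b = ≤-refl

pieri-size : ∀ A D Λ Ω → Valid A Λ → pieri A D Λ Ω ≡ true → size Λ ≤ size Ω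
pieri-size A D [] [] _ _ = z≤n
pieri-size A D [] (_ ∷ _) _ ()
pieri-size A D (_ ∷ _) [] _ ()
pieri-size A D ((a , f) ∷ Λ) ((w , h) ∷ Ω) (b ∷ v) e =
  let e₁ , e₂ = ∧-split {okc f D h} e
      e₃ , e₄ = ∧-split {(lowP A a f D h ≤ᵇ w) ∧ (w <ᵇ upP A f D h)} e₂
      e₅ , _ = ∧-split {lowP A a f D h ≤ᵇ w} e₃
  in +-mono-≤ (≤-trans (lowP≥ A a f D h b) (≤ᵇ→≤ {lowP A a f D h} e₅)) (pieri-size a (nextc f D h) Λ Ω v e₄)

validᵇ→Valid : ∀ W Ω → validᵇ W Ω ≡ true → Valid W Ω
validᵇ→Valid W [] _ = []
validᵇ→Valid W ((w , true) ∷ Ω) e = let p , q = ∧-split {w <ᵇ W} e in <ᵇ→< p ∷ validᵇ→Valid w Ω q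
validᵇ→Valid W ((w , false) ∷ Ω) e = let p , q = ∧-split {w <ᵇ suc W} e in ≤-pred (<ᵇ→< {w} {suc W} p) ∷ validᵇ→Valid w Ω q

Valid→validᵇ : ∀ {W Ω} → Valid W Ω → validᵇ W Ω ≡ true
Valid→validᵇ [] = refl
Valid→validᵇ {W} (_∷_ {a = a} {true} b v) = ∧-intro {a <ᵇ W} (<→<ᵇ b) (Valid→validᵇ v)
Valid→validᵇ {W} (_∷_ {a = a} {false} b v) = ∧-intro {a <ᵇ suc W} (<→<ᵇ (s≤s b)) (Valid→validᵇ v)

Valid-pad : ∀ {W Γ} → Valid W Γ → Valid W (pad Γ)
Valid-pad []      = z≤n ∷ []
Valid-pad (b ∷ v) = b ∷ Valid-pad v

paired : ∀ {A C F G Λ Γ r Γt} → Valid A Λ → Valid C Γt → pad Γ ≡ r ∷ Γt → r ≡ (C , G) → length Λ ≡ length Γ → Paired A C F G Λ Γt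
paired {Λ = []} {[]} [] [] refl refl e = end
paired {Λ = _ ∷ _} {_ ∷ []} (b ∷ v) (b′ ∷ v′) refl refl e = cons b b′ (paired {Γ = []} v v′ refl refl (suc-injective e))
paired {Λ = _ ∷ _} {_ ∷ r ∷ Γ} (b ∷ v) (b′ ∷ v′) refl refl e = cons b b′ (paired {Γ = r ∷ Γ} v v′ refl refl (suc-injective e))

Valid-head : ∀ {A a f Λ} → Valid A ((a , f) ∷ Λ) → below a f A
Valid-head (b ∷ _) = b

Valid-tail : ∀ {A a f Λ} → Valid A ((a , f) ∷ Λ) → Valid a Λ
Valid-tail (_ ∷ v) = v

pad-head : ∀ Γ → ∃[ C ] ∃[ G ] ∃[ Γt ] (pad Γ ≡ (C , G) ∷ Γt)
pad-head []            = 0 , false , [] , refl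
pad-head ((C , G) ∷ Γ) = C , G , pad Γ , refl

-- The commutation of the Pieri and branching strips: the extra length i of the
-- first row of Ω accounts for the i ≤ z cells that disappear on the right hand side.
module Commute {M A F Λt Γ z C G Γt} (vΛ : Valid M ((A , F) ∷ Λt)) (vΓ : Valid M ((C , G) ∷ Γt))
               (pe : pad Γ ≡ (C , G) ∷ Γt) (le : length Λt ≡ length Γ) (z< : size Γ + z < M) where

  Λ : List Row
  Λ = (A , F) ∷ Λt

  private
    sΓ : C + size Γt ≡ size Γ
    sΓ = trans (cong size (sym pe)) (size-pad Γ)

    bA : below A F M
    bA = Valid-head vΛ
    vΛt : Valid A Λt
    vΛt = Valid-tail vΛ
    bC : below C G M
    bC = Valid-head vΓ
    vΓt : Valid C Γt
    vΓt = Valid-tail vΓ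

    -- `φ` fixes the size of Ω, `ψ` is its mirror image about `K`, and `θ` is what is left of `ψ`
    -- once the long first row has been summed out.
    φ ψ θ : ℕ → ℚ
    φ u = when (u ≡ᵇ size Γ + z) 1ℚ
    ψ v = when (v + z ≡ᵇ M + size Λ) 1ℚ
    θ v = when (size Λ ≤ᵇ v + z) 1ℚ

    rel : Rel ((M ⊓ M) + (size Λ + size ((C , G) ∷ Γt))) φ ψ
    rel u v e = when-≡ 1ℚ (bool-ext {u ≡ᵇ size Γ + z}
      (λ h → ≡→≡ᵇ {v + z} (to (≡ᵇ→≡ {u} h))) (λ h → ≡→≡ᵇ {u} (from (≡ᵇ→≡ {v + z} h))))
      where
      tot : u + v ≡ M + size Λ + size Γ
      tot = trans e (trans (cong₂ (λ x y → x + (size Λ + y)) (⊓-idem M) sΓ) (sym (ℕₚ.+-assoc M (size Λ) (size Γ))))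
      to : u ≡ size Γ + z → v + z ≡ M + size Λ
      to refl = +-cancelʳ-≡ (size Γ) (v + z) (M + size Λ) (trans (ar (size Γ) z v) tot)
        where
        ar : ∀ s z v → v + z + s ≡ s + z + v
        ar = solve-∀
      from : v + z ≡ M + size Λ → u ≡ size Γ + z
      from h = +-cancelʳ-≡ v u (size Γ + z) (trans tot (trans (cong (_+ size Γ) (sym h)) (ar v z (size Γ))))
        where
        ar : ∀ v z s → v + z + s ≡ s + z + v
        ar = solve-∀

    X : (ℕ → ℚ) → ℚ
    X = Z A F C G Λt Γt

    b? : List Row → Bool
    b? = betweenᵇ M false false Λ Γ

    X-box : ∀ χ → ∑ (box M (length Γ)) (λ Ω → when (b? Ω) (χ (size Ω))) ≡ X χ
    X-box χ = trans (∑-between M false false A F Λt Γ C G Γt χ pe le (below→≤ F bA) vΛt vΓt)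
      (cong₂ when (∧-intro {topB M A F false} (t F bA) (t′ G bC)) (cong₂ (λ x y → Z A x C y Λt Γt χ) (Boolₚ.∧-identityʳ F) (Boolₚ.∧-identityʳ G)))
      where
      t : ∀ F → below A F M → topB M A F false ≡ true
      t true  b = <→<ᵇ b
      t false b = <→<ᵇ (s≤s b)
      t′ : ∀ G → below C G M → topP M C G false ≡ true
      t′ true  b = <→<ᵇ b
      t′ false b = <→<ᵇ (s≤s b)

    b-size : ∀ {Ω} → b? Ω ≡ true → size Ω ≤ size Λ × size Ω ≤ size Γ
    b-size {Ω} e = let p , q = ∧-split {validᵇ M Ω} e
                       r , s = ∧-split {branch M false (pad Ω) Λ} q
                   in subst (_≤ size Λ) (size-pad Ω) (branch-size M false (pad Ω) Λ r)
                    , pieri-size M false Ω Γ (validᵇ→Valid M Ω p) s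

    lo : ℕ
    lo = lowP M A F false false ⊔ lowB C G false false

    -- The size forces the length `j` of the first row. It is at most `M` exactly when size Λ ≤ s +
    -- z, and it clears the lower bounds because size Γ + z < M.
    single : ∀ s → s ≤ size Λ → s ≤ size Γ → ∑I lo (suc M) (λ w → ψ (w + s)) ≡ θ s
    single s s≤Λ s≤Γ with size Λ ≤? s + z
    ... | no h = trans (∑I-zero lo (suc M) (λ w _ w≤ → when-≡ 1ℚ (≢→≡ᵇ {w + s + z} (bad w (≤-pred w≤)))))
                       (when-≡ 1ℚ (sym (≰→≤ᵇ {size Λ} h)))
      where
      bad : ∀ w → w ≤ M → w + s + z ≢ M + size Λ
      bad w w≤ e = <-irrefl (trans (sym (ℕₚ.+-assoc w s z)) e) (+-mono-≤-< w≤ (≰⇒> h))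
    ... | yes h = trans (∑I-single lo (suc M) j lo≤j (s≤s j≤M) others)
                  (trans (when-≡ 1ℚ (≡→≡ᵇ {j + s + z} j-eq)) (when-≡ 1ℚ (sym (≤→≤ᵇ {size Λ} h))))
      where
      j = M + size Λ ∸ (s + z)
      sz≤ : s + z ≤ M + size Λ
      sz≤ = ≤-trans (+-monoˡ-≤ z s≤Γ) (≤-trans (<⇒≤ z<) (m≤m+n M (size Λ)))
      j-eq : j + s + z ≡ M + size Λ
      j-eq = trans (ℕₚ.+-assoc j s z) (m∸n+n≡m sz≤)
      j≤M : j ≤ M
      j≤M = ≤-trans (ℕₚ.∸-monoʳ-≤ (M + size Λ) h) (≤-reflexive (m+n∸n≡m M (size Λ)))
      others : ∀ w → lo ≤ w → w < suc M → w ≢ j → ψ (w + s) ≡ 0ℚ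
      others w _ _ ne = when-≡ 1ℚ (≢→≡ᵇ {w + s + z} (λ e → ne (+-cancelʳ-≡ (s + z) w j
        (trans (sym (ℕₚ.+-assoc w s z)) (trans e (sym (m∸n+n≡m sz≤)))))))
      loA : lowP M A F false false ≤ suc A
      loA = low F
        where
        low : ∀ F → lowP M A F false false ≤ suc A
        low true = ≤-refl
        low false = n≤1+n A
      loC : lowB C G false false ≤ suc C
      loC = low G
        where
        low : ∀ G → lowB C G false false ≤ suc C
        low true = ≤-refl
        low false = n≤1+n C
      via : ∀ {x} → x + (s + z) ≤ M + size Λ → x ≤ j
      via {x} l = subst (_≤ j) (m+n∸n≡m x (s + z)) (ℕₚ.∸-monoˡ-≤ (s + z) l)
      sA : suc A + (s + z) ≤ M + size Λ
      sA = ≤-trans (≤-reflexive (sym (+-suc A (s + z)))) (≤-trans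
        (+-mono-≤ (m≤m+n A (size Λt)) (≤-trans (s≤s (+-monoˡ-≤ z s≤Γ)) z<)) (≤-reflexive (ℕₚ.+-comm (size Λ) M)))
      sC : suc C + (s + z) ≤ M + size Λ
      sC = ≤-trans (≤-reflexive (ar C s z)) (+-mono-≤ (≤-trans (s≤s (+-monoˡ-≤ z (≤-trans (m≤m+n C (size Γt)) (≤-reflexive sΓ)))) z<) s≤Λ)
        where
        ar : ∀ C s z → suc C + (s + z) ≡ suc (C + z) + s
        ar = solve-∀
      lo≤j : lo ≤ j
      lo≤j = ⊔-lub (≤-trans loA (via sA)) (≤-trans loC (via sC))

    -- row 0 of Ω′ is long, so it cannot carry a circle
    spurious : ∀ F G → when (okc F false true ∧ okc G false true)
      (∑I (lowP M A F false true ⊔ lowB C G false true) (upP M F false true ⊓ upB M C G false true)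
        (λ w → Z A (nextc F false true) C (nextc G false true) Λt Γt (λ u → ψ (w + u)))) ≡ 0ℚ
    spurious false G     = refl
    spurious true  false = refl
    spurious true  true  = ∑I-zero (A ⊔ C) (M ⊓ suc C) (λ w _ w< →
      Z-zero A false C false Λt Γt (λ u → ψ (w + u)) vΛt (λ u u≤ → when-≡ 1ℚ (≢→≡ᵇ {w + u + z} (λ e →
        <-irrefl e (≤-<-trans (+-monoˡ-≤ z (+-mono-≤ (≤-pred (≤-trans w< (m⊓n≤n M (suc C)))) u≤))
          (subst (_< M + size Λ) (ar C (size Λ) z) (ℕₚ.+-monoˡ-< (size Λ) (≤-<-trans (+-monoˡ-≤ z (≤-trans (m≤m+n C (size Γt)) (≤-reflexive sΓ))) z<))))))))
      where
      ar : ∀ C s z → C + z + s ≡ C + s + z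
      ar = solve-∀

  commute : ∑ (box M (suc (length Λt))) (λ Ω → when (pieri M false Λ Ω ∧ branch M false (pad Γ) Ω) (when (size Ω ≡ᵇ size Γ + z) 1ℚ)) ≡
            ∑ (box M (length Γ)) (λ Ω → when (betweenᵇ M false false Λ Γ Ω) (when (size Λ ≤ᵇ size Ω + z) 1ℚ))
  commute = begin
    ∑ (box M (suc (length Λt))) (λ Ω → when (pieri M false Λ Ω ∧ branch M false (pad Γ) Ω) (φ (size Ω)))
      ≡⟨ cong (λ Γp → ∑ (box M (suc (length Λt))) (λ Ω → when (pieri M false Λ Ω ∧ branch M false Γp Ω) (φ (size Ω)))) pe ⟩
    ∑ (box M (suc (length Λt))) (λ Ω → when (pieri M false Λ Ω ∧ branch M false ((C , G) ∷ Γt) Ω) (φ (size Ω)))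
      ≡⟨ ∑-above M false M false Λ ((C , G) ∷ Γt) φ ≤-refl vΛ (cong suc lt) ⟩
    Z M false M false Λ ((C , G) ∷ Γt) φ
      ≡⟨ Palindromic.p00 (palindromic {F = false} {G = false} (cons bA bC (paired {Γ = Γ} vΛt vΓt pe refl le))) rel ⟩
    Z M false M false Λ ((C , G) ∷ Γt) ψ
      ≡⟨ cong₂ _+ℚ_ first (spurious F G) ⟩
    ∑I lo (suc M) (λ w → X (λ u → ψ (w + u))) +ℚ 0ℚ
      ≡⟨ ℚₚ.+-identityʳ _ ⟩
    ∑I lo (suc M) (λ w → X (λ u → ψ (w + u)))
      ≡⟨ ∑I-cong lo (suc M) (λ w _ _ → sym (X-box (λ u → ψ (w + u)))) ⟩
    ∑I lo (suc M) (λ w → ∑ (box M (length Γ)) (λ Ω → when (b? Ω) (ψ (w + size Ω))))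
      ≡⟨ ∑I-∑-swap lo (suc M) (box M (length Γ)) (λ w Ω → when (b? Ω) (ψ (w + size Ω))) ⟩
    ∑ (box M (length Γ)) (λ Ω → ∑I lo (suc M) (λ w → when (b? Ω) (ψ (w + size Ω))))
      ≡⟨ ∑-cong′ (box M (length Γ)) fin ⟩
    ∑ (box M (length Γ)) (λ Ω → when (b? Ω) (θ (size Ω))) ∎
    where
    lt : length Λt ≡ length Γt
    lt = trans le (suc-injective (trans (sym (trans (Listₚ.length-++ Γ) (ℕₚ.+-comm (length Γ) 1))) (cong length pe)))
    first : _ ≡ _
    first = f F G
      where
      f : ∀ F G → when (okc F false false ∧ okc G false false) (∑I (lowP M A F false false ⊔ lowB C G false false) (upP M F false false ⊓ upB M C G false false)
        (λ w → Z A (nextc F false false) C (nextc G false false) Λt Γt (λ u → ψ (w + u))))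
        ≡ ∑I (lowP M A F false false ⊔ lowB C G false false) (suc M) (λ w → Z A F C G Λt Γt (λ u → ψ (w + u)))
      f true  true  = ∑I-bounds _ refl (⊓-idem (suc M))
      f true  false = ∑I-bounds _ refl (⊓-idem (suc M))
      f false true  = ∑I-bounds _ refl (⊓-idem (suc M))
      f false false = ∑I-bounds _ refl (⊓-idem (suc M))
    fin : ∀ Ω → ∑I lo (suc M) (λ w → when (b? Ω) (ψ (w + size Ω))) ≡ when (b? Ω) (θ (size Ω))
    fin Ω with b? Ω in e
    ... | true  = let p , q = b-size {Ω} e in single (size Ω) p q
    ... | false = ∑I-zero lo (suc M) (λ _ _ _ → refl)

-- The exponents of all divisors of a monomial in commuting variables. Summing a coefficient
-- function over them multiplies it by the sum of all h_ℓ.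
sub : List ℕ → List (List ℕ)
sub []       = [] ∷ []
sub (x ∷ xs) = concatMap (λ y → map (y ∷_) (sub xs)) (upTo (suc x))

∑-sub-∷ : ∀ x xs (f : List ℕ → ℚ) → ∑ (sub (x ∷ xs)) f ≡ ∑< (suc x) (λ y → ∑ (sub xs) (λ ys → f (y ∷ ys)))
∑-sub-∷ x xs f = trans (∑-concatMap (λ y → map (y ∷_) (sub xs)) (upTo (suc x)) f)
  (trans (∑-upTo (suc x) (λ y → ∑ (map (y ∷_) (sub xs)) f)) (∑<-cong′ (suc x) (λ y → ∑-map (y ∷_) (sub xs) f)))

-- Sorting and signs

data Desc : List ℕ → Set where
  []   : Desc []
  [_]  : ∀ x → Desc (x ∷ [])
  _∷_  : ∀ {x y l} → y ≤ x → Desc (y ∷ l) → Desc (x ∷ y ∷ l)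

Desc-tail : ∀ {x l} → Desc (x ∷ l) → Desc l
Desc-tail [ _ ]   = []
Desc-tail (_ ∷ d) = d

Desc-head : ∀ {x l z} → Desc (x ∷ l) → z ∈ l → z ≤ x
Desc-head (h ∷ d) (here refl) = h
Desc-head (h ∷ d) (there z∈)  = ≤-trans (Desc-head d z∈) h

Desc-cons : ∀ {x l} → (∀ z → z ∈ l → z ≤ x) → Desc l → Desc (x ∷ l)
Desc-cons {l = []} h d = [ _ ]
Desc-cons {l = y ∷ l} h d = h y (here refl) ∷ d

∈-weaken : ∀ p {v q} {z : ℕ} → z ∈ p ++ q → z ∈ p ++ v ∷ q
∈-weaken []      h         = there h
∈-weaken (_ ∷ p) (here e)  = here e
∈-weaken (_ ∷ p) (there h) = there (∈-weaken p h)

Desc-remove : ∀ p {v q} → Desc (p ++ v ∷ q) → Desc (p ++ q)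
Desc-remove []      d = Desc-tail d
Desc-remove (x ∷ p) {v} {q} d = Desc-cons (λ z z∈ → Desc-head d (∈-weaken p z∈)) (Desc-remove p (Desc-tail d))

insertDesc-∈ : ∀ x l {z} → z ∈ insertDesc x l → z ≡ x ⊎ z ∈ l
insertDesc-∈ x [] (here e) = inj₁ e
insertDesc-∈ x (y ∷ l) h with y ≤ᵇ x
insertDesc-∈ x (y ∷ l) (here e)  | true = inj₁ e
insertDesc-∈ x (y ∷ l) (there h) | true = inj₂ h
insertDesc-∈ x (y ∷ l) (here e)  | false = inj₂ (here e)
insertDesc-∈ x (y ∷ l) (there h) | false with insertDesc-∈ x l h
... | inj₁ e = inj₁ e
... | inj₂ m = inj₂ (there m)

insertDesc-≤ : ∀ x y l → y ≤ x → insertDesc x (y ∷ l) ≡ x ∷ y ∷ l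
insertDesc-≤ x y l h rewrite ≤→≤ᵇ {y} {x} h = refl

insertDesc-> : ∀ x y l → x < y → insertDesc x (y ∷ l) ≡ y ∷ insertDesc x l
insertDesc-> x y l h rewrite ≰→≤ᵇ {y} {x} (<⇒≱ h) = refl

insertDesc-Desc : ∀ x {l} → Desc l → Desc (insertDesc x l)
insertDesc-Desc x {[]} d = [ x ]
insertDesc-Desc x {y ∷ l} d with y ≤? x
... | yes h = subst Desc (sym (insertDesc-≤ x y l h)) (h ∷ d)
... | no h = subst Desc (sym (insertDesc-> x y l (≰⇒> h))) (Desc-cons lem (insertDesc-Desc x (Desc-tail d)))
  where
  lem : ∀ z → z ∈ insertDesc x l → z ≤ y
  lem z z∈ with insertDesc-∈ x l z∈
  ... | inj₁ refl = <⇒≤ (≰⇒> h)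
  ... | inj₂ m = Desc-head d m

sortDesc-Desc : ∀ l → Desc (sortDesc l)
sortDesc-Desc []      = []
sortDesc-Desc (x ∷ l) = insertDesc-Desc x (sortDesc-Desc l)

insertDesc-head : ∀ x l → (∀ z → z ∈ l → z ≤ x) → insertDesc x l ≡ x ∷ l
insertDesc-head x []      h = refl
insertDesc-head x (y ∷ l) h = insertDesc-≤ x y l (h y (here refl))

sortDesc-id : ∀ {l} → Desc l → sortDesc l ≡ l
sortDesc-id [] = refl
sortDesc-id {x ∷ l} d = trans (cong (insertDesc x) (sortDesc-id (Desc-tail d))) (insertDesc-head x l (λ z → Desc-head d))

insertDesc-length : ∀ x l → length (insertDesc x l) ≡ suc (length l)
insertDesc-length x [] = refl
insertDesc-length x (y ∷ l) with y ≤ᵇ x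
... | true  = refl
... | false = cong suc (insertDesc-length x l)

sortDesc-length : ∀ l → length (sortDesc l) ≡ length l
sortDesc-length []      = refl
sortDesc-length (x ∷ l) = trans (insertDesc-length x (sortDesc l)) (cong suc (sortDesc-length l))

above : ℕ → List ℕ → ℕ
above x l = length (filterᵇ (λ y → suc x ≤ᵇ y) l)

above-≤ : ∀ x y l → y ≤ x → above x (y ∷ l) ≡ above x l
above-≤ x y l h rewrite ≮→<ᵇ {x} {y} (≤⇒≯ h) = refl

above-> : ∀ x y l → x < y → above x (y ∷ l) ≡ suc (above x l)
above-> x y l h rewrite <→<ᵇ {x} {y} h = refl

above-∷ : ∀ x y l → above x (y ∷ l) ≡ (if x <ᵇ y then 1 else 0) + above x l
above-∷ x y l with x <? y
... | yes h = trans (above-> x y l h) (cong (λ b → (if b then 1 else 0) + above x l) (sym (<→<ᵇ h)))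
... | no h  = trans (above-≤ x y l (≮⇒≥ h)) (cong (λ b → (if b then 1 else 0) + above x l) (sym (≮→<ᵇ h)))

above-insert : ∀ x y l → above x (insertDesc y l) ≡ above x (y ∷ l)
above-insert x y [] = refl
above-insert x y (z ∷ l) with z ≤ᵇ y
... | true = refl
... | false = begin
  above x (z ∷ insertDesc y l)       ≡⟨ above-∷ x z (insertDesc y l) ⟩
  #z + above x (insertDesc y l)      ≡⟨ cong (#z +_) (trans (above-insert x y l) (above-∷ x y l)) ⟩
  #z + (#y + above x l)              ≡⟨ +-exchange #z #y (above x l) ⟩
  #y + (#z + above x l)              ≡⟨ cong (#y +_) (sym (above-∷ x z l)) ⟩
  #y + above x (z ∷ l)               ≡⟨ sym (above-∷ x y (z ∷ l)) ⟩
  above x (y ∷ z ∷ l) ∎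
  where
  #z = if x <ᵇ z then 1 else 0
  #y = if x <ᵇ y then 1 else 0

above-sort : ∀ x l → above x (sortDesc l) ≡ above x l
above-sort x []      = refl
above-sort x (y ∷ l) = trans (above-insert x y (sortDesc l)) (trans (above-∷ x y (sortDesc l))
  (trans (cong ((if x <ᵇ y then 1 else 0) +_) (above-sort x l)) (sym (above-∷ x y l))))

above-zero : ∀ x l → (∀ z → z ∈ l → z ≤ x) → above x l ≡ 0
above-zero x []      h = refl
above-zero x (y ∷ l) h = trans (above-≤ x y l (h y (here refl))) (above-zero x l (λ z z∈ → h z (there z∈)))

ascPairs-Desc : ∀ {l} → Desc l → ascPairs l ≡ 0
ascPairs-Desc {[]} d = refl
ascPairs-Desc {x ∷ l} d = cong₂ _+_ (above-zero x l (λ z → Desc-head d)) (ascPairs-Desc (Desc-tail d))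

sgn-+ : ∀ m n → sgn (m + n) ≡ sgn m *ℚ sgn n
sgn-+ zero    n = sym (ℚₚ.*-identityˡ (sgn n))
sgn-+ (suc m) n = trans (cong -ℚ_ (sgn-+ m n)) (ℚₚ.neg-distribˡ-* (sgn m) (sgn n))

swapAt : ℕ → List ℕ → List ℕ
swapAt zero    (x ∷ y ∷ l) = y ∷ x ∷ l
swapAt (suc i) (x ∷ l)     = x ∷ swapAt i l
swapAt _       l           = l

Anti : (List ℕ → ℚ) → Set
Anti g = ∀ i l → suc i < length l → g (swapAt i l) ≡ -ℚ g l

Anti-∷ : ∀ {g} x → Anti g → Anti (λ l → g (x ∷ l))
Anti-∷ x a i l h = a (suc i) (x ∷ l) (s≤s h)

Anti-insert : ∀ {g} → Anti g → ∀ x {l} → Desc l → g (x ∷ l) ≡ sgn (above x l) *ℚ g (insertDesc x l)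
Anti-insert {g} a x {[]} d = sym (ℚₚ.*-identityˡ (g (x ∷ [])))
Anti-insert {g} a x {y ∷ l} d with y ≤? x
... | yes h = sym (trans (cong₂ (λ n m → sgn n *ℚ g m) (above-zero x (y ∷ l) lem) (insertDesc-≤ x y l h)) (ℚₚ.*-identityˡ (g (x ∷ y ∷ l))))
  where
  lem : ∀ z → z ∈ y ∷ l → z ≤ x
  lem z (here refl) = h
  lem z (there z∈) = ≤-trans (Desc-head d z∈) h
... | no h = begin
  g (x ∷ y ∷ l)                                  ≡⟨ a 0 (y ∷ x ∷ l) (s≤s (s≤s z≤n)) ⟩
  -ℚ g (y ∷ x ∷ l)                               ≡⟨ cong -ℚ_ (Anti-insert {λ m → g (y ∷ m)} (Anti-∷ {g} y a) x (Desc-tail d)) ⟩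
  -ℚ (sgn (above x l) *ℚ g (y ∷ insertDesc x l)) ≡⟨ ℚₚ.neg-distribˡ-* (sgn (above x l)) (g (y ∷ insertDesc x l)) ⟩
  sgn (suc (above x l)) *ℚ g (y ∷ insertDesc x l) ≡⟨ cong₂ (λ n m → sgn n *ℚ g m) (sym (above-> x y l x<y)) (sym (insertDesc-> x y l x<y)) ⟩
  sgn (above x (y ∷ l)) *ℚ g (insertDesc x (y ∷ l)) ∎
  where
  x<y = ≰⇒> h

-- Insertion sort moves each entry past the larger ones to its right, and `ascPairs` counts these
-- transpositions.
Anti-sort : ∀ {g} → Anti g → ∀ l → g l ≡ sgn (ascPairs l) *ℚ g (sortDesc l)
Anti-sort {g} a []      = sym (ℚₚ.*-identityˡ (g []))
Anti-sort {g} a (x ∷ l) = begin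
  g (x ∷ l)                                            ≡⟨ Anti-sort {λ m → g (x ∷ m)} (Anti-∷ {g} x a) l ⟩
  sgn (ascPairs l) *ℚ g (x ∷ sortDesc l)               ≡⟨ cong (sgn (ascPairs l) *ℚ_) (Anti-insert {g} a x (sortDesc-Desc l)) ⟩
  sgn (ascPairs l) *ℚ (sgn (above x (sortDesc l)) *ℚ g (insertDesc x (sortDesc l)))
    ≡⟨ solve 3 (λ p q r → p :* (q :* r) := (q :* p) :* r) refl (sgn (ascPairs l)) (sgn (above x (sortDesc l))) (g (insertDesc x (sortDesc l))) ⟩
  (sgn (above x (sortDesc l)) *ℚ sgn (ascPairs l)) *ℚ g (insertDesc x (sortDesc l))
    ≡⟨ cong (_*ℚ g (insertDesc x (sortDesc l))) (sym (trans (sgn-+ (above x l) (ascPairs l)) (cong (λ n → sgn n *ℚ sgn (ascPairs l)) (sym (above-sort x l))))) ⟩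
  sgn (ascPairs (x ∷ l)) *ℚ g (sortDesc (x ∷ l)) ∎

-- Alternants: alt a e is the coefficient of x^e in Σ_σ sgn(σ) x^{σ(a)}, expanded along the first entry of a.

lap : ℕ → (List ℕ → ℚ) → List ℕ → ℚ
lap k g []      = 0ℚ
lap k g (x ∷ e) = when (x ≡ᵇ k) (g e) +ℚ (-ℚ lap k (λ e′ → g (x ∷ e′)) e)

alt : List ℕ → List ℕ → ℚ
alt []      []      = 1ℚ
alt []      (_ ∷ _) = 0ℚ
alt (k ∷ a) e       = lap k (alt a) e

lap-cong : ∀ k {g g′} → (∀ l → g l ≡ g′ l) → ∀ e → lap k g e ≡ lap k g′ e
lap-cong k h []      = refl
lap-cong k h (x ∷ e) = cong₂ (λ p q → when (x ≡ᵇ k) p +ℚ (-ℚ q)) (h e) (lap-cong k (λ l → h (x ∷ l)) e)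

lap-neg : ∀ k g e → lap k (λ l → -ℚ g l) e ≡ -ℚ lap k g e
lap-neg k g []      = refl
lap-neg k g (x ∷ e) = trans (cong₂ _+ℚ_ (when-neg (x ≡ᵇ k) (g e)) (cong -ℚ_ (lap-neg k (λ l → g (x ∷ l)) e)))
  (sym (ℚₚ.neg-distrib-+ (when (x ≡ᵇ k) (g e)) (-ℚ lap k (λ l → g (x ∷ l)) e)))

lap-Anti : ∀ k {g} → (∀ i l → suc i < length l → g (swapAt i l) ≡ -ℚ g l) → Anti (lap k g)
lap-Anti k {g} a zero (x ∷ y ∷ e) h = begin
  when (y ≡ᵇ k) (g (x ∷ e)) +ℚ (-ℚ (when (x ≡ᵇ k) (g (y ∷ e)) +ℚ (-ℚ lap k (λ l → g (y ∷ x ∷ l)) e)))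
    ≡⟨ cong (λ w → when (y ≡ᵇ k) (g (x ∷ e)) +ℚ (-ℚ (when (x ≡ᵇ k) (g (y ∷ e)) +ℚ (-ℚ w))))
         (trans (lap-cong k (λ l → a 0 (x ∷ y ∷ l) (s≤s (s≤s z≤n))) e) (lap-neg k (λ l → g (x ∷ y ∷ l)) e)) ⟩
  when (y ≡ᵇ k) (g (x ∷ e)) +ℚ (-ℚ (when (x ≡ᵇ k) (g (y ∷ e)) +ℚ (-ℚ (-ℚ r))))
    ≡⟨ solve 3 (λ p q r → p :+ (:- (q :+ (:- (:- r)))) := :- (q :+ (:- (p :+ (:- r))))) refl (when (y ≡ᵇ k) (g (x ∷ e))) (when (x ≡ᵇ k) (g (y ∷ e))) r ⟩
  -ℚ lap k g (x ∷ y ∷ e) ∎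
  where
  r = lap k (λ l → g (x ∷ y ∷ l)) e
lap-Anti k a zero (x ∷ []) (s≤s ())
lap-Anti k {g} a (suc i) (x ∷ e) (s≤s h) = begin
  when (x ≡ᵇ k) (g (swapAt i e)) +ℚ (-ℚ lap k (λ l → g (x ∷ l)) (swapAt i e))
    ≡⟨ cong₂ (λ p q → when (x ≡ᵇ k) p +ℚ (-ℚ q)) (a i e h) (lap-Anti k {λ l → g (x ∷ l)} (λ j l → λ h′ → a (suc j) (x ∷ l) (s≤s h′)) i e h) ⟩
  when (x ≡ᵇ k) (-ℚ g e) +ℚ (-ℚ (-ℚ lap k (λ l → g (x ∷ l)) e))
    ≡⟨ cong (_+ℚ (-ℚ (-ℚ lap k (λ l → g (x ∷ l)) e))) (when-neg (x ≡ᵇ k) (g e)) ⟩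
  (-ℚ when (x ≡ᵇ k) (g e)) +ℚ (-ℚ (-ℚ lap k (λ l → g (x ∷ l)) e))
    ≡⟨ sym (ℚₚ.neg-distrib-+ (when (x ≡ᵇ k) (g e)) (-ℚ lap k (λ l → g (x ∷ l)) e)) ⟩
  -ℚ lap k g (x ∷ e) ∎

alt-Anti : ∀ a → Anti (alt a)
alt-Anti [] zero (x ∷ y ∷ l) h = refl
alt-Anti [] zero (x ∷ []) (s≤s ())
alt-Anti [] (suc i) (x ∷ l) h = refl
alt-Anti (k ∷ a) = lap-Anti k {alt a} (alt-Anti a)

lap-zero : ∀ k g e → (∀ p q → e ≡ p ++ k ∷ q → g (p ++ q) ≡ 0ℚ) → lap k g e ≡ 0ℚ
lap-zero k g []      h = refl
lap-zero k g (x ∷ e) h = trans (cong₂ (λ p q → p +ℚ (-ℚ q)) first (lap-zero k (λ l → g (x ∷ l)) e (λ p q e → h (x ∷ p) q (cong (x ∷_) e)))) 0+0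
  where
  first : when (x ≡ᵇ k) (g e) ≡ 0ℚ
  first with x ≡ᵇ k in eq
  ... | true  = h [] e (cong (_∷ e) (≡ᵇ→≡ eq))
  ... | false = refl

data Strict : List ℕ → Set where
  []   : Strict []
  [_]  : ∀ x → Strict (x ∷ [])
  _∷_  : ∀ {x y l} → y < x → Strict (y ∷ l) → Strict (x ∷ y ∷ l)

Strict-tail : ∀ {x l} → Strict (x ∷ l) → Strict l
Strict-tail [ _ ]   = []
Strict-tail (_ ∷ d) = d

Strict-head : ∀ {x l z} → Strict (x ∷ l) → z ∈ l → z < x
Strict-head (h ∷ d) (here refl) = h
Strict-head (h ∷ d) (there z∈)  = <-trans (Strict-head d z∈) h

eqL→≡ : ∀ a b → eqL a b ≡ true → a ≡ b
eqL→≡ []      []      _ = refl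
eqL→≡ (x ∷ a) (y ∷ b) e = let p , q = ∧-split {x ≡ᵇ y} e in cong₂ _∷_ (≡ᵇ→≡ {x} p) (eqL→≡ a b q)

eqL-refl : ∀ a → eqL a a ≡ true
eqL-refl []      = refl
eqL-refl (x ∷ a) = ∧-intro (≡→≡ᵇ {x} refl) (eqL-refl a)

-- Only the identity permutation can contribute. Deleting a later entry `k` of `w` leaves the head,
-- which is at least `k`, while the remaining exponents of the alternant are all below `k`.
alt-Desc : ∀ {a} → Strict a → ∀ {w} → Desc w → alt a w ≡ when (eqL w a) 1ℚ
alt-Desc {[]} _ {[]} _ = refl
alt-Desc {[]} _ {_ ∷ _} _ = refl
alt-Desc {k ∷ a} s {[]} _ = refl
alt-Desc {k ∷ a} s {x ∷ w} d = begin
  when (x ≡ᵇ k) (alt a w) +ℚ (-ℚ lap k (λ l → alt a (x ∷ l)) w)  ≡⟨ cong₂ (λ p q → when (x ≡ᵇ k) p +ℚ (-ℚ q)) (alt-Desc (Strict-tail s) (Desc-tail d)) rest ⟩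
  when (x ≡ᵇ k) (when (eqL w a) 1ℚ) +ℚ (-ℚ 0ℚ)                   ≡⟨ ℚₚ.+-identityʳ _ ⟩
  when (x ≡ᵇ k) (when (eqL w a) 1ℚ)                              ≡⟨ sym (when-∧ (x ≡ᵇ k) (eqL w a) 1ℚ) ⟩
  when (eqL (x ∷ w) (k ∷ a)) 1ℚ ∎
  where
  rest : lap k (λ l → alt a (x ∷ l)) w ≡ 0ℚ
  rest = lap-zero k _ w (λ p q e → trans (alt-Desc (Strict-tail s) (Desc-remove (x ∷ p) (subst Desc (cong (x ∷_) e) d)))
      (when-≡ 1ℚ (miss p q e)))
    where
    miss : ∀ p q → w ≡ p ++ k ∷ q → eqL (x ∷ p ++ q) a ≡ false
    miss p q refl with eqL (x ∷ p ++ q) a in eq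
    ... | false = refl
    ... | true = ⊥-elim (<-irrefl refl (<-≤-trans (Strict-head s (subst (x ∈_) (eqL→≡ (x ∷ p ++ q) a eq) (here refl)))
                   (Desc-head d (∈ₚ.∈-++⁺ʳ p (here refl)))))

alt-sort : ∀ {a} → Strict a → ∀ e → alt a e ≡ when (eqL (sortDesc e) a) (sgn (ascPairs e))
alt-sort {a} s e = trans (Anti-sort {alt a} (alt-Anti a) e) (trans (cong (sgn (ascPairs e) *ℚ_) (alt-Desc s (sortDesc-Desc e)))
  (trans (when-*ˡ (eqL (sortDesc e) a) (sgn (ascPairs e)) 1ℚ) (cong (when (eqL (sortDesc e) a)) (ℚₚ.*-identityʳ (sgn (ascPairs e))))))

-- The product of an alternant with all complete symmetric functions

lap≤ : ℕ → (List ℕ → ℚ) → List ℕ → ℚ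
lap≤ k g []      = 0ℚ
lap≤ k g (x ∷ e) = when (k ≤ᵇ x) (g e) +ℚ (-ℚ lap≤ k (λ e′ → g (x ∷ e′)) e)

lap≤-zero : ∀ k g e → (∀ p v q → e ≡ p ++ v ∷ q → k ≤ v → g (p ++ q) ≡ 0ℚ) → lap≤ k g e ≡ 0ℚ
lap≤-zero k g []      h = refl
lap≤-zero k g (x ∷ e) h = trans (cong₂ (λ p q → p +ℚ (-ℚ q)) first (lap≤-zero k (λ l → g (x ∷ l)) e (λ p v q e → h (x ∷ p) v q (cong (x ∷_) e)))) 0+0
  where
  first : when (k ≤ᵇ x) (g e) ≡ 0ℚ
  first with k ≤ᵇ x in eq
  ... | true  = h [] x e refl (≤ᵇ→≤ {k} eq)
  ... | false = refl

lap≤-cong : ∀ k {g g′} → (∀ l → g l ≡ g′ l) → ∀ e → lap≤ k g e ≡ lap≤ k g′ e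
lap≤-cong k h []      = refl
lap≤-cong k h (x ∷ e) = cong₂ (λ p q → when (k ≤ᵇ x) p +ℚ (-ℚ q)) (h e) (lap≤-cong k (λ l → h (x ∷ l)) e)

lap≤-∑ : ∀ k n (g : ℕ → List ℕ → ℚ) e → ∑< n (λ y → lap≤ k (g y) e) ≡ lap≤ k (λ l → ∑< n (λ y → g y l)) e
lap≤-∑ k n g []      = ∑<-zero n (λ _ _ → refl)
lap≤-∑ k n g (x ∷ e) = trans (∑<-+ n (λ y → when (k ≤ᵇ x) (g y e)) (λ y → -ℚ lap≤ k (λ l → g y (x ∷ l)) e))
  (cong₂ _+ℚ_ (∑<-when (k ≤ᵇ x) n (λ y → g y e))
    (trans (∑<-neg n (λ y → lap≤ k (λ l → g y (x ∷ l)) e)) (cong -ℚ_ (lap≤-∑ k n (λ y l → g y (x ∷ l)) e))))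

∑<-delta : ∀ n k c → ∑< n (λ y → when (y ≡ᵇ k) c) ≡ when (k <ᵇ n) c
∑<-delta n k c with k <ᵇ n in e
... | true  = trans (∑<-single n k (<ᵇ→< e) (λ y _ ne → when-≡ c (≢→≡ᵇ ne))) (when-≡ c (≡→≡ᵇ {k} refl))
... | false = ∑<-zero n (λ y y< → when-≡ c (≢→≡ᵇ {y} λ { refl → false≢true e (<→<ᵇ y<) }))

≤ᵇ-<ᵇ-suc : ∀ k x → (k <ᵇ suc x) ≡ (k ≤ᵇ x)
≤ᵇ-<ᵇ-suc zero    x = refl
≤ᵇ-<ᵇ-suc (suc k) x = refl

-- The entry along which the alternant is expanded must be lowered exactly to `k`, which is possible
-- once if it is at least `k` and impossible otherwise.
∑-sub-lap : ∀ k g e → ∑ (sub e) (lap k g) ≡ lap≤ k (λ l → ∑ (sub l) g) e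
∑-sub-lap k g []      = ℚₚ.+-identityʳ 0ℚ
∑-sub-lap k g (x ∷ e) = begin
  ∑ (sub (x ∷ e)) (lap k g)
    ≡⟨ ∑-sub-∷ x e (lap k g) ⟩
  ∑< (suc x) (λ y → ∑ (sub e) (λ l → when (y ≡ᵇ k) (g l) +ℚ (-ℚ lap k (λ e′ → g (y ∷ e′)) l)))
    ≡⟨ ∑<-cong′ (suc x) (λ y → trans (∑-+ (sub e) (λ l → when (y ≡ᵇ k) (g l)) (λ l → -ℚ lap k (λ e′ → g (y ∷ e′)) l))
         (cong₂ _+ℚ_ (∑-when (y ≡ᵇ k) (sub e) g) (∑-neg (sub e) (lap k (λ e′ → g (y ∷ e′)))))) ⟩
  ∑< (suc x) (λ y → when (y ≡ᵇ k) (∑ (sub e) g) +ℚ (-ℚ ∑ (sub e) (lap k (λ e′ → g (y ∷ e′)))))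
    ≡⟨ ∑<-+ (suc x) (λ y → when (y ≡ᵇ k) (∑ (sub e) g)) (λ y → -ℚ ∑ (sub e) (lap k (λ e′ → g (y ∷ e′)))) ⟩
  ∑< (suc x) (λ y → when (y ≡ᵇ k) (∑ (sub e) g)) +ℚ ∑< (suc x) (λ y → -ℚ ∑ (sub e) (lap k (λ e′ → g (y ∷ e′))))
    ≡⟨ cong₂ _+ℚ_ (trans (∑<-delta (suc x) k (∑ (sub e) g)) (when-≡ (∑ (sub e) g) (≤ᵇ-<ᵇ-suc k x)))
         (trans (∑<-neg (suc x) (λ y → ∑ (sub e) (lap k (λ e′ → g (y ∷ e′))))) (cong -ℚ_
           (trans (∑<-cong′ (suc x) (λ y → ∑-sub-lap k (λ e′ → g (y ∷ e′)) e))
             (trans (lap≤-∑ k (suc x) (λ y l → ∑ (sub l) (λ e′ → g (y ∷ e′))) e)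
               (lap≤-cong k (λ l → sym (∑-sub-∷ x l g)) e))))) ⟩
  lap≤ k (λ l → ∑ (sub l) g) (x ∷ e) ∎

-- For strictly decreasing lists this is a horizontal strip after subtraction of the staircase.
interl : ℕ → List ℕ → List ℕ → Bool
interl A []      []      = true
interl A (a ∷ as) (w ∷ ws) = (a ≤ᵇ w) ∧ (w <ᵇ A) ∧ interl a as ws
interl _ _       _       = false

interl-top : ∀ {A B} a as w ws → w < A → w < B → interl A (a ∷ as) (w ∷ ws) ≡ interl B (a ∷ as) (w ∷ ws)
interl-top {A} {B} a as w ws h h′ = cong (λ b → (a ≤ᵇ w) ∧ b ∧ interl a as ws) (trans (<→<ᵇ h) (sym (<→<ᵇ h′)))

-- The Pieri rule for alternants. Along the largest exponent `k` only the first two entries of `w`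
-- matter: if both are at least `k`, their terms cancel, and otherwise the first term alone yields
-- the interlacing condition.
∑-sub-alt-Desc : ∀ {M a} → Strict a → ∀ {w} → Desc w → length w ≡ length a → (∀ z → z ∈ w → z < M) →
  ∑ (sub w) (alt a) ≡ when (interl M a w) 1ℚ
∑-sub-alt-Desc {M} {[]} _ {[]} _ _ _ = ℚₚ.+-identityʳ 1ℚ
∑-sub-alt-Desc {M} {k ∷ []} s {x ∷ []} d e b = trans (∑-sub-lap k (alt []) (x ∷ [])) (trans (ℚₚ.+-identityʳ _)
  (when-≡ 1ℚ (trans (sym (Boolₚ.∧-identityʳ (k ≤ᵇ x))) (cong (λ b → (k ≤ᵇ x) ∧ b ∧ true) (sym (<→<ᵇ (b x (here refl))))))))
∑-sub-alt-Desc {M} {k ∷ k′ ∷ a} s@(k′<k ∷ s′) {x ∷ y ∷ w} d@(y≤x ∷ d′) e b = begin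
  ∑ (sub (x ∷ y ∷ w)) (lap k A)
    ≡⟨ ∑-sub-lap k A (x ∷ y ∷ w) ⟩
  when (k ≤ᵇ x) (D (y ∷ w)) +ℚ (-ℚ (when (k ≤ᵇ y) (D (x ∷ w)) +ℚ (-ℚ lap≤ k (λ l → D (x ∷ y ∷ l)) w)))
    ≡⟨ cong (λ r → when (k ≤ᵇ x) (D (y ∷ w)) +ℚ (-ℚ (when (k ≤ᵇ y) (D (x ∷ w)) +ℚ (-ℚ r)))) far ⟩
  when (k ≤ᵇ x) (D (y ∷ w)) +ℚ (-ℚ (when (k ≤ᵇ y) (D (x ∷ w)) +ℚ (-ℚ 0ℚ)))
    ≡⟨ cong₂ (λ p q → when (k ≤ᵇ x) p +ℚ (-ℚ (when (k ≤ᵇ y) q +ℚ (-ℚ 0ℚ))))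
         (IH d′ (suc-injective e) (λ z z∈ → b z (there z∈)))
         (IH (Desc-remove (x ∷ []) d) (suc-injective e) (λ { z (here h) → b z (here h) ; z (there h) → b z (there (there h)) })) ⟩
  when (k ≤ᵇ x) (when (interl M (k′ ∷ a) (y ∷ w)) 1ℚ) +ℚ (-ℚ (when (k ≤ᵇ y) (when (interl M (k′ ∷ a) (x ∷ w)) 1ℚ) +ℚ (-ℚ 0ℚ)))
    ≡⟨ fin ⟩
  when (interl M (k ∷ k′ ∷ a) (x ∷ y ∷ w)) 1ℚ ∎
  where
  A = alt (k′ ∷ a)
  D : List ℕ → ℚ
  D l = ∑ (sub l) A
  IH : ∀ {w} → Desc w → length w ≡ length (k′ ∷ a) → (∀ z → z ∈ w → z < M) → D w ≡ when (interl M (k′ ∷ a) w) 1ℚ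
  IH = ∑-sub-alt-Desc s′
  x<M = b x (here refl)
  y<M = b y (there (here refl))
  -- An entry from the third on that is at least `k` forces y ≥ k > k′, which violates the
  -- interlacing y < k′.
  far : lap≤ k (λ l → D (x ∷ y ∷ l)) w ≡ 0ℚ
  far = lap≤-zero k (λ l → D (x ∷ y ∷ l)) w z
    where
    z : ∀ p v q → w ≡ p ++ v ∷ q → k ≤ v → D (x ∷ y ∷ p ++ q) ≡ 0ℚ
    z p v q refl k≤v = trans (IH (Desc-remove (x ∷ y ∷ p) d) len bd) (when-≡ 1ℚ (miss a (p ++ q) (≤-trans k≤v (Desc-head d′ (∈ₚ.∈-++⁺ʳ p (here refl))))))
      where
      len : length (x ∷ y ∷ p ++ q) ≡ length (k′ ∷ a)
      len = trans (cong suc (trans (cong suc (Listₚ.length-++ p)) (trans (sym (+-suc (length p) (length q))) (sym (Listₚ.length-++ p))))) (suc-injective e)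
      bd : ∀ u → u ∈ x ∷ y ∷ p ++ q → u < M
      bd u (here h) = b u (here h)
      bd u (there (here h)) = b u (there (here h))
      bd u (there (there h)) = b u (there (there (∈-weaken p h)))
      miss : ∀ a l → k ≤ y → interl M (k′ ∷ a) (x ∷ y ∷ l) ≡ false
      miss a l k≤y with interl M (k′ ∷ a) (x ∷ y ∷ l) in eq
      ... | false = refl
      miss (k″ ∷ a) l k≤y | true = ⊥-elim (<⇒≱ (<-≤-trans k′<k k≤y) (<⇒≤ (<ᵇ→< {y} {k′}
        (proj₁ (∧-split {y <ᵇ k′} (proj₂ (∧-split {k″ ≤ᵇ y} (proj₂ (∧-split {x <ᵇ M} (proj₂ (∧-split {k′ ≤ᵇ x} eq)))))))))))
      miss [] l k≤y | true with ∧-split {k′ ≤ᵇ x} eq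
      ... | _ , r with ∧-split {x <ᵇ M} r
      ... | _ , ()
  fin : when (k ≤ᵇ x) (when (interl M (k′ ∷ a) (y ∷ w)) 1ℚ) +ℚ (-ℚ (when (k ≤ᵇ y) (when (interl M (k′ ∷ a) (x ∷ w)) 1ℚ) +ℚ (-ℚ 0ℚ)))
        ≡ when ((k ≤ᵇ x) ∧ (x <ᵇ M) ∧ interl k (k′ ∷ a) (y ∷ w)) 1ℚ
  fin with k ≤? y
  ... | yes h = begin
    when (k ≤ᵇ x) (when (interl M (k′ ∷ a) (y ∷ w)) 1ℚ) +ℚ (-ℚ (when (k ≤ᵇ y) (when (interl M (k′ ∷ a) (x ∷ w)) 1ℚ) +ℚ (-ℚ 0ℚ)))
      ≡⟨ cong₂ (λ p q → when p (when (interl M (k′ ∷ a) (y ∷ w)) 1ℚ) +ℚ (-ℚ (when q (when (interl M (k′ ∷ a) (x ∷ w)) 1ℚ) +ℚ (-ℚ 0ℚ)))) (≤→≤ᵇ (≤-trans h y≤x)) (≤→≤ᵇ h) ⟩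
    when (interl M (k′ ∷ a) (y ∷ w)) 1ℚ +ℚ (-ℚ (when (interl M (k′ ∷ a) (x ∷ w)) 1ℚ +ℚ (-ℚ 0ℚ)))
      ≡⟨ cong (λ p → when (interl M (k′ ∷ a) (y ∷ w)) 1ℚ +ℚ (-ℚ (when p 1ℚ +ℚ (-ℚ 0ℚ)))) same ⟩
    when (interl M (k′ ∷ a) (y ∷ w)) 1ℚ +ℚ (-ℚ (when (interl M (k′ ∷ a) (y ∷ w)) 1ℚ +ℚ (-ℚ 0ℚ)))
      ≡⟨ solve 1 (λ p → p :+ (:- (p :+ con 0ℚ)) := con 0ℚ) refl (when (interl M (k′ ∷ a) (y ∷ w)) 1ℚ) ⟩
    0ℚ
      ≡⟨ when-≡ 1ℚ (sym zero′) ⟩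
    when ((k ≤ᵇ x) ∧ (x <ᵇ M) ∧ interl k (k′ ∷ a) (y ∷ w)) 1ℚ ∎
    where
    same : interl M (k′ ∷ a) (x ∷ w) ≡ interl M (k′ ∷ a) (y ∷ w)
    same = cong₂ (λ p q → p ∧ q ∧ interl k′ a w) (trans (≤→≤ᵇ (≤-trans k′≤y y≤x)) (sym (≤→≤ᵇ k′≤y))) (trans (<→<ᵇ x<M) (sym (<→<ᵇ y<M)))
      where k′≤y = ≤-trans (<⇒≤ k′<k) h
    zero′ : (k ≤ᵇ x) ∧ (x <ᵇ M) ∧ interl k (k′ ∷ a) (y ∷ w) ≡ false
    zero′ rewrite ≮→<ᵇ {y} {k} (≤⇒≯ h) = f (k ≤ᵇ x) (x <ᵇ M) (k′ ≤ᵇ y)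
      where
      f : ∀ p q r → p ∧ q ∧ r ∧ false ≡ false
      f true true true = refl
      f true true false = refl
      f true false r = refl
      f false q r = refl
  ... | no h = begin
    when (k ≤ᵇ x) (when (interl M (k′ ∷ a) (y ∷ w)) 1ℚ) +ℚ (-ℚ (when (k ≤ᵇ y) (when (interl M (k′ ∷ a) (x ∷ w)) 1ℚ) +ℚ (-ℚ 0ℚ)))
      ≡⟨ cong (λ q → when (k ≤ᵇ x) (when (interl M (k′ ∷ a) (y ∷ w)) 1ℚ) +ℚ (-ℚ (when q (when (interl M (k′ ∷ a) (x ∷ w)) 1ℚ) +ℚ (-ℚ 0ℚ)))) (≰→≤ᵇ h) ⟩
    when (k ≤ᵇ x) (when (interl M (k′ ∷ a) (y ∷ w)) 1ℚ) +ℚ 0ℚ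
      ≡⟨ ℚₚ.+-identityʳ _ ⟩
    when (k ≤ᵇ x) (when (interl M (k′ ∷ a) (y ∷ w)) 1ℚ)
      ≡⟨ cong (λ p → when (k ≤ᵇ x) (when p 1ℚ)) (interl-top k′ a y w y<M (≰⇒> h)) ⟩
    when (k ≤ᵇ x) (when (interl k (k′ ∷ a) (y ∷ w)) 1ℚ)
      ≡⟨ sym (when-∧ (k ≤ᵇ x) (interl k (k′ ∷ a) (y ∷ w)) 1ℚ) ⟩
    when ((k ≤ᵇ x) ∧ interl k (k′ ∷ a) (y ∷ w)) 1ℚ
      ≡⟨ cong (λ q → when ((k ≤ᵇ x) ∧ q ∧ interl k (k′ ∷ a) (y ∷ w)) 1ℚ) (sym (<→<ᵇ x<M)) ⟩
    when ((k ≤ᵇ x) ∧ (x <ᵇ M) ∧ interl k (k′ ∷ a) (y ∷ w)) 1ℚ ∎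

swap-sub : ∀ g i e → ∑ (sub (swapAt i e)) g ≡ ∑ (sub e) (λ l → g (swapAt i l))
swap-sub g zero    []          = refl
swap-sub g zero    (x ∷ [])    = trans (∑-sub-∷ x [] g) (sym (∑-sub-∷ x [] (λ l → g (swapAt 0 l))))
swap-sub g zero    (x ∷ y ∷ e) = begin
  ∑ (sub (y ∷ x ∷ e)) g
    ≡⟨ trans (∑-sub-∷ y (x ∷ e) g) (∑<-cong′ (suc y) (λ j → ∑-sub-∷ x e (λ l → g (j ∷ l)))) ⟩
  ∑< (suc y) (λ j → ∑< (suc x) (λ i → ∑ (sub e) (λ l → g (j ∷ i ∷ l))))
    ≡⟨ ∑<-swap (suc y) (suc x) (λ j i → ∑ (sub e) (λ l → g (j ∷ i ∷ l))) ⟩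
  ∑< (suc x) (λ i → ∑< (suc y) (λ j → ∑ (sub e) (λ l → g (j ∷ i ∷ l))))
    ≡⟨ sym (trans (∑-sub-∷ x (y ∷ e) (λ l → g (swapAt 0 l))) (∑<-cong′ (suc x) (λ i → ∑-sub-∷ y e (λ l → g (swapAt 0 (i ∷ l)))))) ⟩
  ∑ (sub (x ∷ y ∷ e)) (λ l → g (swapAt 0 l)) ∎
swap-sub g (suc i) []      = refl
swap-sub g (suc i) (x ∷ e) = trans (∑-sub-∷ x (swapAt i e) g) (trans (∑<-cong′ (suc x) (λ y → swap-sub (λ l → g (y ∷ l)) i e))
  (sym (∑-sub-∷ x e (λ l → g (swapAt (suc i) l)))))

sub-length : ∀ e {l} → l ∈ sub e → length l ≡ length e
sub-length []      (here refl) = refl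
sub-length (x ∷ e) l∈ with ∈ₚ.∈-concatMap⁻ (λ y → map (y ∷_) (sub e)) {xs = upTo (suc x)} l∈
... | l∈′ = f (upTo (suc x)) l∈′
  where
  open import Data.List.Relation.Unary.Any using (Any)
  f : ∀ ys {l} → Any (λ y → l ∈ map (y ∷_) (sub e)) ys → length l ≡ suc (length e)
  f (y ∷ ys) (here h) with ∈ₚ.∈-map⁻ (y ∷_) h
  ... | l′ , l′∈ , refl = cong suc (sub-length e l′∈)
  f (y ∷ ys) (there h) = f ys h

∑-sub-Anti : ∀ {g} → Anti g → Anti (λ e → ∑ (sub e) g)
∑-sub-Anti {g} a i e h = trans (swap-sub g i e) (trans
  (∑-cong (sub e) (λ l l∈ → a i l (subst (suc i <_) (sym (sub-length e l∈)) h))) (∑-neg (sub e) g))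

sortDesc-∈ : ∀ l {z} → z ∈ sortDesc l → z ∈ l
sortDesc-∈ (x ∷ l) h with insertDesc-∈ x (sortDesc l) h
... | inj₁ e = here e
... | inj₂ m = there (sortDesc-∈ l m)

∑-sub-alt : ∀ {M a} → Strict a → ∀ e → length e ≡ length a → (∀ z → z ∈ e → z < M) →
  ∑ (sub e) (alt a) ≡ when (interl M a (sortDesc e)) (sgn (ascPairs e))
∑-sub-alt {M} {a} s e le b = trans (Anti-sort {λ l → ∑ (sub l) (alt a)} (∑-sub-Anti {alt a} (alt-Anti a)) e)
  (trans (cong (sgn (ascPairs e) *ℚ_) (∑-sub-alt-Desc s (sortDesc-Desc e) (trans (sortDesc-length e) le) (λ z z∈ → b z (sortDesc-∈ e z∈))))
  (trans (when-*ˡ (interl M a (sortDesc e)) (sgn (ascPairs e)) 1ℚ) (cong (when (interl M a (sortDesc e))) (ℚₚ.*-identityʳ (sgn (ascPairs e))))))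

∈-concatMap⁻′ : ∀ {A B : Set} (f : A → List B) xs {y} → y ∈ concatMap f xs → ∃[ x ] (x ∈ xs × y ∈ f x)
∈-concatMap⁻′ f (x ∷ xs) h with ∈ₚ.∈-++⁻ (f x) h
... | inj₁ m = x , here refl , m
... | inj₂ m = let x′ , p , q = ∈-concatMap⁻′ f xs m in x′ , there p , q

∈-concatMap⁺′ : ∀ {A B : Set} (f : A → List B) {xs x y} → x ∈ xs → y ∈ f x → y ∈ concatMap f xs
∈-concatMap⁺′ f {x ∷ xs} (here refl) h = ∈ₚ.∈-++⁺ˡ h
∈-concatMap⁺′ f {x ∷ xs} (there m)   h = ∈ₚ.∈-++⁺ʳ (f x) (∈-concatMap⁺′ f m h)

Unique-concatMap : ∀ {A B : Set} (f : A → List B) {xs} → Unique xs → (∀ x → x ∈ xs → Unique (f x)) →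
  (∀ x x′ y → x ∈ xs → x′ ∈ xs → y ∈ f x → y ∈ f x′ → x ≡ x′) → Unique (concatMap f xs)
Unique-concatMap f {[]} u h d = []
Unique-concatMap f {x ∷ xs} (x∉ ∷ u) h d = Uniqueₚ.++⁺ (h x (here refl))
  (Unique-concatMap f u (λ x′ m → h x′ (there m)) (λ a b y m n → d a b y (there m) (there n)))
  (λ {y} (p , q) → let x′ , m , r = ∈-concatMap⁻′ f xs q in All.lookup x∉ m (d x x′ y (here refl) (there m) p r))

upTo-∈ : ∀ {n k} → k < n → k ∈ upTo n
upTo-∈ h = ∈ₚ.∈-upTo⁺ h

rowsOf-Unique : ∀ M → Unique (rowsOf M)
rowsOf-Unique M = Unique-concatMap (λ w → (w , false) ∷ (w , true) ∷ []) (Uniqueₚ.upTo⁺ (suc M))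
  (λ w _ → ((λ ()) ∷ []) ∷ [] ∷ [])
  (λ { w w′ _ _ _ (here refl) (here refl) → refl ; w w′ _ _ _ (there (here refl)) (there (here refl)) → refl
     ; w w′ _ _ _ (here refl) (there (here ())) ; w w′ _ _ _ (there (here refl)) (here ()) })

rowsOf-∈ : ∀ {M w} h → w ≤ M → (w , h) ∈ rowsOf M
rowsOf-∈ {M} {w} h w≤ = ∈-concatMap⁺′ (λ w → (w , false) ∷ (w , true) ∷ []) (upTo-∈ (s≤s w≤)) (m h)
  where
  m : ∀ h → (w , h) ∈ (w , false) ∷ (w , true) ∷ []
  m false = here refl
  m true  = there (here refl)

∷-injective-∈ : ∀ {A : Set} {r r′ : A} {L : List (List A)} {y : List A} → y ∈ map (r ∷_) L → y ∈ map (r′ ∷_) L → r ≡ r′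
∷-injective-∈ {r = r} {r′} p q with ∈ₚ.∈-map⁻ (r ∷_) p | ∈ₚ.∈-map⁻ (r′ ∷_) q
... | _ , _ , refl | _ , _ , refl = refl

box-Unique : ∀ M k → Unique (box M k)
box-Unique M zero    = [] ∷ []
box-Unique M (suc k) = Unique-concatMap (λ r → map (r ∷_) (box M k)) (rowsOf-Unique M)
  (λ r _ → Uniqueₚ.map⁺ (λ { refl → refl }) (box-Unique M k)) (λ r r′ y _ _ → ∷-injective-∈)

box-length : ∀ M k {Ω} → Ω ∈ box M k → length Ω ≡ k
box-length M zero (here refl) = refl
box-length M (suc k) h with ∈-concatMap⁻′ (λ r → map (r ∷_) (box M k)) (rowsOf M) h
... | r , _ , m with ∈ₚ.∈-map⁻ (r ∷_) m
... | Ω , m′ , refl = cong suc (box-length M k m′)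

box-∈ : ∀ M Ω → (∀ r → r ∈ Ω → proj₁ r ≤ M) → Ω ∈ box M (length Ω)
box-∈ M [] h = here refl
box-∈ M (r ∷ Ω) h = ∈-concatMap⁺′ (λ r → map (r ∷_) (box M (length Ω))) (rowsOf-∈ (proj₂ r) (h r (here refl)))
  (∈ₚ.∈-map⁺ (r ∷_) (box-∈ M Ω (λ r′ m → h r′ (there m))))

_≟Rows_ : (Λ Ω : List Row) → Dec (Λ ≡ Ω)
_≟Rows_ = Listₚ.≡-dec (Productₚ.≡-dec _≟_ Boolₚ._≟_)

-- The coefficient of y^e z^s in s_Λ, one bosonic variable at a time

lens : List Row → List ℕ
lens = map proj₁

allCirc : List Row → Bool
allCirc []            = true
allCirc ((_ , f) ∷ Λ) = f ∧ allCirc Λ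

-- The diagram has as many rows as there are variables, so each bosonic variable takes one row away.
-- When only fermionic variables are left, every row must carry a circle.
schur : ℕ → List ℕ → List ℕ → List Row → ℚ
schur M e []      Λ = when (allCirc Λ) (alt (lens Λ) e)
schur M e (z ∷ s) Λ = ∑ (box M (length Λ ∸ 1)) (λ Γ →
  when (validᵇ M Γ ∧ branch M false (pad Γ) Λ) (when (size Λ ≡ᵇ size Γ + z) (schur M e s Γ)))

sum-++ : ∀ a b → sum (a ++ b) ≡ sum a + sum b
sum-++ []      b = refl
sum-++ (x ∷ a) b = trans (cong (x +_) (sum-++ a b)) (sym (ℕₚ.+-assoc x (sum a) (sum b)))

alt-homog : ∀ a e → sum a ≢ sum e → alt a e ≡ 0ℚ
alt-homog []      []      h = ⊥-elim (h refl)
alt-homog []      (_ ∷ _) h = refl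
alt-homog (k ∷ a) e       h = lap-zero k (alt a) e (λ { p q refl → alt-homog a (p ++ q) (λ eq → h (begin
  k + sum a               ≡⟨ cong (k +_) (trans eq (sum-++ p q)) ⟩
  k + (sum p + sum q)     ≡⟨ +-exchange k (sum p) (sum q) ⟩
  sum p + (k + sum q)     ≡⟨ sym (sum-++ p (k ∷ q)) ⟩
  sum (p ++ k ∷ q) ∎)) })

size-lens : ∀ Λ → size Λ ≡ sum (lens Λ)
size-lens []            = refl
size-lens ((a , _) ∷ Λ) = cong (a +_) (size-lens Λ)

schur-homog : ∀ M e s Λ → size Λ ≢ sum e + sum s → schur M e s Λ ≡ 0ℚ
schur-homog M e [] Λ h = trans (cong (when (allCirc Λ)) (alt-homog (lens Λ) e
  (λ q → h (trans (size-lens Λ) (trans q (sym (ℕₚ.+-identityʳ (sum e)))))))) (when-zero (allCirc Λ))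
schur-homog M e (z ∷ s) Λ h = ∑-zero (box M (length Λ ∸ 1)) (λ Γ _ →
  trans (cong (when (validᵇ M Γ ∧ branch M false (pad Γ) Λ)) (f Γ)) (when-zero (validᵇ M Γ ∧ branch M false (pad Γ) Λ)))
  where
  ar : ∀ p q r → p + q + r ≡ p + (r + q)
  ar = solve-∀
  f : ∀ Γ → when (size Λ ≡ᵇ size Γ + z) (schur M e s Γ) ≡ 0ℚ
  f Γ with size Λ ≡ᵇ size Γ + z in eq
  ... | false = refl
  ... | true  = schur-homog M e s Γ (λ q → h (trans (≡ᵇ→≡ {size Λ} eq) (trans (cong (_+ z) q) (ar (sum e) (sum s) z))))

-- With a carry the new row has length exactly `A` and a circle, so it fits below `W` only if A < W.
pieri-valid : ∀ {A W} D Λ Ω → Valid A Λ → A ≤ W → (D ≡ true → A < W) → pieri A D Λ Ω ≡ true → Valid W Ω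
pieri-valid D [] [] _ _ _ _ = []
pieri-valid {A} {W} D ((a , f) ∷ Λ) ((w , h) ∷ Ω) (b ∷ v) A≤W D< e with ∧-split {okc f D h} e
... | e₁ , e₂ with ∧-split {(lowP A a f D h ≤ᵇ w) ∧ (w <ᵇ upP A f D h)} e₂
... | e₃ , e₄ with ∧-split {lowP A a f D h ≤ᵇ w} e₃
... | p , q = go f D h b D< e₁ (≤ᵇ→≤ {lowP A a f D h} p) (<ᵇ→< {w} q) e₄
  where
  go : ∀ f D h → below a f A → (D ≡ true → A < W) → okc f D h ≡ true → lowP A a f D h ≤ w → w < upP A f D h →
       pieri a (nextc f D h) Λ Ω ≡ true → Valid W ((w , h) ∷ Ω)
  go false false false b D< _ l u r = ≤-trans (≤-pred u) A≤W ∷ pieri-valid false Λ Ω v l (λ ()) r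
  go false true  true  b D< _ l u r = ≤-<-trans (≤-pred u) (D< refl) ∷ pieri-valid false Λ Ω v (≤-trans b l) (λ ()) r
  go true  false true  b D< _ l u r = <-≤-trans u A≤W ∷ pieri-valid false Λ Ω v l (λ ()) r
  go true  false false b D< _ l u r = ≤-trans (≤-pred u) A≤W ∷ pieri-valid true Λ Ω v (<⇒≤ l) (λ _ → l) r
  go true  true  true  b D< _ l u r = ≤-<-trans (≤-pred u) (D< refl) ∷ pieri-valid true Λ Ω v (≤-trans (<⇒≤ b) l) (λ _ → <-≤-trans b l) r

-- Without a carry, a circled new row needs a circled old row whose circle stays. If all new rows
-- are circled, no circle ever drops and the strip is plain interlacing.
pieri-circ : ∀ A Λ Ω → pieri A false Λ Ω ∧ allCirc Ω ≡ (allCirc Λ ∧ interl A (lens Λ) (lens Ω)) ∧ allCirc Ω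
pieri-circ A [] [] = refl
pieri-circ A [] ((w , h) ∷ Ω) = refl
pieri-circ A ((a , f) ∷ Λ) [] = cong (_∧ true) (sym (z f (allCirc Λ)))
  where
  z : ∀ f b → (f ∧ b) ∧ false ≡ false
  z true true = refl
  z true false = refl
  z false b = refl
pieri-circ A ((a , f) ∷ Λ) ((w , false) ∷ Ω) = trans (∧-false (pieri A false ((a , f) ∷ Λ) ((w , false) ∷ Ω)))
  (sym (∧-false ((f ∧ allCirc Λ) ∧ interl A (a ∷ lens Λ) (w ∷ lens Ω))))
  where
  ∧-false : ∀ b → b ∧ false ≡ false
  ∧-false true = refl
  ∧-false false = refl
pieri-circ A ((a , false) ∷ Λ) ((w , true) ∷ Ω) = refl
pieri-circ A ((a , true) ∷ Λ) ((w , true) ∷ Ω) = begin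
  (((a ≤ᵇ w) ∧ (w <ᵇ A)) ∧ pieri a false Λ Ω) ∧ allCirc Ω  ≡⟨ l1 (a ≤ᵇ w) (w <ᵇ A) _ _ ⟩
  ((a ≤ᵇ w) ∧ (w <ᵇ A)) ∧ (pieri a false Λ Ω ∧ allCirc Ω)  ≡⟨ cong (((a ≤ᵇ w) ∧ (w <ᵇ A)) ∧_) (pieri-circ a Λ Ω) ⟩
  ((a ≤ᵇ w) ∧ (w <ᵇ A)) ∧ ((allCirc Λ ∧ interl a (lens Λ) (lens Ω)) ∧ allCirc Ω)  ≡⟨ l2 (a ≤ᵇ w) (w <ᵇ A) (allCirc Λ) _ _ ⟩
  (allCirc Λ ∧ ((a ≤ᵇ w) ∧ (w <ᵇ A) ∧ interl a (lens Λ) (lens Ω))) ∧ allCirc Ω ∎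
  where
  l1 : ∀ p q r s → ((p ∧ q) ∧ r) ∧ s ≡ (p ∧ q) ∧ (r ∧ s)
  l1 true true r s = refl
  l1 true false r s = refl
  l1 false q r s = refl
  l2 : ∀ p q c i s → (p ∧ q) ∧ ((c ∧ i) ∧ s) ≡ (c ∧ (p ∧ q ∧ i)) ∧ s
  l2 true true c i s = refl
  l2 true false true i s = refl
  l2 true false false i s = refl
  l2 false q true i s = refl
  l2 false q false i s = refl

interl-Strict : ∀ A a w → interl A a w ≡ true → Strict w
interl-Strict A [] [] _ = []
interl-Strict A (a ∷ []) (w ∷ []) _ = [ w ]
interl-Strict A (a ∷ []) (w ∷ w′ ∷ ws) e = ⊥-elim (f (a ≤ᵇ w) (w <ᵇ A) e)
  where
  f : ∀ p q → p ∧ q ∧ false ≡ true → ⊥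
  f true true ()
  f true false ()
  f false q ()
interl-Strict A (a ∷ a′ ∷ as) (w ∷ []) e = [ w ]
interl-Strict A (a ∷ a′ ∷ as) (w ∷ w′ ∷ ws) e =
  let p , q = ∧-split {a ≤ᵇ w} e
      r , s = ∧-split {w <ᵇ A} q
      _ , t = ∧-split {a′ ≤ᵇ w′} s
      u , _ = ∧-split {w′ <ᵇ a} t
  in <-≤-trans (<ᵇ→< {w′} u) (≤ᵇ→≤ {a} p) ∷ interl-Strict a (a′ ∷ as) (w′ ∷ ws) s

allCirc-Strict : ∀ {A} Λ → Valid A Λ → allCirc Λ ≡ true → Strict (lens Λ)
allCirc-Strict [] _ _ = []
allCirc-Strict ((a , true) ∷ []) _ _ = [ a ]
allCirc-Strict ((a , true) ∷ (b , true) ∷ Λ) (_ ∷ (h ∷ v)) e = h ∷ allCirc-Strict ((b , true) ∷ Λ) (h ∷ v) e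

∈-sum : ∀ {z} l → z ∈ l → z ≤ sum l
∈-sum (x ∷ l) (here refl) = m≤m+n x (sum l)
∈-sum (x ∷ l) (there h)   = ≤-trans (∈-sum l h) (m≤n+m (sum l) x)

circled : List ℕ → List Row
circled = map (_, true)

lens-circled : ∀ l → lens (circled l) ≡ l
lens-circled []      = refl
lens-circled (x ∷ l) = cong (x ∷_) (lens-circled l)

allCirc-circled : ∀ l → allCirc (circled l) ≡ true
allCirc-circled []      = refl
allCirc-circled (x ∷ l) = allCirc-circled l

circled-lens : ∀ Ω → allCirc Ω ≡ true → Ω ≡ circled (lens Ω)
circled-lens [] _ = refl
circled-lens ((w , true) ∷ Ω) e = cong ((w , true) ∷_) (circled-lens Ω e)

-- The case without bosonic variables. The alternant at `e` singles out one Ω: all rows circled,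
-- with lengths `e` in decreasing order.
pieri-alt : ∀ M e Λ → Valid M Λ → length Λ ≡ length e → sum e < M →
  ∑ (sub e) (λ e′ → schur M e′ [] Λ) ≡ ∑ (box M (length Λ)) (λ Ω → when (pieri M false Λ Ω) (schur M e [] Ω))
pieri-alt M e Λ v le se = begin
  ∑ (sub e) (λ e′ → when (allCirc Λ) (alt (lens Λ) e′))        ≡⟨ ∑-when (allCirc Λ) (sub e) (alt (lens Λ)) ⟩
  when (allCirc Λ) (∑ (sub e) (alt (lens Λ)))                  ≡⟨ when-cong (allCirc Λ) (λ c → ∑-sub-alt (allCirc-Strict Λ v c) e (trans (sym le) (sym (Listₚ.length-map proj₁ Λ))) bd) ⟩
  when (allCirc Λ) (when (interl M (lens Λ) w) (sgn (ascPairs e)))  ≡⟨ sym (when-∧ (allCirc Λ) (interl M (lens Λ) w) (sgn (ascPairs e))) ⟩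
  when (allCirc Λ ∧ interl M (lens Λ) w) (sgn (ascPairs e))    ≡⟨ when-cong (allCirc Λ ∧ interl M (lens Λ) w) (λ c → sym (value c)) ⟩
  when (allCirc Λ ∧ interl M (lens Λ) w) (alt w e)             ≡⟨ sym (at-R) ⟩
  g (circled w)                                                ≡⟨ sym (∑-single (circled w) (box-Unique M (length Λ)) R∈ others (_≟Rows circled w)) ⟩
  ∑ (box M (length Λ)) g                                       ≡⟨ ∑-cong′ (box M (length Λ)) (λ Ω → when-∧ (allCirc Λ ∧ interl M (lens Λ) (lens Ω)) (allCirc Ω) (alt (lens Ω) e)) ⟩
  ∑ (box M (length Λ)) (λ Ω → when (allCirc Λ ∧ interl M (lens Λ) (lens Ω)) (when (allCirc Ω) (alt (lens Ω) e)))
    ≡⟨ ∑-cong′ (box M (length Λ)) (λ Ω → trans (sym (when-∧ (allCirc Λ ∧ interl M (lens Λ) (lens Ω)) (allCirc Ω) (alt (lens Ω) e)))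
         (trans (when-≡ (alt (lens Ω) e) (sym (pieri-circ M Λ Ω))) (when-∧ (pieri M false Λ Ω) (allCirc Ω) (alt (lens Ω) e)))) ⟩
  ∑ (box M (length Λ)) (λ Ω → when (pieri M false Λ Ω) (when (allCirc Ω) (alt (lens Ω) e))) ∎
  where
  w = sortDesc e
  bd : ∀ z → z ∈ e → z < M
  bd z m = ≤-<-trans (∈-sum e m) se
  g : List Row → ℚ
  g Ω = when ((allCirc Λ ∧ interl M (lens Λ) (lens Ω)) ∧ allCirc Ω) (alt (lens Ω) e)
  value : allCirc Λ ∧ interl M (lens Λ) w ≡ true → alt w e ≡ sgn (ascPairs e)
  value c = trans (alt-sort (interl-Strict M (lens Λ) w (proj₂ (∧-split {allCirc Λ} c))) e) (when-≡ (sgn (ascPairs e)) (eqL-refl w))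
  at-R : g (circled w) ≡ when (allCirc Λ ∧ interl M (lens Λ) w) (alt w e)
  at-R = cong₂ (λ b l → when ((allCirc Λ ∧ interl M (lens Λ) l) ∧ b) (alt l e)) (allCirc-circled w) (lens-circled w) ⟫
         when-≡ (alt w e) (Boolₚ.∧-identityʳ (allCirc Λ ∧ interl M (lens Λ) w))
    where
    _⟫_ = trans
  R∈ : circled w ∈ box M (length Λ)
  R∈ = subst (λ n → circled w ∈ box M n) (trans (Listₚ.length-map (_, true) w) (trans (sortDesc-length e) (sym le)))
         (box-∈ M (circled w) (λ r m → f m))
    where
    f : ∀ {r} → r ∈ circled w → proj₁ r ≤ M
    f m with ∈ₚ.∈-map⁻ (_, true) m
    ... | z , z∈ , refl = <⇒≤ (bd z (sortDesc-∈ e z∈))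
  others : ∀ Ω → Ω ∈ box M (length Λ) → Ω ≢ circled w → g Ω ≡ 0ℚ
  others Ω _ ne with (allCirc Λ ∧ interl M (lens Λ) (lens Ω)) ∧ allCirc Ω in eq
  ... | false = refl
  ... | true with ∧-split {allCirc Λ ∧ interl M (lens Λ) (lens Ω)} eq
  ...   | p , q with eqL w (lens Ω) in eq′ | alt-sort (interl-Strict M (lens Λ) (lens Ω) (proj₂ (∧-split {allCirc Λ} p))) e
  ...     | false | r = r
  ...     | true  | _ = ⊥-elim (ne (trans (circled-lens Ω q) (cong circled (sym (eqL→≡ w (lens Ω) eq′)))))

when-collect : ∀ a b c d x → when (a ∧ b) (when c (when d x)) ≡ x *ℚ when (a ∧ (b ∧ d)) (when c 1ℚ)
when-collect true  true  true  true  x = sym (ℚₚ.*-identityʳ x)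
when-collect true  true  true  false x = sym (ℚₚ.*-zeroʳ x)
when-collect true  true  false true  x = sym (ℚₚ.*-zeroʳ x)
when-collect true  true  false false x = sym (ℚₚ.*-zeroʳ x)
when-collect true  false c     d     x = sym (ℚₚ.*-zeroʳ x)
when-collect false b     c     d     x = sym (ℚₚ.*-zeroʳ x)

when-collect′ : ∀ p v b c x → when p (when (v ∧ b) (when c x)) ≡ when v (x *ℚ when (p ∧ b) (when c 1ℚ))
when-collect′ p     false b     c     x = when-zero p
when-collect′ true  true  true  true  x = sym (ℚₚ.*-identityʳ x)
when-collect′ true  true  true  false x = sym (ℚₚ.*-zeroʳ x)
when-collect′ true  true  false c     x = sym (ℚₚ.*-zeroʳ x)
when-collect′ false true  b     c     x = sym (ℚₚ.*-zeroʳ x)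

-- All h_ℓ are treated at once; since `schur` is homogeneous, the degrees of the two sides select ℓ.
-- A fixed ℓ would be awkward in the induction, because the removed bosonic variable uses up a
-- varying share of it.
pieri-rows : ∀ M e s Λ → Valid M Λ → length Λ ≡ length e + length s → sum e + sum s < M →
  ∑ (sub e) (λ e′ → ∑ (sub s) (λ s′ → schur M e′ s′ Λ)) ≡ ∑ (box M (length Λ)) (λ Ω → when (pieri M false Λ Ω) (schur M e s Ω))
pieri-rows M e [] Λ v le se = trans (∑-cong′ (sub e) (λ e′ → ℚₚ.+-identityʳ (schur M e′ [] Λ)))
  (pieri-alt M e Λ v (trans le (ℕₚ.+-identityʳ (length e))) (subst (_< M) (ℕₚ.+-identityʳ (sum e)) se))
pieri-rows M e (z ∷ s) [] v le se = case trans le (+-suc (length e) (length s)) of λ ()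
pieri-rows M e (z ∷ s) Λ@((A , F) ∷ Λt) v le se = begin
  ∑ (sub e) (λ e′ → ∑ (sub (z ∷ s)) (λ s′ → schur M e′ s′ Λ))
    ≡⟨ ∑-cong′ (sub e) (λ e′ → trans (∑-sub-∷ z s (λ s′ → schur M e′ s′ Λ)) (∑<-cong′ (suc z) (λ j →
         trans (∑-swap (sub s) B (λ s′ Γ → when (b Γ) (when (c j Γ) (schur M e′ s′ Γ))))
           (∑-cong′ B (λ Γ → trans (∑-when (b Γ) (sub s) (λ s′ → when (c j Γ) (schur M e′ s′ Γ)))
             (cong (when (b Γ)) (∑-when (c j Γ) (sub s) (λ s′ → schur M e′ s′ Γ)))))))) ⟩
  ∑ (sub e) (λ e′ → ∑< (suc z) (λ j → ∑ B (λ Γ → when (b Γ) (when (c j Γ) (g e′ Γ)))))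
    ≡⟨ ∑-cong′ (sub e) (λ e′ → ∑<-∑-swap (suc z) B (λ j Γ → when (b Γ) (when (c j Γ) (g e′ Γ)))) ⟩
  ∑ (sub e) (λ e′ → ∑ B (λ Γ → ∑< (suc z) (λ j → when (b Γ) (when (c j Γ) (g e′ Γ)))))
    ≡⟨ ∑-swap (sub e) B (λ e′ Γ → ∑< (suc z) (λ j → when (b Γ) (when (c j Γ) (g e′ Γ)))) ⟩
  ∑ B (λ Γ → ∑ (sub e) (λ e′ → ∑< (suc z) (λ j → when (b Γ) (when (c j Γ) (g e′ Γ)))))
    ≡⟨ ∑-cong B (λ Γ Γ∈ → trans (collapse Γ) (trans (when-cong (b Γ) (λ bt → cong (when (size Λ ≤ᵇ size Γ + z)) (ih Γ Γ∈ bt)))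
         (trans (cong (when (b Γ)) (sym (∑-when (size Λ ≤ᵇ size Γ + z) B (λ Ω → when (pieri M false Γ Ω) (S Ω)))))
           (sym (∑-when (b Γ) B (λ Ω → when (size Λ ≤ᵇ size Γ + z) (when (pieri M false Γ Ω) (S Ω)))))))) ⟩
  ∑ B (λ Ω′ → ∑ B (λ Γ → when (b Ω′) (when (size Λ ≤ᵇ size Ω′ + z) (when (pieri M false Ω′ Γ) (S Γ)))))
    ≡⟨ ∑-swap B B (λ Ω′ Γ → when (b Ω′) (when (size Λ ≤ᵇ size Ω′ + z) (when (pieri M false Ω′ Γ) (S Γ)))) ⟩
  ∑ B (λ Γ → ∑ B (λ Ω′ → when (b Ω′) (when (size Λ ≤ᵇ size Ω′ + z) (when (pieri M false Ω′ Γ) (S Γ)))))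
    ≡⟨ ∑-cong′ B (λ Γ → trans (∑-cong′ B (λ Ω′ → when-collect (validᵇ M Ω′) (branch M false (pad Ω′) Λ) (size Λ ≤ᵇ size Ω′ + z) (pieri M false Ω′ Γ) (S Γ)))
         (sym (∑-*ˡ (S Γ) B (λ Ω′ → when (betweenᵇ M false false Λ Γ Ω′) (when (size Λ ≤ᵇ size Ω′ + z) 1ℚ))))) ⟩
  ∑ B (λ Γ → S Γ *ℚ ∑ B (λ Ω′ → when (betweenᵇ M false false Λ Γ Ω′) (when (size Λ ≤ᵇ size Ω′ + z) 1ℚ)))
    ≡⟨ ∑-cong B core ⟩
  ∑ B (λ Γ → when (validᵇ M Γ) (S Γ *ℚ ∑ B⁺ (λ Ω → when (pieri M false Λ Ω ∧ branch M false (pad Γ) Ω) (when (size Ω ≡ᵇ size Γ + z) 1ℚ))))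
    ≡⟨ ∑-cong′ B (λ Γ → trans (cong (when (validᵇ M Γ)) (∑-*ˡ (S Γ) B⁺ (λ Ω → when (pieri M false Λ Ω ∧ branch M false (pad Γ) Ω) (when (size Ω ≡ᵇ size Γ + z) 1ℚ))))
         (trans (sym (∑-when (validᵇ M Γ) B⁺ (λ Ω → S Γ *ℚ when (pieri M false Λ Ω ∧ branch M false (pad Γ) Ω) (when (size Ω ≡ᵇ size Γ + z) 1ℚ))))
           (∑-cong′ B⁺ (λ Ω → sym (when-collect′ (pieri M false Λ Ω) (validᵇ M Γ) (branch M false (pad Γ) Ω) (size Ω ≡ᵇ size Γ + z) (S Γ)))))) ⟩
  ∑ B (λ Γ → ∑ B⁺ (λ Ω → when (pieri M false Λ Ω) (when (validᵇ M Γ ∧ branch M false (pad Γ) Ω) (when (size Ω ≡ᵇ size Γ + z) (S Γ)))))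
    ≡⟨ ∑-swap B B⁺ (λ Γ Ω → when (pieri M false Λ Ω) (when (validᵇ M Γ ∧ branch M false (pad Γ) Ω) (when (size Ω ≡ᵇ size Γ + z) (S Γ)))) ⟩
  ∑ B⁺ (λ Ω → ∑ B (λ Γ → when (pieri M false Λ Ω) (when (validᵇ M Γ ∧ branch M false (pad Γ) Ω) (when (size Ω ≡ᵇ size Γ + z) (S Γ)))))
    ≡⟨ ∑-cong B⁺ (λ Ω Ω∈ → trans (∑-when (pieri M false Λ Ω) B (λ Γ → when (validᵇ M Γ ∧ branch M false (pad Γ) Ω) (when (size Ω ≡ᵇ size Γ + z) (S Γ))))
         (cong (λ k → when (pieri M false Λ Ω) (∑ (box M (k ∸ 1)) (λ Γ → when (validᵇ M Γ ∧ branch M false (pad Γ) Ω) (when (size Ω ≡ᵇ size Γ + z) (S Γ)))))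
           (sym (box-length M (suc (length Λt)) Ω∈)))) ⟩
  ∑ B⁺ (λ Ω → when (pieri M false Λ Ω) (schur M e (z ∷ s) Ω)) ∎
  where
  k = length Λt
  B = box M k
  B⁺ = box M (suc k)
  S : List Row → ℚ
  S = schur M e s
  b : List Row → Bool
  b Γ = validᵇ M Γ ∧ branch M false (pad Γ) Λ
  c : ℕ → List Row → Bool
  c j Γ = size Λ ≡ᵇ size Γ + j
  g : List ℕ → List Row → ℚ
  g e′ Γ = ∑ (sub s) (λ s′ → schur M e′ s′ Γ)
  G : List Row → ℚ
  G Γ = ∑ (sub e) (λ e′ → g e′ Γ)
  se′ : sum e + sum s < M
  se′ = ≤-<-trans (+-monoʳ-≤ (sum e) (m≤n+m (sum s) z)) se
  lk : k ≡ length e + length s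
  lk = suc-injective (trans le (+-suc (length e) (length s)))
  ih : ∀ Γ → Γ ∈ B → b Γ ≡ true → G Γ ≡ ∑ B (λ Ω → when (pieri M false Γ Ω) (S Ω))
  ih Γ Γ∈ bt = trans (pieri-rows M e s Γ (validᵇ→Valid M Γ (proj₁ (∧-split {validᵇ M Γ} bt))) (trans (box-length M k Γ∈) lk) se′)
    (cong (λ n → ∑ (box M n) (λ Ω → when (pieri M false Γ Ω) (S Ω))) (box-length M k Γ∈))
  collapse : ∀ Γ → ∑ (sub e) (λ e′ → ∑< (suc z) (λ j → when (b Γ) (when (c j Γ) (g e′ Γ)))) ≡ when (b Γ) (when (size Λ ≤ᵇ size Γ + z) (G Γ))
  collapse Γ = trans (∑-cong′ (sub e) (λ e′ → trans (∑<-when (b Γ) (suc z) (λ j → when (c j Γ) (g e′ Γ))) (when-cong (b Γ) (λ bt →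
      trans (∑<-cong′ (suc z) (λ j → cong (λ x → when x (g e′ Γ)) (c≡ j (le′ bt)))) (trans (∑<-delta (suc z) (size Λ ∸ size Γ) (g e′ Γ)) (cong (λ x → when x (g e′ Γ)) c′))))))
    (trans (∑-when (b Γ) (sub e) (λ e′ → when (size Λ ≤ᵇ size Γ + z) (g e′ Γ))) (cong (when (b Γ)) (∑-when (size Λ ≤ᵇ size Γ + z) (sub e) (λ e′ → g e′ Γ))))
    where
    le′ : b Γ ≡ true → size Γ ≤ size Λ
    le′ bt = subst (_≤ size Λ) (size-pad Γ) (branch-size M false (pad Γ) Λ (proj₂ (∧-split {validᵇ M Γ} bt)))
    c≡ : ∀ j → size Γ ≤ size Λ → c j Γ ≡ (j ≡ᵇ size Λ ∸ size Γ)
    c≡ j l = bool-ext {c j Γ} (λ h → ≡→≡ᵇ {j} (trans (sym (m+n∸m≡n (size Γ) j)) (cong (_∸ size Γ) (sym (≡ᵇ→≡ {size Λ} h)))))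
                     (λ h → ≡→≡ᵇ {size Λ} (sym (trans (cong (size Γ +_) (≡ᵇ→≡ {j} h)) (m+[n∸m]≡n l))))
    c′ : (size Λ ∸ size Γ <ᵇ suc z) ≡ (size Λ ≤ᵇ size Γ + z)
    c′ = bool-ext {size Λ ∸ size Γ <ᵇ suc z} (λ h → ≤→≤ᵇ {size Λ} (≤-trans (ℕₚ.m≤n+m∸n (size Λ) (size Γ)) (+-monoʳ-≤ (size Γ) (≤-pred (<ᵇ→< {size Λ ∸ size Γ} h)))))
                  (λ h → <→<ᵇ {size Λ ∸ size Γ} (s≤s (ℕₚ.m≤n+o⇒m∸n≤o (size Λ) (size Γ) (≤ᵇ→≤ {size Λ} h))))
  -- Commutation requires size Γ + z < M. By homogeneity only the Γ of the degree of the remaining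
  -- monomial have `S Γ` nonzero, and for those the bound follows from the one on the whole
  -- monomial.
  core : ∀ Γ → Γ ∈ B → S Γ *ℚ ∑ B (λ Ω′ → when (betweenᵇ M false false Λ Γ Ω′) (when (size Λ ≤ᵇ size Ω′ + z) 1ℚ)) ≡
         when (validᵇ M Γ) (S Γ *ℚ ∑ B⁺ (λ Ω → when (pieri M false Λ Ω ∧ branch M false (pad Γ) Ω) (when (size Ω ≡ᵇ size Γ + z) 1ℚ)))
  core Γ Γ∈ with size Γ ≟ sum e + sum s
  ... | no ne = trans (vanish (∑ B (λ Ω′ → when (betweenᵇ M false false Λ Γ Ω′) (when (size Λ ≤ᵇ size Ω′ + z) 1ℚ))))
      (sym (trans (cong (when (validᵇ M Γ)) (vanish (∑ B⁺ (λ Ω → when (pieri M false Λ Ω ∧ branch M false (pad Γ) Ω) (when (size Ω ≡ᵇ size Γ + z) 1ℚ))))) (when-zero (validᵇ M Γ))))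
    where
    vanish : ∀ x → S Γ *ℚ x ≡ 0ℚ
    vanish x = *-0ˡ x (schur-homog M e s Γ ne)
  ... | yes eq with validᵇ M Γ in vb
  ...   | false = *-0ʳ (S Γ) (∑-zero B (λ Ω′ _ → cong (λ x → when x (when (size Λ ≤ᵇ size Ω′ + z) 1ℚ)) (nb Ω′)))
    where
    nb : ∀ Ω′ → betweenᵇ M false false Λ Γ Ω′ ≡ false
    nb Ω′ with betweenᵇ M false false Λ Γ Ω′ in q
    ... | false = refl
    ... | true = let q₁ , q₂ = ∧-split {validᵇ M Ω′} q
                     _ , q₃ = ∧-split {branch M false (pad Ω′) Λ} q₂
                 in ⊥-elim (false≢true vb (Valid→validᵇ (pieri-valid false Ω′ Γ (validᵇ→Valid M Ω′ q₁) ≤-refl (λ ()) q₃)))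
  ...   | true with pad-head Γ
  ...     | C , H , Γt , pe = cong (S Γ *ℚ_) (sym (trans (Commute.commute {Γ = Γ} {z = z} v (subst (Valid M) pe (Valid-pad (validᵇ→Valid M Γ vb))) pe (sym (box-length M k Γ∈)) z<)
        (cong (λ n → ∑ (box M n) (λ Ω′ → when (betweenᵇ M false false Λ Γ Ω′) (when (size Λ ≤ᵇ size Ω′ + z) 1ℚ))) (box-length M k Γ∈))))
    where
    ar : ∀ p q r → p + q + r ≡ p + (r + q)
    ar = solve-∀
    z< : size Γ + z < M
    z< = subst (_< M) (sym (trans (cong (_+ z) eq) (ar (sum e) (sum s) z))) se

-- Diagrams of superpartitions

-- The circled row goes above all rows of length at most `x`, so that its extra cell is an addable
-- corner, as in Λ^⊛ / Λ^*.
insRow : ℕ → List Row → List Row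
insRow x []            = (x , true) ∷ []
insRow x ((y , f) ∷ l) = if y ≤ᵇ x then (x , true) ∷ (y , f) ∷ l else (y , f) ∷ insRow x l

bosons : List ℕ → List Row
bosons = map (_, false)

rows : SPart → List Row
rows (a , s) = foldr insRow (bosons s) a

insRow-≤ : ∀ x y f l → y ≤ x → insRow x ((y , f) ∷ l) ≡ (x , true) ∷ (y , f) ∷ l
insRow-≤ x y f l h rewrite ≤→≤ᵇ {y} {x} h = refl

insRow-> : ∀ x y f l → x < y → insRow x ((y , f) ∷ l) ≡ (y , f) ∷ insRow x l
insRow-> x y f l h rewrite ≰→≤ᵇ {y} {x} (<⇒≱ h) = refl

clen : Row → ℕ
clen (a , true)  = suc a
clen (a , false) = a

circs : List Row → List ℕ
circs = map clen

lens-insRow : ∀ x l → lens (insRow x l) ≡ insertDesc x (lens l)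
lens-insRow x [] = refl
lens-insRow x ((y , f) ∷ l) with y ≤ᵇ x
... | true  = refl
... | false = cong (y ∷_) (lens-insRow x l)

lens-bosons : ∀ s → lens (bosons s) ≡ s
lens-bosons []      = refl
lens-bosons (x ∷ s) = cong (x ∷_) (lens-bosons s)

circs-bosons : ∀ s → circs (bosons s) ≡ s
circs-bosons []      = refl
circs-bosons (x ∷ s) = cong (x ∷_) (circs-bosons s)

foldr-insertDesc : ∀ a s → Desc s → sortDesc (a ++ s) ≡ foldr insertDesc s a
foldr-insertDesc []      s d = sortDesc-id d
foldr-insertDesc (x ∷ a) s d = cong (insertDesc x) (foldr-insertDesc a s d)

lens-rows : ∀ a s → Desc s → lens (rows (a , s)) ≡ star (a , s)
lens-rows a s d = trans (go a) (sym (foldr-insertDesc a s d))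
  where
  go : ∀ a → lens (rows (a , s)) ≡ foldr insertDesc s a
  go []      = lens-bosons s
  go (x ∷ a) = trans (lens-insRow x (rows (a , s))) (cong (insertDesc x) (go a))

circs-insRow : ∀ x l → Desc (circs l) → circs (insRow x l) ≡ insertDesc (suc x) (circs l)
circs-insRow x [] d = refl
circs-insRow x ((y , true) ∷ l) d with y ≤? x
... | yes h = trans (cong circs (insRow-≤ x y true l h)) (sym (insertDesc-≤ (suc x) (suc y) (circs l) (s≤s h)))
... | no h  = trans (cong circs (insRow-> x y true l (≰⇒> h)))
                (trans (cong (suc y ∷_) (circs-insRow x l (Desc-tail d))) (sym (insertDesc-> (suc x) (suc y) (circs l) (s≤s (≰⇒> h)))))
circs-insRow x ((y , false) ∷ l) d with y ≤? x
... | yes h = trans (cong circs (insRow-≤ x y false l h)) (sym (insertDesc-≤ (suc x) y (circs l) (m≤n⇒m≤1+n h)))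
... | no h with y ≟ suc x
...   | no ne = trans (cong circs (insRow-> x y false l (≰⇒> h)))
                (trans (cong (y ∷_) (circs-insRow x l (Desc-tail d))) (sym (insertDesc-> (suc x) y (circs l) (≤∧≢⇒< (≰⇒> h) (ne ∘ sym)))))
-- A circled row of length x meets an uncircled row of length x + 1. The two insertions order them
-- differently, but in Λ^⊛ both have length x + 1.
...   | yes refl = trans (cong circs (insRow-> x (suc x) false l ≤-refl))
                (trans (cong (suc x ∷_) (trans (circs-insRow x l (Desc-tail d)) (insertDesc-head (suc x) (circs l) (λ z → Desc-head d))))
                  (sym (insertDesc-≤ (suc x) (suc x) (circs l) ≤-refl)))

circs-rows : ∀ a s → Desc s → circs (rows (a , s)) ≡ circ (a , s)
circs-rows a s d = trans (proj₁ (go a)) (sym (foldr-insertDesc (map suc a) s d))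
  where
  go : ∀ a → circs (rows (a , s)) ≡ foldr insertDesc s (map suc a) × Desc (foldr insertDesc s (map suc a))
  go []      = circs-bosons s , d
  go (x ∷ a) = let p , q = go a in
    trans (circs-insRow x (rows (a , s)) (subst Desc (sym p) q)) (cong (insertDesc (suc x)) p) , insertDesc-Desc (suc x) q

length-insRow : ∀ x l → length (insRow x l) ≡ suc (length l)
length-insRow x [] = refl
length-insRow x ((y , f) ∷ l) with y ≤ᵇ x
... | true  = refl
... | false = cong suc (length-insRow x l)

length-rows : ∀ a s → length (rows (a , s)) ≡ length a + length s
length-rows []      s = Listₚ.length-map (_, false) s
length-rows (x ∷ a) s = trans (length-insRow x (rows (a , s))) (cong suc (length-rows a s))

size-insRow : ∀ x l → size (insRow x l) ≡ x + size l
size-insRow x [] = refl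
size-insRow x ((y , f) ∷ l) with y ≤ᵇ x
... | true  = refl
... | false = trans (cong (y +_) (size-insRow x l)) (+-exchange y x (size l))

size-rows : ∀ a s → size (rows (a , s)) ≡ sum a + sum s
size-rows []      s = trans (size-lens (bosons s)) (cong sum (lens-bosons s))
size-rows (x ∷ a) s = trans (size-insRow x (rows (a , s))) (trans (cong (x +_) (size-rows a s)) (sym (ℕₚ.+-assoc x (sum a) (sum s))))

record IsSP (Λ : SPart) : Set where
  constructor mkSP
  field
    strict : Strict (proj₁ Λ)
    desc   : Desc (proj₂ Λ)
    pos    : ∀ z → z ∈ proj₂ Λ → 1 ≤ z

strictDesc→ : ∀ a → strictDesc a ≡ true → Strict a
strictDesc→ []          _ = []
strictDesc→ (x ∷ [])    _ = [ x ]
strictDesc→ (x ∷ y ∷ a) e = let p , q = ∧-split {suc y ≤ᵇ x} e in <ᵇ→< {y} p ∷ strictDesc→ (y ∷ a) q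

→strictDesc : ∀ {a} → Strict a → strictDesc a ≡ true
→strictDesc []      = refl
→strictDesc [ x ]   = refl
→strictDesc (_∷_ {x} {y} h s) = ∧-intro {y <ᵇ x} (<→<ᵇ h) (→strictDesc s)

weakDesc→ : ∀ a → weakDesc a ≡ true → Desc a
weakDesc→ []          _ = []
weakDesc→ (x ∷ [])    _ = [ x ]
weakDesc→ (x ∷ y ∷ a) e = let p , q = ∧-split {y ≤ᵇ x} e in ≤ᵇ→≤ {y} p ∷ weakDesc→ (y ∷ a) q

→weakDesc : ∀ {a} → Desc a → weakDesc a ≡ true
→weakDesc []      = refl
→weakDesc [ x ]   = refl
→weakDesc (_∷_ {x} {y} h s) = ∧-intro {y ≤ᵇ x} (≤→≤ᵇ h) (→weakDesc s)

allPos→ : ∀ s → allPos s ≡ true → ∀ z → z ∈ s → 1 ≤ z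
allPos→ (x ∷ s) e z (here refl) = ≤ᵇ→≤ {1} (proj₁ (∧-split {1 ≤ᵇ x} e))
allPos→ (x ∷ s) e z (there m)   = allPos→ s (proj₂ (∧-split {1 ≤ᵇ x} e)) z m

→allPos : ∀ s → (∀ z → z ∈ s → 1 ≤ z) → allPos s ≡ true
→allPos []      h = refl
→allPos (x ∷ s) h = ∧-intro {1 ≤ᵇ x} (≤→≤ᵇ (h x (here refl))) (→allPos s (λ z m → h z (there m)))

isSPart→ : ∀ Λ → isSPart Λ ≡ true → IsSP Λ
isSPart→ (a , s) e = let p , q = ∧-split {strictDesc a} e
                         r , t = ∧-split {weakDesc s} q
                     in mkSP (strictDesc→ a p) (weakDesc→ s r) (allPos→ s t)

→isSPart : ∀ {Λ} → IsSP Λ → isSPart Λ ≡ true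
→isSPart {a , s} (mkSP p q r) = ∧-intro (→strictDesc p) (∧-intro (→weakDesc q) (→allPos s r))

-- Valid diagrams and superpartitions

Valid-head-≤ : ∀ {M a f Λ x} → Valid M ((a , f) ∷ Λ) → (f ≡ true → a < x) → a ≤ x → Valid x ((a , f) ∷ Λ)
Valid-head-≤ {f = true}  (_ ∷ v) h l = h refl ∷ v
Valid-head-≤ {f = false} (_ ∷ v) h l = l ∷ v

bosons-Valid : ∀ {M s} → Desc s → (∀ z → z ∈ s → z ≤ M) → Valid M (bosons s)
bosons-Valid {s = []} d h = []
bosons-Valid {s = x ∷ s} d h = h x (here refl) ∷ bosons-Valid (Desc-tail d) (λ z → Desc-head d)

-- The two halves of an inverse of `rows`. An uncircled row of length 0 is padding and yields no
-- part, whereas a circled one is the part 0 of Λ^a.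
ca bo : List Row → List ℕ
ca []                = []
ca ((w , true) ∷ Λ)  = w ∷ ca Λ
ca ((w , false) ∷ Λ) = ca Λ
bo []                    = []
bo ((w , true) ∷ Λ)      = bo Λ
bo ((zero , false) ∷ Λ)  = bo Λ
bo ((suc w , false) ∷ Λ) = suc w ∷ bo Λ

toSP : List Row → SPart
toSP Λ = ca Λ , bo Λ

ca-insRow : ∀ x l → (∀ z → z ∈ ca l → z < x) → ca (insRow x l) ≡ x ∷ ca l
ca-insRow x [] h = refl
ca-insRow x ((y , true) ∷ l) h with y ≤? x
... | yes p = cong ca (insRow-≤ x y true l p)
... | no p = ⊥-elim (p (<⇒≤ (h y (here refl))))
ca-insRow x ((y , false) ∷ l) h with y ≤? x
... | yes p = cong ca (insRow-≤ x y false l p)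
... | no p = trans (cong ca (insRow-> x y false l (≰⇒> p))) (ca-insRow x l h)

bo-insRow : ∀ x l → bo (insRow x l) ≡ bo l
bo-insRow x [] = refl
bo-insRow x ((y , f) ∷ l) with y ≤ᵇ x
... | true  = refl
bo-insRow x ((y , true) ∷ l)      | false = bo-insRow x l
bo-insRow x ((zero , false) ∷ l)  | false = bo-insRow x l
bo-insRow x ((suc y , false) ∷ l) | false = cong (suc y ∷_) (bo-insRow x l)

ca-bosons : ∀ s → ca (bosons s) ≡ []
ca-bosons []      = refl
ca-bosons (x ∷ s) = ca-bosons s

bo-bosons : ∀ s → (∀ z → z ∈ s → 1 ≤ z) → bo (bosons s) ≡ s
bo-bosons []          h = refl
bo-bosons (zero ∷ s)  h = case h 0 (here refl) of λ ()
bo-bosons (suc x ∷ s) h = cong (suc x ∷_) (bo-bosons s (λ z m → h z (there m)))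

toSP-rows : ∀ {Λ} → IsSP Λ → toSP (rows Λ) ≡ Λ
toSP-rows {a , s} (mkSP p q r) = cong₂ _,_ (c a p) (b a)
  where
  c : ∀ a → Strict a → ca (rows (a , s)) ≡ a
  c []      _ = ca-bosons s
  c (x ∷ a) p = trans (ca-insRow x (rows (a , s)) (λ z m → Strict-head p (subst (z ∈_) (c a (Strict-tail p)) m))) (cong (x ∷_) (c a (Strict-tail p)))
  b : ∀ a → bo (rows (a , s)) ≡ s
  b []      = bo-bosons s r
  b (x ∷ a) = trans (bo-insRow x (rows (a , s))) (b a)

insRow-Valid : ∀ {M} x l → x < M → Valid M l → (∀ z → z ∈ ca l → z < x) → Valid M (insRow x l)
insRow-Valid x [] h v c = h ∷ []
insRow-Valid x ((y , f) ∷ l) h v c with y ≤? x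
... | yes p = subst (Valid _) (sym (insRow-≤ x y f l p)) (h ∷ Valid-head-≤ v (λ { refl → c y (here refl) }) p)
... | no p with v
...   | b ∷ v′ = subst (Valid _) (sym (insRow-> x y f l (≰⇒> p))) (b ∷ insRow-Valid x l (≰⇒> p) v′ (λ z m → c z (mem f m)))
  where
  mem : ∀ f {z} → z ∈ ca l → z ∈ ca ((y , f) ∷ l)
  mem true  = there
  mem false = id

rows-Valid : ∀ {M Λ} → IsSP Λ → (∀ z → z ∈ proj₁ Λ → z < M) → (∀ z → z ∈ proj₂ Λ → z ≤ M) → Valid M (rows Λ)
rows-Valid {M} {a , s} (mkSP p q r) ha hs = go a p ha
  where
  ca≡ : ∀ a → Strict a → ca (rows (a , s)) ≡ a
  ca≡ a p = cong proj₁ (toSP-rows {a , s} (mkSP p q r))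
  go : ∀ a → Strict a → (∀ z → z ∈ a → z < M) → Valid M (rows (a , s))
  go []      p h = bosons-Valid q hs
  go (x ∷ a) p h = insRow-Valid x (rows (a , s)) (h x (here refl)) (go a (Strict-tail p) (λ z m → h z (there m)))
    (λ z m → Strict-head p (subst (z ∈_) (ca≡ a (Strict-tail p)) m))

zeros : ℕ → List Row
zeros n = replicate n (0 , false)

padTo : ℕ → List Row → List Row
padTo N Λ = Λ ++ zeros (N ∸ length Λ)

padTo-length : ∀ {N Λ} → length Λ ≤ N → length (padTo N Λ) ≡ N
padTo-length {N} {Λ} h = trans (Listₚ.length-++ Λ) (trans (cong (length Λ +_) (Listₚ.length-replicate (N ∸ length Λ))) (m+[n∸m]≡n h))

size-++-zeros : ∀ Λ n → size (Λ ++ zeros n) ≡ size Λ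
size-++-zeros []      zero    = refl
size-++-zeros []      (suc n) = size-++-zeros [] n
size-++-zeros ((a , _) ∷ Λ) n = cong (a +_) (size-++-zeros Λ n)

zeros-Valid : ∀ {M} n → Valid M (zeros n)
zeros-Valid zero    = []
zeros-Valid (suc n) = z≤n ∷ zeros-Valid n

Valid-++-zeros : ∀ {M Λ} n → Valid M Λ → Valid M (Λ ++ zeros n)
Valid-++-zeros n []      = zeros-Valid n
Valid-++-zeros n (b ∷ v) = b ∷ Valid-++-zeros n v

toSP-zeros : ∀ Λ n → toSP (Λ ++ zeros n) ≡ toSP Λ
toSP-zeros Λ n = cong₂ _,_ (c Λ) (b Λ)
  where
  c0 : ∀ n → ca (zeros n) ≡ []
  c0 zero = refl
  c0 (suc n) = c0 n
  b0 : ∀ n → bo (zeros n) ≡ []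
  b0 zero = refl
  b0 (suc n) = b0 n
  c : ∀ Λ → ca (Λ ++ zeros n) ≡ ca Λ
  c [] = c0 n
  c ((w , true) ∷ Λ) = cong (w ∷_) (c Λ)
  c ((w , false) ∷ Λ) = c Λ
  b : ∀ Λ → bo (Λ ++ zeros n) ≡ bo Λ
  b [] = b0 n
  b ((w , true) ∷ Λ) = b Λ
  b ((zero , false) ∷ Λ) = b Λ
  b ((suc w , false) ∷ Λ) = cong (suc w ∷_) (b Λ)

ca-below : ∀ {M} Λ → Valid M Λ → ∀ z → z ∈ ca Λ → z < M
ca-below ((w , true) ∷ Λ) (b ∷ v) z (here refl) = b
ca-below ((w , true) ∷ Λ) (b ∷ v) z (there m)   = <-trans (ca-below Λ v z m) b
ca-below ((w , false) ∷ Λ) (b ∷ v) z m          = <-≤-trans (ca-below Λ v z m) b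

bo-below : ∀ {M} Λ → Valid M Λ → ∀ z → z ∈ bo Λ → z ≤ M
bo-below ((w , true) ∷ Λ) (b ∷ v) z m             = ≤-trans (bo-below Λ v z m) (<⇒≤ b)
bo-below ((zero , false) ∷ Λ) (b ∷ v) z m         = ≤-trans (bo-below Λ v z m) b
bo-below ((suc w , false) ∷ Λ) (b ∷ v) z (here refl) = b
bo-below ((suc w , false) ∷ Λ) (b ∷ v) z (there m) = ≤-trans (bo-below Λ v z m) b

Strict-cons : ∀ {x l} → (∀ z → z ∈ l → z < x) → Strict l → Strict (x ∷ l)
Strict-cons {l = []} h d = [ _ ]
Strict-cons {l = y ∷ l} h d = h y (here refl) ∷ d

toSP-IsSP : ∀ {M Λ} → Valid M Λ → IsSP (toSP Λ)
toSP-IsSP {M} {Λ} v = mkSP (c Λ v) (b Λ v) (p Λ)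
  where
  c : ∀ {M} Λ → Valid M Λ → Strict (ca Λ)
  c [] v = []
  c ((w , true) ∷ Λ) (_ ∷ v) = Strict-cons (ca-below Λ v) (c Λ v)
  c ((w , false) ∷ Λ) (_ ∷ v) = c Λ v
  b : ∀ {M} Λ → Valid M Λ → Desc (bo Λ)
  b [] v = []
  b ((w , true) ∷ Λ) (_ ∷ v) = b Λ v
  b ((zero , false) ∷ Λ) (_ ∷ v) = b Λ v
  b ((suc w , false) ∷ Λ) (_ ∷ v) = Desc-cons (bo-below Λ v) (b Λ v)
  p : ∀ Λ z → z ∈ bo Λ → 1 ≤ z
  p ((w , true) ∷ Λ) z m = p Λ z m
  p ((zero , false) ∷ Λ) z m = p Λ z m
  p ((suc w , false) ∷ Λ) z (here refl) = s≤s z≤n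
  p ((suc w , false) ∷ Λ) z (there m) = p Λ z m

insRow-top : ∀ x l → (∀ r → r ∈ l → proj₁ r ≤ x) → insRow x l ≡ (x , true) ∷ l
insRow-top x []            h = refl
insRow-top x ((y , f) ∷ l) h = insRow-≤ x y f l (h (y , f) (here refl))

rows-boson : ∀ a w s → (∀ z → z ∈ a → z < w) → rows (a , w ∷ s) ≡ (w , false) ∷ rows (a , s)
rows-boson []      w s h = refl
rows-boson (x ∷ a) w s h = trans (cong (insRow x) (rows-boson a w s (λ z m → h z (there m)))) (insRow-> x w false _ (h x (here refl)))

Valid-lens : ∀ {M Λ} → Valid M Λ → ∀ r → r ∈ Λ → proj₁ r ≤ M
Valid-lens (_∷_ {f = f} b v) r (here refl) = below→≤ f b
Valid-lens (_∷_ {f = f} b v) r (there m) = ≤-trans (Valid-lens v r m) (below→≤ f b)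

Valid-zero : ∀ Λ → Valid 0 Λ → Λ ≡ zeros (length Λ) × toSP Λ ≡ ([] , [])
Valid-zero [] [] = refl , refl
Valid-zero ((zero , false) ∷ Λ) (z≤n ∷ v) = let p , q = Valid-zero Λ v in cong ((0 , false) ∷_) p , q

-- In a valid diagram a circled row is the first of its length, which is where insertion puts it;
-- below an uncircled empty row there are only such rows.
rows-toSP : ∀ {M} Λ → Valid M Λ → length (rows (toSP Λ)) ≤ length Λ × padTo (length Λ) (rows (toSP Λ)) ≡ Λ
rows-toSP [] _ = z≤n , refl
rows-toSP ((w , true) ∷ Λ) (b ∷ v) = subst (_≤ suc (length Λ)) (sym (cong length top)) (s≤s l) ,
  trans (cong (λ r → r ++ zeros (suc (length Λ) ∸ length r)) top) (cong ((w , true) ∷_) e)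
  where
  l = proj₁ (rows-toSP Λ v)
  e = proj₂ (rows-toSP Λ v)
  top : rows (w ∷ ca Λ , bo Λ) ≡ (w , true) ∷ rows (toSP Λ)
  top = insRow-top w (rows (toSP Λ)) (λ r m → Valid-lens v r (subst (r ∈_) e (∈ₚ.∈-++⁺ˡ m)))
rows-toSP ((zero , false) ∷ Λ) (b ∷ v) =
  let p , q = Valid-zero Λ v in
  subst (λ x → length (rows x) ≤ suc (length Λ)) (sym q) z≤n ,
  trans (cong (padTo (suc (length Λ)) ∘ rows) q) (cong ((0 , false) ∷_) (sym p))
rows-toSP ((suc w , false) ∷ Λ) (b ∷ v) = subst (_≤ suc (length Λ)) (sym (cong length top)) (s≤s l) ,
  trans (cong (λ r → r ++ zeros (suc (length Λ) ∸ length r)) top) (cong ((suc w , false) ∷_) e)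
  where
  l = proj₁ (rows-toSP Λ v)
  e = proj₂ (rows-toSP Λ v)
  top : rows (ca Λ , suc w ∷ bo Λ) ≡ (suc w , false) ∷ rows (toSP Λ)
  top = rows-boson (ca Λ) (suc w) (bo Λ) (λ z m → ca-below Λ v z m)

toSP-padTo : ∀ N {Λ} → IsSP Λ → toSP (padTo N (rows Λ)) ≡ Λ
toSP-padTo N {Λ} i = trans (toSP-zeros (rows Λ) (N ∸ length (rows Λ))) (toSP-rows i)

circlesFrom : ℕ → List Row → List (ℕ × ℕ)
circlesFrom k []                = []
circlesFrom k ((a , true) ∷ Λ)  = (k , a) ∷ circlesFrom (suc k) Λ
circlesFrom k ((a , false) ∷ Λ) = circlesFrom (suc k) Λ

concatMap-applyUpTo : ∀ {A B : Set} (g : A → List B) (h : ℕ → A) n → concatMap g (applyUpTo h n) ≡ concatMap (g ∘ h) (upTo n)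
concatMap-applyUpTo g h zero    = refl
concatMap-applyUpTo g h (suc n) = cong (g (h 0) ++_) (trans (concatMap-applyUpTo g (h ∘ suc) n) (sym (concatMap-applyUpTo (g ∘ h) suc n)))

concatMap-cong′ : ∀ {A B : Set} {f g : A → List B} → (∀ x → f x ≡ g x) → ∀ xs → concatMap f xs ≡ concatMap g xs
concatMap-cong′ h []       = refl
concatMap-cong′ h (x ∷ xs) = cong₂ _++_ (h x) (concatMap-cong′ h xs)

circles-list : ∀ k Λ → concatMap (λ r → if at (circs Λ) r ≡ᵇ suc (at (lens Λ) r) then (k + r , at (lens Λ) r) ∷ [] else []) (upTo (length (circs Λ)))
               ≡ circlesFrom k Λ
circles-list k [] = refl
circles-list k (r@(a , f) ∷ Λ) = trans (cong (hd ++_) (trans (concatMap-applyUpTo g suc (length (circs Λ)))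
    (trans (concatMap-cong′ (λ i → cong (λ j → if at (circs Λ) i ≡ᵇ suc (at (lens Λ) i) then (j , at (lens Λ) i) ∷ [] else []) (+-suc k i)) (upTo (length (circs Λ))))
      (circles-list (suc k) Λ)))) (fin f)
  where
  g : ℕ → List (ℕ × ℕ)
  g i = if at (circs (r ∷ Λ)) i ≡ᵇ suc (at (lens (r ∷ Λ)) i) then (k + i , at (lens (r ∷ Λ)) i) ∷ [] else []
  hd = g 0
  fin : ∀ f → (if clen (a , f) ≡ᵇ suc a then (k + 0 , a) ∷ [] else []) ++ circlesFrom (suc k) Λ ≡ circlesFrom k ((a , f) ∷ Λ)
  fin true  = trans (cong (λ b → (if b then (k + 0 , a) ∷ [] else []) ++ circlesFrom (suc k) Λ) (≡→≡ᵇ {a} refl)) (cong (λ j → (j , a) ∷ circlesFrom (suc k) Λ) (ℕₚ.+-identityʳ k))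
  fin false = cong (λ b → (if b then (k + 0 , a) ∷ [] else []) ++ circlesFrom (suc k) Λ) (≢→≡ᵇ {a} (ℕₚ.<⇒≢ ≤-refl))

circles-rows : ∀ {Λ} → IsSP Λ → circles Λ ≡ circlesFrom 0 (rows Λ)
circles-rows {a , s} (mkSP p q r) = trans (cong₂ (λ c l → concatMap (λ r → if at c r ≡ᵇ suc (at l r) then (r , at l r) ∷ [] else []) (upTo (length c)))
  (sym (circs-rows a s q)) (sym (lens-rows a s q))) (circles-list 0 (rows (a , s)))

circlesFrom-zeros : ∀ k Λ n → circlesFrom k (Λ ++ zeros n) ≡ circlesFrom k Λ
circlesFrom-zeros k [] zero = refl
circlesFrom-zeros k [] (suc n) = circlesFrom-zeros (suc k) [] n
circlesFrom-zeros k ((a , true) ∷ Λ) n = cong ((k , a) ∷_) (circlesFrom-zeros (suc k) Λ n)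
circlesFrom-zeros k ((a , false) ∷ Λ) n = circlesFrom-zeros (suc k) Λ n

length-circlesFrom : ∀ k Λ → length (circlesFrom k Λ) ≡ length (ca Λ)
length-circlesFrom k [] = refl
length-circlesFrom k ((a , true) ∷ Λ) = cong suc (length-circlesFrom (suc k) Λ)
length-circlesFrom k ((a , false) ∷ Λ) = length-circlesFrom (suc k) Λ

-- Admissibility in terms of rows

data HS : ℕ → List Row → List Row → Set where
  []  : ∀ {A} → HS A [] []
  row : ∀ {A a f w h Λ Ω} → a ≤ w → w ≤ A → HS a Λ Ω → HS A ((a , f) ∷ Λ) ((w , h) ∷ Ω)

-- `B` r is the length of row r - 1 in absolute numbering from 0, as in the circle condition. The
-- recursion sees only tails of Λ, hence the offset `k`.
Heads : (ℕ → ℕ) → ℕ → List Row → Set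
Heads B k []            = ⊤
Heads B k ((a , _) ∷ Λ) = B (suc k) ≡ a × Heads B (suc k) Λ

Heads-intro : ∀ B k Λ → (∀ i → B (suc (k + i)) ≡ at (lens Λ) i) → Heads B k Λ
Heads-intro B k []            h = tt
Heads-intro B k ((a , _) ∷ Λ) h = trans (cong (B ∘ suc) (sym (ℕₚ.+-identityʳ k))) (h 0) ,
  Heads-intro B (suc k) Λ (λ i → trans (cong (B ∘ suc) (sym (+-suc k i))) (h (suc i)))

Match : (ℕ → ℕ) → (ℕ × ℕ) → (ℕ × ℕ) → Set
Match B (rΩ , cΩ) (rΛ , cΛ) = ((rΩ ≡ rΛ) ⊎ (cΩ ≡ cΛ)) × (rΩ ≡ rΛ → 1 ≤ rΩ → suc cΩ ≤ B rΩ)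

circ-∈ : ∀ {k W} Λ → Valid W Λ → ∀ p → p ∈ circlesFrom k Λ → k ≤ proj₁ p × proj₂ p < W
circ-∈ ((a , true) ∷ Λ)  (b ∷ v) p (here refl) = ≤-refl , b
circ-∈ ((a , true) ∷ Λ)  (b ∷ v) p (there m) = let x , y = circ-∈ Λ v p m in <⇒≤ x , <-trans y b
circ-∈ ((a , false) ∷ Λ) (b ∷ v) p m = let x , y = circ-∈ Λ v p m in <⇒≤ x , <-≤-trans y b

-- The remaining circles of Λ lie strictly further down and strictly further left, so they share
-- neither row nor column with this one.
unmatched-new : ∀ {B k w a xs ys} → (∀ p → p ∈ ys → suc k ≤ proj₁ p × proj₂ p < a) → a ≤ w →
  Pointwise (Match B) ((k , w) ∷ xs) ys → ⊥
unmatched-new h a≤w ((inj₁ refl , _) ∷ _) = <-irrefl refl (proj₁ (h _ (here refl)))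
unmatched-new h a≤w ((inj₂ refl , _) ∷ _) = <⇒≱ (proj₂ (h _ (here refl))) a≤w

-- The partner lies in a later row, so only the column can be shared, and that column is inside the
-- row of length `w`.
moved-down : ∀ {B j k w A xs ys} → j ≤ k → (∀ p → p ∈ xs → suc k ≤ proj₁ p × proj₂ p < w) →
  Pointwise (Match B) xs ((j , A) ∷ ys) → A < w
moved-down j≤k h ((inj₁ refl , _) ∷ _) = ⊥-elim (<⇒≱ (proj₁ (h _ (here refl))) j≤k)
moved-down j≤k h ((inj₂ refl , _) ∷ _) = proj₂ (h _ (here refl))

-- The circle of the row just passed, still waiting for its partner; its column is the length `A` of
-- that row.
pend : Bool → ℕ → ℕ → List (ℕ × ℕ)
pend true  k A = (k ∸ 1 , A) ∷ []
pend false k A = []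

-- The rule lets a circle slide down its column by any number of rows, while `pieri` allows one. The
-- horizontal strip closes the gap: if a pending circle skipped row k, that row of Ω would be longer
-- than `A`. In row 0 the rule puts no bound on a staying circle, and the hypothesis `top` stands in
-- for it.
match→pieri : ∀ B k A D Λ Ω W → Heads B k Λ → (1 ≤ k → B k ≡ A) → (∀ w h Ω′ → k ≡ 0 → Ω ≡ (w , h) ∷ Ω′ → w < A) →
  (D ≡ true → 1 ≤ k) → HS A Λ Ω → Valid A Λ → Valid W Ω →
  Pointwise (Match B) (circlesFrom k Ω) (pend D k A ++ circlesFrom k Λ) → pieri A D Λ Ω ≡ true
match→pieri B k A false [] [] W hd bk top dk [] vΛ vΩ pw = refl
match→pieri B k A D ((a , f) ∷ Λ) ((w , h) ∷ Ω) W (hd₁ , hd) bk top dk (row a≤w w≤A hs) (ba ∷ vΛ) (bw ∷ vΩ) = go D f h dk ba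
  where
  <s : ∀ {m n} → m ≤ n → (m <ᵇ suc n) ≡ true
  <s l = <→<ᵇ (s≤s l)
  top<A : (1 ≤ k → suc w ≤ B k) → w < A
  top<A g with k ≟ 0
  ... | yes e = top w h Ω e refl
  ... | no ne = subst (w <_) (bk (ℕₚ.n≢0⇒n>0 ne)) (g (ℕₚ.n≢0⇒n>0 ne))
  next : ∀ D → Pointwise (Match B) (circlesFrom (suc k) Ω) (pend D (suc k) a ++ circlesFrom (suc k) Λ) → pieri a D Λ Ω ≡ true
  next D = match→pieri B (suc k) a D Λ Ω w hd (λ _ → hd₁) (λ _ _ _ ()) (λ _ → s≤s z≤n) hs vΛ vΩ
  row≢ : (1 ≤ k) → k ≢ k ∸ 1
  row≢ (s≤s _) e = <-irrefl (sym e) ≤-refl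
  go : ∀ D f h → (D ≡ true → 1 ≤ k) → below a f A → Pointwise (Match B) (circlesFrom k ((w , h) ∷ Ω)) (pend D k A ++ circlesFrom k ((a , f) ∷ Λ)) →
       pieri A D ((a , f) ∷ Λ) ((w , h) ∷ Ω) ≡ true
  go false false false dk ba pw = ∧-intro (∧-intro (≤→≤ᵇ a≤w) (<s w≤A)) (next false pw)
  go false false true  dk ba pw = ⊥-elim (unmatched-new (circ-∈ Λ vΛ) a≤w pw)
  go true  false false dk ba pw = ⊥-elim (<⇒≱ (moved-down (m∸n≤m k 1) (circ-∈ Ω vΩ) pw) w≤A)
  go true  false true  dk ba ((inj₁ e , _) ∷ pw) = ⊥-elim (row≢ (dk refl) e)
  go true  false true  dk ba ((inj₂ refl , _) ∷ pw) = ∧-intro (∧-intro (≤→≤ᵇ {w} ≤-refl) (<s w≤A)) (next false pw)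
  go false true  true  dk ba ((_ , g) ∷ pw) = ∧-intro (∧-intro (≤→≤ᵇ a≤w) (<→<ᵇ (top<A (g refl)))) (next false pw)
  go false true  false dk ba pw = ∧-intro (∧-intro (<→<ᵇ (moved-down ≤-refl (circ-∈ Ω vΩ) pw)) (<s w≤A)) (next true pw)
  go true  true  true  dk ba ((inj₁ e , _) ∷ pw) = ⊥-elim (row≢ (dk refl) e)
  go true  true  true  dk ba ((inj₂ refl , _) ∷ pw) = ∧-intro (∧-intro (≤→≤ᵇ {w} ≤-refl) (<s w≤A)) (next true pw)
  go true  true  false dk ba pw = ⊥-elim (<⇒≱ (moved-down (m∸n≤m k 1) (circ-∈ Ω vΩ) pw) w≤A)

pieri→match : ∀ B k A D Λ Ω → Heads B k Λ → (1 ≤ k → B k ≡ A) → (D ≡ true → 1 ≤ k) → Valid A Λ → pieri A D Λ Ω ≡ true →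
  HS A Λ Ω × Pointwise (Match B) (circlesFrom k Ω) (pend D k A ++ circlesFrom k Λ)
pieri→match B k A false [] [] hd bk dk vΛ e = [] , []
pieri→match B k A true  [] [] hd bk dk vΛ ()
pieri→match B k A D ((a , f) ∷ Λ) ((w , h) ∷ Ω) (hd₁ , hd) bk dk (ba ∷ vΛ) e with ∧-split {okc f D h} e
... | e₁ , e₂ with ∧-split {(lowP A a f D h ≤ᵇ w) ∧ (w <ᵇ upP A f D h)} e₂
... | e₃ , e₄ with ∧-split {lowP A a f D h ≤ᵇ w} e₃
... | p , q = row (≤-trans (lowP≥ A a f D h ba) l) (≤-pred (≤-trans u (upP≤ A f D h))) (proj₁ ih) , go D f h dk e₁ l u (proj₂ ih)
  where
  l : lowP A a f D h ≤ w
  l = ≤ᵇ→≤ {lowP A a f D h} p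
  u : w < upP A f D h
  u = <ᵇ→< {w} q
  ih = pieri→match B (suc k) a (nextc f D h) Λ Ω hd (λ _ → hd₁) (λ _ → s≤s z≤n) vΛ e₄
  row≢ : (1 ≤ k) → k ≢ k ∸ 1
  row≢ (s≤s _) e = <-irrefl (sym e) ≤-refl
  go : ∀ D f h → (D ≡ true → 1 ≤ k) → okc f D h ≡ true → lowP A a f D h ≤ w → w < upP A f D h →
    Pointwise (Match B) (circlesFrom (suc k) Ω) (pend (nextc f D h) (suc k) a ++ circlesFrom (suc k) Λ) →
    Pointwise (Match B) (circlesFrom k ((w , h) ∷ Ω)) (pend D k A ++ circlesFrom k ((a , f) ∷ Λ))
  go false false false dk _ l u pw = pw
  go false true  true  dk _ l u pw = (inj₁ refl , (λ _ k≥ → subst (suc w ≤_) (sym (bk k≥)) u)) ∷ pw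
  go false true  false dk _ l u pw = pw
  go true  false true  dk _ l u pw = (inj₂ (≤-antisym (≤-pred u) l) , (λ e → ⊥-elim (row≢ (dk refl) e))) ∷ pw
  go true  true  true  dk _ l u pw = (inj₂ (≤-antisym (≤-pred u) l) , (λ e → ⊥-elim (row≢ (dk refl) e))) ∷ pw

HS-bound : ∀ {A Λ Ω} → HS A Λ Ω → Valid A Λ → ∀ j → at (lens Ω) j ≤ A
HS-bound [] _ j = z≤n
HS-bound (row _ h hs) _ zero = h
HS-bound (row {f = f} _ _ hs) (b ∷ v) (suc j) = ≤-trans (HS-bound hs v j) (below→≤ f b)

HS-below : ∀ {A Λ Ω} → HS A Λ Ω → Valid A Λ → ∀ i j → i < j → at (lens Ω) j ≤ at (lens Λ) i
HS-below [] _ i j _ = z≤n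
HS-below (row _ _ hs) (_ ∷ v) zero (suc j) _ = HS-bound hs v j
HS-below (row _ _ hs) (_ ∷ v) (suc i) (suc j) (s≤s h) = HS-below hs v i j h

HS-inc : ∀ {A Λ Ω} → HS A Λ Ω → ∀ i → at (lens Λ) i ≤ at (lens Ω) i
HS-inc [] i = z≤n
HS-inc (row h _ hs) zero = h
HS-inc (row _ _ hs) (suc i) = HS-inc hs i

HS→HStrip : ∀ {A Λ Ω ℓ} → HS A Λ Ω → Valid A Λ → size Ω ≡ size Λ + ℓ → HStrip (lens Λ) (lens Ω) ℓ
HS→HStrip {Λ = Λ} {Ω} {ℓ} hs v e = HS-inc hs , trans (sym (size-lens Ω)) (trans e (cong (_+ ℓ) (size-lens Λ))) ,
  λ i j c i<j μ≤c _ _ c<ν → <⇒≱ c<ν (≤-trans (HS-below hs v i j i<j) μ≤c)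

strip→HS : ∀ {A W} Λ Ω → length Λ ≡ length Ω → Valid A Λ → Valid W Ω → (∀ i → at (lens Λ) i ≤ at (lens Ω) i) →
  (∀ i j c → i < j → at (lens Λ) i ≤ c → c < at (lens Ω) i → at (lens Λ) j ≤ c → c < at (lens Ω) j → ⊥) →
  at (lens Ω) 0 ≤ A → HS A Λ Ω
strip→HS [] [] _ _ _ _ _ _ = []
strip→HS ((a , f) ∷ Λ) ((w , h) ∷ Ω) e (b ∷ v) (b′ ∷ v′) inc no2 top = row (inc 0) top
  (strip→HS Λ Ω (suc-injective e) v v′ (inc ∘ suc) (λ i j c i<j → no2 (suc i) (suc j) c (s≤s i<j)) next)
  where
  hd≤ : ∀ {A} Λ → Valid A Λ → at (lens Λ) 0 ≤ A
  hd≤ [] _ = z≤n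
  hd≤ ((a , f) ∷ Λ) (b ∷ _) = below→≤ f b
  next : at (lens Ω) 0 ≤ a
  next with at (lens Ω) 0 ≤? a
  ... | yes l = l
  -- Otherwise column `a` would contain cells of the strip in both of these rows.
  ... | no l = ⊥-elim (no2 0 1 a (s≤s z≤n) ≤-refl (<-≤-trans (≰⇒> l) (hd≤ Ω v′)) (hd≤ Λ v) (≰⇒> l))

HStrip-cong : ∀ {μ μ′ ν ν′ ℓ} → (∀ i → at μ i ≡ at μ′ i) → (∀ i → at ν i ≡ at ν′ i) → sum μ ≡ sum μ′ → sum ν ≡ sum ν′ →
  HStrip μ ν ℓ → HStrip μ′ ν′ ℓ
HStrip-cong {ℓ = ℓ} m n sm sn (inc , s , no2) = (λ i → subst₂ _≤_ (m i) (n i) (inc i)) , trans (sym sn) (trans s (cong (_+ ℓ) sm)) ,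
  λ i j c i<j p q r t → no2 i j c i<j (subst (_≤ c) (sym (m i)) p) (subst (c <_) (sym (n i)) q) (subst (_≤ c) (sym (m j)) r) (subst (c <_) (sym (n j)) t)

at-zeros : ∀ Λ n i → at (lens (Λ ++ zeros n)) i ≡ at (lens Λ) i
at-zeros [] zero i = refl
at-zeros [] (suc n) zero = refl
at-zeros [] (suc n) (suc i) = at-zeros [] n i
at-zeros (r ∷ Λ) n zero = refl
at-zeros (r ∷ Λ) n (suc i) = at-zeros Λ n i

Pointwise-map : ∀ {A B : Set} {R S : A → B → Set} → (∀ {x y} → R x y → S x y) → ∀ {xs ys} → Pointwise R xs ys → Pointwise S xs ys
Pointwise-map f []       = []
Pointwise-map f (r ∷ rs) = f r ∷ Pointwise-map f rs

Pointwise-len : ∀ {A B : Set} {R : A → B → Set} {xs ys} → Pointwise R xs ys → length xs ≡ length ys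
Pointwise-len []       = refl
Pointwise-len (_ ∷ rs) = cong suc (Pointwise-len rs)

bdeg-size : ∀ Λ n → size (rows Λ ++ zeros n) ≡ bdeg Λ
bdeg-size (a , s) n = trans (size-++-zeros (rows (a , s)) n) (size-rows a s)

padded-Valid : ∀ {M N Λ} → IsSP Λ → bdeg Λ < M → Valid M (padTo N (rows Λ))
padded-Valid {M} {N} {a , s} i h = Valid-++-zeros (N ∸ length (rows (a , s))) (rows-Valid i
  (λ z m → ≤-<-trans (≤-trans (∈-sum a m) (m≤m+n (sum a) (sum s))) h)
  (λ z m → <⇒≤ (≤-<-trans (≤-trans (∈-sum s m) (m≤n+m (sum s) (sum a))) h)))

-- Both diagrams are padded to `N` rows because `pieri` compares lists of equal length; `M` exceeds
-- both degrees, so it does not restrict the first row.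
module AdmissiblePieri {M N : ℕ} {Λ Ω : SPart} (iΛ : IsSP Λ) (iΩ : IsSP Ω) (bΛ : bdeg Λ < M) (bΩ : bdeg Ω < M)
                (lΛ : length (rows Λ) ≤ N) (lΩ : length (rows Ω) ≤ N) where

  u v : List Row
  u = padTo N (rows Λ)
  v = padTo N (rows Ω)

  private
    B : ℕ → ℕ
    B r = at (star Λ) (r ∸ 1)
    star-at : ∀ {Λ} → IsSP Λ → ∀ n i → at (star Λ) i ≡ at (lens (rows Λ ++ zeros n)) i
    star-at {a , s} i n k = trans (cong (λ l → at l k) (sym (lens-rows a s (IsSP.desc i)))) (sym (at-zeros (rows (a , s)) n k))
    star-sum : ∀ {Λ} → IsSP Λ → ∀ n → sum (star Λ) ≡ sum (lens (rows Λ ++ zeros n))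
    star-sum {a , s} i n = trans (cong sum (sym (lens-rows a s (IsSP.desc i)))) (trans (sym (size-lens (rows (a , s))))
      (trans (sym (size-++-zeros (rows (a , s)) n)) (size-lens (rows (a , s) ++ zeros n))))
    nΛ = N ∸ length (rows Λ)
    nΩ = N ∸ length (rows Ω)
    heads : Heads B 0 u
    heads = Heads-intro B 0 u (star-at iΛ nΛ)
    vu : Valid M u
    vu = padded-Valid iΛ bΛ
    vv : Valid M v
    vv = padded-Valid iΩ bΩ
    cΛ : circles Λ ≡ circlesFrom 0 u
    cΛ = trans (circles-rows iΛ) (sym (circlesFrom-zeros 0 (rows Λ) nΛ))
    cΩ : circles Ω ≡ circlesFrom 0 v
    cΩ = trans (circles-rows iΩ) (sym (circlesFrom-zeros 0 (rows Ω) nΩ))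
    v<M : ∀ r → r ∈ v → proj₁ r < M
    v<M r m = ≤-<-trans (subst (proj₁ r ≤_) (trans (sym (size-lens v)) (bdeg-size Ω nΩ)) (∈-sum (lens v) (∈ₚ.∈-map⁺ proj₁ m))) bΩ

  admissible→pieri : ∀ {ℓ} → Admissible Λ ℓ Ω → pieri M false u v ≡ true
  admissible→pieri (_ , _ , strip , cc) = match→pieri B 0 M false u v M heads (λ ()) (λ w h Ω′ _ e → v<M (w , h) (subst ((w , h) ∈_) (sym e) (here refl)))
    (λ ()) (strip→HS u v (trans (padTo-length {N} {rows Λ} lΛ) (sym (padTo-length {N} {rows Ω} lΩ))) vu vv inc no2 (top v v<M)) vu vv
    (subst₂ (Pointwise (Match B)) cΩ cΛ (Pointwise-map id cc))
    where
    top : ∀ l → (∀ r → r ∈ l → proj₁ r < M) → at (lens l) 0 ≤ M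
    top []      h = z≤n
    top (r ∷ l) h = <⇒≤ (h r (here refl))
    strip′ = HStrip-cong {μ = star Λ} {μ′ = lens u} {ν = star Ω} {ν′ = lens v} (star-at iΛ nΛ) (star-at iΩ nΩ) (star-sum iΛ nΛ) (star-sum iΩ nΩ) strip
    inc = proj₁ strip′
    no2 = proj₂ (proj₂ strip′)

  pieri→admissible : ∀ {ℓ} → bdeg Ω ≡ bdeg Λ + ℓ → pieri M false u v ≡ true → Admissible Λ ℓ Ω
  pieri→admissible {ℓ} e p with pieri→match B 0 M false u v heads (λ ()) (λ ()) vu p
  ... | hs , pw = →isSPart iΩ , fd ,
    HStrip-cong {μ = lens u} {μ′ = star Λ} {ν = lens v} {ν′ = star Ω} (λ i → sym (star-at iΛ nΛ i)) (λ i → sym (star-at iΩ nΩ i)) (sym (star-sum iΛ nΛ)) (sym (star-sum iΩ nΩ))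
      (HS→HStrip hs vu (trans (bdeg-size Ω nΩ) (trans e (cong (_+ ℓ) (sym (bdeg-size Λ nΛ)))))) ,
    subst₂ (Pointwise (CirclePair Λ)) (sym cΩ) (sym cΛ) (Pointwise-map id pw)
    where
    count : ∀ {Λ} → IsSP Λ → ∀ n → length (circlesFrom 0 (rows Λ ++ zeros n)) ≡ fdeg Λ
    count {Λ} i n = trans (length-circlesFrom 0 (rows Λ ++ zeros n)) (cong (length ∘ proj₁) (trans (toSP-zeros (rows Λ) n) (toSP-rows i)))
    fd : fdeg Ω ≡ fdeg Λ
    fd = trans (sym (count iΩ nΩ)) (trans (Pointwise-len pw) (count iΛ nΛ))

-- The functions F_Λ and the Pieri rule for them

-- The diagram is padded to one row per variable. With more rows than variables there is no monomial
-- left and the value is 0.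
FS : ℕ → SPart → List ℕ → List ℕ → ℚ
FS M Λ e s = when (length (rows Λ) ≤ᵇ length e + length s) (schur M e s (padTo (length e + length s) (rows Λ)))

FS-homog : ∀ M Λ e s → bdeg Λ ≢ sum e + sum s → FS M Λ e s ≡ 0ℚ
FS-homog M Λ e s h = trans (cong (when (length (rows Λ) ≤ᵇ length e + length s))
  (schur-homog M e s (padTo (length e + length s) (rows Λ)) (λ q → h (trans (sym (bdeg-size Λ _)) q)))) (when-zero (length (rows Λ) ≤ᵇ length e + length s))

-- A row of Λ facing an empty uncircled row of Ω has no circle either: that circle would have to
-- drop, and then the row would have to grow.
pieri-zeros : ∀ A D Λ X k → pieri A D Λ (X ++ zeros k) ≡ true → drop (length X) Λ ≡ zeros k
pieri-zeros A D [] [] zero e = refl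
pieri-zeros A D (_ ∷ _) [] zero ()
pieri-zeros A D [] [] (suc k) ()
pieri-zeros A D ((a , f) ∷ Λ) [] (suc k) e with ∧-split {okc f D false} e
... | e₁ , e₂ with ∧-split {(lowP A a f D false ≤ᵇ 0) ∧ (0 <ᵇ upP A f D false)} e₂
... | e₃ , e₄ with ∧-split {lowP A a f D false ≤ᵇ 0} e₃
... | p , _ = go f D e₁ p e₄
  where
  go : ∀ f D → okc f D false ≡ true → (lowP A a f D false ≤ᵇ 0) ≡ true → pieri a (nextc f D false) Λ (zeros k) ≡ true → (a , f) ∷ Λ ≡ zeros (suc k)
  go false false _ l r = cong₂ (λ x y → (x , false) ∷ y) (ℕₚ.n≤0⇒n≡0 (≤ᵇ→≤ {a} l)) (pieri-zeros a false Λ [] k r)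
  go true  false _ () r
pieri-zeros A D [] (x ∷ X) k ()
pieri-zeros A D ((a , f) ∷ Λ) ((w , h) ∷ X) k e =
  pieri-zeros a (nextc f D h) Λ X k (proj₂ (∧-split {(lowP A a f D h ≤ᵇ w) ∧ (w <ᵇ upP A f D h)} (proj₂ (∧-split {okc f D h} e))))

insRow-∈ : ∀ x l {r} → r ∈ insRow x l → r ≡ (x , true) ⊎ r ∈ l
insRow-∈ x [] (here e) = inj₁ e
insRow-∈ x ((y , f) ∷ l) h with y ≤ᵇ x
insRow-∈ x ((y , f) ∷ l) (here e)  | true = inj₁ e
insRow-∈ x ((y , f) ∷ l) (there h) | true = inj₂ h
insRow-∈ x ((y , f) ∷ l) (here e)  | false = inj₂ (here e)
insRow-∈ x ((y , f) ∷ l) (there h) | false with insRow-∈ x l h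
... | inj₁ e = inj₁ e
... | inj₂ m = inj₂ (there m)

rows-nonempty : ∀ {Λ} → IsSP Λ → (0 , false) ∈ rows Λ → ⊥
rows-nonempty {a , s} i = go a
  where
  go : ∀ a → (0 , false) ∈ rows (a , s) → ⊥
  go [] m with ∈ₚ.∈-map⁻ (_, false) m
  ... | _ , z∈ , refl = case IsSP.pos i 0 z∈ of λ ()
  go (x ∷ a) m with insRow-∈ x (rows (a , s)) m
  ... | inj₁ ()
  ... | inj₂ m′ = go a m′

drop-zeros : ∀ i l z k → i < length l → drop i (l ++ z) ≡ zeros (suc k) → (0 , false) ∈ l
drop-zeros zero    (r ∷ l) z k h e = here (sym (Listₚ.∷-injectiveˡ e))
drop-zeros (suc i) (r ∷ l) z k (s≤s h) e = there (drop-zeros i l z k h e)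

admissible-length : ∀ {Λ Ω ℓ} → IsSP Λ → IsSP Ω → Admissible Λ ℓ Ω → length (rows Λ) ≤ length (rows Ω)
admissible-length {Λ} {Ω} {ℓ} iΛ iΩ ad with length (rows Λ) ≤? length (rows Ω)
... | yes h = h
... | no h = ⊥-elim (rows-nonempty iΛ (drop-zeros (length (rows Ω)) (rows Λ) (zeros (length (rows Λ) ∸ length (rows Λ))) _ (≰⇒> h)
    (trans (pieri-zeros M false (padTo N (rows Λ)) (rows Ω) (N ∸ length (rows Ω))
      (AdmissiblePieri.admissible→pieri {M} {N} {Λ} {Ω} iΛ iΩ (s≤s (m≤m+n (bdeg Λ) (bdeg Ω))) (s≤s (m≤n+m (bdeg Ω) (bdeg Λ))) ≤-refl (<⇒≤ (≰⇒> h)) {ℓ} ad))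
      (cong zeros (∸-suc (≰⇒> h))))))
  where
  N = length (rows Λ)
  M = suc (bdeg Λ + bdeg Ω)

sum-insert : ∀ x l → sum (insertDesc x l) ≡ x + sum l
sum-insert x [] = refl
sum-insert x (y ∷ l) with y ≤ᵇ x
... | true  = refl
... | false = trans (cong (y +_) (sum-insert x l)) (+-exchange y x (sum l))

sum-sortDesc : ∀ l → sum (sortDesc l) ≡ sum l
sum-sortDesc [] = refl
sum-sortDesc (x ∷ l) = trans (sum-insert x (sortDesc l)) (cong (x +_) (sum-sortDesc l))

sum-star : ∀ Λ → sum (star Λ) ≡ bdeg Λ
sum-star (a , s) = trans (sum-sortDesc (a ++ s)) (sum-++ a s)

admissible-bdeg : ∀ Λ ℓ Ω → Admissible Λ ℓ Ω → bdeg Ω ≡ bdeg Λ + ℓ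
admissible-bdeg Λ ℓ Ω (_ , _ , (_ , e , _) , _) = trans (sym (sum-star Ω)) (trans e (cong (_+ ℓ) (sum-star Λ)))

-- Multiplication by h_ℓ, on coefficients as functions of the fermionic and the bosonic exponents.
hop : ℕ → (List ℕ → List ℕ → ℚ) → List ℕ → List ℕ → ℚ
hop ℓ G e s = ∑ (sub e) (λ e′ → ∑ (sub s) (λ s′ → when ((sum e′ + sum s′) + ℓ ≡ᵇ sum e + sum s) (G e′ s′)))

-- Passage from diagrams with exactly `N` rows to superpartitions. Members of `L` with more rows
-- vanish in `N` variables, and diagrams of the wrong degree vanish by homogeneity.
pieriSP : ∀ M Λ ℓ L → IsSP Λ → Unique L → (∀ Ω → (Ω ∈ L → Admissible Λ ℓ Ω) × (Admissible Λ ℓ Ω → Ω ∈ L)) →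
  ∀ e s → sum e + sum s < M → hop ℓ (FS M Λ) e s ≡ ∑ L (λ Ω → FS M Ω e s)
pieriSP M Λ ℓ L iΛ uL adm e s lt with bdeg Λ + ℓ ≟ sum e + sum s
... | no ne = trans (∑-zero (sub e) (λ e′ _ → ∑-zero (sub s) (λ s′ _ → z e′ s′)))
                    (sym (∑-zero L (λ Ω Ω∈ → FS-homog M Ω e s (λ q → ne (trans (sym (admissible-bdeg Λ ℓ Ω (proj₁ (adm Ω) Ω∈))) q)))))
  where
  z : ∀ e′ s′ → when ((sum e′ + sum s′) + ℓ ≡ᵇ sum e + sum s) (FS M Λ e′ s′) ≡ 0ℚ
  z e′ s′ with (sum e′ + sum s′) + ℓ ≡ᵇ sum e + sum s in eq
  ... | false = refl
  ... | true  = FS-homog M Λ e′ s′ (λ q → ne (trans (cong (_+ ℓ) q) (≡ᵇ→≡ {(sum e′ + sum s′) + ℓ} eq)))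
... | yes deg = main (length (rows Λ) ≤? N)
  where
  N = length e + length s
  subN : ∀ {e′ s′} → e′ ∈ sub e → s′ ∈ sub s → length e′ + length s′ ≡ N
  subN p q = cong₂ _+_ (sub-length e p) (sub-length s q)
  iΩ : ∀ {Ω} → Ω ∈ L → IsSP Ω
  iΩ {Ω} m = isSPart→ Ω (proj₁ (proj₁ (adm Ω) m))
  bΩ : ∀ {Ω} → Ω ∈ L → bdeg Ω < M
  bΩ {Ω} m = subst (_< M) (sym (trans (admissible-bdeg Λ ℓ Ω (proj₁ (adm Ω) m)) deg)) lt
  bΛ : bdeg Λ < M
  bΛ = ≤-<-trans (m≤m+n (bdeg Λ) ℓ) (subst (_< M) (sym deg) lt)
  fits : SPart → Bool
  fits Ω = length (rows Ω) ≤ᵇ N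
  main : Dec (length (rows Λ) ≤ N) → hop ℓ (FS M Λ) e s ≡ ∑ L (λ Ω → FS M Ω e s)
  main (no h) = trans (∑-zero (sub e) (λ e′ p → ∑-zero (sub s) (λ s′ q →
      trans (cong (λ b → when ((sum e′ + sum s′) + ℓ ≡ᵇ sum e + sum s) (when b (schur M e′ s′ (padTo (length e′ + length s′) (rows Λ)))))
        (trans (cong (length (rows Λ) ≤ᵇ_) (subN p q)) (≰→≤ᵇ h))) (when-zero ((sum e′ + sum s′) + ℓ ≡ᵇ sum e + sum s)))))
    (sym (∑-zero L (λ Ω m → when-≡ (schur M e s (padTo N (rows Ω)))
      (≰→≤ᵇ (λ l → h (≤-trans (admissible-length {Λ} {Ω} {ℓ} iΛ (iΩ m) (proj₁ (adm Ω) m)) l))))))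
  main (yes fit) = begin
    hop ℓ (FS M Λ) e s
      ≡⟨ ∑-cong (sub e) (λ e′ p → ∑-cong (sub s) (λ s′ q → simp e′ s′ (subN p q))) ⟩
    ∑ (sub e) (λ e′ → ∑ (sub s) (λ s′ → schur M e′ s′ u))
      ≡⟨ pieri-rows M e s u (padded-Valid iΛ bΛ) (padTo-length {N} {rows Λ} fit) lt ⟩
    ∑ (box M (length u)) (λ Ω → when (pieri M false u Ω) (schur M e s Ω))
      ≡⟨ cong (λ k → ∑ (box M k) (λ Ω → when (pieri M false u Ω) (schur M e s Ω))) (padTo-length {N} {rows Λ} fit) ⟩
    ∑ (box M N) (λ Ω → when (pieri M false u Ω) (schur M e s Ω))
      ≡⟨ ∑-reindex {ys = filterᵇ fits L} (λ Ω → padTo N (rows Ω)) (box-Unique M N) (Uniqueₚ.filter⁺ (λ Ω → Boolₚ.T? (fits Ω)) uL) to inj surj ⟩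
    ∑ (filterᵇ fits L) (λ Ω → schur M e s (padTo N (rows Ω)))
      ≡⟨ ∑-filter fits L (λ Ω → schur M e s (padTo N (rows Ω))) ⟩
    ∑ L (λ Ω → FS M Ω e s) ∎
    where
    u = padTo N (rows Λ)
    simp : ∀ e′ s′ → length e′ + length s′ ≡ N → when ((sum e′ + sum s′) + ℓ ≡ᵇ sum e + sum s) (FS M Λ e′ s′) ≡ schur M e′ s′ u
    simp e′ s′ eq with bdeg Λ ≟ sum e′ + sum s′
    ... | no ne = trans (trans (cong (when ((sum e′ + sum s′) + ℓ ≡ᵇ sum e + sum s)) (FS-homog M Λ e′ s′ ne)) (when-zero ((sum e′ + sum s′) + ℓ ≡ᵇ sum e + sum s)))
                        (sym (schur-homog M e′ s′ u (λ q → ne (trans (sym (bdeg-size Λ _)) q))))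
    ... | yes d = trans (when-≡ (FS M Λ e′ s′) (≡→≡ᵇ {(sum e′ + sum s′) + ℓ} (trans (cong (_+ ℓ) (sym d)) deg)))
                   (trans (cong (λ k → when (length (rows Λ) ≤ᵇ k) (schur M e′ s′ (padTo k (rows Λ)))) eq) (when-≡ (schur M e′ s′ u) (≤→≤ᵇ fit)))
    fits→ : ∀ {Ω} → Ω ∈ filterᵇ fits L → Ω ∈ L × length (rows Ω) ≤ N
    fits→ {Ω} m = let p , q = ∈ₚ.∈-filter⁻ (λ Ω → Boolₚ.T? (fits Ω)) {xs = L} m in p , ≤ᵇ→≤ {length (rows Ω)} (T→≡ q)
    to : ∀ Ω → Ω ∈ filterᵇ fits L → padTo N (rows Ω) ∈ box M N × schur M e s (padTo N (rows Ω)) ≡ when (pieri M false u (padTo N (rows Ω))) (schur M e s (padTo N (rows Ω)))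
    to Ω m = let p , q = fits→ m in
      subst (λ k → padTo N (rows Ω) ∈ box M k) (padTo-length {N} {rows Ω} q) (box-∈ M _ (Valid-lens (padded-Valid {M} {N} (iΩ p) (bΩ p)))) ,
      when-≡ (schur M e s (padTo N (rows Ω))) (sym (AdmissiblePieri.admissible→pieri {M} {N} {Λ} {Ω} iΛ (iΩ p) bΛ (bΩ p) fit q {ℓ} (proj₁ (adm Ω) p)))
    inj : ∀ Ω Ω′ → Ω ∈ filterᵇ fits L → Ω′ ∈ filterᵇ fits L → padTo N (rows Ω) ≡ padTo N (rows Ω′) → Ω ≡ Ω′
    inj Ω Ω′ m m′ eq = trans (sym (toSP-padTo N (iΩ (proj₁ (fits→ m))))) (trans (cong toSP eq) (toSP-padTo N (iΩ (proj₁ (fits→ m′)))))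
    surj : ∀ x → x ∈ box M N → (∃[ Ω ] (Ω ∈ filterᵇ fits L × x ≡ padTo N (rows Ω))) ⊎ when (pieri M false u x) (schur M e s x) ≡ 0ℚ
    surj x m with pieri M false u x in eq
    ... | false = inj₂ refl
    ... | true with size x ≟ sum e + sum s
    ...   | no ne = inj₂ (schur-homog M e s x ne)
    ...   | yes d = inj₁ (toSP x , ∈ₚ.∈-filter⁺ (λ Ω → Boolₚ.T? (fits Ω)) (proj₂ (adm (toSP x)) ad) (≡→T (≤→≤ᵇ l)) , sym back)
      where
      vx : Valid M x
      vx = pieri-valid false u x (padded-Valid iΛ bΛ) ≤-refl (λ ()) eq
      lx : length x ≡ N
      lx = box-length M N m
      l : length (rows (toSP x)) ≤ N
      l = subst (length (rows (toSP x)) ≤_) lx (proj₁ (rows-toSP x vx))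
      back : padTo N (rows (toSP x)) ≡ x
      back = trans (cong (λ k → padTo k (rows (toSP x))) (sym lx)) (proj₂ (rows-toSP x vx))
      ix : IsSP (toSP x)
      ix = toSP-IsSP vx
      bd : bdeg (toSP x) ≡ size x
      bd = trans (sym (bdeg-size (toSP x) _)) (cong size back)
      ad : Admissible Λ ℓ (toSP x)
      ad = AdmissiblePieri.pieri→admissible {M} {N} {Λ} {toSP x} iΛ ix bΛ (subst (_< M) (sym (trans bd d)) lt) fit l (trans bd (trans d (sym deg)))
             (trans (cong (pieri M false u) back) eq)

-- Dominance

psum : ℕ → List ℕ → ℕ
psum k l = sum (take k l)

psum-[] : ∀ k → psum k [] ≡ 0
psum-[] zero    = refl
psum-[] (suc k) = refl

-- What dominance needs of a strip once its circles are forgotten. It applies to Λ^* and to Λ^⊛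
-- alike.
data IL : ℕ → List ℕ → List ℕ → Set where
  []  : ∀ {A} → IL A [] []
  row : ∀ {A a w μ ν} → a ≤ w → w ≤ A → IL a μ ν → IL A (a ∷ μ) (w ∷ ν)

IL-mono : ∀ {A μ ν} → IL A μ ν → sum μ ≤ sum ν
IL-mono []           = z≤n
IL-mono (row h _ il) = +-mono-≤ h (IL-mono il)

IL-sum : ∀ {A μ ν} → IL A μ ν → sum ν ≤ A + sum μ
IL-sum []                      = z≤n
IL-sum (row {A} {a} {w} _ h il) = +-mono-≤ h (IL-sum il)

IL-psum : ∀ {A μ ν} k → IL A μ ν → psum k μ ≤ psum k ν
IL-psum zero    il           = z≤n
IL-psum (suc k) []           = z≤n
IL-psum (suc k) (row h _ il) = +-mono-≤ h (IL-psum k il)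

-- Beyond row k + 1 the rows of ν are bounded by those of μ beyond row k. So the first k + 1 rows of
-- ν hold all the rest, which amounts to at least the first k rows of μ and all ℓ new cells.
IL-shift : ∀ {A μ ν ℓ} k → IL A μ ν → sum ν ≡ sum μ + ℓ → ℓ + psum k μ ≤ psum (suc k) ν
IL-shift {ℓ = ℓ} k [] e = ≤-reflexive (trans (cong (_+ psum k []) (sym e)) (psum-[] k))
IL-shift {ℓ = ℓ} zero (row {A} {a} {w} {μ} {ν} h _ il) e = subst₂ _≤_ (sym (ℕₚ.+-identityʳ ℓ)) (sym (ℕₚ.+-identityʳ w))
  (ℕₚ.+-cancelˡ-≤ (a + sum μ) ℓ w (≤-trans (≤-reflexive (sym e)) (≤-trans (+-monoʳ-≤ w (IL-sum il)) (≤-reflexive (ℕₚ.+-comm w (a + sum μ))))))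
IL-shift {ℓ = ℓ} (suc k) (row {A} {a} {w} {μ} {ν} h _ il) e = ≤-trans (≤-reflexive (begin
  ℓ + (a + psum k μ)   ≡⟨ trans (+-exchange ℓ a (psum k μ)) (sym (ℕₚ.+-assoc a ℓ (psum k μ))) ⟩
  (a + ℓ) + psum k μ   ≡⟨ cong (_+ psum k μ) tot ⟩
  (w + ℓ′) + psum k μ  ≡⟨ ℕₚ.+-assoc w ℓ′ (psum k μ) ⟩
  w + (ℓ′ + psum k μ) ∎)) (+-monoʳ-≤ w (IL-shift k il s))
  where
  ℓ′ = sum ν ∸ sum μ
  s : sum ν ≡ sum μ + ℓ′
  s = sym (m+[n∸m]≡n (IL-mono il))
  tot : a + ℓ ≡ w + ℓ′
  tot = +-cancelʳ-≡ (sum μ) (a + ℓ) (w + ℓ′) (trans (sym (+-swapʳ a (sum μ) ℓ)) (trans (sym e) (trans (cong (w +_) s) (+-rotate w (sum μ) ℓ′))))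

insert-psum : ∀ z m k → psum (suc k) (insertDesc z m) ≡ psum (suc k) m ⊎ psum (suc k) (insertDesc z m) ≡ z + psum k m
insert-psum z [] k = inj₂ (cong (z +_) (trans (psum-[] k) (sym (psum-[] k))))
insert-psum z (y ∷ m) k with y ≤ᵇ z
... | true = inj₂ refl
insert-psum z (y ∷ m) zero    | false = inj₁ refl
insert-psum z (y ∷ m) (suc k) | false with insert-psum z m k
... | inj₁ e = inj₁ (cong (y +_) e)
... | inj₂ e = inj₂ (trans (cong (y +_) e) (+-exchange y z (psum k m)))

_⊑_ : List ℕ → List ℕ → Set
x ⊑ y = ∀ k → psum k x ≤ psum k y

-- After insertion of z a partial sum is either unchanged or z plus the previous one; `IL-psum` and
-- `IL-shift` bound the two cases.
⊑-insert : ∀ {A x μ ν z} → x ⊑ μ → IL A μ ν → sum ν ≡ sum μ + z → insertDesc z x ⊑ ν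
⊑-insert h il e zero = z≤n
⊑-insert {x = x} {z = z} h il e (suc k) with insert-psum z x k
... | inj₁ q = ≤-trans (≤-reflexive q) (≤-trans (h (suc k)) (IL-psum (suc k) il))
... | inj₂ q = ≤-trans (≤-reflexive q) (≤-trans (+-monoʳ-≤ z (h k)) (IL-shift k il e))

insert-comm : ∀ x y l → insertDesc x (insertDesc y l) ≡ insertDesc y (insertDesc x l)
insert-comm x y [] with ℕₚ.<-cmp x y
... | tri< x<y _ _ = trans (insertDesc-> x y [] x<y) (sym (insertDesc-≤ y x [] (<⇒≤ x<y)))
... | tri≈ _ refl _ = refl
... | tri> _ _ y<x = trans (insertDesc-≤ x y [] (<⇒≤ y<x)) (sym (insertDesc-> y x [] y<x))
insert-comm x y (z ∷ l) with z ≤? y | z ≤? x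
... | yes z≤y | yes z≤x = trans (cong (insertDesc x) (insertDesc-≤ y z l z≤y)) (trans both (sym (cong (insertDesc y) (insertDesc-≤ x z l z≤x))))
  where
  both : insertDesc x (y ∷ z ∷ l) ≡ insertDesc y (x ∷ z ∷ l)
  both with ℕₚ.<-cmp x y
  ... | tri< x<y _ _ = trans (insertDesc-> x y (z ∷ l) x<y) (trans (cong (y ∷_) (insertDesc-≤ x z l z≤x)) (sym (insertDesc-≤ y x (z ∷ l) (<⇒≤ x<y))))
  ... | tri≈ _ refl _ = refl
  ... | tri> _ _ y<x = trans (insertDesc-≤ x y (z ∷ l) (<⇒≤ y<x)) (sym (trans (insertDesc-> y x (z ∷ l) y<x) (cong (x ∷_) (insertDesc-≤ y z l z≤y))))
... | yes z≤y | no z≰x = trans (cong (insertDesc x) (insertDesc-≤ y z l z≤y)) (trans (insertDesc-> x y (z ∷ l) (<-≤-trans (≰⇒> z≰x) z≤y))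
    (trans (cong (y ∷_) (insertDesc-> x z l (≰⇒> z≰x))) (sym (trans (cong (insertDesc y) (insertDesc-> x z l (≰⇒> z≰x))) (insertDesc-≤ y z (insertDesc x l) z≤y)))))
... | no z≰y | yes z≤x = trans (cong (insertDesc x) (insertDesc-> y z l (≰⇒> z≰y))) (trans (insertDesc-≤ x z (insertDesc y l) z≤x)
    (sym (trans (cong (insertDesc y) (insertDesc-≤ x z l z≤x)) (trans (insertDesc-> y x (z ∷ l) (<-≤-trans (≰⇒> z≰y) z≤x)) (cong (x ∷_) (insertDesc-> y z l (≰⇒> z≰y)))))))
... | no z≰y | no z≰x = trans (cong (insertDesc x) (insertDesc-> y z l (≰⇒> z≰y))) (trans (insertDesc-> x z (insertDesc y l) (≰⇒> z≰x))
    (trans (cong (z ∷_) (insert-comm x y l)) (sym (trans (cong (insertDesc y) (insertDesc-> x z l (≰⇒> z≰x))) (insertDesc-> y z (insertDesc x l) (≰⇒> z≰y))))))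

sort-++-∷ : ∀ a z s → sortDesc (a ++ z ∷ s) ≡ insertDesc z (sortDesc (a ++ s))
sort-++-∷ []      z s = refl
sort-++-∷ (x ∷ a) z s = trans (cong (insertDesc x) (sort-++-∷ a z s)) (insert-comm x z (sortDesc (a ++ s)))

pieri→IL : ∀ A D Λ Ω → Valid A Λ → pieri A D Λ Ω ≡ true → IL A (lens Λ) (lens Ω)
pieri→IL A D [] [] _ _ = []
pieri→IL A D ((a , f) ∷ Λ) ((w , h) ∷ Ω) (b ∷ v) e =
  let e₁ , e₂ = ∧-split {okc f D h} e
      e₃ , e₄ = ∧-split {(lowP A a f D h ≤ᵇ w) ∧ (w <ᵇ upP A f D h)} e₂
      p , q = ∧-split {lowP A a f D h ≤ᵇ w} e₃
  in row (≤-trans (lowP≥ A a f D h b) (≤ᵇ→≤ {lowP A a f D h} p)) (≤-pred (≤-trans (<ᵇ→< {w} q) (upP≤ A f D h)))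
         (pieri→IL a (nextc f D h) Λ Ω v e₄)

plus0 : ∀ {m n} → m + 0 ≤ n → m ≤ n
plus0 {m} {n} = subst (_≤ n) (ℕₚ.+-identityʳ m)
plus1 : ∀ {m n} → m + 1 ≤ n → suc m ≤ n
plus1 {m} {n} = subst (_≤ n) (ℕₚ.+-comm m 1)

bit : Bool → ℕ
bit true  = 1
bit false = 0

-- A circle in transit belongs to the row above, which in Λ^⊛ is longer by one; hence the bound A +
-- bit D ≤ A′.
pieri→ILc : ∀ A A′ D Λ Ω → A + bit D ≤ A′ → Valid A Λ → pieri A D Λ Ω ≡ true → IL A′ (circs Λ) (circs Ω)
pieri→ILc A A′ D [] [] _ _ _ = []
pieri→ILc A A′ D ((a , f) ∷ Λ) ((w , h) ∷ Ω) le (b ∷ v) e =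
  let e₁ , e₂ = ∧-split {okc f D h} e
      e₃ , e₄ = ∧-split {(lowP A a f D h ≤ᵇ w) ∧ (w <ᵇ upP A f D h)} e₂
      p , q = ∧-split {lowP A a f D h ≤ᵇ w} e₃
  in go f D h b le e₁ (≤ᵇ→≤ {lowP A a f D h} p) (<ᵇ→< {w} q) e₄
  where
  a0 : a + 0 ≤ a
  a0 = ≤-reflexive (ℕₚ.+-identityʳ a)
  a1 : a + 1 ≤ suc a
  a1 = ≤-reflexive (ℕₚ.+-comm a 1)
  go : ∀ f D h → below a f A → A + bit D ≤ A′ → okc f D h ≡ true → lowP A a f D h ≤ w → w < upP A f D h →
       pieri a (nextc f D h) Λ Ω ≡ true → IL A′ (circs ((a , f) ∷ Λ)) (circs ((w , h) ∷ Ω))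
  go false false false b le _ l u r = row l (≤-trans (≤-pred u) (plus0 le)) (pieri→ILc a a false Λ Ω a0 v r)
  go false true  true  b le _ l u r = row (m≤n⇒m≤1+n (≤-trans b l)) (≤-trans u (plus1 le)) (pieri→ILc a a false Λ Ω a0 v r)
  go true  false true  b le _ l u r = row (s≤s l) (≤-trans u (plus0 le)) (pieri→ILc a (suc a) false Λ Ω (m≤n⇒m≤1+n a0) v r)
  go true  false false b le _ l u r = row l (≤-trans (≤-pred u) (plus0 le)) (pieri→ILc a (suc a) true Λ Ω a1 v r)
  go true  true  true  b le _ l u r = row (s≤s (≤-trans (<⇒≤ b) l)) (≤-trans u (plus1 le)) (pieri→ILc a (suc a) true Λ Ω a1 v r)

branch→IL : ∀ C C′ E Γ Ω → C + bit E ≤ C′ → Valid C Γ → branch C E Γ Ω ≡ true → IL C (lens Γ) (lens Ω) × IL C′ (circs Γ) (circs Ω)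
branch→IL C C′ E [] [] _ _ _ = [] , []
branch→IL C C′ E ((c , g) ∷ Γ) ((w , h) ∷ Ω) le (b ∷ v) e =
  let e₁ , e₂ = ∧-split {okc g E h} e
      e₃ , e₄ = ∧-split {(lowB c g E h ≤ᵇ w) ∧ (w <ᵇ upB C c g E h)} e₂
      p , q = ∧-split {lowB c g E h ≤ᵇ w} e₃
  in go g E h b le e₁ (≤ᵇ→≤ {lowB c g E h} p) (<ᵇ→< {w} q) e₄
  where
  c0 : c + 0 ≤ c
  c0 = ≤-reflexive (ℕₚ.+-identityʳ c)
  c1 : c + 1 ≤ suc c
  c1 = ≤-reflexive (ℕₚ.+-comm c 1)
  go : ∀ g E h → below c g C → C + bit E ≤ C′ → okc g E h ≡ true → lowB c g E h ≤ w → w < upB C c g E h →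
       branch c (nextc g E h) Γ Ω ≡ true → IL C (lens ((c , g) ∷ Γ)) (lens ((w , h) ∷ Ω)) × IL C′ (circs ((c , g) ∷ Γ)) (circs ((w , h) ∷ Ω))
  go false false false b le _ l u r = let x , y = branch→IL c c false Γ Ω c0 v r in
    row l (≤-pred u) x , row l (≤-trans (≤-pred u) (plus0 le)) y
  go false true  true  b le _ l u r = let x , y = branch→IL c c false Γ Ω c0 v r in
    row l (≤-pred u) x , row (m≤n⇒m≤1+n l) (≤-trans u (plus1 le)) y
  go true  false true  b le _ l u r = let x , y = branch→IL c (suc c) false Γ Ω (m≤n⇒m≤1+n c0) v r in
    row l (≤-trans (≤-pred u) (<⇒≤ b)) x , row (s≤s l) (≤-trans u (≤-trans b (plus0 le))) y
  go true  false false b le _ l u r = let x , y = branch→IL c (suc c) true Γ Ω c1 v r in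
    row (<⇒≤ l) (≤-pred u) x , row l (≤-trans (≤-pred u) (plus0 le)) y
  go true  true  true  b le _ l u r = let x , y = branch→IL c (suc c) true Γ Ω c1 v r in
    row (<⇒≤ l) (≤-pred u) x , row (m≤n⇒m≤1+n l) (≤-trans u (plus1 le)) y

ncirc : List Row → ℕ
ncirc []            = 0
ncirc ((_ , f) ∷ Λ) = bit f + ncirc Λ

sum-circs : ∀ Λ → sum (circs Λ) ≡ size Λ + ncirc Λ
sum-circs [] = refl
sum-circs ((a , true) ∷ Λ) = trans (cong (suc a +_) (sum-circs Λ)) (ar a (size Λ) (ncirc Λ))
  where
  ar : ∀ p q r → suc p + (q + r) ≡ (p + q) + suc r
  ar = solve-∀
sum-circs ((a , false) ∷ Λ) = trans (cong (a +_) (sum-circs Λ)) (sym (ℕₚ.+-assoc a (size Λ) (ncirc Λ)))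

branch-ncirc : ∀ C E Γ Ω → branch C E Γ Ω ≡ true → ncirc Ω ≡ ncirc Γ + bit E
branch-ncirc C false [] [] _ = refl
branch-ncirc C true  [] [] ()
branch-ncirc C E [] (_ ∷ _) ()
branch-ncirc C E (_ ∷ _) [] ()
branch-ncirc C E ((c , g) ∷ Γ) ((w , h) ∷ Ω) e = go g E h (proj₁ e₁) (branch-ncirc c (nextc g E h) Γ Ω (proj₂ (∧-split {(lowB c g E h ≤ᵇ w) ∧ (w <ᵇ upB C c g E h)} (proj₂ e₁))))
  where
  e₁ = ∧-split {okc g E h} e
  go : ∀ g E h → okc g E h ≡ true → ncirc Ω ≡ ncirc Γ + bit (nextc g E h) → bit h + ncirc Ω ≡ (bit g + ncirc Γ) + bit E
  go false false false _ q = q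
  go false true  true  _ q = trans (cong suc (trans q (ℕₚ.+-identityʳ _))) (ℕₚ.+-comm 1 (ncirc Γ))
  go true  false true  _ q = cong suc q
  go true  false false _ q = trans q (trans (ℕₚ.+-comm (ncirc Γ) 1) (cong suc (sym (ℕₚ.+-identityʳ _))))
  go true  true  true  _ q = cong suc q

ncirc-pad : ∀ Γ → ncirc (pad Γ) ≡ ncirc Γ
ncirc-pad []            = refl
ncirc-pad ((_ , f) ∷ Γ) = cong (bit f +_) (ncirc-pad Γ)

⊑-++ : ∀ x y → x ⊑ (x ++ y)
⊑-++ x       y zero    = z≤n
⊑-++ []      y (suc k) = z≤n
⊑-++ (a ∷ x) y (suc k) = +-monoʳ-≤ a (⊑-++ x y k)

⊑-trans : ∀ {x y z} → x ⊑ y → y ⊑ z → x ⊑ z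
⊑-trans p q k = ≤-trans (p k) (q k)

⊑-refl : ∀ x → x ⊑ x
⊑-refl x k = ≤-refl

∑-nonzero : ∀ {A : Set} (xs : List A) f → ∑ xs f ≢ 0ℚ → ∃[ x ] (x ∈ xs × f x ≢ 0ℚ)
∑-nonzero []       f h = ⊥-elim (h refl)
∑-nonzero (x ∷ xs) f h with f x ℚₚ.≟ 0ℚ
... | no ne = x , here refl , ne
... | yes e = let y , m , q = ∑-nonzero xs f (λ z → h (trans (cong₂ _+ℚ_ e z) 0+0)) in y , there m , q

when-nonzero : ∀ b {x} → when b x ≢ 0ℚ → b ≡ true × x ≢ 0ℚ
when-nonzero true  h = refl , h
when-nonzero false h = ⊥-elim (h refl)

insert-suc : ∀ x l → map suc (insertDesc x l) ≡ insertDesc (suc x) (map suc l)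
insert-suc x [] = refl
insert-suc x (y ∷ l) with y ≤? x
... | yes h = trans (cong (map suc) (insertDesc-≤ x y l h)) (sym (insertDesc-≤ (suc x) (suc y) (map suc l) (s≤s h)))
... | no h = trans (cong (map suc) (insertDesc-> x y l (≰⇒> h))) (trans (cong (suc y ∷_) (insert-suc x l)) (sym (insertDesc-> (suc x) (suc y) (map suc l) (s≤s (≰⇒> h)))))

sort-suc : ∀ l → map suc (sortDesc l) ≡ sortDesc (map suc l)
sort-suc []      = refl
sort-suc (x ∷ l) = trans (insert-suc x (sortDesc l)) (cong (insertDesc (suc x)) (sort-suc l))

circs-allCirc : ∀ Λ → allCirc Λ ≡ true → circs Λ ≡ map suc (lens Λ)
circs-allCirc [] _ = refl
circs-allCirc ((a , true) ∷ Λ) e = cong (suc a ∷_) (circs-allCirc Λ e)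

-- Each bosonic variable inserts its exponent into the sorted list and adds an interlacing strip of
-- the same size, to Λ^* as well as to Λ^⊛. At the end of the chain the alternant gives equality.
schur-dominant : ∀ M e s Λ → Valid M Λ → schur M e s Λ ≢ 0ℚ → sortDesc (e ++ s) ⊑ lens Λ × sortDesc (map suc e ++ s) ⊑ circs Λ
schur-dominant M e [] Λ v ne with when-nonzero (allCirc Λ) ne
... | c , ne′ with when-nonzero (eqL (sortDesc e) (lens Λ)) (λ z → ne′ (trans (alt-sort (allCirc-Strict Λ v c) e) z))
... | q , _ = subst₂ _⊑_ (cong sortDesc (sym (Listₚ.++-identityʳ e))) refl (subst (_⊑ lens Λ) (sym eq) (⊑-refl (lens Λ))) ,
  subst₂ _⊑_ (cong sortDesc (sym (Listₚ.++-identityʳ (map suc e)))) refl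
    (subst (_⊑ circs Λ) (trans (circs-allCirc Λ c) (trans (cong (map suc) (sym eq)) (sort-suc e))) (⊑-refl (circs Λ)))
  where
  eq : sortDesc e ≡ lens Λ
  eq = eqL→≡ (sortDesc e) (lens Λ) q
schur-dominant M e (z ∷ s) Λ v ne with ∑-nonzero (box M (length Λ ∸ 1)) _ ne
... | Γ , _ , ne₁ with when-nonzero (validᵇ M Γ ∧ branch M false (pad Γ) Λ) ne₁
... | vb , ne₂ with when-nonzero (size Λ ≡ᵇ size Γ + z) ne₂ | ∧-split {validᵇ M Γ} vb
... | sz , ne₃ | vΓ , br =
  let v′ = validᵇ→Valid M Γ vΓ
      d₁ , d₂ = schur-dominant M e s Γ v′ ne₃
      i₁ , i₂ = branch→IL M (M + 0) false (pad Γ) Λ ≤-refl (Valid-pad v′) br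
  in subst (_⊑ lens Λ) (sym (sort-++-∷ e z s)) (⊑-insert (⊑-trans d₁ (subst (lens Γ ⊑_) (sym (Listₚ.map-++ proj₁ Γ _)) (⊑-++ (lens Γ) _))) i₁ sl) ,
     subst (_⊑ circs Λ) (sym (sort-++-∷ (map suc e) z s)) (⊑-insert (⊑-trans d₂ (subst (circs Γ ⊑_) (sym (Listₚ.map-++ clen Γ _)) (⊑-++ (circs Γ) _))) i₂ sc)
  where
  sl : sum (lens Λ) ≡ sum (lens (pad Γ)) + z
  sl = trans (sym (size-lens Λ)) (trans (≡ᵇ→≡ {size Λ} sz) (cong (_+ z) (trans (sym (size-pad Γ)) (size-lens (pad Γ)))))
  sc : sum (circs Λ) ≡ sum (circs (pad Γ)) + z
  sc = trans (sum-circs Λ) (trans (cong₂ _+_ (≡ᵇ→≡ {size Λ} sz) (trans (branch-ncirc M false (pad Γ) Λ br) (trans (ℕₚ.+-identityʳ _) (ncirc-pad Γ))))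
    (trans (+-swapʳ (size Γ) z (ncirc Γ)) (cong (_+ z) (sym (trans (sum-circs (pad Γ)) (cong₂ _+_ (size-pad Γ) (ncirc-pad Γ)))))))

psum-zeros : ∀ (f : Row → ℕ) → f (0 , false) ≡ 0 → ∀ Λ n k → psum k (map f (Λ ++ zeros n)) ≡ psum k (map f Λ)
psum-zeros f f0 Λ       n       zero    = refl
psum-zeros f f0 []      zero    (suc k) = refl
psum-zeros f f0 []      (suc n) (suc k) = cong₂ _+_ f0 (trans (psum-zeros f f0 [] n k) (psum-[] k))
psum-zeros f f0 (r ∷ Λ) n       (suc k) = cong (f r +_) (psum-zeros f f0 Λ n k)

star-psum : ∀ {Λ} → IsSP Λ → ∀ n k → psum k (lens (rows Λ ++ zeros n)) ≡ psum k (star Λ)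
star-psum {a , s} i n k = trans (psum-zeros proj₁ refl (rows (a , s)) n k) (cong (psum k) (lens-rows a s (IsSP.desc i)))

circ-psum : ∀ {Λ} → IsSP Λ → ∀ n k → psum k (circs (rows Λ ++ zeros n)) ≡ psum k (circ Λ)
circ-psum {a , s} i n k = trans (psum-zeros clen refl (rows (a , s)) n k) (cong (psum k) (circs-rows a s (IsSP.desc i)))

Dominates : SPart → List ℕ → List ℕ → Set
Dominates Λ e s = sortDesc (e ++ s) ⊑ star Λ × sortDesc (map suc e ++ s) ⊑ circ Λ

FS-dominant : ∀ M Λ e s → IsSP Λ → bdeg Λ < M → FS M Λ e s ≢ 0ℚ → Dominates Λ e s
FS-dominant M Λ e s i b ne with when-nonzero (length (rows Λ) ≤ᵇ length e + length s) ne
... | _ , ne′ = let p , q = schur-dominant M e s (padTo (length e + length s) (rows Λ)) (padded-Valid {M} {length e + length s} i b) ne′ in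
  (λ k → ≤-trans (p k) (≤-reflexive (star-psum i _ k))) , (λ k → ≤-trans (q k) (≤-reflexive (circ-psum i _ k)))

-- The counterpart of `schur-dominant` for Pieri strips. It makes the expansion of h_μ times an
-- alternant over the F_Γ triangular upwards.
admissible-dominant : ∀ Λ Ω ℓ e s → IsSP Λ → IsSP Ω → Admissible Λ ℓ Ω → Dominates Λ e s → Dominates Ω e (ℓ ∷ s)
admissible-dominant Λ Ω ℓ e s iΛ iΩ ad (d₁ , d₂) =
  (λ k → subst₂ _≤_ (cong (psum k) (sym (sort-++-∷ e ℓ s))) (star-psum iΩ nΩ k)
    (⊑-insert {M} {sortDesc (e ++ s)} (λ j → ≤-trans (d₁ j) (≤-reflexive (sym (star-psum iΛ nΛ j)))) (pieri→IL M false u v vu p) sl k)) ,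
  (λ k → subst₂ _≤_ (cong (psum k) (sym (sort-++-∷ (map suc e) ℓ s))) (circ-psum iΩ nΩ k)
    (⊑-insert {M + 0} {sortDesc (map suc e ++ s)} (λ j → ≤-trans (d₂ j) (≤-reflexive (sym (circ-psum iΛ nΛ j)))) (pieri→ILc M (M + 0) false u v ≤-refl vu p) sc k))
  where
  N = length (rows Λ) + length (rows Ω)
  M = suc (bdeg Λ + bdeg Ω)
  bΛ : bdeg Λ < M
  bΛ = s≤s (m≤m+n (bdeg Λ) (bdeg Ω))
  bΩ : bdeg Ω < M
  bΩ = s≤s (m≤n+m (bdeg Ω) (bdeg Λ))
  nΛ = N ∸ length (rows Λ)
  nΩ = N ∸ length (rows Ω)
  open AdmissiblePieri {M} {N} {Λ} {Ω} iΛ iΩ bΛ bΩ (m≤m+n (length (rows Λ)) (length (rows Ω))) (m≤n+m (length (rows Ω)) (length (rows Λ)))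
  vu : Valid M u
  vu = padded-Valid iΛ bΛ
  p : pieri M false u v ≡ true
  p = admissible→pieri {ℓ} ad
  sz : size v ≡ size u + ℓ
  sz = trans (bdeg-size Ω nΩ) (trans (admissible-bdeg Λ ℓ Ω ad) (cong (_+ ℓ) (sym (bdeg-size Λ nΛ))))
  sl : sum (lens v) ≡ sum (lens u) + ℓ
  sl = trans (sym (size-lens v)) (trans sz (cong (_+ ℓ) (size-lens u)))
  nc : ∀ Λ → ncirc Λ ≡ length (ca Λ)
  nc [] = refl
  nc ((_ , true) ∷ Λ) = cong suc (nc Λ)
  nc ((_ , false) ∷ Λ) = nc Λ
  nc′ : ∀ {Λ} → IsSP Λ → ∀ n → ncirc (rows Λ ++ zeros n) ≡ fdeg Λ
  nc′ {Λ} i n = trans (nc (rows Λ ++ zeros n)) (cong (length ∘ proj₁) (trans (toSP-zeros (rows Λ) n) (toSP-rows i)))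
  sc : sum (circs v) ≡ sum (circs u) + ℓ
  sc = trans (sum-circs v) (trans (cong₂ _+_ sz (trans (nc′ iΩ nΩ) (trans (proj₁ (proj₂ ad)) (sym (nc′ iΛ nΛ)))))
    (trans (+-swapʳ (size u) ℓ (ncirc u)) (cong (_+ ℓ) (sym (sum-circs u)))))

-- The leading coefficient

-- A new first row moves every row of Γ down by one place. As a branching strip this means that
-- every circle drops to the next row; the flag `h` of the new row is the carry from above.
branch-shift : ∀ C h z Γ → z ≤ C → Valid z Γ → branch C h (pad Γ) ((z , h) ∷ Γ) ≡ true
branch-shift C h z [] z≤C _ = ∧-intro (ok h) (∧-intro (<→<ᵇ (up h)) refl)
  where
  ok : ∀ h → okc false h h ≡ true
  ok true = refl
  ok false = refl
  up : ∀ h → z < upB C 0 false h h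
  up h = s≤s z≤C
branch-shift C h z ((c , g) ∷ Γ) z≤C (b ∷ v) = go g h b
  where
  go : ∀ g h → below c g z → branch C h ((c , g) ∷ pad Γ) ((z , h) ∷ (c , g) ∷ Γ) ≡ true
  go false false b = ∧-intro (∧-intro (≤→≤ᵇ b) (<→<ᵇ (s≤s z≤C))) (branch-shift c false c Γ ≤-refl v)
  go false true  b = ∧-intro (∧-intro (≤→≤ᵇ b) (<→<ᵇ (s≤s z≤C))) (branch-shift c false c Γ ≤-refl v)
  go true  false b = ∧-intro (∧-intro (<→<ᵇ b) (<→<ᵇ (s≤s z≤C))) (branch-shift c true c Γ ≤-refl v)
  go true  true  b = ∧-intro (∧-intro (<→<ᵇ b) (<→<ᵇ (s≤s z≤C))) (branch-shift c true c Γ ≤-refl v)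

-- Above the row of the part `z` nothing changes, and below it the rows are shifted by one; this is
-- the strip that gives the leading coefficient.
record Split (M : ℕ) (a : List ℕ) (z : ℕ) (s : List ℕ) : Set where
  field
    X Y : List Row
    with-z : rows (a , z ∷ s) ≡ X ++ (z , false) ∷ Y
    sans-z : rows (a , s) ≡ X ++ Y
    strip  : branch M false (pad (X ++ Y)) (X ++ (z , false) ∷ Y) ≡ true

split : ∀ M a z s → IsSP (a , z ∷ s) → (∀ x → x ∈ a → x < M) → z ≤ M → Split M a z s
split M [] z s (mkSP p q r) h z≤M = record { X = [] ; Y = bosons s ; with-z = refl ; sans-z = refl
  ; strip = branch-shift M false z (bosons s) z≤M (bosons-Valid (Desc-tail q) (λ x → Desc-head q)) }
split M (x ∷ a) z s i@(mkSP p q r) h z≤M with z ≤? x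
... | yes z≤x = record { X = (x , true) ∷ S.X ; Y = S.Y
  ; with-z = trans (insRow-top x _ (λ r m → Valid-lens vz r m)) (cong ((x , true) ∷_) S.with-z)
  ; sans-z = trans (insRow-top x _ (λ r m → Valid-lens vs r m)) (cong ((x , true) ∷_) S.sans-z)
  ; strip = ∧-intro (∧-intro (≤→≤ᵇ {x} ≤-refl) (<→<ᵇ {x} ≤-refl)) S.strip }
  where
  ia : IsSP (a , z ∷ s)
  ia = mkSP (Strict-tail p) q r
  vz : Valid x (rows (a , z ∷ s))
  vz = rows-Valid ia (λ y → Strict-head p) (λ { y (here refl) → z≤x ; y (there m) → ≤-trans (Desc-head q m) z≤x })
  vs : Valid x (rows (a , s))
  vs = rows-Valid (mkSP (Strict-tail p) (Desc-tail q) (λ y m → r y (there m))) (λ y → Strict-head p) (λ y m → ≤-trans (Desc-head q m) z≤x)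
  module S = Split (split x a z s ia (λ y → Strict-head p) z≤x)
... | no z≰x = record { X = [] ; Y = rows (x ∷ a , s) ; with-z = rows-boson (x ∷ a) z s a<z ; sans-z = refl
  ; strip = branch-shift M false z (rows (x ∷ a , s)) z≤M (rows-Valid (mkSP p (Desc-tail q) (λ y m → r y (there m))) a<z (λ y → Desc-head q)) }
  where
  a<z : ∀ y → y ∈ x ∷ a → y < z
  a<z y (here refl) = ≰⇒> z≰x
  a<z y (there m) = <-trans (Strict-head p m) (≰⇒> z≰x)

IL-head : ∀ {A μ y ν} → IL A μ (y ∷ ν) → y ≤ A
IL-head (row _ h _) = h

sum-squeeze : ∀ {A} u z t → IL A (u ++ 0 ∷ []) (z ∷ t) → length u ≡ length t → sum u ≡ sum t → u ≡ t
sum-squeeze [] z [] il le se = refl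
sum-squeeze (x ∷ u) z (y ∷ t) (row _ _ il) le se = eq (suc-injective le)
  where
  y≤x : y ≤ x
  y≤x = IL-head il
  tail≤ : ∀ {A} u z t → IL A (u ++ 0 ∷ []) (z ∷ t) → length u ≡ length t → sum t ≤ sum u
  tail≤ [] z [] il le = z≤n
  tail≤ (x ∷ u) z (y ∷ t) (row _ _ il) le = +-mono-≤ (IL-head il) (tail≤ u y t il (suc-injective le))
  eq : length u ≡ length t → x ∷ u ≡ y ∷ t
  eq le′ with x ≟ y
  ... | yes refl = cong (x ∷_) (sum-squeeze u x t il le′ (+-cancelˡ-≡ x (sum u) (sum t) se))
  ... | no ne = ⊥-elim (<-irrefl (sym se) (+-mono-<-≤ (≤∧≢⇒< y≤x (ne ∘ sym)) (tail≤ u y t il le′)))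

-- In the rows before `z` interlacing makes `u` at most `p`, and dominance reverses this for the
-- sum. In the rows after, interlacing makes `u` at least `t`, and the total reverses it. So
-- equality holds everywhere.
squeeze : ∀ {A} u p z t → IL A (u ++ 0 ∷ []) (p ++ z ∷ t) → length u ≡ length (p ++ t) → sum u ≡ sum (p ++ t) →
  psum (length p) (p ++ t) ≤ psum (length p) u → u ≡ p ++ t
squeeze u [] z t il le se d = sum-squeeze u z t il le se
squeeze (x ∷ u) (y ∷ p) z t (row x≤y _ il) le se d with x ≟ y
... | yes refl = cong (x ∷_) (squeeze u p z t il (suc-injective le) (+-cancelˡ-≡ x (sum u) (sum (p ++ t)) se) (ℕₚ.+-cancelˡ-≤ x _ _ d))
... | no ne = ⊥-elim (<⇒≱ (+-mono-<-≤ (≤∧≢⇒< x≤y ne) (prefix u p il (suc-injective le))) d)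
  where
  prefix : ∀ {A} u p → IL A (u ++ 0 ∷ []) (p ++ z ∷ t) → length u ≡ length (p ++ t) → psum (length p) u ≤ psum (length p) (p ++ t)
  prefix u [] il le = z≤n
  prefix [] (_ ∷ _) il ()
  prefix (x ∷ u) (y ∷ p) (row h _ il) le = +-mono-≤ h (prefix u p il (suc-injective le))

rows-determined : ∀ Γ Δ → lens Γ ≡ lens Δ → circs Γ ≡ circs Δ → Γ ≡ Δ
rows-determined [] [] _ _ = refl
rows-determined ((a , f) ∷ Γ) ((b , g) ∷ Δ) e₁ e₂ with Listₚ.∷-injective e₁ | Listₚ.∷-injective e₂
... | refl , e₃ | q , e₄ = cong₂ (λ x y → (a , x) ∷ y) (fl f g q) (rows-determined Γ Δ e₃ e₄)
  where
  fl : ∀ f g → clen (a , f) ≡ clen (a , g) → f ≡ g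
  fl true true _ = refl
  fl false false _ = refl
  fl true false q = ⊥-elim (<-irrefl (sym q) ≤-refl)
  fl false true q = ⊥-elim (<-irrefl q ≤-refl)

Strict→Desc : ∀ {l} → Strict l → Desc l
Strict→Desc []      = []
Strict→Desc [ x ]   = [ x ]
Strict→Desc (h ∷ s) = <⇒≤ h ∷ Strict→Desc s

rows-circled : ∀ {a} → Strict a → rows (a , []) ≡ circled a
rows-circled {[]} s = refl
rows-circled {x ∷ a} s = trans (cong (insRow x) (rows-circled (Strict-tail s))) (insRow-top x (circled a) (λ r m → h r m))
  where
  h : ∀ r → r ∈ circled a → proj₁ r ≤ x
  h r m with ∈ₚ.∈-map⁻ (_, true) m
  ... | y , y∈ , refl = <⇒≤ (Strict-head s y∈)

-- Only the diagram with the part z removed contributes to the sum over Γ: `squeeze` applied to Λ^*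
-- determines the row lengths, and applied to Λ^⊛ it determines the circles.
schur-leading : ∀ M a s → IsSP (a , s) → bdeg (a , s) < M → schur M a s (rows (a , s)) ≡ 1ℚ
schur-leading M a [] (mkSP p _ _) b = trans (cong₂ (λ r l → when r (alt l a)) (trans (cong allCirc (rows-circled p)) (allCirc-circled a))
  (trans (cong lens (rows-circled p)) (lens-circled a))) (trans (alt-Desc p (Strict→Desc p)) (cong (λ r → when r 1ℚ) (eqL-refl a)))
schur-leading M a (z ∷ s) i@(mkSP p q r) b = trans
  (cong (λ k → ∑ (box M (k ∸ 1)) term) lenΛ)
  (trans (∑-single Γ₀ (box-Unique M (length a + length s)) Γ₀∈ others (_≟Rows Γ₀))
  (trans (cong (λ c → when c (when (size Λ ≡ᵇ size Γ₀ + z) (schur M a s Γ₀))) (∧-intro (Valid→validᵇ v₀) strip₀))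
  (trans (cong (λ c → when c (schur M a s Γ₀)) (≡→≡ᵇ {size Λ} size₀)) (schur-leading M a s i₀ b₀))))
  where
  Λ = rows (a , z ∷ s)
  Γ₀ = rows (a , s)
  i₀ : IsSP (a , s)
  i₀ = mkSP p (Desc-tail q) (λ y m → r y (there m))
  b₀ : bdeg (a , s) < M
  b₀ = ≤-<-trans (+-monoʳ-≤ (sum a) (m≤n+m (sum s) z)) b
  size₀ : size Λ ≡ size Γ₀ + z
  size₀ = trans (size-rows a (z ∷ s)) (trans (+-rotate (sum a) z (sum s)) (cong (_+ z) (sym (size-rows a s))))
  lenΛ : length Λ ≡ suc (length a + length s)
  lenΛ = trans (length-rows a (z ∷ s)) (+-suc (length a) (length s))
  v₀ : Valid M Γ₀
  v₀ = rows-Valid i₀ (λ y m → ≤-<-trans (≤-trans (∈-sum a m) (m≤m+n (sum a) (sum s))) b₀)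
                     (λ y m → <⇒≤ (≤-<-trans (≤-trans (∈-sum s m) (m≤n+m (sum s) (sum a))) b₀))
  module S = Split (split M a z s i (λ y m → ≤-<-trans (≤-trans (∈-sum a m) (m≤m+n (sum a) (z + sum s))) b)
                     (<⇒≤ (≤-<-trans (≤-trans (m≤m+n z (sum s)) (m≤n+m (z + sum s) (sum a))) b)))
  strip₀ : branch M false (pad Γ₀) Λ ≡ true
  strip₀ = trans (cong₂ (λ g l → branch M false (pad g) l) S.sans-z S.with-z) S.strip
  Γ₀∈ : Γ₀ ∈ box M (length a + length s)
  Γ₀∈ = subst (λ k → Γ₀ ∈ box M k) (length-rows a s) (box-∈ M Γ₀ (Valid-lens v₀))
  term : List Row → ℚ
  term Γ = when (validᵇ M Γ ∧ branch M false (pad Γ) Λ) (when (size Λ ≡ᵇ size Γ + z) (schur M a s Γ))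
  same : ∀ Γ → Γ ∈ box M (length a + length s) → term Γ ≢ 0ℚ → Γ ≡ Γ₀
  same Γ m ne with when-nonzero (validᵇ M Γ ∧ branch M false (pad Γ) Λ) ne
  ... | vb , ne₂ with when-nonzero (size Λ ≡ᵇ size Γ + z) ne₂ | ∧-split {validᵇ M Γ} vb
  ... | sz , ne₃ | vΓ , br = rows-determined Γ Γ₀
    (trans (squeeze (lens Γ) (lens S.X) z (lens S.Y) (subst₂ (IL M) (Listₚ.map-++ proj₁ Γ _) (trans (cong lens S.with-z) (Listₚ.map-++ proj₁ S.X _)) (proj₁ il))
        (trans (Listₚ.length-map proj₁ Γ) (trans len (trans (sym (Listₚ.length-map proj₁ Γ₀)) (cong length lens₀))))
        (trans (sym (size-lens Γ)) (trans size-eq (trans (size-lens Γ₀) (cong sum lens₀))))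
        (subst (λ l → psum (length (lens S.X)) l ≤ psum (length (lens S.X)) (lens Γ)) (trans (sym (lens-rows a s (Desc-tail q))) lens₀) (proj₁ dom (length (lens S.X)))))
      (sym lens₀))
    (trans (squeeze (circs Γ) (circs S.X) z (circs S.Y) (subst₂ (IL (M + 0)) (Listₚ.map-++ clen Γ _) (trans (cong circs S.with-z) (Listₚ.map-++ clen S.X _)) (proj₂ il))
        (trans (Listₚ.length-map clen Γ) (trans len (trans (sym (Listₚ.length-map clen Γ₀)) (cong length circs₀))))
        (trans (sum-circs Γ) (trans (cong₂ _+_ size-eq nc) (trans (sym (sum-circs Γ₀)) (cong sum circs₀))))
        (subst (λ l → psum (length (circs S.X)) l ≤ psum (length (circs S.X)) (circs Γ)) (trans (sym (circs-rows a s (Desc-tail q))) circs₀) (proj₂ dom (length (circs S.X)))))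
      (sym circs₀))
    where
    v′ = validᵇ→Valid M Γ vΓ
    dom = schur-dominant M a s Γ v′ ne₃
    il = branch→IL M (M + 0) false (pad Γ) Λ ≤-refl (Valid-pad v′) br
    lens₀ : lens Γ₀ ≡ lens S.X ++ lens S.Y
    lens₀ = trans (cong lens S.sans-z) (Listₚ.map-++ proj₁ S.X S.Y)
    circs₀ : circs Γ₀ ≡ circs S.X ++ circs S.Y
    circs₀ = trans (cong circs S.sans-z) (Listₚ.map-++ clen S.X S.Y)
    len : length Γ ≡ length Γ₀
    len = trans (box-length M (length a + length s) m) (sym (length-rows a s))
    size-eq : size Γ ≡ size Γ₀
    size-eq = +-cancelʳ-≡ z (size Γ) (size Γ₀) (trans (sym (≡ᵇ→≡ {size Λ} sz)) size₀)
    nc : ncirc Γ ≡ ncirc Γ₀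
    nc = trans (trans (sym (ncirc-pad Γ)) (trans (sym (ℕₚ.+-identityʳ _)) (sym (branch-ncirc M false (pad Γ) Λ br))))
               (trans (branch-ncirc M false (pad Γ₀) Λ strip₀) (trans (ℕₚ.+-identityʳ _) (ncirc-pad Γ₀)))
  others : ∀ Γ → Γ ∈ box M (length a + length s) → Γ ≢ Γ₀ → term Γ ≡ 0ℚ
  others Γ m ne with term Γ ℚₚ.≟ 0ℚ
  ... | yes e = e
  ... | no ne′ = ⊥-elim (ne (same Γ m ne′))

FS-leading : ∀ M Λ → IsSP Λ → bdeg Λ < M → FS M Λ (proj₁ Λ) (proj₂ Λ) ≡ 1ℚ
FS-leading M (a , s) i b = trans (cong (λ c → when c (schur M a s (padTo N (rows (a , s))))) (≤→≤ᵇ (≤-reflexive (length-rows a s))))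
  (trans (cong (schur M a s) (trans (cong (λ k → rows (a , s) ++ zeros k) (trans (cong (N ∸_) (length-rows a s)) (n∸n≡0 N))) (Listₚ.++-identityʳ _))) (schur-leading M a s i b))
  where N = length a + length s

-- Natural numbers as rationals, and inverses

ℕtoℚ-+ : ∀ m n → ℕtoℚ (m + n) ≡ ℕtoℚ m +ℚ ℕtoℚ n
ℕtoℚ-+ m n = ℚₚ.toℚᵘ-injective (ℚᵘₚ.≃-trans (ℚₚ.toℚᵘ-fromℚᵘ (int (m + n))) (ℚᵘₚ.≃-trans
  (ℚᵘ.*≡* {int (m + n)} {int m ℚᵘ.+ int n} (cong (ℤ._* ℤ.+ 1) (sym (cong₂ ℤ._+_ (ℤₚ.*-identityʳ (ℤ.+ m)) (ℤₚ.*-identityʳ (ℤ.+ n))))))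
  (ℚᵘₚ.≃-trans (ℚᵘₚ.+-cong (ℚᵘₚ.≃-sym (ℚₚ.toℚᵘ-fromℚᵘ (int m))) (ℚᵘₚ.≃-sym (ℚₚ.toℚᵘ-fromℚᵘ (int n)))) (ℚᵘₚ.≃-sym (ℚₚ.toℚᵘ-homo-+ (ℕtoℚ m) (ℕtoℚ n))))))
  where
  int : ℕ → ℚᵘ.ℚᵘ
  int k = ℚᵘ.mkℚᵘ (ℤ.+ k) 0

ℕtoℚ-* : ∀ m n → ℕtoℚ (m * n) ≡ ℕtoℚ m *ℚ ℕtoℚ n
ℕtoℚ-* zero    n = sym (ℚₚ.*-zeroˡ (ℕtoℚ n))
ℕtoℚ-* (suc m) n = trans (ℕtoℚ-+ n (m * n)) (trans (cong (ℕtoℚ n +ℚ_) (ℕtoℚ-* m n))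
  (trans (lem (ℕtoℚ n) (ℕtoℚ m)) (cong (_*ℚ ℕtoℚ n) (sym (ℕtoℚ-+ 1 m)))))
  where
  lem : ∀ n m → n +ℚ m *ℚ n ≡ (1ℚ +ℚ m) *ℚ n
  lem = solve 2 (λ n m → n :+ m :* n := (con 1ℚ :+ m) :* n) refl

ℕtoℚ-pos : ∀ n → 0ℚ <ℚ ℕtoℚ (suc n)
ℕtoℚ-pos zero    = ℚₚ.positive⁻¹ 1ℚ
ℕtoℚ-pos (suc n) = subst (0ℚ <ℚ_) (sym (ℕtoℚ-+ 1 (suc n))) (subst (_<ℚ 1ℚ +ℚ ℕtoℚ (suc n)) (ℚₚ.+-identityˡ 0ℚ) (ℚₚ.+-mono-< (ℚₚ.positive⁻¹ 1ℚ) (ℕtoℚ-pos n)))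

ℕtoℚ-≢0 : ∀ {n} → 1 ≤ n → ℕtoℚ n ≢ 0ℚ
ℕtoℚ-≢0 {suc n} _ e = ℚₚ.<-irrefl (sym e) (ℕtoℚ-pos n)

inverse : ℚ → ℚ
inverse q with q ℚₚ.≟ 0ℚ
... | yes _ = 0ℚ
... | no ne = (Rat.1/ q) {{Rat.≢-nonZero ne}}

inverse-* : ∀ {q} → q ≢ 0ℚ → q *ℚ inverse q ≡ 1ℚ
inverse-* {q} h with q ℚₚ.≟ 0ℚ
... | yes e = ⊥-elim (h e)
... | no ne = ℚₚ.*-inverseʳ q {{Rat.≢-nonZero ne}}

*-cancel : ∀ {c x y} → c ≢ 0ℚ → c *ℚ x ≡ c *ℚ y → x ≡ y
*-cancel {c} {x} {y} h e = trans (sym (un x)) (trans (cong (inverse c *ℚ_) e) (un y))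
  where
  un : ∀ x → inverse c *ℚ (c *ℚ x) ≡ x
  un x = trans (solve 3 (λ i c x → i :* (c :* x) := (c :* i) :* x) refl (inverse c) c x) (*-1ˡ x (inverse-* h))

-- Multiplication by power sums and by complete symmetric functions. A coefficient function takes
-- one list, consisting of the fermionic exponents followed by the bosonic ones.

popL : ℕ → (List ℕ → ℚ) → List ℕ → ℚ
popL r g []      = 0ℚ
popL r g (x ∷ l) = when (r ≤ᵇ x) (g (x ∸ r ∷ l)) +ℚ popL r (λ l′ → g (x ∷ l′)) l

hopL : ℕ → (List ℕ → ℚ) → List ℕ → ℚ
hopL ℓ g l = ∑ (sub l) (λ l′ → when (sum l′ + ℓ ≡ᵇ sum l) (g l′))

popL-cong : ∀ r {g g′ : List ℕ → ℚ} l → (∀ l′ → sum l′ + r ≡ sum l → length l′ ≡ length l → g l′ ≡ g′ l′) → popL r g l ≡ popL r g′ l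
popL-cong r []      h = refl
popL-cong r {g} {g′} (x ∷ l) h = cong₂ _+ℚ_ (when-cong (r ≤ᵇ x) (λ e → h (x ∸ r ∷ l) (trans (+-swapʳ (x ∸ r) (sum l) r) (cong (_+ sum l) (m∸n+n≡m (≤ᵇ→≤ {r} e)))) refl))
  (popL-cong r l (λ l′ e e′ → h (x ∷ l′) (trans (ℕₚ.+-assoc x (sum l′) r) (cong (x +_) e)) (cong suc e′)))

popL-cong′ : ∀ r {g g′ : List ℕ → ℚ} → (∀ l → g l ≡ g′ l) → ∀ l → popL r g l ≡ popL r g′ l
popL-cong′ r h l = popL-cong r l (λ l′ _ _ → h l′)

popL-+ : ∀ r g g′ l → popL r (λ l′ → g l′ +ℚ g′ l′) l ≡ popL r g l +ℚ popL r g′ l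
popL-+ r g g′ []      = sym (ℚₚ.+-identityˡ 0ℚ)
popL-+ r g g′ (x ∷ l) = trans (cong₂ _+ℚ_ (when-+ (r ≤ᵇ x) (g (x ∸ r ∷ l)) (g′ (x ∸ r ∷ l))) (popL-+ r (λ l′ → g (x ∷ l′)) (λ l′ → g′ (x ∷ l′)) l))
  (+-interchange (when (r ≤ᵇ x) (g (x ∸ r ∷ l))) (when (r ≤ᵇ x) (g′ (x ∸ r ∷ l))) _ _)

popL-0 : ∀ r l → popL r (λ _ → 0ℚ) l ≡ 0ℚ
popL-0 r []      = refl
popL-0 r (x ∷ l) = zero₂ (when-zero (r ≤ᵇ x)) (popL-0 r l)

popL-*ˡ : ∀ c r g l → popL r (λ l′ → c *ℚ g l′) l ≡ c *ℚ popL r g l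
popL-*ˡ c r g []      = sym (ℚₚ.*-zeroʳ c)
popL-*ˡ c r g (x ∷ l) = trans (cong₂ _+ℚ_ (sym (when-*ˡ (r ≤ᵇ x) c (g (x ∸ r ∷ l)))) (popL-*ˡ c r (λ l′ → g (x ∷ l′)) l))
  (sym (ℚₚ.*-distribˡ-+ c (when (r ≤ᵇ x) (g (x ∸ r ∷ l))) _))

popL-when : ∀ b r g l → popL r (λ l′ → when b (g l′)) l ≡ when b (popL r g l)
popL-when true  r g l = refl
popL-when false r g l = popL-0 r l

popL-∑ : ∀ {A : Set} r (xs : List A) (g : A → List ℕ → ℚ) l → popL r (λ l′ → ∑ xs (λ x → g x l′)) l ≡ ∑ xs (λ x → popL r (g x) l)
popL-∑ r []       g l = popL-0 r l
popL-∑ r (x ∷ xs) g l = trans (popL-+ r (g x) (λ l′ → ∑ xs (λ y → g y l′)) l) (cong (popL r (g x) l +ℚ_) (popL-∑ r xs g l))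

popL-∑< : ∀ r n (g : ℕ → List ℕ → ℚ) l → popL r (λ l′ → ∑< n (λ x → g x l′)) l ≡ ∑< n (λ x → popL r (g x) l)
popL-∑< r zero    g l = popL-0 r l
popL-∑< r (suc n) g l = trans (popL-+ r (g 0) (λ l′ → ∑< n (λ y → g (suc y) l′)) l) (cong (popL r (g 0) l +ℚ_) (popL-∑< r n (λ y → g (suc y)) l))

when-∸-swap : ∀ x r r′ (h : ℕ → ℚ) → when (r ≤ᵇ x) (when (r′ ≤ᵇ x ∸ r) (h (x ∸ r ∸ r′))) ≡ when (r′ ≤ᵇ x) (when (r ≤ᵇ x ∸ r′) (h (x ∸ r′ ∸ r)))
when-∸-swap x r r′ h = trans (sym (when-∧ (r ≤ᵇ x) (r′ ≤ᵇ x ∸ r) _)) (trans (cong₂ (λ b y → when b (h y)) (trans (cond r r′) (trans (cong (_≤ᵇ x) (ℕₚ.+-comm r r′)) (sym (cond r′ r))))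
  (trans (∸-+-assoc x r r′) (trans (cong (x ∸_) (ℕₚ.+-comm r r′)) (sym (∸-+-assoc x r′ r))))) (when-∧ (r′ ≤ᵇ x) (r ≤ᵇ x ∸ r′) _))
  where
  cond : ∀ r r′ → (r ≤ᵇ x) ∧ (r′ ≤ᵇ x ∸ r) ≡ (r + r′ ≤ᵇ x)
  cond r r′ = bool-ext {(r ≤ᵇ x) ∧ (r′ ≤ᵇ x ∸ r)}
    (λ h → let p , q = ∧-split {r ≤ᵇ x} h in ≤→≤ᵇ {r + r′} (subst (_≤ x) (ℕₚ.+-comm r′ r) (ℕₚ.m≤o∸n⇒m+n≤o r′ (≤ᵇ→≤ {r} p) (≤ᵇ→≤ {r′} q))))
    (λ h → ∧-intro (≤→≤ᵇ {r} (≤-trans (m≤m+n r r′) (≤ᵇ→≤ {r + r′} h)))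
                   (≤→≤ᵇ {r′} (ℕₚ.m+n≤o⇒m≤o∸n r′ (subst (_≤ x) (ℕₚ.+-comm r r′) (≤ᵇ→≤ {r + r′} h)))))

popL-comm : ∀ r r′ g l → popL r (popL r′ g) l ≡ popL r′ (popL r g) l
popL-comm r r′ g []      = refl
popL-comm r r′ g (x ∷ l) = begin
  when (r ≤ᵇ x) (when (r′ ≤ᵇ x ∸ r) (g (x ∸ r ∸ r′ ∷ l)) +ℚ popL r′ (λ k → g (x ∸ r ∷ k)) l) +ℚ
    popL r (λ k → when (r′ ≤ᵇ x) (g (x ∸ r′ ∷ k)) +ℚ popL r′ (λ k′ → g (x ∷ k′)) k) l
    ≡⟨ expand r r′ ⟩
  (u r r′ +ℚ w r r′) +ℚ (w r′ r +ℚ popL r (popL r′ (λ k → g (x ∷ k))) l)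
    ≡⟨ cong₂ (λ p q → (p +ℚ w r r′) +ℚ (w r′ r +ℚ q)) u-sym (popL-comm r r′ (λ k → g (x ∷ k)) l) ⟩
  (u r′ r +ℚ w r r′) +ℚ (w r′ r +ℚ popL r′ (popL r (λ k → g (x ∷ k))) l)
    ≡⟨ solve 4 (λ a b c d → (a :+ b) :+ (c :+ d) := (a :+ c) :+ (b :+ d)) refl (u r′ r) (w r r′) (w r′ r) _ ⟩
  (u r′ r +ℚ w r′ r) +ℚ (w r r′ +ℚ popL r′ (popL r (λ k → g (x ∷ k))) l)
    ≡⟨ sym (expand r′ r) ⟩
  when (r′ ≤ᵇ x) (when (r ≤ᵇ x ∸ r′) (g (x ∸ r′ ∸ r ∷ l)) +ℚ popL r (λ k → g (x ∸ r′ ∷ k)) l) +ℚ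
    popL r′ (λ k → when (r ≤ᵇ x) (g (x ∸ r ∷ k)) +ℚ popL r (λ k′ → g (x ∷ k′)) k) l ∎
  where
  u w : ℕ → ℕ → ℚ
  u r r′ = when (r ≤ᵇ x) (when (r′ ≤ᵇ x ∸ r) (g (x ∸ r ∸ r′ ∷ l)))
  w r r′ = when (r ≤ᵇ x) (popL r′ (λ k → g (x ∸ r ∷ k)) l)
  expand : ∀ r r′ → when (r ≤ᵇ x) (when (r′ ≤ᵇ x ∸ r) (g (x ∸ r ∸ r′ ∷ l)) +ℚ popL r′ (λ k → g (x ∸ r ∷ k)) l) +ℚ
    popL r (λ k → when (r′ ≤ᵇ x) (g (x ∸ r′ ∷ k)) +ℚ popL r′ (λ k′ → g (x ∷ k′)) k) l ≡
    (u r r′ +ℚ w r r′) +ℚ (w r′ r +ℚ popL r (popL r′ (λ k → g (x ∷ k))) l)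
  expand r r′ = cong₂ _+ℚ_ (when-+ (r ≤ᵇ x) _ _) (trans (popL-+ r (λ k → when (r′ ≤ᵇ x) (g (x ∸ r′ ∷ k))) (popL r′ (λ k′ → g (x ∷ k′))) l)
    (cong (_+ℚ popL r (popL r′ (λ k → g (x ∷ k))) l) (popL-when (r′ ≤ᵇ x) r (λ k → g (x ∸ r′ ∷ k)) l)))
  u-sym : u r r′ ≡ u r′ r
  u-sym = when-∸-swap x r r′ (λ y → g (y ∷ l))

sub-sum : ∀ l {k} → k ∈ sub l → sum k ≤ sum l
sub-sum [] (here refl) = z≤n
sub-sum (x ∷ l) m with ∈-concatMap⁻′ (λ y → map (y ∷_) (sub l)) (upTo (suc x)) m
... | y , y∈ , m′ with ∈ₚ.∈-map⁻ (y ∷_) m′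
... | k , k∈ , refl = +-mono-≤ (≤-pred (∈ₚ.∈-upTo⁻ y∈)) (sub-sum l k∈)

∑<-shift : ∀ x r (Q : ℕ → ℚ) → ∑< (suc x) (λ y → when (r ≤ᵇ y) (Q (y ∸ r))) ≡ when (r ≤ᵇ x) (∑< (suc (x ∸ r)) Q)
∑<-shift x       zero    Q = refl
∑<-shift zero    (suc r) Q = ℚₚ.+-identityʳ 0ℚ
∑<-shift (suc x) (suc r) Q = trans (ℚₚ.+-identityˡ _) (trans (∑<-cong′ (suc x) (λ y → when-≡ (Q (y ∸ r)) (≤ᵇ-<ᵇ-suc r y)))
  (trans (∑<-shift x r Q) (when-≡ (∑< (suc (x ∸ r)) Q) (sym (≤ᵇ-<ᵇ-suc r x)))))

∑-sub-popL : ∀ r g l → ∑ (sub l) (popL r g) ≡ popL r (λ k → ∑ (sub k) g) l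
∑-sub-popL r g []      = ℚₚ.+-identityʳ 0ℚ
∑-sub-popL r g (x ∷ l) = begin
  ∑ (sub (x ∷ l)) (popL r g)
    ≡⟨ ∑-sub-∷ x l (popL r g) ⟩
  ∑< (suc x) (λ y → ∑ (sub l) (λ k → when (r ≤ᵇ y) (g (y ∸ r ∷ k)) +ℚ popL r (λ k′ → g (y ∷ k′)) k))
    ≡⟨ ∑<-cong′ (suc x) (λ y → trans (∑-+ (sub l) (λ k → when (r ≤ᵇ y) (g (y ∸ r ∷ k))) (popL r (λ k′ → g (y ∷ k′))))
         (cong₂ _+ℚ_ (∑-when (r ≤ᵇ y) (sub l) (λ k → g (y ∸ r ∷ k))) (∑-sub-popL r (λ k′ → g (y ∷ k′)) l))) ⟩
  ∑< (suc x) (λ y → when (r ≤ᵇ y) (Q (y ∸ r)) +ℚ popL r (λ k → ∑ (sub k) (λ k′ → g (y ∷ k′))) l)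
    ≡⟨ ∑<-+ (suc x) (λ y → when (r ≤ᵇ y) (Q (y ∸ r))) (λ y → popL r (λ k → ∑ (sub k) (λ k′ → g (y ∷ k′))) l) ⟩
  ∑< (suc x) (λ y → when (r ≤ᵇ y) (Q (y ∸ r))) +ℚ ∑< (suc x) (λ y → popL r (λ k → ∑ (sub k) (λ k′ → g (y ∷ k′))) l)
    ≡⟨ cong₂ _+ℚ_ (trans (∑<-shift x r Q) (cong (when (r ≤ᵇ x)) (sym (∑-sub-∷ (x ∸ r) l g))))
         (trans (sym (popL-∑< r (suc x) (λ y k → ∑ (sub k) (λ k′ → g (y ∷ k′))) l)) (popL-cong′ r (λ k → sym (∑-sub-∷ x k g)) l)) ⟩
  popL r (λ k → ∑ (sub k) g) (x ∷ l) ∎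
  where
  Q : ℕ → ℚ
  Q y = ∑ (sub l) (λ k → g (y ∷ k))

≡ᵇ-cong : ∀ {a b c d} → (a ≡ b → c ≡ d) → (c ≡ d → a ≡ b) → (a ≡ᵇ b) ≡ (c ≡ᵇ d)
≡ᵇ-cong {a} {b} {c} {d} f g = bool-ext {a ≡ᵇ b} (λ h → ≡→≡ᵇ {c} (f (≡ᵇ→≡ {a} h))) (λ h → ≡→≡ᵇ {a} (g (≡ᵇ→≡ {c} h)))

-- Deduced from `∑-sub-popL`, which has all ℓ together. The operator `popL` lowers the degree by
-- exactly r, so the degree test can be carried through it.
hopL-popL : ∀ ℓ r g l → hopL ℓ (popL r g) l ≡ popL r (hopL ℓ g) l
hopL-popL ℓ r g l = begin
  ∑ (sub l) (λ k → when (sum k + ℓ ≡ᵇ sum l) (popL r g k))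
    ≡⟨ ∑-cong′ (sub l) (λ k → trans (sym (popL-when (sum k + ℓ ≡ᵇ sum l) r g k))
         (popL-cong r k (λ k′ e _ → cong (λ s → when (s + ℓ ≡ᵇ sum l) (g k′)) (sym e)))) ⟩
  ∑ (sub l) (popL r (λ k → when ((sum k + r) + ℓ ≡ᵇ sum l) (g k)))
    ≡⟨ ∑-sub-popL r (λ k → when ((sum k + r) + ℓ ≡ᵇ sum l) (g k)) l ⟩
  popL r (λ k → ∑ (sub k) (λ k′ → when ((sum k′ + r) + ℓ ≡ᵇ sum l) (g k′))) l
    ≡⟨ popL-cong r l (λ k e _ → ∑-cong′ (sub k) (λ k′ → when-≡ (g k′) (≡ᵇ-cong
         (λ h → +-cancelʳ-≡ r _ _ (trans (+-swapʳ (sum k′) ℓ r) (trans h (sym e))))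
         (λ h → trans (sym (+-swapʳ (sum k′) ℓ r)) (trans (cong (_+ r) h) e))))) ⟩
  popL r (hopL ℓ g) l ∎

-- A value y below x is reached by lowering x first by some r ≥ 1 and then arbitrarily; there are x
-- - y choices of r.
∑<-triangle : ∀ R x (Q : ℕ → ℚ) → x ≤ R → ∑< R (λ k → when (suc k ≤ᵇ x) (∑< (suc (x ∸ suc k)) Q)) ≡ ∑< (suc x) (λ y → ℕtoℚ (x ∸ y) *ℚ Q y)
∑<-triangle R zero Q _ = trans (∑<-zero R (λ _ _ → refl)) (sym (trans (ℚₚ.+-identityʳ _) (ℚₚ.*-zeroˡ (Q 0))))
∑<-triangle (suc R) (suc x) Q (s≤s h) = begin
  ∑< (suc x) Q +ℚ ∑< R (λ k → when (suc k <ᵇ suc x) (∑< (suc (x ∸ suc k)) Q))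
    ≡⟨ cong (∑< (suc x) Q +ℚ_) (∑<-triangle R x Q h) ⟩
  ∑< (suc x) Q +ℚ ∑< (suc x) (λ y → ℕtoℚ (x ∸ y) *ℚ Q y)
    ≡⟨ sym (∑<-+ (suc x) Q (λ y → ℕtoℚ (x ∸ y) *ℚ Q y)) ⟩
  ∑< (suc x) (λ y → Q y +ℚ ℕtoℚ (x ∸ y) *ℚ Q y)
    ≡⟨ ∑<-cong (suc x) (λ y y< → trans (lem (Q y) (ℕtoℚ (x ∸ y))) (cong (_*ℚ Q y) (trans (sym (ℕtoℚ-+ 1 (x ∸ y))) (cong ℕtoℚ (sym (+-∸-assoc 1 (≤-pred y<))))))) ⟩
  ∑< (suc x) (λ y → ℕtoℚ (suc x ∸ y) *ℚ Q y)
    ≡⟨ sym (ℚₚ.+-identityʳ _) ⟩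
  ∑< (suc x) (λ y → ℕtoℚ (suc x ∸ y) *ℚ Q y) +ℚ 0ℚ
    ≡⟨ cong (∑< (suc x) (λ y → ℕtoℚ (suc x ∸ y) *ℚ Q y) +ℚ_) (sym (trans (cong (λ n → ℕtoℚ n *ℚ Q (suc x)) (n∸n≡0 x)) (ℚₚ.*-zeroˡ (Q (suc x))))) ⟩
  ∑< (suc x) (λ y → ℕtoℚ (suc x ∸ y) *ℚ Q y) +ℚ ℕtoℚ (suc x ∸ suc x) *ℚ Q (suc x)
    ≡⟨ sym (∑<-last (suc x) (λ y → ℕtoℚ (suc x ∸ y) *ℚ Q y)) ⟩
  ∑< (suc (suc x)) (λ y → ℕtoℚ (suc x ∸ y) *ℚ Q y) ∎
  where
  lem : ∀ q n → q +ℚ n *ℚ q ≡ (1ℚ +ℚ n) *ℚ q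
  lem = solve 2 (λ q n → q :+ n :* q := (con 1ℚ :+ n) :* q) refl

-- The logarithmic derivative of H(t) = Σ h_ℓ t^ℓ, that is t H′ = H Σ p_r t^r, at t = 1 and applied
-- to `g`. In each coordinate it is `∑<-triangle`.
euler : ∀ R g l → sum l ≤ R → ∑ (sub l) (λ k → ℕtoℚ (sum l ∸ sum k) *ℚ g k) ≡ ∑< R (λ k → popL (suc k) (λ l′ → ∑ (sub l′) g) l)
euler R g [] h = trans (ℚₚ.+-identityʳ _) (trans (ℚₚ.*-zeroˡ (g [])) (sym (∑<-zero R (λ _ _ → refl))))
euler R g (x ∷ l) h = begin
  ∑ (sub (x ∷ l)) (λ k → ℕtoℚ (x + sum l ∸ sum k) *ℚ g k)
    ≡⟨ ∑-sub-∷ x l (λ k → ℕtoℚ (x + sum l ∸ sum k) *ℚ g k) ⟩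
  ∑< (suc x) (λ y → ∑ (sub l) (λ k → ℕtoℚ (x + sum l ∸ (y + sum k)) *ℚ g (y ∷ k)))
    ≡⟨ ∑<-cong (suc x) (λ y y< → trans (∑-cong (sub l) (λ k k∈ → trans (cong (_*ℚ g (y ∷ k)) (trans (cong ℕtoℚ (∸-split (≤-pred y<) (sub-sum l k∈))) (ℕtoℚ-+ (x ∸ y) (sum l ∸ sum k))))
           (ℚₚ.*-distribʳ-+ (g (y ∷ k)) (ℕtoℚ (x ∸ y)) (ℕtoℚ (sum l ∸ sum k)))))
         (trans (∑-+ (sub l) (λ k → ℕtoℚ (x ∸ y) *ℚ g (y ∷ k)) (λ k → ℕtoℚ (sum l ∸ sum k) *ℚ g (y ∷ k)))
           (cong₂ _+ℚ_ (sym (∑-*ˡ (ℕtoℚ (x ∸ y)) (sub l) (λ k → g (y ∷ k)))) (euler R (λ k → g (y ∷ k)) l (≤-trans (m≤n+m (sum l) x) h))))) ⟩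
  ∑< (suc x) (λ y → ℕtoℚ (x ∸ y) *ℚ Q y +ℚ ∑< R (λ k → popL (suc k) (λ l′ → ∑ (sub l′) (λ k′ → g (y ∷ k′))) l))
    ≡⟨ ∑<-+ (suc x) (λ y → ℕtoℚ (x ∸ y) *ℚ Q y) (λ y → ∑< R (λ k → popL (suc k) (λ l′ → ∑ (sub l′) (λ k′ → g (y ∷ k′))) l)) ⟩
  ∑< (suc x) (λ y → ℕtoℚ (x ∸ y) *ℚ Q y) +ℚ ∑< (suc x) (λ y → ∑< R (λ k → popL (suc k) (λ l′ → ∑ (sub l′) (λ k′ → g (y ∷ k′))) l))
    ≡⟨ cong₂ _+ℚ_ (trans (sym (∑<-triangle R x Q (≤-trans (m≤m+n x (sum l)) h)))
                         (∑<-cong′ R (λ k → cong (when (suc k ≤ᵇ x)) (sym (∑-sub-∷ (x ∸ suc k) l g)))))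
         (trans (∑<-swap (suc x) R (λ y k → popL (suc k) (λ l′ → ∑ (sub l′) (λ k′ → g (y ∷ k′))) l))
           (∑<-cong′ R (λ k → trans (sym (popL-∑< (suc k) (suc x) (λ y l′ → ∑ (sub l′) (λ k′ → g (y ∷ k′))) l)) (popL-cong′ (suc k) (λ l′ → sym (∑-sub-∷ x l′ g)) l)))) ⟩
  ∑< R (λ k → when (suc k ≤ᵇ x) (∑ (sub (x ∸ suc k ∷ l)) g)) +ℚ ∑< R (λ k → popL (suc k) (λ l′ → ∑ (sub (x ∷ l′)) g) l)
    ≡⟨ sym (∑<-+ R (λ k → when (suc k ≤ᵇ x) (∑ (sub (x ∸ suc k ∷ l)) g)) (λ k → popL (suc k) (λ l′ → ∑ (sub (x ∷ l′)) g) l)) ⟩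
  ∑< R (λ k → popL (suc k) (λ l′ → ∑ (sub l′) g) (x ∷ l)) ∎
  where
  Q : ℕ → ℚ
  Q y = ∑ (sub l) (λ k → g (y ∷ k))
  ∸-split : ∀ {x y s t} → y ≤ x → t ≤ s → x + s ∸ (y + t) ≡ (x ∸ y) + (s ∸ t)
  ∸-split {x} {y} {s} {t} p q = trans (sym (∸-+-assoc (x + s) y t)) (trans (cong (_∸ t) (trans (cong (_∸ y) (ℕₚ.+-comm x s)) (trans (+-∸-assoc s p) (ℕₚ.+-comm s (x ∸ y)))))
    (+-∸-assoc (x ∸ y) q))

-- The part of degree ℓ in `euler`: Newton's identity for ℓ h_ℓ. The free bound `R` lets sums of
-- different degrees share one range.
newton : ∀ R ℓ g l → ℓ ≤ R → ℕtoℚ ℓ *ℚ hopL ℓ g l ≡ ∑< R (λ k → when (suc k ≤ᵇ ℓ) (popL (suc k) (hopL (ℓ ∸ suc k) g) l))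
newton R ℓ g l ℓ≤R = begin
  ℕtoℚ ℓ *ℚ ∑ (sub l) g′                                  ≡⟨ ∑-*ˡ (ℕtoℚ ℓ) (sub l) g′ ⟩
  ∑ (sub l) (λ k → ℕtoℚ ℓ *ℚ g′ k)                        ≡⟨ ∑-cong′ (sub l) deg ⟩
  ∑ (sub l) (λ k → ℕtoℚ (sum l ∸ sum k) *ℚ g′ k)          ≡⟨ euler (R + sum l) g′ l (m≤n+m (sum l) R) ⟩
  ∑< (R + sum l) (λ k → popL (suc k) (λ l′ → ∑ (sub l′) g′) l)  ≡⟨ ∑<-cong′ (R + sum l) inner ⟩
  ∑< (R + sum l) t                                        ≡⟨ ∑<-split R (sum l) t ⟩
  ∑< R t +ℚ ∑< (sum l) (λ k → t (R + k))                  ≡⟨ cong (∑< R t +ℚ_) (∑<-zero (sum l) (λ k _ → when-≡ (popL (suc (R + k)) (hopL (ℓ ∸ suc (R + k)) g) l)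
                                                              (≮→<ᵇ (≤⇒≯ (≤-trans ℓ≤R (m≤m+n R k)))))) ⟩
  ∑< R t +ℚ 0ℚ                                            ≡⟨ ℚₚ.+-identityʳ _ ⟩
  ∑< R t ∎
  where
  g′ : List ℕ → ℚ
  g′ k = when (sum k + ℓ ≡ᵇ sum l) (g k)
  t : ℕ → ℚ
  t k = when (suc k ≤ᵇ ℓ) (popL (suc k) (hopL (ℓ ∸ suc k) g) l)
  deg : ∀ k → ℕtoℚ ℓ *ℚ g′ k ≡ ℕtoℚ (sum l ∸ sum k) *ℚ g′ k
  deg k with sum k + ℓ ≡ᵇ sum l in e
  ... | false = trans (ℚₚ.*-zeroʳ (ℕtoℚ ℓ)) (sym (ℚₚ.*-zeroʳ (ℕtoℚ (sum l ∸ sum k))))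
  ... | true  = cong (λ n → ℕtoℚ n *ℚ g k) (trans (sym (m+n∸m≡n (sum k) ℓ)) (cong (_∸ sum k) (≡ᵇ→≡ {sum k + ℓ} e)))
  inner : ∀ k → popL (suc k) (λ l′ → ∑ (sub l′) g′) l ≡ t k
  inner k with suc k ≤ᵇ ℓ in e
  ... | true = popL-cong (suc k) l (λ l′ q _ → ∑-cong′ (sub l′) (λ j → when-≡ (g j) (≡ᵇ-cong
      (λ h → +-cancelʳ-≡ (suc k) _ _ (trans (ℕₚ.+-assoc (sum j) (ℓ ∸ suc k) (suc k)) (trans (cong (sum j +_) (m∸n+n≡m le)) (trans h (sym q)))))
      (λ h → trans (cong (sum j +_) (sym (m∸n+n≡m le))) (trans (sym (ℕₚ.+-assoc (sum j) (ℓ ∸ suc k) (suc k))) (trans (cong (_+ suc k) h) q))))))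
    where
    le : suc k ≤ ℓ
    le = <ᵇ→< {k} e
  ... | false = trans (popL-cong (suc k) l (λ l′ q _ → ∑-zero (sub l′) (λ j j∈ → when-≡ (g j) (≢→≡ᵇ {sum j + ℓ} (λ h →
      <-irrefl (trans h (sym q)) (+-mono-≤-< (sub-sum l′ j∈) (≰⇒> (λ le → false≢true e (<→<ᵇ le))))))))) (popL-0 (suc k) l)

opP opH : List ℕ → (List ℕ → ℚ) → List ℕ → ℚ
opP γ g = foldr popL g γ
opH μ g = foldr hopL g μ

hopL-cong : ∀ ℓ {g g′ : List ℕ → ℚ} l → (∀ k → length k ≡ length l → g k ≡ g′ k) → hopL ℓ g l ≡ hopL ℓ g′ l
hopL-cong ℓ l h = ∑-cong (sub l) (λ k k∈ → cong (when (sum k + ℓ ≡ᵇ sum l)) (h k (sub-length l k∈)))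

hopL-*ˡ : ∀ c ℓ g l → hopL ℓ (λ k → c *ℚ g k) l ≡ c *ℚ hopL ℓ g l
hopL-*ˡ c ℓ g l = trans (∑-cong′ (sub l) (λ k → sym (when-*ˡ (sum k + ℓ ≡ᵇ sum l) c (g k)))) (sym (∑-*ˡ c (sub l) (λ k → when (sum k + ℓ ≡ᵇ sum l) (g k))))

hopL-∑< : ∀ ℓ n (g : ℕ → List ℕ → ℚ) l → hopL ℓ (λ k → ∑< n (λ i → g i k)) l ≡ ∑< n (λ i → hopL ℓ (g i) l)
hopL-∑< ℓ n g l = trans (∑-cong′ (sub l) (λ k → sym (∑<-when (sum k + ℓ ≡ᵇ sum l) n (λ i → g i k)))) (sym (∑<-∑-swap n (sub l) (λ i k → when (sum k + ℓ ≡ᵇ sum l) (g i k))))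

popL-hopL : ∀ r ℓ (g : List ℕ → List ℕ → ℚ) μ l → popL r (λ ν → hopL ℓ (g ν) l) μ ≡ hopL ℓ (λ k → popL r (λ ν → g ν k) μ) l
popL-hopL r ℓ g μ l = trans (popL-∑ r (sub l) (λ k ν → when (sum k + ℓ ≡ᵇ sum l) (g ν k)) μ) (∑-cong′ (sub l) (λ k → popL-when (sum k + ℓ ≡ᵇ sum l) r (λ ν → g ν k) μ))

-- The Euler operator in y on the kernel Π 1/(1 - x_i y_j): y^μ has degree |μ|, and p_k acts once on
-- the exponents μ and once on those of x. This recursion determines the kernel degree by degree.
opH-euler : ∀ R g μ l → sum μ ≤ R → ℕtoℚ (sum μ) *ℚ opH μ g l ≡ ∑< R (λ k → popL (suc k) (λ ν → popL (suc k) (opH ν g) l) μ)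
opH-euler R g []      l h = trans (ℚₚ.*-zeroˡ (g l)) (sym (∑<-zero R (λ _ _ → refl)))
opH-euler R g (ℓ ∷ μ) l h = begin
  ℕtoℚ (ℓ + sum μ) *ℚ hopL ℓ Q l
    ≡⟨ trans (cong (_*ℚ hopL ℓ Q l) (ℕtoℚ-+ ℓ (sum μ))) (ℚₚ.*-distribʳ-+ (hopL ℓ Q l) (ℕtoℚ ℓ) (ℕtoℚ (sum μ))) ⟩
  ℕtoℚ ℓ *ℚ hopL ℓ Q l +ℚ ℕtoℚ (sum μ) *ℚ hopL ℓ Q l
    ≡⟨ cong₂ _+ℚ_ (newton R ℓ Q l (≤-trans (m≤m+n ℓ (sum μ)) h)) second ⟩
  ∑< R (λ k → when (suc k ≤ᵇ ℓ) (popL (suc k) (hopL (ℓ ∸ suc k) Q) l)) +ℚ ∑< R (λ k → popL (suc k) (λ ν → popL (suc k) (hopL ℓ (opH ν g)) l) μ)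
    ≡⟨ sym (∑<-+ R (λ k → when (suc k ≤ᵇ ℓ) (popL (suc k) (hopL (ℓ ∸ suc k) Q) l)) (λ k → popL (suc k) (λ ν → popL (suc k) (hopL ℓ (opH ν g)) l) μ)) ⟩
  ∑< R (λ k → popL (suc k) (λ ν → popL (suc k) (opH ν g) l) (ℓ ∷ μ)) ∎
  where
  Q = opH μ g
  second : ℕtoℚ (sum μ) *ℚ hopL ℓ Q l ≡ ∑< R (λ k → popL (suc k) (λ ν → popL (suc k) (hopL ℓ (opH ν g)) l) μ)
  second = begin
    ℕtoℚ (sum μ) *ℚ hopL ℓ Q l
      ≡⟨ sym (hopL-*ˡ (ℕtoℚ (sum μ)) ℓ Q l) ⟩
    hopL ℓ (λ k → ℕtoℚ (sum μ) *ℚ Q k) l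
      ≡⟨ hopL-cong ℓ l (λ k _ → opH-euler R g μ k (≤-trans (m≤n+m (sum μ) ℓ) h)) ⟩
    hopL ℓ (λ j → ∑< R (λ k → popL (suc k) (λ ν → popL (suc k) (opH ν g) j) μ)) l
      ≡⟨ hopL-∑< ℓ R (λ k j → popL (suc k) (λ ν → popL (suc k) (opH ν g) j) μ) l ⟩
    ∑< R (λ k → hopL ℓ (λ j → popL (suc k) (λ ν → popL (suc k) (opH ν g) j) μ) l)
      ≡⟨ ∑<-cong′ R (λ k → trans (sym (popL-hopL (suc k) ℓ (λ ν → popL (suc k) (opH ν g)) μ l)) (popL-cong′ (suc k) (λ ν → hopL-popL ℓ (suc k) (opH ν g) l) μ)) ⟩
    ∑< R (λ k → popL (suc k) (λ ν → popL (suc k) (hopL ℓ (opH ν g)) l) μ) ∎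

-- Partitions and the centralizer orders z_λ

isPart : ℕ → List ℕ → Bool
isPart n s = (weakDesc s ∧ allPos s) ∧ (sum s ≡ᵇ n)

listsLen-length : ∀ k B {l} → l ∈ listsLen k B → length l ≡ k
listsLen-length zero B (here refl) = refl
listsLen-length (suc k) B m with ∈-concatMap⁻′ (λ x → map (x ∷_) (listsLen k B)) (upTo (suc B)) m
... | x , _ , m′ with ∈ₚ.∈-map⁻ (x ∷_) m′
... | l , l∈ , refl = cong suc (listsLen-length k B l∈)

listsLen-∈ : ∀ B l → (∀ z → z ∈ l → z ≤ B) → l ∈ listsLen (length l) B
listsLen-∈ B []      h = here refl
listsLen-∈ B (x ∷ l) h = ∈-concatMap⁺′ (λ x → map (x ∷_) (listsLen (length l) B)) (upTo-∈ (s≤s (h x (here refl))))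
  (∈ₚ.∈-map⁺ (x ∷_) (listsLen-∈ B l (λ z m → h z (there m))))

listsLen-Unique : ∀ k B → Unique (listsLen k B)
listsLen-Unique zero    B = [] ∷ []
listsLen-Unique (suc k) B = Unique-concatMap (λ x → map (x ∷_) (listsLen k B)) (Uniqueₚ.upTo⁺ (suc B))
  (λ x _ → Uniqueₚ.map⁺ (λ { refl → refl }) (listsLen-Unique k B)) (λ x x′ y _ _ → ∷-injective-∈)

listsLeq-Unique : ∀ k B → Unique (listsLeq k B)
listsLeq-Unique k B = Unique-concatMap (λ j → listsLen j B) (Uniqueₚ.upTo⁺ (suc k)) (λ j _ → listsLen-Unique j B)
  (λ j j′ l _ _ m m′ → trans (sym (listsLen-length j B m)) (listsLen-length j′ B m′))

listsLeq-∈ : ∀ {k} B l → length l ≤ k → (∀ z → z ∈ l → z ≤ B) → l ∈ listsLeq k B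
listsLeq-∈ B l h b = ∈-concatMap⁺′ (λ j → listsLen j B) (upTo-∈ (s≤s h)) (listsLen-∈ B l b)

record IsPart (n : ℕ) (s : List ℕ) : Set where
  constructor mkPart
  field
    desc  : Desc s
    pos   : ∀ z → z ∈ s → 1 ≤ z
    total : sum s ≡ n

pos-length : ∀ s → (∀ z → z ∈ s → 1 ≤ z) → length s ≤ sum s
pos-length []      h = z≤n
pos-length (x ∷ s) h = +-mono-≤ (h x (here refl)) (pos-length s (λ z m → h z (there m)))

opaque

  parts : ℕ → List (List ℕ)
  parts n = filterᵇ (isPart n) (listsLeq n n)

  parts-0 : parts 0 ≡ [] ∷ []
  parts-0 = refl

  parts-Unique : ∀ n → Unique (parts n)
  parts-Unique n = Uniqueₚ.filter⁺ (λ s → Boolₚ.T? (isPart n s)) (listsLeq-Unique n n)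

  parts→ : ∀ {n s} → s ∈ parts n → IsPart n s
  parts→ {n} {s} m =
    let _ , t = ∈ₚ.∈-filter⁻ (λ s → Boolₚ.T? (isPart n s)) {xs = listsLeq n n} m
        p , q = ∧-split {weakDesc s ∧ allPos s} (T→≡ t)
        p₁ , p₂ = ∧-split {weakDesc s} p
    in mkPart (weakDesc→ s p₁) (allPos→ s p₂) (≡ᵇ→≡ {sum s} q)

  →parts : ∀ {n s} → IsPart n s → s ∈ parts n
  →parts {n} {s} (mkPart d p t) = ∈ₚ.∈-filter⁺ (λ s → Boolₚ.T? (isPart n s))
    (listsLeq-∈ n s (subst (length s ≤_) t (pos-length s p)) (λ z m → subst (z ≤_) t (∈-sum s m)))
    (≡→T (∧-intro (∧-intro (→weakDesc d) (→allPos s p)) (≡→≡ᵇ {sum s} t)))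

del : ℕ → List ℕ → List ℕ
del r []      = []
del r (y ∷ l) = if y ≡ᵇ r then l else y ∷ del r l

del-insert : ∀ r l → del r (insertDesc r l) ≡ l
del-insert r [] = cong (λ b → if b then [] else r ∷ []) (≡→≡ᵇ {r} refl)
del-insert r (y ∷ l) with y ≤? r
... | yes h = trans (cong (del r) (insertDesc-≤ r y l h)) (cong (λ b → if b then y ∷ l else r ∷ del r (y ∷ l)) (≡→≡ᵇ {r} refl))
... | no h = trans (cong (del r) (insertDesc-> r y l (≰⇒> h))) (trans (cong (λ b → if b then insertDesc r l else y ∷ del r (insertDesc r l)) (≢→≡ᵇ {y} (λ e → h (≤-reflexive e))))
    (cong (y ∷_) (del-insert r l)))

mult-insert : ∀ i r l → mult i (insertDesc r l) ≡ mult i (r ∷ l)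
mult-∷ : ∀ i y l → mult i (y ∷ l) ≡ (if y ≡ᵇ i then 1 else 0) + mult i l
mult-∷ i y l with y ≡ᵇ i
... | true  = refl
... | false = refl
mult-insert i r [] = refl
mult-insert i r (y ∷ l) with y ≤ᵇ r
... | true = refl
... | false = begin
  mult i (y ∷ insertDesc r l)   ≡⟨ mult-∷ i y (insertDesc r l) ⟩
  #y + mult i (insertDesc r l)  ≡⟨ cong (#y +_) (trans (mult-insert i r l) (mult-∷ i r l)) ⟩
  #y + (#r + mult i l)          ≡⟨ +-exchange #y #r (mult i l) ⟩
  #r + (#y + mult i l)          ≡⟨ cong (#r +_) (sym (mult-∷ i y l)) ⟩
  #r + mult i (y ∷ l)           ≡⟨ sym (mult-∷ i r (y ∷ l)) ⟩
  mult i (r ∷ y ∷ l) ∎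
  where
  #y = if y ≡ᵇ i then 1 else 0
  #r = if r ≡ᵇ i then 1 else 0

mult-∈ : ∀ i l → mult i l ≢ 0 → i ∈ l
mult-∈ i [] h = ⊥-elim (h refl)
mult-∈ i (y ∷ l) h with y ≡ᵇ i in e
... | true  = here (sym (≡ᵇ→≡ {y} e))
... | false = there (mult-∈ i l (λ z → h z))

mult-zero : ∀ i l → (i ∈ l → ⊥) → mult i l ≡ 0
mult-zero i l h with mult i l ≟ 0
... | yes e = e
... | no ne = ⊥-elim (h (mult-∈ i l ne))

∏< : ℕ → (ℕ → ℕ) → ℕ
∏< zero    f = 1
∏< (suc n) f = f 0 * ∏< n (f ∘ suc)

∏<-cong : ∀ n {f g : ℕ → ℕ} → (∀ k → f k ≡ g k) → ∏< n f ≡ ∏< n g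
∏<-cong zero    h = refl
∏<-cong (suc n) h = cong₂ _*_ (h 0) (∏<-cong n (h ∘ suc))

∏<-update : ∀ n j c {f g : ℕ → ℕ} → j < n → f j ≡ c * g j → (∀ k → k ≢ j → f k ≡ g k) → ∏< n f ≡ c * ∏< n g
∏<-update (suc n) zero    c {f} {g} _ e h = trans (cong₂ _*_ e (∏<-cong n (λ k → h (suc k) (λ ())))) (ℕₚ.*-assoc c (g 0) _)
∏<-update (suc n) (suc j) c {f} {g} (s≤s j<) e h = trans (cong₂ _*_ (h 0 (λ ())) (∏<-update n j c j< e (λ k ne → h (suc k) (λ q → ne (suc-injective q)))))
  (ar (g 0) c (∏< n (g ∘ suc)))
  where
  ar : ∀ p q r → p * (q * r) ≡ q * (p * r)
  ar = solve-∀

∏<-extend : ∀ m n {f : ℕ → ℕ} → (∀ k → m ≤ k → f k ≡ 1) → ∏< (m + n) f ≡ ∏< m f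
∏<-extend zero    zero    h = refl
∏<-extend zero    (suc n) h = trans (cong₂ _*_ (h 0 z≤n) (∏<-extend zero n (λ k _ → h (suc k) z≤n))) refl
∏<-extend (suc m) n {f} h = cong (f 0 *_) (∏<-extend m n (λ k le → h (suc k) (s≤s le)))

zfactor : List ℕ → ℕ → ℕ
zfactor l i = (suc i Data.Nat.^ mult (suc i) l) * ((mult (suc i) l) Data.Nat.!)
  where import Data.Nat

zee-∏ : ∀ l → zee l ≡ ∏< (sum l) (zfactor l)
zee-∏ l = go (sum l) id
  where
  go : ∀ n (h : ℕ → ℕ) → foldr (λ i acc → zfactor l i * acc) 1 (applyUpTo h n) ≡ ∏< n (zfactor l ∘ h)
  go zero    h = refl
  go (suc n) h = cong (zfactor l (h 0) *_) (go n (h ∘ suc))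

zee-∏′ : ∀ l N → sum l ≤ N → zee l ≡ ∏< N (zfactor l)
zee-∏′ l N h = trans (zee-∏ l) (trans (sym (∏<-extend (sum l) (N ∸ sum l) (λ k le → cong (λ m → (suc k Data.Nat.^ m) * (m Data.Nat.!)) (mult-zero (suc k) l (λ m → <⇒≱ (s≤s le) (∈-sum l m))))))
  (cong (λ n → ∏< n (zfactor l)) (m+[n∸m]≡n h)))
  where import Data.Nat

-- Both products are first brought to a common range `N`, where the additional factors are 1. Then
-- only the factor of r + 1 changes, its multiplicity m becoming m + 1.
zee-insert : ∀ r l → zee (insertDesc (suc r) l) ≡ (suc r * suc (mult (suc r) l)) * zee l
zee-insert r l = trans (zee-∏′ (insertDesc (suc r) l) N (m≤m+n _ (suc r + sum l))) (trans
  (∏<-update N r (suc r * suc (mult (suc r) l)) r<N at-r off-r)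
  (cong ((suc r * suc (mult (suc r) l)) *_) (sym (zee-∏′ l N (≤-trans (m≤n+m (sum l) (suc r)) (m≤n+m (suc r + sum l) (sum (insertDesc (suc r) l))))))))
  where
  import Data.Nat
  N = sum (insertDesc (suc r) l) + (suc r + sum l)
  r<N : r < N
  r<N = ≤-trans (m≤m+n (suc r) (sum l)) (m≤n+m (suc r + sum l) (sum (insertDesc (suc r) l)))
  m = mult (suc r) l
  at-r : zfactor (insertDesc (suc r) l) r ≡ (suc r * suc m) * zfactor l r
  at-r = trans (cong (λ k → (suc r Data.Nat.^ k) * (k Data.Nat.!)) (trans (mult-insert (suc r) (suc r) l) (trans (mult-∷ (suc r) (suc r) l) (cong (λ b → (if b then 1 else 0) + m) (≡→≡ᵇ {r} refl)))))
    (ar (suc r) (suc r Data.Nat.^ m) (suc m) (m Data.Nat.!))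
    where
    ar : ∀ p q s t → (p * q) * (s * t) ≡ (p * s) * (q * t)
    ar = solve-∀
  off-r : ∀ k → k ≢ r → zfactor (insertDesc (suc r) l) k ≡ zfactor l k
  off-r k ne = cong (λ j → (suc k Data.Nat.^ j) * (j Data.Nat.!)) (trans (mult-insert (suc k) (suc r) l) (trans (mult-∷ (suc k) (suc r) l)
    (cong (λ b → (if b then 1 else 0) + mult (suc k) l) (≢→≡ᵇ {r} (ne ∘ sym)))))

zee-pos : ∀ l → 1 ≤ zee l
zee-pos l = subst (1 ≤_) (sym (zee-∏ l)) (go (sum l) (zfactor l) (λ k → ℕₚ.*-mono-≤ (ℕₚ.m^n>0 (suc k) (mult (suc k) l)) (ℕₚ.1≤n! (mult (suc k) l))))
  where
  go : ∀ n f → (∀ k → 1 ≤ f k) → 1 ≤ ∏< n f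
  go zero    f h = ≤-refl
  go (suc n) f h = ℕₚ.*-mono-≤ (h 0) (go n (f ∘ suc) (h ∘ suc))

opaque

  wz : List ℕ → ℚ
  wz l = inverse (ℕtoℚ (zee l))

  wz-* : ∀ l → ℕtoℚ (zee l) *ℚ wz l ≡ 1ℚ
  wz-* l = inverse-* (ℕtoℚ-≢0 (zee-pos l))

wz-[] : wz [] ≡ 1ℚ
wz-[] = trans (sym (ℚₚ.*-identityˡ (wz []))) (wz-* [])

wz-insert : ∀ r l → ℕtoℚ (suc r * suc (mult (suc r) l)) *ℚ wz (insertDesc (suc r) l) ≡ wz l
wz-insert r l = *-cancel {ℕtoℚ (zee l)} (ℕtoℚ-≢0 (zee-pos l)) (trans (l1 (ℕtoℚ (zee l)) (ℕtoℚ c) (wz (insertDesc (suc r) l)))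
  (trans (cong (_*ℚ wz (insertDesc (suc r) l)) (trans (sym (ℕtoℚ-* c (zee l))) (cong ℕtoℚ (sym (zee-insert r l)))))
    (trans (wz-* (insertDesc (suc r) l)) (sym (wz-* l)))))
  where
  c = suc r * suc (mult (suc r) l)
  l1 : ∀ z c w → z *ℚ (c *ℚ w) ≡ (c *ℚ z) *ℚ w
  l1 = solve 3 (λ z c w → z :* (c :* w) := (c :* z) :* w) refl

sum-mult : ∀ N l → (∀ z → z ∈ l → 1 ≤ z × z ≤ N) → ℕtoℚ (sum l) ≡ ∑< N (λ k → ℕtoℚ (suc k * mult (suc k) l))
sum-mult N []      h = sym (∑<-zero N (λ k _ → cong ℕtoℚ (*-zeroʳ (suc k))))
sum-mult N (x ∷ l) h with h x (here refl)
sum-mult N (suc x ∷ l) h | _ , x<N = begin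
  ℕtoℚ (suc x + sum l)
    ≡⟨ trans (ℕtoℚ-+ (suc x) (sum l)) (cong (ℕtoℚ (suc x) +ℚ_) (sum-mult N l (λ z m → h z (there m)))) ⟩
  ℕtoℚ (suc x) +ℚ ∑< N (λ k → ℕtoℚ (suc k * mult (suc k) l))
    ≡⟨ cong (_+ℚ ∑< N (λ k → ℕtoℚ (suc k * mult (suc k) l))) (sym delta) ⟩
  ∑< N (λ k → ℕtoℚ (suc k * (if x ≡ᵇ k then 1 else 0))) +ℚ ∑< N (λ k → ℕtoℚ (suc k * mult (suc k) l))
    ≡⟨ sym (∑<-+ N (λ k → ℕtoℚ (suc k * (if x ≡ᵇ k then 1 else 0))) (λ k → ℕtoℚ (suc k * mult (suc k) l))) ⟩
  ∑< N (λ k → ℕtoℚ (suc k * (if x ≡ᵇ k then 1 else 0)) +ℚ ℕtoℚ (suc k * mult (suc k) l))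
    ≡⟨ ∑<-cong′ N (λ k → trans (sym (ℕtoℚ-+ (suc k * (if x ≡ᵇ k then 1 else 0)) (suc k * mult (suc k) l)))
         (cong ℕtoℚ (trans (sym (ℕₚ.*-distribˡ-+ (suc k) (if x ≡ᵇ k then 1 else 0) (mult (suc k) l))) (cong (suc k *_) (sym (mult-∷ (suc k) (suc x) l)))))) ⟩
  ∑< N (λ k → ℕtoℚ (suc k * mult (suc k) (suc x ∷ l))) ∎
  where
  delta : ∑< N (λ k → ℕtoℚ (suc k * (if x ≡ᵇ k then 1 else 0))) ≡ ℕtoℚ (suc x)
  delta = trans (∑<-single N x x<N (λ k _ ne → trans (cong (λ b → ℕtoℚ (suc k * (if b then 1 else 0))) (≢→≡ᵇ {x} (ne ∘ sym))) (cong ℕtoℚ (*-zeroʳ (suc k)))))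
    (trans (cong (λ b → ℕtoℚ (suc x * (if b then 1 else 0))) (≡→≡ᵇ {x} refl)) (cong ℕtoℚ (ℕₚ.*-identityʳ (suc x))))

-- Here n = Σ k m_k(γ), and k m_k(γ) / z_γ = 1 / z_δ, where δ is γ with one part k removed. It is
-- the recursion of `opH-euler` on the power-sum side of Cauchy's identity.
parts-euler : ∀ n (g : List ℕ → ℚ) → ℕtoℚ n *ℚ ∑ (parts n) (λ γ → wz γ *ℚ g γ) ≡
  ∑< n (λ k → ∑ (parts (n ∸ suc k)) (λ γ → wz γ *ℚ g (insertDesc (suc k) γ)))
parts-euler n g = begin
  ℕtoℚ n *ℚ ∑ (parts n) (λ γ → wz γ *ℚ g γ)
    ≡⟨ ∑-*ˡ (ℕtoℚ n) (parts n) (λ γ → wz γ *ℚ g γ) ⟩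
  ∑ (parts n) (λ γ → ℕtoℚ n *ℚ (wz γ *ℚ g γ))
    ≡⟨ ∑-cong (parts n) (λ γ γ∈ → let mkPart d p t = parts→ γ∈ in
         trans (cong (_*ℚ (wz γ *ℚ g γ)) (trans (cong ℕtoℚ (sym t)) (sum-mult n γ (λ z m → p z m , subst (z ≤_) t (∈-sum γ m)))))
               (trans (ℚₚ.*-comm (∑< n (λ k → ℕtoℚ (suc k * mult (suc k) γ))) (wz γ *ℚ g γ)) (trans (∑<-*ˡ (wz γ *ℚ g γ) n (λ k → ℕtoℚ (suc k * mult (suc k) γ)))
                 (∑<-cong′ n (λ k → ℚₚ.*-comm (wz γ *ℚ g γ) (ℕtoℚ (suc k * mult (suc k) γ))))))) ⟩
  ∑ (parts n) (λ γ → ∑< n (λ k → t k γ))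
    ≡⟨ sym (∑<-∑-swap n (parts n) t) ⟩
  ∑< n (λ k → ∑ (parts n) (t k))
    ≡⟨ ∑<-cong n (λ k k< → ∑-reindex (insertDesc (suc k)) (parts-Unique n) (parts-Unique (n ∸ suc k)) (to k k<) (inj k) (surj k)) ⟩
  ∑< n (λ k → ∑ (parts (n ∸ suc k)) (λ γ → wz γ *ℚ g (insertDesc (suc k) γ))) ∎
  where
  t : ℕ → List ℕ → ℚ
  t k γ = ℕtoℚ (suc k * mult (suc k) γ) *ℚ (wz γ *ℚ g γ)
  value : ∀ k γ → wz γ *ℚ g (insertDesc (suc k) γ) ≡ t k (insertDesc (suc k) γ)
  value k γ = sym (trans (cong (λ m → ℕtoℚ (suc k * m) *ℚ (wz δ *ℚ g δ))
      (trans (mult-insert (suc k) (suc k) γ) (trans (mult-∷ (suc k) (suc k) γ) (cong (λ b → (if b then 1 else 0) + mult (suc k) γ) (≡→≡ᵇ {k} refl)))))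
    (trans (sym (ℚₚ.*-assoc (ℕtoℚ (suc k * suc (mult (suc k) γ))) (wz δ) (g δ))) (cong (_*ℚ g δ) (wz-insert k γ))))
    where
    δ = insertDesc (suc k) γ
  to : ∀ k → k < n → ∀ γ → γ ∈ parts (n ∸ suc k) → insertDesc (suc k) γ ∈ parts n × wz γ *ℚ g (insertDesc (suc k) γ) ≡ t k (insertDesc (suc k) γ)
  to k k< γ γ∈ = let mkPart d p s = parts→ γ∈ in
    →parts (mkPart (insertDesc-Desc (suc k) d) (λ z m → pos′ p (insertDesc-∈ (suc k) γ m)) (trans (sum-insert (suc k) γ) (trans (cong (suc k +_) s) (m+[n∸m]≡n k<)))) , value k γ
    where
    pos′ : (∀ z → z ∈ γ → 1 ≤ z) → ∀ {z} → z ≡ suc k ⊎ z ∈ γ → 1 ≤ z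
    pos′ p (inj₁ refl) = s≤s z≤n
    pos′ p (inj₂ m) = p _ m
  inj : ∀ k γ γ′ → γ ∈ parts (n ∸ suc k) → γ′ ∈ parts (n ∸ suc k) → insertDesc (suc k) γ ≡ insertDesc (suc k) γ′ → γ ≡ γ′
  inj k γ γ′ _ _ e = trans (sym (del-insert (suc k) γ)) (trans (cong (del (suc k)) e) (del-insert (suc k) γ′))
  surj : ∀ k γ → γ ∈ parts n → (∃[ δ ] (δ ∈ parts (n ∸ suc k) × γ ≡ insertDesc (suc k) δ)) ⊎ t k γ ≡ 0ℚ
  surj k γ γ∈ with mult (suc k) γ ≟ 0
  ... | yes e = inj₂ (trans (cong (λ m → ℕtoℚ m *ℚ (wz γ *ℚ g γ)) (trans (cong (suc k *_) e) (*-zeroʳ (suc k)))) (ℚₚ.*-zeroˡ (wz γ *ℚ g γ)))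
  ... | no ne with ∈ₚ.∈-∃++ (mult-∈ (suc k) γ ne)
  ...   | p , q , refl = inj₁ (p ++ q , →parts (mkPart (Desc-remove p (IsPart.desc (parts→ γ∈))) (λ z m → IsPart.pos (parts→ γ∈) z (∈-weaken p m)) tot) ,
      trans (sym (sortDesc-id (IsPart.desc (parts→ γ∈)))) (trans (sort-++-∷ p (suc k) q) (cong (insertDesc (suc k)) (sortDesc-id (Desc-remove p (IsPart.desc (parts→ γ∈)))))))
    where
    ar : ∀ p q r → p + (q + r) ≡ (p + r) + q
    ar = solve-∀
    tot : sum (p ++ q) ≡ n ∸ suc k
    tot = trans (sym (m+n∸n≡m (sum (p ++ q)) (suc k))) (cong (_∸ suc k) (trans (cong (_+ suc k) (sum-++ p q)) (trans (sym (ar (sum p) (suc k) (sum q))) (trans (sym (sum-++ p (suc k ∷ q))) (IsPart.total (parts→ γ∈))))))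

zeroL : List ℕ → Bool
zeroL []      = true
zeroL (x ∷ l) = (x ≡ᵇ 0) ∧ zeroL l

oneL : List ℕ → ℚ
oneL l = when (zeroL l) 1ℚ

opP-insert : ∀ r γ g l → opP (insertDesc r γ) g l ≡ popL r (opP γ g) l
opP-insert r [] g l = refl
opP-insert r (y ∷ γ) g l with y ≤ᵇ r
... | true  = refl
... | false = trans (popL-cong′ y (opP-insert r γ g) l) (popL-comm y r (opP γ g) l)

hopL-0 : ∀ g l → hopL 0 g l ≡ g l
hopL-0 g [] = ℚₚ.+-identityʳ (g [])
hopL-0 g (x ∷ l) = begin
  hopL 0 g (x ∷ l)
    ≡⟨ ∑-sub-∷ x l (λ k → when (sum k + 0 ≡ᵇ x + sum l) (g k)) ⟩
  ∑< (suc x) (λ y → ∑ (sub l) (λ k → when ((y + sum k) + 0 ≡ᵇ x + sum l) (g (y ∷ k))))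
    ≡⟨ ∑<-single (suc x) x ≤-refl (λ y y< ne → ∑-zero (sub l) (λ k k∈ → when-≡ (g (y ∷ k))
         (≢→≡ᵇ {y + sum k + 0} (λ e → <-irrefl (trans (sym (ℕₚ.+-identityʳ _)) e) (+-mono-<-≤ (≤∧≢⇒< (≤-pred y<) ne) (sub-sum l k∈)))))) ⟩
  ∑ (sub l) (λ k → when ((x + sum k) + 0 ≡ᵇ x + sum l) (g (x ∷ k)))
    ≡⟨ ∑-cong′ (sub l) (λ k → when-≡ (g (x ∷ k)) (≡ᵇ-cong
         (λ h → +-cancelˡ-≡ x _ _ (trans (sym (ℕₚ.+-assoc x (sum k) 0)) h)) (λ h → trans (ℕₚ.+-assoc x (sum k) 0) (cong (x +_) h)))) ⟩
  hopL 0 (λ k → g (x ∷ k)) l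
    ≡⟨ hopL-0 (λ k → g (x ∷ k)) l ⟩
  g (x ∷ l) ∎

opH-zero : ∀ μ g l → sum μ ≡ 0 → opH μ g l ≡ g l
opH-zero [] g l e = refl
opH-zero (zero ∷ μ) g l e = trans (hopL-0 (opH μ g) l) (opH-zero μ g l e)

zeroL-sum : ∀ l → sum l ≡ 0 → zeroL l ≡ true
zeroL-sum [] e = refl
zeroL-sum (zero ∷ l) e = zeroL-sum l e

-- Cauchy's identity: h_μ = Σ_γ z_γ⁻¹ [x^μ]p_γ · p_γ, as operators
cauchy : ∀ b μ g l → sum μ ≤ b → opH μ g l ≡ ∑ (parts (sum μ)) (λ γ → wz γ *ℚ (opP γ oneL μ *ℚ opP γ g l))
cauchy b μ g l h with sum μ in eq
... | zero = trans (opH-zero μ g l eq) (sym (trans (cong (λ ps → ∑ ps (λ γ → wz γ *ℚ (opP γ oneL μ *ℚ opP γ g l))) parts-0) (trans (ℚₚ.+-identityʳ _) (trans (cong₂ (λ w o → w *ℚ (when o 1ℚ *ℚ g l)) wz-[] (zeroL-sum μ eq))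
    (trans (ℚₚ.*-identityˡ (1ℚ *ℚ g l)) (ℚₚ.*-identityˡ (g l)))))))
cauchy (suc b) μ g l (s≤s h) | suc n = *-cancel (ℕtoℚ-≢0 {suc n} (s≤s z≤n)) (begin
  ℕtoℚ (suc n) *ℚ opH μ g l
    ≡⟨ cong (λ k → ℕtoℚ k *ℚ opH μ g l) (sym eq) ⟩
  ℕtoℚ (sum μ) *ℚ opH μ g l
    ≡⟨ opH-euler (suc n) g μ l (≤-reflexive eq) ⟩
  ∑< (suc n) (λ k → popL (suc k) (λ ν → popL (suc k) (opH ν g) l) μ)
    ≡⟨ ∑<-cong (suc n) (λ k k< → step k) ⟩
  ∑< (suc n) (λ k → ∑ (parts (n ∸ k)) (λ γ → wz γ *ℚ (opP (insertDesc (suc k) γ) oneL μ *ℚ opP (insertDesc (suc k) γ) g l)))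
    ≡⟨ sym (parts-euler (suc n) (λ γ → opP γ oneL μ *ℚ opP γ g l)) ⟩
  ℕtoℚ (suc n) *ℚ ∑ (parts (suc n)) (λ γ → wz γ *ℚ (opP γ oneL μ *ℚ opP γ g l)) ∎)
  where
  comm₄ : ∀ w b c → c *ℚ (w *ℚ b) ≡ w *ℚ (b *ℚ c)
  comm₄ = solve 3 (λ w b c → c :* (w :* b) := w :* (b :* c)) refl
  step : ∀ k → popL (suc k) (λ ν → popL (suc k) (opH ν g) l) μ ≡
    ∑ (parts (n ∸ k)) (λ γ → wz γ *ℚ (opP (insertDesc (suc k) γ) oneL μ *ℚ opP (insertDesc (suc k) γ) g l))
  step k = begin
    popL r (λ ν → popL r (opH ν g) l) μ
      ≡⟨ popL-cong r μ (λ ν e _ → let sν = sν≡ ν e in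
           trans (popL-cong′ r (λ j → trans (cauchy b ν g j (≤-trans (≤-reflexive sν) (≤-trans (m∸n≤m n k) h)))
                   (cong (λ m → ∑ (parts m) (λ γ → wz γ *ℚ (opP γ oneL ν *ℚ opP γ g j))) sν)) l)
             (trans (popL-∑ r (parts (n ∸ k)) (λ γ j → wz γ *ℚ (opP γ oneL ν *ℚ opP γ g j)) l)
               (∑-cong′ (parts (n ∸ k)) (λ γ → trans (popL-*ˡ (wz γ) r (λ j → opP γ oneL ν *ℚ opP γ g j) l)
                 (trans (cong (wz γ *ℚ_) (popL-*ˡ (opP γ oneL ν) r (opP γ g) l)) (sym (comm₄ (wz γ) (opP γ oneL ν) (popL r (opP γ g) l)))))))) ⟩
    popL r (λ ν → ∑ (parts (n ∸ k)) (λ γ → popL r (opP γ g) l *ℚ (wz γ *ℚ opP γ oneL ν))) μ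
      ≡⟨ popL-∑ r (parts (n ∸ k)) (λ γ ν → popL r (opP γ g) l *ℚ (wz γ *ℚ opP γ oneL ν)) μ ⟩
    ∑ (parts (n ∸ k)) (λ γ → popL r (λ ν → popL r (opP γ g) l *ℚ (wz γ *ℚ opP γ oneL ν)) μ)
      ≡⟨ ∑-cong′ (parts (n ∸ k)) (λ γ → trans (popL-*ˡ (popL r (opP γ g) l) r (λ ν → wz γ *ℚ opP γ oneL ν) μ)
           (trans (cong (popL r (opP γ g) l *ℚ_) (popL-*ˡ (wz γ) r (opP γ oneL) μ))
             (trans (comm₄ (wz γ) (popL r (opP γ oneL) μ) (popL r (opP γ g) l))
               (cong₂ (λ x y → wz γ *ℚ (x *ℚ y)) (sym (opP-insert r γ oneL μ)) (sym (opP-insert r γ g l)))))) ⟩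
    ∑ (parts (n ∸ k)) (λ γ → wz γ *ℚ (opP (insertDesc r γ) oneL μ *ℚ opP (insertDesc r γ) g l)) ∎
    where
    r = suc k
    sν≡ : ∀ ν → sum ν + r ≡ sum μ → sum ν ≡ n ∸ k
    sν≡ ν e = trans (sym (m+n∸n≡m (sum ν) r)) (cong (_∸ r) (trans e eq))

-- Triangular matrices over a finite index set

-- `ρ` is any preorder respected by the entries of `T`; the inverse respects it as well. It is kept
-- apart from `rank`, because the inverse must also be controlled by a statistic that need not
-- decrease strictly.
module Triangular {A : Set} (I : List A) (uI : Unique I) (_≟A_ : (x y : A) → Dec (x ≡ y)) (T : A → A → ℚ) (rank : A → ℕ)
  (ρ : A → A → Set) (ρ-refl : ∀ x → ρ x x) (ρ-trans : ∀ {x y z} → ρ x y → ρ y z → ρ x z)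
  (tri : ∀ x y → x ∈ I → y ∈ I → x ≢ y → T x y ≢ 0ℚ → rank y < rank x × ρ x y)
  (diag : ∀ x → x ∈ I → T x x ≢ 0ℚ) where

  δ : A → A → ℚ
  δ x y = when (does (x ≟A y)) 1ℚ

  δ-refl : ∀ x → δ x x ≡ 1ℚ
  δ-refl x = when-≡ 1ℚ (dec-true (x ≟A x) refl)

  δ-≢ : ∀ {x y} → x ≢ y → δ x y ≡ 0ℚ
  δ-≢ {x} {y} ne = when-≡ 1ℚ (dec-false (x ≟A y) ne)

  ∑-δˡ : ∀ x (f : A → ℚ) → x ∈ I → ∑ I (λ y → δ x y *ℚ f y) ≡ f x
  ∑-δˡ x f x∈ = trans (∑-single x uI x∈ (λ y _ ne → *-0ˡ (f y) (δ-≢ (ne ∘ sym))) (_≟A x))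
    (*-1ˡ (f x) (δ-refl x))

  ∑-δʳ : ∀ z (f : A → ℚ) → z ∈ I → ∑ I (λ y → f y *ℚ δ y z) ≡ f z
  ∑-δʳ z f z∈ = trans (∑-single z uI z∈ (λ y _ ne → *-0ʳ (f y) (δ-≢ ne)) (_≟A z))
    (*-1ʳ (f z) (δ-refl z))

  off : A → A → Bool
  off x y = not (does (x ≟A y))

  ∑-off : ∀ x (f : A → ℚ) → x ∈ I → ∑ I f ≡ f x +ℚ ∑ I (λ y → when (off x y) (f y))
  ∑-off x f x∈ = trans (∑-cong′ I (λ y → part y (does (x ≟A y)))) (trans (∑-+ I (λ y → when (does (x ≟A y)) (f y)) (λ y → when (off x y) (f y)))
    (cong (_+ℚ ∑ I (λ y → when (off x y) (f y))) (trans (∑-single x uI x∈ (λ y _ ne → when-≡ (f y) (dec-false (x ≟A y) (ne ∘ sym))) (_≟A x))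
      (when-≡ (f x) (dec-true (x ≟A x) refl)))))
    where
    part : ∀ y b → f y ≡ when b (f y) +ℚ when (not b) (f y)
    part y true  = sym (ℚₚ.+-identityʳ (f y))
    part y false = sym (ℚₚ.+-identityˡ (f y))

  -- Back substitution with fuel; by `stable` the fuel does not matter once it exceeds the rank.
  approx : ℕ → A → A → ℚ
  approx zero    x z = 0ℚ
  approx (suc k) x z = inverse (T x x) *ℚ (δ x z +ℚ (-ℚ ∑ I (λ y → when (off x y) (T x y *ℚ approx k y z))))

  stable : ∀ k k′ x z → x ∈ I → rank x < k → rank x < k′ → approx k x z ≡ approx k′ x z
  stable (suc k) (suc k′) x z x∈ (s≤s h) (s≤s h′) = cong (λ s → inverse (T x x) *ℚ (δ x z +ℚ (-ℚ s))) (∑-cong I term)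
    where
    term : ∀ y → y ∈ I → when (off x y) (T x y *ℚ approx k y z) ≡ when (off x y) (T x y *ℚ approx k′ y z)
    term y y∈ with x ≟A y
    ... | yes _ = refl
    ... | no ne with T x y ℚₚ.≟ 0ℚ
    ...   | yes e = trans (cong (_*ℚ approx k y z) e) (trans (ℚₚ.*-zeroˡ (approx k y z)) (sym (*-0ˡ (approx k′ y z) e)))
    ...   | no nz = let r , _ = tri x y x∈ y∈ ne nz in cong (T x y *ℚ_) (stable k k′ y z y∈ (<-≤-trans r h) (<-≤-trans r h′))

  inv-matrix : A → A → ℚ
  inv-matrix x z = approx (suc (rank x)) x z

  T-inv : ∀ x z → x ∈ I → ∑ I (λ y → T x y *ℚ inv-matrix y z) ≡ δ x z
  T-inv x z x∈ = begin
    ∑ I (λ y → T x y *ℚ inv-matrix y z)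
      ≡⟨ ∑-off x (λ y → T x y *ℚ inv-matrix y z) x∈ ⟩
    T x x *ℚ inv-matrix x z +ℚ ∑ I (λ y → when (off x y) (T x y *ℚ inv-matrix y z))
      ≡⟨ cong (T x x *ℚ inv-matrix x z +ℚ_) (∑-cong I term) ⟩
    T x x *ℚ (inverse (T x x) *ℚ (δ x z +ℚ (-ℚ rest))) +ℚ rest
      ≡⟨ cong (_+ℚ rest) (trans (sym (ℚₚ.*-assoc (T x x) (inverse (T x x)) (δ x z +ℚ (-ℚ rest)))) (*-1ˡ (δ x z +ℚ (-ℚ rest)) (inverse-* (diag x x∈)))) ⟩
    (δ x z +ℚ (-ℚ rest)) +ℚ rest
      ≡⟨ solve 2 (λ d r → (d :+ (:- r)) :+ r := d) refl (δ x z) rest ⟩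
    δ x z ∎
    where
    rest = ∑ I (λ y → when (off x y) (T x y *ℚ approx (rank x) y z))
    term : ∀ y → y ∈ I → when (off x y) (T x y *ℚ inv-matrix y z) ≡ when (off x y) (T x y *ℚ approx (rank x) y z)
    term y y∈ with x ≟A y
    ... | yes _ = refl
    ... | no ne with T x y ℚₚ.≟ 0ℚ
    ...   | yes e = trans (cong (_*ℚ inv-matrix y z) e) (trans (ℚₚ.*-zeroˡ (inv-matrix y z)) (sym (*-0ˡ (approx (rank x) y z) e)))
    ...   | no nz = cong (T x y *ℚ_) (stable (suc (rank y)) (rank x) y z y∈ ≤-refl (proj₁ (tri x y x∈ y∈ ne nz)))

  -- Follows from the one-sided inverse: W = inv-matrix · T satisfies T W = T, and a triangular T
  -- with nonzero diagonal can be cancelled, again by recursion on the rank.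
  inv-T : ∀ x z → x ∈ I → z ∈ I → ∑ I (λ y → inv-matrix x y *ℚ T y z) ≡ δ x z
  inv-T x z x∈ z∈ = go (suc (rank x)) x z x∈ z∈ ≤-refl
    where
    W : A → A → ℚ
    W x z = ∑ I (λ y → inv-matrix x y *ℚ T y z)
    TW : ∀ x z → x ∈ I → z ∈ I → ∑ I (λ y → T x y *ℚ W y z) ≡ T x z
    TW x z x∈ z∈ = trans (∑-assoc I I (T x) inv-matrix (λ u → T u z))
      (trans (∑-cong′ I (λ u → cong (_*ℚ T u z) (T-inv x u x∈))) (∑-δˡ x (λ u → T u z) x∈))
    go : ∀ k x z → x ∈ I → z ∈ I → rank x < k → W x z ≡ δ x z
    go (suc k) x z x∈ z∈ (s≤s h) = *-cancel (diag x x∈) (+-cancelʳ (begin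
      T x x *ℚ W x z +ℚ rest
        ≡⟨ sym (∑-off x (λ y → T x y *ℚ W y z) x∈) ⟩
      ∑ I (λ y → T x y *ℚ W y z)
        ≡⟨ TW x z x∈ z∈ ⟩
      T x z
        ≡⟨ sym (∑-δʳ z (T x) z∈) ⟩
      ∑ I (λ y → T x y *ℚ δ y z)
        ≡⟨ ∑-off x (λ y → T x y *ℚ δ y z) x∈ ⟩
      T x x *ℚ δ x z +ℚ ∑ I (λ y → when (off x y) (T x y *ℚ δ y z))
        ≡⟨ cong (T x x *ℚ δ x z +ℚ_) (sym (∑-cong I term)) ⟩
      T x x *ℚ δ x z +ℚ rest ∎))
      where
      rest = ∑ I (λ y → when (off x y) (T x y *ℚ W y z))
      +-cancelʳ : ∀ {a b} → a +ℚ rest ≡ b +ℚ rest → a ≡ b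
      +-cancelʳ {a} {b} e = +-cancelˡℚ rest (trans (ℚₚ.+-comm rest a) (trans e (ℚₚ.+-comm b rest)))
      term : ∀ y → y ∈ I → when (off x y) (T x y *ℚ W y z) ≡ when (off x y) (T x y *ℚ δ y z)
      term y y∈ with x ≟A y
      ... | yes _ = refl
      ... | no ne with T x y ℚₚ.≟ 0ℚ
      ...   | yes e = trans (cong (_*ℚ W y z) e) (trans (ℚₚ.*-zeroˡ (W y z)) (sym (*-0ˡ (δ y z) e)))
      ...   | no nz = cong (T x y *ℚ_) (go k y z y∈ z∈ (<-≤-trans (proj₁ (tri x y x∈ y∈ ne nz)) h))

  inv-support : ∀ x z → x ∈ I → z ∈ I → inv-matrix x z ≢ 0ℚ → ρ x z
  inv-support x z x∈ z∈ = go (suc (rank x)) x x∈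
    where
    go : ∀ k x → x ∈ I → approx k x z ≢ 0ℚ → ρ x z
    go zero    x x∈ nz = ⊥-elim (nz refl)
    go (suc k) x x∈ nz with x ≟A z in eq
    ... | yes refl = ρ-refl x
    ... | no ne with ∑ I (λ y → when (off x y) (T x y *ℚ approx k y z)) ℚₚ.≟ 0ℚ
    ...   | yes e = ⊥-elim (nz (trans (cong (λ s → inverse (T x x) *ℚ (0ℚ +ℚ (-ℚ s))) e) (ℚₚ.*-zeroʳ (inverse (T x x)))))
    ...   | no nz′ with ∑-nonzero I (λ y → when (off x y) (T x y *ℚ approx k y z)) nz′
    ...     | y , y∈ , h with when-nonzero (off x y) h
    ...       | o , h′ = ρ-trans (proj₂ (tri x y x∈ y∈ x≢y (λ e → h′ (*-0ˡ (approx k y z) e))))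
                                 (go k y y∈ (λ e → h′ (*-0ʳ (T x y) e)))
      where
      x≢y : x ≢ y
      x≢y refl = false≢true (cong not (dec-true (x ≟A x) refl)) o

-- Sectors

_≟SP_ : (Λ Ω : SPart) → Dec (Λ ≡ Ω)
_≟SP_ = Productₚ.≡-dec (Listₚ.≡-dec _≟_) (Listₚ.≡-dec _≟_)

sector→ : ∀ {n m Λ} → Λ ∈ sector n m → IsSP Λ × bdeg Λ ≡ n × fdeg Λ ≡ m
sector→ {n} {m} {Λ} Λ∈ =
  let h , t = ∈ₚ.∈-filter⁻ (λ Λ → Boolₚ.T? (isSPart Λ ∧ (bdeg Λ ≡ᵇ n))) {xs = concatMap (λ a → map (a ,_) (listsLeq n n)) (listsLen m n)} Λ∈
      i , d = ∧-split {isSPart Λ} (T→≡ t)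
      a , a∈ , h′ = ∈-concatMap⁻′ (λ a → map (a ,_) (listsLeq n n)) (listsLen m n) h
      _ , _ , e = ∈ₚ.∈-map⁻ (a ,_) h′
  in isSPart→ Λ i , ≡ᵇ→≡ {bdeg Λ} d , trans (cong fdeg e) (listsLen-length m n a∈)

→sector : ∀ {Λ} → IsSP Λ → Λ ∈ sector (bdeg Λ) (fdeg Λ)
→sector {a , s} i = ∈ₚ.∈-filter⁺ (λ Λ → Boolₚ.T? (isSPart Λ ∧ (bdeg Λ ≡ᵇ n)))
  (∈-concatMap⁺′ (λ a → map (a ,_) (listsLeq n n)) (listsLen-∈ n a (λ z m → ≤-trans (∈-sum a m) (m≤m+n (sum a) (sum s))))
    (∈ₚ.∈-map⁺ (a ,_) (listsLeq-∈ n s (≤-trans (pos-length s (IsSP.pos i)) s≤) (λ z m → ≤-trans (∈-sum s m) s≤))))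
  (≡→T (∧-intro (→isSPart i) (≡→≡ᵇ {n} refl)))
  where
  n = sum a + sum s
  s≤ = m≤n+m (sum s) (sum a)

→sector′ : ∀ {n m Λ} → IsSP Λ → bdeg Λ ≡ n → fdeg Λ ≡ m → Λ ∈ sector n m
→sector′ i refl refl = →sector i

sector-Unique : ∀ n m → Unique (sector n m)
sector-Unique n m = Uniqueₚ.filter⁺ (λ Λ → Boolₚ.T? (isSPart Λ ∧ (bdeg Λ ≡ᵇ n))) (Unique-concatMap (λ a → map (a ,_) (listsLeq n n)) (listsLen-Unique m n)
  (λ a _ → Uniqueₚ.map⁺ (λ { refl → refl }) (listsLeq-Unique n n)) disj)
  where
  disj : ∀ a a′ Λ → a ∈ listsLen m n → a′ ∈ listsLen m n → Λ ∈ map (a ,_) (listsLeq n n) → Λ ∈ map (a′ ,_) (listsLeq n n) → a ≡ a′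
  disj a a′ Λ _ _ p q with ∈ₚ.∈-map⁻ (a ,_) p | ∈ₚ.∈-map⁻ (a′ ,_) q
  ... | _ , _ , refl | _ , _ , refl = refl

-- Monomial functions and the expansion of a supersymmetric coefficient function

nz : List ℕ → List ℕ
nz []      = []
nz (x ∷ l) = if x ≡ᵇ 0 then nz l else x ∷ nz l

nz-id : ∀ l → (∀ z → z ∈ l → 1 ≤ z) → nz l ≡ l
nz-id [] h = refl
nz-id (zero ∷ l) h = case h 0 (here refl) of λ ()
nz-id (suc x ∷ l) h = cong (suc x ∷_) (nz-id l (λ z m → h z (there m)))

nz-pos : ∀ l z → z ∈ nz l → 1 ≤ z
nz-pos (zero ∷ l)  z m           = nz-pos l z m
nz-pos (suc x ∷ l) z (here refl) = s≤s z≤n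
nz-pos (suc x ∷ l) z (there m)   = nz-pos l z m

-- `mP` as a function of the fermionic and the bosonic exponents. Zeros among the latter belong to
-- variables that do not occur.
mL : SPart → List ℕ → List ℕ → ℚ
mL (a , s) e t = when (eqL (sortDesc e) a ∧ eqL (sortDesc (nz t)) s) (sgn (ascPairs e))

mL-≢0 : ∀ Ω e t → mL Ω e t ≢ 0ℚ → Ω ≡ (sortDesc e , sortDesc (nz t))
mL-≢0 (a , s) e t h = let p , q = ∧-split {eqL (sortDesc e) a} (proj₁ (when-nonzero (eqL (sortDesc e) a ∧ eqL (sortDesc (nz t)) s) h)) in
  sym (cong₂ _,_ (eqL→≡ (sortDesc e) a p) (eqL→≡ (sortDesc (nz t)) s q))

mL-self : ∀ e t → mL (sortDesc e , sortDesc (nz t)) e t ≡ sgn (ascPairs e)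
mL-self e t = when-≡ (sgn (ascPairs e)) (∧-intro (eqL-refl (sortDesc e)) (eqL-refl (sortDesc (nz t))))

SP-normal : ∀ {Ω} → IsSP Ω → (sortDesc (proj₁ Ω) , sortDesc (nz (proj₂ Ω))) ≡ Ω
SP-normal {a , s} i = cong₂ _,_ (sortDesc-id (Strict→Desc (IsSP.strict i))) (trans (cong sortDesc (nz-id s (IsSP.pos i))) (sortDesc-id (IsSP.desc i)))

mL-diag : ∀ {Ω} → IsSP Ω → mL Ω (proj₁ Ω) (proj₂ Ω) ≡ 1ℚ
mL-diag {a , s} i = trans (cong (λ Γ → mL Γ a s) (sym (SP-normal i))) (trans (mL-self a s) (cong sgn (ascPairs-Desc (Strict→Desc (IsSP.strict i)))))

mL-off : ∀ {Γ} Ω → IsSP Γ → Ω ≢ Γ → mL Ω (proj₁ Γ) (proj₂ Γ) ≡ 0ℚ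
mL-off {a , s} Ω i ne with mL Ω a s ℚₚ.≟ 0ℚ
... | yes e = e
... | no h = ⊥-elim (ne (trans (mL-≢0 Ω a s h) (SP-normal i)))

-- Coefficient functions of symmetric functions in superspace of degree n and fermionic degree m;
-- the first m entries of the list are fermionic. The factors -1 and 1 are written out so that
-- `popL-swapAt` treats both kinds of swap with one constant.
record SuperSym (n m : ℕ) (g : List ℕ → ℚ) : Set where
  field
    swap<  : ∀ i l → suc i < m → m ≤ length l → g (swapAt i l) ≡ (-ℚ 1ℚ) *ℚ g l
    swap≥  : ∀ i l → m ≤ i → suc i < length l → g (swapAt i l) ≡ 1ℚ *ℚ g l
    stable : ∀ e s → length e ≡ m → g (e ++ 0 ∷ s) ≡ g (e ++ s)
    homog  : ∀ l → m ≤ length l → sum l ≢ n → g l ≡ 0ℚ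

neg-one : ∀ q → (-ℚ 1ℚ) *ℚ q ≡ -ℚ q
neg-one q = trans (sym (ℚₚ.neg-distribˡ-* 1ℚ q)) (cong -ℚ_ (ℚₚ.*-identityˡ q))

swapAt-length : ∀ i l → length (swapAt i l) ≡ length l
swapAt-length zero    []          = refl
swapAt-length zero    (x ∷ [])    = refl
swapAt-length zero    (x ∷ y ∷ l) = refl
swapAt-length (suc i) []          = refl
swapAt-length (suc i) (x ∷ l)     = cong suc (swapAt-length i l)

swapAt-++ˡ : ∀ i e s → suc i < length e → swapAt i (e ++ s) ≡ swapAt i e ++ s
swapAt-++ˡ zero    (x ∷ y ∷ e) s h       = refl
swapAt-++ˡ zero    (x ∷ [])    s (s≤s ())
swapAt-++ˡ (suc i) (x ∷ e)     s (s≤s h) = cong (x ∷_) (swapAt-++ˡ i e s h)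

swapAt-++ʳ : ∀ i e s → swapAt (length e + i) (e ++ s) ≡ e ++ swapAt i s
swapAt-++ʳ i []      s = refl
swapAt-++ʳ i (x ∷ e) s = cong (x ∷_) (swapAt-++ʳ i e s)

splitAt′ : ∀ m (l : List ℕ) → m ≤ length l → ∃[ e ] ∃[ s ] (l ≡ e ++ s × length e ≡ m)
splitAt′ m l h = take m l , drop m l , sym (Listₚ.take++drop≡id m l) , trans (Listₚ.length-take m l) (ℕₚ.m≤n⇒m⊓n≡m h)

popL-swapAt : ∀ c r i g l → suc i < length l → (∀ k → length k ≡ length l → g (swapAt i k) ≡ c *ℚ g k) → popL r g (swapAt i l) ≡ c *ℚ popL r g l
popL-swapAt c r zero g (x ∷ y ∷ l) lt h = trans
  (cong₂ _+ℚ_ (trans (cong (when (r ≤ᵇ y)) (h (x ∷ y ∸ r ∷ l) refl)) (sym (when-*ˡ (r ≤ᵇ y) c (g (x ∷ y ∸ r ∷ l)))))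
    (cong₂ _+ℚ_ (trans (cong (when (r ≤ᵇ x)) (h (x ∸ r ∷ y ∷ l) refl)) (sym (when-*ˡ (r ≤ᵇ x) c (g (x ∸ r ∷ y ∷ l)))))
      (trans (popL-cong r l (λ k _ e → h (x ∷ y ∷ k) (cong (suc ∘ suc) e))) (popL-*ˡ c r (λ k → g (x ∷ y ∷ k)) l))))
  (solve 4 (λ c p q t → c :* p :+ (c :* q :+ c :* t) := c :* (q :+ (p :+ t))) refl c (when (r ≤ᵇ y) (g (x ∷ y ∸ r ∷ l))) (when (r ≤ᵇ x) (g (x ∸ r ∷ y ∷ l))) (popL r (λ k → g (x ∷ y ∷ k)) l))
popL-swapAt c r zero g (x ∷ []) (s≤s ()) h
popL-swapAt c r (suc i) g (x ∷ l) (s≤s lt) h = trans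
  (cong₂ _+ℚ_ (trans (cong (when (r ≤ᵇ x)) (h (x ∸ r ∷ l) refl)) (sym (when-*ˡ (r ≤ᵇ x) c (g (x ∸ r ∷ l)))))
    (popL-swapAt c r i (λ k → g (x ∷ k)) l lt (λ k e → h (x ∷ k) (cong suc e))))
  (sym (ℚₚ.*-distribˡ-+ c (when (r ≤ᵇ x) (g (x ∸ r ∷ l))) (popL r (λ k → g (x ∷ k)) l)))

popL-stable : ∀ r g e s → 1 ≤ r → (∀ e′ s′ → length e′ ≡ length e → g (e′ ++ 0 ∷ s′) ≡ g (e′ ++ s′)) → popL r g (e ++ 0 ∷ s) ≡ popL r g (e ++ s)
popL-stable (suc r) g [] s _ h = trans (ℚₚ.+-identityˡ _) (popL-cong′ (suc r) (λ l → h [] l refl) s)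
popL-stable r g (x ∷ e) s r≥1 h = cong₂ (λ p q → when (r ≤ᵇ x) p +ℚ q) (h (x ∸ r ∷ e) s refl)
  (popL-stable r (λ k → g (x ∷ k)) e s r≥1 (λ e′ s′ q → h (x ∷ e′) s′ (cong suc q)))

popL-SuperSym : ∀ {n m g} r → 1 ≤ r → SuperSym n m g → SuperSym (r + n) m (popL r g)
popL-SuperSym {n} {m} {g} r r≥1 ss = record
  { swap<  = λ i l i< m≤ → popL-swapAt (-ℚ 1ℚ) r i g l (<-≤-trans i< m≤) (λ k e → swap< i k i< (≤-trans m≤ (≤-reflexive (sym e))))
  ; swap≥  = λ i l m≤ i< → popL-swapAt 1ℚ r i g l i< (λ k e → swap≥ i k m≤ (<-≤-trans i< (≤-reflexive (sym e))))
  ; stable = λ e s le → popL-stable r g e s r≥1 (λ e′ s′ q → stable e′ s′ (trans q le))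
  ; homog  = λ l m≤ ne → trans (popL-cong r l (λ k e q → homog k (≤-trans m≤ (≤-reflexive (sym q))) (λ z → ne (trans (sym e) (trans (cong (_+ r) z) (ℕₚ.+-comm n r)))))) (popL-0 r l)
  }
  where open SuperSym ss

-- The product of the odd power sums with indices `a`: an alternant in the variables that carry a θ,
-- with no other variable occurring.
base : List ℕ → List ℕ → ℚ
base a l = when (zeroL (drop (length a) l)) (alt a (take (length a) l))

take-++′ : ∀ (e s : List ℕ) {m} → length e ≡ m → take m (e ++ s) ≡ e
take-++′ []      s refl = refl
take-++′ (x ∷ e) s refl = cong (x ∷_) (take-++′ e s refl)

drop-++′ : ∀ (e s : List ℕ) {m} → length e ≡ m → drop m (e ++ s) ≡ s
drop-++′ []      s refl = refl
drop-++′ (x ∷ e) s refl = drop-++′ e s refl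

base-++ : ∀ a e s → length e ≡ length a → base a (e ++ s) ≡ when (zeroL s) (alt a e)
base-++ a e s q = cong₂ (λ x y → when (zeroL x) (alt a y)) (drop-++′ e s q) (take-++′ e s q)

zeroL→sum : ∀ l → zeroL l ≡ true → sum l ≡ 0
zeroL→sum [] _ = refl
zeroL→sum (zero ∷ l) h = zeroL→sum l h

zeroL-swap : ∀ i l → zeroL (swapAt i l) ≡ zeroL l
zeroL-swap zero    []          = refl
zeroL-swap zero    (x ∷ [])    = refl
zeroL-swap zero    (zero ∷ zero ∷ l)   = refl
zeroL-swap zero    (zero ∷ suc y ∷ l)  = refl
zeroL-swap zero    (suc x ∷ zero ∷ l)  = refl
zeroL-swap zero    (suc x ∷ suc y ∷ l) = refl
zeroL-swap (suc i) []          = refl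
zeroL-swap (suc i) (x ∷ l)     = cong ((x ≡ᵇ 0) ∧_) (zeroL-swap i l)

base-SuperSym : ∀ a → SuperSym (sum a) (length a) (base a)
base-SuperSym a = record
  { swap<  = λ i l i< m≤ → sw< i l i< (splitAt′ (length a) l m≤)
  ; swap≥  = λ i l m≤ i< → sw≥ i l m≤ (splitAt′ (length a) l (<⇒≤ (≤-<-trans m≤ (<⇒≤ i<))))
  ; stable = λ e s q → trans (base-++ a e (0 ∷ s) q) (sym (base-++ a e s q))
  ; homog  = λ l m≤ ne → hom l ne (splitAt′ (length a) l m≤)
  }
  where
  sw< : ∀ i l → suc i < length a → ∃[ e ] ∃[ s ] (l ≡ e ++ s × length e ≡ length a) → base a (swapAt i l) ≡ (-ℚ 1ℚ) *ℚ base a l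
  sw< i _ i< (e , s , refl , q) = begin
    base a (swapAt i (e ++ s))           ≡⟨ cong (base a) (swapAt-++ˡ i e s i<e) ⟩
    base a (swapAt i e ++ s)             ≡⟨ base-++ a (swapAt i e) s (trans (swapAt-length i e) q) ⟩
    when (zeroL s) (alt a (swapAt i e))  ≡⟨ cong (when (zeroL s)) (trans (alt-Anti a i e i<e) (sym (neg-one (alt a e)))) ⟩
    when (zeroL s) ((-ℚ 1ℚ) *ℚ alt a e)  ≡⟨ sym (when-*ˡ (zeroL s) (-ℚ 1ℚ) (alt a e)) ⟩
    (-ℚ 1ℚ) *ℚ when (zeroL s) (alt a e)  ≡⟨ cong ((-ℚ 1ℚ) *ℚ_) (sym (base-++ a e s q)) ⟩
    (-ℚ 1ℚ) *ℚ base a (e ++ s) ∎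
    where
    i<e = <-≤-trans i< (≤-reflexive (sym q))
  sw≥ : ∀ i l → length a ≤ i → ∃[ e ] ∃[ s ] (l ≡ e ++ s × length e ≡ length a) → base a (swapAt i l) ≡ 1ℚ *ℚ base a l
  sw≥ i _ m≤ (e , s , refl , q) = begin
    base a (swapAt i (e ++ s))               ≡⟨ cong (λ k → base a (swapAt k (e ++ s))) (sym (trans (cong (_+ (i ∸ length a)) q) (m+[n∸m]≡n m≤))) ⟩
    base a (swapAt (length e + (i ∸ length a)) (e ++ s)) ≡⟨ cong (base a) (swapAt-++ʳ (i ∸ length a) e s) ⟩
    base a (e ++ swapAt (i ∸ length a) s)    ≡⟨ base-++ a e (swapAt (i ∸ length a) s) q ⟩
    when (zeroL (swapAt (i ∸ length a) s)) (alt a e) ≡⟨ when-≡ (alt a e) (zeroL-swap (i ∸ length a) s) ⟩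
    when (zeroL s) (alt a e)                 ≡⟨ trans (sym (base-++ a e s q)) (sym (ℚₚ.*-identityˡ (base a (e ++ s)))) ⟩
    1ℚ *ℚ base a (e ++ s) ∎
  hom : ∀ l → sum l ≢ sum a → ∃[ e ] ∃[ s ] (l ≡ e ++ s × length e ≡ length a) → base a l ≡ 0ℚ
  hom _ ne (e , s , refl , q) with zeroL s in z
  ... | false = trans (base-++ a e s q) (when-≡ (alt a e) z)
  ... | true  = trans (base-++ a e s q) (trans (when-≡ (alt a e) z) (alt-homog a e (λ h → ne
    (trans (sum-++ e s) (trans (cong₂ _+_ (sym h) (zeroL→sum s z)) (ℕₚ.+-identityʳ (sum a)))))))

pL : SPart → List ℕ → ℚ
pL (a , s) = opP s (base a)

pL-SuperSym : ∀ {Γ} → IsSP Γ → SuperSym (bdeg Γ) (fdeg Γ) (pL Γ)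
pL-SuperSym {a , s} i = go s (IsSP.pos i)
  where
  go : ∀ s → (∀ z → z ∈ s → 1 ≤ z) → SuperSym (sum a + sum s) (length a) (opP s (base a))
  go []      h = subst (λ n → SuperSym n (length a) (base a)) (sym (ℕₚ.+-identityʳ (sum a))) (base-SuperSym a)
  go (r ∷ s) h = subst (λ n → SuperSym n (length a) (popL r (opP s (base a)))) (+-exchange r (sum a) (sum s)) (popL-SuperSym r (h r (here refl)) (go s (λ z m → h z (there m))))

record Symm (h : List ℕ → ℚ) : Set where
  constructor mkSymm
  field
    swap : ∀ i l → suc i < length l → h (swapAt i l) ≡ h l
    drop0 : ∀ l → h (0 ∷ l) ≡ h l

Symm-∷ : ∀ {h} x → Symm h → Symm (λ l → h (x ∷ l))
Symm-∷ x (mkSymm sw dr) = mkSymm (λ i l lt → sw (suc i) (x ∷ l) (s≤s lt)) (λ l → trans (sw 0 (0 ∷ x ∷ l) (s≤s (s≤s z≤n))) (dr (x ∷ l)))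

Symm-insert : ∀ {h} → Symm h → ∀ x t → h (x ∷ t) ≡ h (insertDesc x t)
Symm-insert sy x [] = refl
Symm-insert sy x (y ∷ t) with y ≤ᵇ x
... | true  = refl
... | false = trans (Symm.swap sy 0 (y ∷ x ∷ t) (s≤s (s≤s z≤n))) (Symm-insert (Symm-∷ y sy) x t)

Symm-normal : ∀ {h} → Symm h → ∀ s → h s ≡ h (sortDesc (nz s))
Symm-normal sy []          = refl
Symm-normal sy (zero ∷ s)  = trans (Symm.drop0 sy s) (Symm-normal sy s)
Symm-normal sy (suc x ∷ s) = trans (Symm-normal (Symm-∷ (suc x) sy) s) (Symm-insert sy (suc x) (sortDesc (nz s)))

self-neg : ∀ q → q ≡ -ℚ q → q ≡ 0ℚ
self-neg q h = *-cancel {1ℚ +ℚ 1ℚ} (λ ()) (trans (solve 1 (λ q → (con 1ℚ :+ con 1ℚ) :* q := q :+ q) refl q)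
  (trans (cong (q +ℚ_) h) (trans (ℚₚ.+-inverseʳ q) (sym (ℚₚ.*-zeroʳ (1ℚ +ℚ 1ℚ))))))

-- Swapping two equal neighbours changes the sign but not the list.
Anti-repeat : ∀ {g} → Anti g → ∀ l → Desc l → strictDesc l ≡ false → g l ≡ 0ℚ
Anti-repeat {g} an (x ∷ y ∷ l) d h = step (suc y ≤? x) (Anti-repeat {λ k → g (x ∷ k)} (Anti-∷ {g} x an) (y ∷ l) (Desc-tail d))
  where
  step : Dec (suc y ≤ x) → (strictDesc (y ∷ l) ≡ false → g (x ∷ y ∷ l) ≡ 0ℚ) → g (x ∷ y ∷ l) ≡ 0ℚ
  step (yes lt) rec = rec (trans (sym (cong (_∧ strictDesc (y ∷ l)) (≤→≤ᵇ lt))) h)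
  step (no ge) _ with ≤-antisym (Desc-head d (here refl)) (≮⇒≥ ge)
  ... | refl = self-neg (g (x ∷ x ∷ l)) (an 0 (x ∷ x ∷ l) (s≤s (s≤s z≤n)))

module _ {n m g} (ss : SuperSym n m g) where
  open SuperSym ss

  private
    cut : List ℕ → List ℕ → ℚ
    cut s e = when (length e ≡ᵇ m) (g (e ++ s))

    cut-Anti : ∀ s → Anti (cut s)
    cut-Anti s i e i< with length e ≟ m
    ... | yes refl = trans (cong₂ when (≡→≡ᵇ {length (swapAt i e)} (swapAt-length i e)) (cong g (sym (swapAt-++ˡ i e s i<))))
      (trans (trans (swap< i (e ++ s) i< (≤-trans (m≤m+n (length e) (length s)) (≤-reflexive (sym (Listₚ.length-++ e))))) (neg-one (g (e ++ s))))
        (sym (cong (λ b → -ℚ when b (g (e ++ s))) (≡→≡ᵇ {length e} refl))))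
    ... | no ne = trans (when-≡ (g (swapAt i e ++ s)) (≢→≡ᵇ {length (swapAt i e)} (λ q → ne (trans (sym (swapAt-length i e)) q))))
        (sym (cong (λ b → -ℚ when b (g (e ++ s))) (≢→≡ᵇ {length e} ne)))

    cut-≡ : ∀ s e → length e ≡ m → cut s e ≡ g (e ++ s)
    cut-≡ s e q = when-≡ (g (e ++ s)) (≡→≡ᵇ {length e} q)

    boson : ∀ e → length e ≡ m → Symm (λ s → g (e ++ s))
    boson e q = mkSymm (λ i s i< → trans (cong g (sym (swapAt-++ʳ i e s))) (trans (swap≥ (length e + i) (e ++ s) (≤-trans (≤-reflexive (sym q)) (m≤m+n (length e) i))
        (subst₂ _<_ (+-suc (length e) i) (sym (Listₚ.length-++ e)) (ℕₚ.+-monoʳ-< (length e) i<))) (ℚₚ.*-identityˡ (g (e ++ s)))))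
      (λ s → stable e s q)

  SuperSym-normal : ∀ e s → length e ≡ m → g (e ++ s) ≡ sgn (ascPairs e) *ℚ g (sortDesc e ++ sortDesc (nz s))
  SuperSym-normal e s q = begin
    g (e ++ s)                                       ≡⟨ Symm-normal (boson e q) s ⟩
    g (e ++ t)                                       ≡⟨ sym (cut-≡ t e q) ⟩
    cut t e                                          ≡⟨ Anti-sort {cut t} (cut-Anti t) e ⟩
    sgn (ascPairs e) *ℚ cut t (sortDesc e)           ≡⟨ cong (sgn (ascPairs e) *ℚ_) (cut-≡ t (sortDesc e) (trans (sortDesc-length e) q)) ⟩
    sgn (ascPairs e) *ℚ g (sortDesc e ++ t) ∎
    where
    t = sortDesc (nz s)

  -- Sorting reduces every value of `g` to a value at decreasing exponents, with the same sign that
  -- m_Ω carries. If a fermionic exponent repeats or the degree is wrong, both sides vanish.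
  SuperSym-expand : ∀ e s → length e ≡ m → g (e ++ s) ≡ ∑ (sector n m) (λ Ω → g (proj₁ Ω ++ proj₂ Ω) *ℚ mL Ω e s)
  SuperSym-expand e s q = main (strictDesc a) refl (sum a + sum t ≟ n)
    where
    a = sortDesc e
    t = sortDesc (nz s)
    la : length a ≡ m
    la = trans (sortDesc-length e) q
    other : ∀ Ω → Ω ≢ (a , t) → g (proj₁ Ω ++ proj₂ Ω) *ℚ mL Ω e s ≡ 0ℚ
    other Ω ne with mL Ω e s ℚₚ.≟ 0ℚ
    ... | yes z = *-0ʳ (g (proj₁ Ω ++ proj₂ Ω)) z
    ... | no nz = ⊥-elim (ne (mL-≢0 Ω e s nz))
    vanish : g (a ++ t) ≡ 0ℚ → ((a , t) ∈ sector n m → ⊥) → g (e ++ s) ≡ ∑ (sector n m) (λ Ω → g (proj₁ Ω ++ proj₂ Ω) *ℚ mL Ω e s)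
    vanish z out = trans (trans (SuperSym-normal e s q) (*-0ʳ (sgn (ascPairs e)) z))
      (sym (∑-zero (sector n m) (λ Ω Ω∈ → other Ω (λ { refl → out Ω∈ }))))
    main : ∀ b → strictDesc a ≡ b → Dec (sum a + sum t ≡ n) → g (e ++ s) ≡ ∑ (sector n m) (λ Ω → g (proj₁ Ω ++ proj₂ Ω) *ℚ mL Ω e s)
    main false st _ = vanish (trans (sym (cut-≡ t a la)) (Anti-repeat {cut t} (cut-Anti t) a (sortDesc-Desc e) st))
      (λ h → false≢true st (→strictDesc (IsSP.strict (proj₁ (sector→ {n} {m} h)))))
    main true st (no ne) = vanish (homog (a ++ t) (≤-trans (≤-reflexive (sym la)) (≤-trans (m≤m+n (length a) (length t)) (≤-reflexive (sym (Listₚ.length-++ a)))))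
      (λ h → ne (trans (sym (sum-++ a t)) h))) (λ h → ne (proj₁ (proj₂ (sector→ {n} {m} h))))
    main true st (yes d) = trans (SuperSym-normal e s q) (trans (ℚₚ.*-comm (sgn (ascPairs e)) (g (a ++ t))) (trans (cong (g (a ++ t) *ℚ_) (sym (mL-self e s)))
      (sym (∑-single (a , t) (sector-Unique n m) (→sector′ i d la) (λ Ω _ → other Ω) (_≟SP (a , t))))))
      where
      i : IsSP (a , t)
      i = mkSP (strictDesc→ a st) (sortDesc-Desc (nz s)) (λ z z∈ → nz-pos s z (sortDesc-∈ (nz s) z∈))

-- The transition matrix from power sums to monomials

popL-++ : ∀ r g e s → popL r g (e ++ s) ≡ popL r (λ e′ → g (e′ ++ s)) e +ℚ popL r (λ s′ → g (e ++ s′)) s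
popL-++ r g []      s = sym (ℚₚ.+-identityˡ (popL r g s))
popL-++ r g (x ∷ e) s = trans (cong (when (r ≤ᵇ x) (g (x ∸ r ∷ e ++ s)) +ℚ_) (popL-++ r (λ l → g (x ∷ l)) e s))
  (sym (ℚₚ.+-assoc (when (r ≤ᵇ x) (g (x ∸ r ∷ e ++ s))) (popL r (λ e′ → g (x ∷ e′ ++ s)) e) (popL r (λ s′ → g (x ∷ e ++ s′)) s)))

+-nonzero : ∀ {x y} → x +ℚ y ≢ 0ℚ → x ≢ 0ℚ ⊎ y ≢ 0ℚ
+-nonzero {x} {y} h with x ℚₚ.≟ 0ℚ
... | no ne = inj₁ ne
... | yes refl = inj₂ (λ { refl → h refl })

popL-hit : ∀ r g l → popL r g l ≢ 0ℚ → ∃[ p ] ∃[ x ] ∃[ q ] (l ≡ p ++ x ∷ q × r ≤ x × g (p ++ (x ∸ r) ∷ q) ≢ 0ℚ)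
popL-hit r g []      h = ⊥-elim (h refl)
popL-hit r g (x ∷ l) h with +-nonzero {when (r ≤ᵇ x) (g (x ∸ r ∷ l))} h
... | inj₁ h₁ = let b , h₂ = when-nonzero (r ≤ᵇ x) h₁ in [] , x , l , refl , ≤ᵇ→≤ {r} b , h₂
... | inj₂ h₁ with popL-hit r (λ k → g (x ∷ k)) l h₁
...   | p , y , q , refl , le , h₂ = x ∷ p , y , q , refl , le , h₂

sum-mid : ∀ p x q → sum (p ++ x ∷ q) ≡ x + sum (p ++ q)
sum-mid p x q = trans (sum-++ p (x ∷ q)) (trans (+-exchange (sum p) x (sum q)) (cong (x +_) (sym (sum-++ p q))))

nz-++ : ∀ p q → nz (p ++ q) ≡ nz p ++ nz q
nz-++ []          q = refl
nz-++ (zero ∷ p)  q = nz-++ p q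
nz-++ (suc x ∷ p) q = cong (suc x ∷_) (nz-++ p q)

zeroL→nz : ∀ l → zeroL l ≡ true → nz l ≡ []
zeroL→nz [] h = refl
zeroL→nz (zero ∷ l) h = zeroL→nz l h

length-mid : ∀ (p : List ℕ) x q → length (p ++ x ∷ q) ≡ suc (length (p ++ q))
length-mid []      x q = refl
length-mid (_ ∷ p) x q = cong suc (length-mid p x q)

-- Each power sum acts on a fermionic or on a bosonic variable. In the former case it can only
-- increase the fermionic exponents; only on a fresh bosonic variable does it create a bosonic part.
-- So the maximal number of parts forces every factor onto a variable of its own.
opP-support : ∀ a γ e s → length e ≡ length a → opP γ (base a) (e ++ s) ≢ 0ℚ →
  sum a ≤ sum e × length (nz s) ≤ length γ × (length (nz s) ≡ length γ → sortDesc (nz s) ≡ sortDesc γ × alt a e ≢ 0ℚ)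
opP-support a [] e s q h with when-nonzero (zeroL s) (λ z → h (trans (base-++ a e s q) z))
... | z , ne = ≤-reflexive homog , ≤-reflexive (cong length (zeroL→nz s z)) , λ _ → cong sortDesc (zeroL→nz s z) , ne
  where
  homog : sum a ≡ sum e
  homog with sum a ≟ sum e
  ... | yes d = d
  ... | no d = ⊥-elim (ne (alt-homog a e d))
opP-support a (r ∷ γ) e s q h with +-nonzero {popL r (λ e′ → opP γ (base a) (e′ ++ s)) e} (λ z → h (trans (popL-++ r (opP γ (base a)) e s) z))
... | inj₁ h₁ with popL-hit r (λ e′ → opP γ (base a) (e′ ++ s)) e h₁
...   | p , x , t , refl , r≤x , h₂ with opP-support a γ (p ++ (x ∸ r) ∷ t) s (trans (trans (length-mid p (x ∸ r) t) (sym (length-mid p x t))) q) h₂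
...     | le , ln , _ = ≤-trans le (subst₂ _≤_ (sym (sum-mid p (x ∸ r) t)) (sym (sum-mid p x t)) (+-monoˡ-≤ (sum (p ++ t)) (m∸n≤m x r))) ,
                        m≤n⇒m≤1+n ln , λ z → ⊥-elim (<-irrefl z (s≤s ln))
opP-support a (r ∷ γ) e s q h | inj₂ h₁ with popL-hit r (λ s′ → opP γ (base a) (e ++ s′)) s h₁
... | p , x , t , refl , r≤x , h₂ with opP-support a γ e (p ++ (x ∸ r) ∷ t) q h₂
...   | le , ln , eq = le , hit x (x ∸ r) r≤x refl ln eq
  where
  ns : ∀ y → nz (p ++ y ∷ t) ≡ nz p ++ nz (y ∷ t)
  ns y = nz-++ p (y ∷ t)
  hit : ∀ x y → r ≤ x → y ≡ x ∸ r → length (nz (p ++ y ∷ t)) ≤ length γ → (length (nz (p ++ y ∷ t)) ≡ length γ → sortDesc (nz (p ++ y ∷ t)) ≡ sortDesc γ × alt a e ≢ 0ℚ) →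
    length (nz (p ++ x ∷ t)) ≤ suc (length γ) × (length (nz (p ++ x ∷ t)) ≡ suc (length γ) → sortDesc (nz (p ++ x ∷ t)) ≡ sortDesc (r ∷ γ) × alt a e ≢ 0ℚ)
  hit zero y _ eq ln _ rewrite eq | ℕₚ.0∸n≡0 r = m≤n⇒m≤1+n ln , λ z → ⊥-elim (<-irrefl z (s≤s ln))
  hit (suc x) (suc y) _ _ ln _ rewrite ns (suc x) | ns (suc y) | length-mid (nz p) (suc y) (nz t) | length-mid (nz p) (suc x) (nz t) =
    m≤n⇒m≤1+n ln , λ z → ⊥-elim (<-irrefl z (s≤s ln))
  hit (suc x) zero r≤ eq ln f rewrite ns (suc x) | ns 0 | length-mid (nz p) (suc x) (nz t) = s≤s ln , λ z → let f₁ , f₂ = f (suc-injective z) in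
    trans (sort-++-∷ (nz p) (suc x) (nz t)) (cong₂ insertDesc x≡r f₁) , f₂
    where
    x≡r : suc x ≡ r
    x≡r = ≤-antisym (m∸n≡0⇒m≤n (sym eq)) r≤

-- When the fermionic exponents sum to at most |a|, no power sum can be spent on them, and the
-- coefficient factors.
opP-homog : ∀ a γ e s → (∀ z → z ∈ γ → 1 ≤ z) → length e ≡ length a → sum e ≤ sum a → opP γ (base a) (e ++ s) ≡ alt a e *ℚ opP γ oneL s
opP-homog a [] e s h q le = trans (base-++ a e s q) (trans (cong (when (zeroL s)) (sym (ℚₚ.*-identityʳ (alt a e)))) (sym (when-*ˡ (zeroL s) (alt a e) 1ℚ)))
opP-homog a (r ∷ γ) e s h q le = begin
  popL r (opP γ (base a)) (e ++ s)
    ≡⟨ popL-++ r (opP γ (base a)) e s ⟩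
  popL r (λ e′ → opP γ (base a) (e′ ++ s)) e +ℚ popL r (λ s′ → opP γ (base a) (e ++ s′)) s
    ≡⟨ cong₂ _+ℚ_ (trans (popL-cong r e lower) (popL-0 r e)) (trans (popL-cong′ r (λ s′ → opP-homog a γ e s′ h′ q le) s) (popL-*ˡ (alt a e) r (opP γ oneL) s)) ⟩
  0ℚ +ℚ alt a e *ℚ popL r (opP γ oneL) s
    ≡⟨ ℚₚ.+-identityˡ (alt a e *ℚ popL r (opP γ oneL) s) ⟩
  alt a e *ℚ popL r (opP γ oneL) s ∎
  where
  h′ : ∀ z → z ∈ γ → 1 ≤ z
  h′ z m = h z (there m)
  lower : ∀ e′ → sum e′ + r ≡ sum e → length e′ ≡ length e → opP γ (base a) (e′ ++ s) ≡ 0ℚ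
  lower e′ d l = trans (opP-homog a γ e′ s h′ (trans l q) (<⇒≤ lt)) (*-0ˡ (opP γ oneL s) (alt-homog a e′ (λ z → <-irrefl (sym z) lt)))
    where
    lt : sum e′ < sum a
    lt = <-≤-trans (subst (sum e′ <_) d (ℕₚ.m<m+n (sum e′) (h r (here refl)))) le

popL-nonneg : ∀ r {g} → (∀ l → 0ℚ ≤ℚ g l) → ∀ l → 0ℚ ≤ℚ popL r g l
popL-nonneg r h [] = ℚₚ.≤-refl
popL-nonneg r {g} h (x ∷ l) = ℚₚ.+-mono-≤ {0ℚ} {when (r ≤ᵇ x) (g (x ∸ r ∷ l))} {0ℚ} first (popL-nonneg r (λ k → h (x ∷ k)) l)
  where
  first : 0ℚ ≤ℚ when (r ≤ᵇ x) (g (x ∸ r ∷ l))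
  first with r ≤ᵇ x
  ... | true  = h (x ∸ r ∷ l)
  ... | false = ℚₚ.≤-refl

opP-nonneg : ∀ γ l → 0ℚ ≤ℚ opP γ oneL l
opP-nonneg [] l with zeroL l
... | true  = ℚₚ.nonNegative⁻¹ 1ℚ
... | false = ℚₚ.≤-refl
opP-nonneg (r ∷ γ) l = popL-nonneg r (opP-nonneg γ) l

opP-stable0 : ∀ γ l → (∀ z → z ∈ γ → 1 ≤ z) → opP γ oneL (0 ∷ l) ≡ opP γ oneL l
opP-stable0 []      l h = refl
opP-stable0 (r ∷ γ) l h = popL-stable r (opP γ oneL) [] l (h r (here refl)) (λ { [] s _ → opP-stable0 γ s (λ z m → h z (there m)) })

-- All terms are nonnegative, and placing each factor on its own variable gives a positive one.
opP-pos : ∀ γ → (∀ z → z ∈ γ → 1 ≤ z) → 0ℚ <ℚ opP γ oneL γ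
opP-pos []      h = ℚₚ.positive⁻¹ 1ℚ
opP-pos (r ∷ γ) h = subst (0ℚ <ℚ_) (sym (cong₂ (λ b x → when b (opP γ oneL (x ∷ γ)) +ℚ popL r (λ k → opP γ oneL (r ∷ k)) γ) (≤→≤ᵇ (≤-refl {r})) (n∸n≡0 r)))
  (ℚₚ.+-mono-<-≤ {0ℚ} {opP γ oneL (0 ∷ γ)} {0ℚ} (subst (0ℚ <ℚ_) (sym (opP-stable0 γ γ h′)) (opP-pos γ h′)) (popL-nonneg r (λ k → opP-nonneg γ (r ∷ k)) γ))
  where
  h′ : ∀ z → z ∈ γ → 1 ≤ z
  h′ z m = h z (there m)

alt-Strict : ∀ {a b} → Strict a → Strict b → alt a b ≡ when (eqL b a) 1ℚ
alt-Strict s t = alt-Desc s (Strict→Desc t)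

alt-self : ∀ {a} → Strict a → alt a a ≡ 1ℚ
alt-self {a} s = trans (alt-Strict s s) (when-≡ 1ℚ (eqL-refl a))

module Sector (n m : ℕ) where

  I : List SPart
  I = sector n m

  sp : ∀ {Λ} → Λ ∈ I → IsSP Λ
  sp h = proj₁ (sector→ {n} {m} h)

  bd : ∀ {Λ} → Λ ∈ I → bdeg Λ ≡ n
  bd h = proj₁ (proj₂ (sector→ {n} {m} h))

  fd : ∀ {Λ} → Λ ∈ I → fdeg Λ ≡ m
  fd h = proj₂ (proj₂ (sector→ {n} {m} h))

  -- The coefficient of m_Ω in p_Γ, which by `SuperSym-expand` is the value at the exponents of Ω.
  R : SPart → SPart → ℚ
  R Γ Ω = pL Γ (proj₁ Ω ++ proj₂ Ω)

  R-support : ∀ Γ Ω → Γ ∈ I → Ω ∈ I → Γ ≢ Ω → R Γ Ω ≢ 0ℚ → length (proj₂ Ω) < length (proj₂ Γ) × sum (proj₁ Γ) ≤ sum (proj₁ Ω)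
  R-support (a , γ) (b , s) Γ∈ Ω∈ ne h with opP-support a γ b s (trans (fd Ω∈) (sym (fd Γ∈))) h
  ... | le , ln , eq = ≤∧≢⇒< ln′ strict , le
    where
    nzs = nz-id s (IsSP.pos (sp Ω∈))
    ln′ : length s ≤ length γ
    ln′ = subst (λ t → length t ≤ length γ) nzs ln
    strict : length s ≢ length γ
    strict z with eq (trans (cong length nzs) z)
    ... | f₁ , f₂ with when-nonzero (eqL b a) (λ w → f₂ (trans (alt-Strict (IsSP.strict (sp Γ∈)) (IsSP.strict (sp Ω∈))) w))
    ...   | b≡a , _ = ne (sym (cong₂ _,_ (eqL→≡ b a b≡a) (trans (sym (sortDesc-id (IsSP.desc (sp Ω∈)))) (trans (cong sortDesc (sym nzs)) (trans f₁ (sortDesc-id (IsSP.desc (sp Γ∈))))))))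

  R-diag : ∀ Γ → Γ ∈ I → R Γ Γ ≢ 0ℚ
  R-diag (a , γ) Γ∈ z = ℚₚ.<-irrefl (sym (trans (sym (trans (opP-homog a γ a γ pos refl ≤-refl) (*-1ˡ (opP γ oneL γ) (alt-self (IsSP.strict (sp Γ∈)))))) z))
    (opP-pos γ pos)
    where pos = IsSP.pos (sp Γ∈)

  -- The rank is the number of bosonic parts. The preorder records that |Γ^a| can only grow from p_Γ
  -- to m_Ω, which later controls the powers of q.
  open Triangular I (sector-Unique n m) _≟SP_ R (length ∘ proj₂) (λ Γ Ω → sum (proj₁ Γ) ≤ sum (proj₁ Ω)) (λ _ → ≤-refl) ≤-trans R-support R-diag public

  pL-expand : ∀ Γ e s → Γ ∈ I → length e ≡ m → pL Γ (e ++ s) ≡ ∑ I (λ Ω → R Γ Ω *ℚ mL Ω e s)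
  pL-expand Γ e s Γ∈ q = SuperSym-expand (subst₂ (λ n m → SuperSym n m (pL Γ)) (bd Γ∈) (fd Γ∈) (pL-SuperSym (sp Γ∈))) e s q

  mL-expand : ∀ Ω e s → Ω ∈ I → length e ≡ m → mL Ω e s ≡ ∑ I (λ Γ → inv-matrix Ω Γ *ℚ pL Γ (e ++ s))
  mL-expand Ω e s Ω∈ q = sym (trans (∑-cong I (λ Γ Γ∈ → cong (inv-matrix Ω Γ *ℚ_) (pL-expand Γ e s Γ∈ q)))
    (trans (∑-assoc I I (inv-matrix Ω) R (λ Δ → mL Δ e s)) (trans (∑-cong I (λ Δ Δ∈ → cong (_*ℚ mL Δ e s) (inv-T Ω Δ Ω∈ Δ∈))) (∑-δˡ Ω (λ Δ → mL Δ e s) Ω∈))))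

  -- The coefficients of h_μ · (base of Λ^a) in power sums, with the Cauchy weights moved onto R.
  η : SPart → SPart → ℚ
  η Ω Γ = when (sum (proj₁ Γ) ≡ᵇ sum (proj₁ Ω)) (wz (proj₂ Γ) *ℚ R Γ Ω)

  HL : SPart → List ℕ → ℚ
  HL (a , μ) = opH μ (base a)

  -- Cauchy's identity yields only Γ with Γ^a = Ω^a, and there `opP-homog` identifies its
  -- coefficient with R Γ Ω. The test in `η` compares only sizes; for another Γ^a of the same size R
  -- Γ Ω vanishes by the same lemma.
  HL-power : ∀ Ω l → Ω ∈ I → HL Ω l ≡ ∑ I (λ Γ → η Ω Γ *ℚ pL Γ l)
  HL-power (a , μ) l Ω∈ = trans (cauchy (sum μ) μ (base a) l ≤-refl) (sym (∑-reindex {ys = parts (sum μ)} (a ,_) (sector-Unique n m) (parts-Unique (sum μ)) to (λ { _ _ _ _ refl → refl }) surj))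
    where
    to : ∀ γ → γ ∈ parts (sum μ) → (a , γ) ∈ I × wz γ *ℚ (opP γ oneL μ *ℚ opP γ (base a) l) ≡ η (a , μ) (a , γ) *ℚ pL (a , γ) l
    to γ γ∈ with parts→ γ∈
    ... | mkPart d p t = →sector′ (mkSP (IsSP.strict (sp Ω∈)) d p) (trans (cong (sum a +_) t) (bd Ω∈)) (fd Ω∈) ,
      trans (sym (ℚₚ.*-assoc (wz γ) (opP γ oneL μ) (opP γ (base a) l))) (cong (_*ℚ opP γ (base a) l) (sym (cong₂ when (≡→≡ᵇ {sum a} refl) (cong (wz γ *ℚ_)
        (trans (opP-homog a γ a μ p refl ≤-refl) (*-1ˡ (opP γ oneL μ) (alt-self (IsSP.strict (sp Ω∈)))))))))
    surj : ∀ Γ → Γ ∈ I → (∃[ γ ] (γ ∈ parts (sum μ) × Γ ≡ (a , γ))) ⊎ η (a , μ) Γ *ℚ pL Γ l ≡ 0ℚ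
    surj (b , γ) Γ∈ with sum b ≟ sum a
    ... | no ne = inj₂ (trans (cong (λ c → when c (wz γ *ℚ R (b , γ) (a , μ)) *ℚ pL (b , γ) l) (≢→≡ᵇ {sum b} ne)) (ℚₚ.*-zeroˡ (pL (b , γ) l)))
    ... | yes d with eqL a b in e
    ...   | true with eqL→≡ a b e
    ...     | refl = inj₁ (γ , →parts (mkPart (IsSP.desc (sp Γ∈)) (IsSP.pos (sp Γ∈)) (+-cancelˡ-≡ (sum a) (sum γ) (sum μ) (trans (bd Γ∈) (sym (bd Ω∈))))) , refl)
    surj (b , γ) Γ∈ | yes d | false = inj₂ (*-0ˡ (pL (b , γ) l) (trans (cong (when (sum b ≡ᵇ sum a)) (*-0ʳ (wz γ) R0)) (when-zero (sum b ≡ᵇ sum a))))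
      where
      R0 : R (b , γ) (a , μ) ≡ 0ℚ
      R0 = trans (opP-homog b γ a μ (IsSP.pos (sp Γ∈)) (trans (fd Ω∈) (sym (fd Γ∈))) (≤-reflexive (sym d)))
        (*-0ˡ (opP γ oneL μ) (trans (alt-Strict (IsSP.strict (sp Γ∈)) (IsSP.strict (sp Ω∈))) (cong (λ c → when c 1ℚ) e)))

-- The expansion of products of complete functions over the F_Λ

branch-circled : ∀ C a j Γ → branch C false Γ (circled a ++ zeros j) ≡ true → Γ ≡ circled a ++ zeros j
branch-circled C (x ∷ a) j ((c , false) ∷ Γ) ()
branch-circled C (x ∷ a) j ((c , true) ∷ Γ) e =
  let e₁ , e₂ = ∧-split {(c ≤ᵇ x) ∧ (x <ᵇ suc c)} e ; p , q = ∧-split {c ≤ᵇ x} e₁ in cong₂ (λ w l → (w , true) ∷ l) (≤-antisym (≤ᵇ→≤ {c} p) (≤-pred (<ᵇ→< {x} {suc c} q))) (branch-circled c a j Γ e₂)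
branch-circled C [] zero [] e = refl
branch-circled C [] (suc j) ((c , true) ∷ Γ) ()
branch-circled C [] (suc j) ((c , false) ∷ Γ) e with ∧-split {(c ≤ᵇ 0) ∧ (0 <ᵇ suc C)} e
... | e₁ , e₂ = cong₂ (λ w l → (w , false) ∷ l) (ℕₚ.n≤0⇒n≡0 (≤ᵇ→≤ {c} (proj₁ (∧-split {c ≤ᵇ 0} e₁)))) (branch-circled c [] j Γ e₂)

branch-refl : ∀ C a j → branch C false (circled a ++ zeros j) (circled a ++ zeros j) ≡ true
branch-refl C (x ∷ a) j       = ∧-intro (∧-intro (≤→≤ᵇ {x} ≤-refl) (<→<ᵇ {x} ≤-refl)) (branch-refl x a j)
branch-refl C []      zero    = refl
branch-refl C []      (suc j) = branch-refl 0 [] j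

pad-zeros : ∀ k → pad (zeros k) ≡ zeros (suc k)
pad-zeros zero    = refl
pad-zeros (suc k) = cong ((0 , false) ∷_) (pad-zeros k)

-- The only branching strip into such a diagram takes away an empty row, so every bosonic exponent
-- has to be zero.
schur-circled : ∀ M a e s → Strict a → (∀ z → z ∈ a → z < M) → schur M e s (circled a ++ zeros (length s)) ≡ when (zeroL s) (alt a e)
schur-circled M a e [] st h = trans (cong (λ l → when (allCirc l) (alt (lens l) e)) (Listₚ.++-identityʳ (circled a)))
  (cong₂ (λ b l → when b (alt l e)) (allCirc-circled a) (lens-circled a))
schur-circled M a e (z ∷ s) st h = begin
  ∑ (box M (length Λ ∸ 1)) term
    ≡⟨ cong (λ k → ∑ (box M k) term) lenΛ ⟩
  ∑ (box M (length Γ₀)) term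
    ≡⟨ ∑-single Γ₀ (box-Unique M (length Γ₀)) (box-∈ M Γ₀ (Valid-lens vΓ)) others (_≟Rows Γ₀) ⟩
  term Γ₀
    ≡⟨ when-≡ (when (size Λ ≡ᵇ size Γ₀ + z) (schur M e s Γ₀)) (∧-intro (Valid→validᵇ vΓ) (trans (cong (λ Γ → branch M false Γ Λ) padΓ₀) (branch-refl M a (suc k)))) ⟩
  when (size Λ ≡ᵇ size Γ₀ + z) (schur M e s Γ₀)
    ≡⟨ cong₂ when (≡ᵇ-cong {size Λ} {size Γ₀ + z} {z} {0}
         (λ q → +-cancelˡ-≡ (size Γ₀) z 0 (trans (sym q) (trans szΛ (sym (ℕₚ.+-identityʳ (size Γ₀)))))) (λ q → trans szΛ (sym (trans (cong (size Γ₀ +_) q) (ℕₚ.+-identityʳ (size Γ₀))))))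
         (schur-circled M a e s st h) ⟩
  when (z ≡ᵇ 0) (when (zeroL s) (alt a e))
    ≡⟨ sym (when-∧ (z ≡ᵇ 0) (zeroL s) (alt a e)) ⟩
  when (zeroL (z ∷ s)) (alt a e) ∎
  where
  k = length s
  Λ = circled a ++ zeros (suc k)
  Γ₀ = circled a ++ zeros k
  term : List Row → ℚ
  term Γ = when (validᵇ M Γ ∧ branch M false (pad Γ) Λ) (when (size Λ ≡ᵇ size Γ + z) (schur M e s Γ))
  padΓ₀ : pad Γ₀ ≡ Λ
  padΓ₀ = trans (Listₚ.++-assoc (circled a) (zeros k) _) (cong (circled a ++_) (pad-zeros k))
  szΛ : size Λ ≡ size Γ₀
  szΛ = trans (cong size (sym padΓ₀)) (size-pad Γ₀)
  lenΛ : length Λ ∸ 1 ≡ length Γ₀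
  lenΛ = cong (_∸ 1) (trans (Listₚ.length-++ (circled a)) (trans (+-suc (length (circled a)) (length (zeros k))) (cong suc (sym (Listₚ.length-++ (circled a))))))
  vΓ : Valid M Γ₀
  vΓ = Valid-++-zeros k (subst (Valid M) (rows-circled st) (rows-Valid (mkSP st [] (λ _ ())) h (λ _ ())))
  others : ∀ Γ → Γ ∈ box M (length Γ₀) → Γ ≢ Γ₀ → term Γ ≡ 0ℚ
  others Γ _ ne with validᵇ M Γ ∧ branch M false (pad Γ) Λ in eq
  ... | false = refl
  ... | true = ⊥-elim (ne (Listₚ.++-cancelʳ ((0 , false) ∷ []) Γ Γ₀ (trans (branch-circled M a (suc k) (pad Γ) (proj₂ (∧-split {validᵇ M Γ} eq))) (sym padΓ₀))))

FS-base : ∀ M a e s → Strict a → sum a < M → length e ≡ length a → FS M (a , []) e s ≡ base a (e ++ s)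
FS-base M a e s st lt q = trans (cong₂ (λ b l → when b (schur M e s l)) (≤→≤ᵇ fit) pd)
  (trans (schur-circled M a e s st (λ z m → ≤-<-trans (∈-sum a m) lt)) (sym (base-++ a e s q)))
  where
  len : length (rows (a , [])) ≡ length e
  len = trans (length-rows a []) (trans (ℕₚ.+-identityʳ (length a)) (sym q))
  fit : length (rows (a , [])) ≤ length e + length s
  fit = ≤-trans (≤-reflexive len) (m≤m+n (length e) (length s))
  pd : padTo (length e + length s) (rows (a , [])) ≡ circled a ++ zeros (length s)
  pd = cong₂ (λ l k → l ++ zeros k) (rows-circled st) (trans (cong (length e + length s ∸_) len) (m+n∸m≡n (length e) (length s)))

-- A decision of admissibility, which is needed to list the Ω above a given Γ; the bounds are just
-- large enough for both diagrams.
admᵇ : ℕ → SPart → SPart → Bool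
admᵇ ℓ Γ Ω = pieri (suc (bdeg Γ + bdeg Ω)) false (padTo (length (rows Γ) + length (rows Ω)) (rows Γ)) (padTo (length (rows Γ) + length (rows Ω)) (rows Ω))

admᵇ-⇔ : ∀ {ℓ Γ Ω} → IsSP Γ → IsSP Ω → bdeg Ω ≡ bdeg Γ + ℓ → (admᵇ ℓ Γ Ω ≡ true → Admissible Γ ℓ Ω) × (Admissible Γ ℓ Ω → admᵇ ℓ Γ Ω ≡ true)
admᵇ-⇔ {ℓ} {Γ} {Ω} iΓ iΩ d = AdmissiblePieri.pieri→admissible {M} {N} {Γ} {Ω} iΓ iΩ bΓ bΩ lΓ lΩ {ℓ} d , AdmissiblePieri.admissible→pieri {M} {N} {Γ} {Ω} iΓ iΩ bΓ bΩ lΓ lΩ {ℓ}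
  where
  M = suc (bdeg Γ + bdeg Ω)
  N = length (rows Γ) + length (rows Ω)
  bΓ : bdeg Γ < M
  bΓ = s≤s (m≤m+n (bdeg Γ) (bdeg Ω))
  bΩ : bdeg Ω < M
  bΩ = s≤s (m≤n+m (bdeg Ω) (bdeg Γ))
  lΓ = m≤m+n (length (rows Γ)) (length (rows Ω))
  lΩ = m≤n+m (length (rows Ω)) (length (rows Γ))

∑-sub-++ : ∀ e s f → ∑ (sub (e ++ s)) f ≡ ∑ (sub e) (λ e′ → ∑ (sub s) (λ s′ → f (e′ ++ s′)))
∑-sub-++ []      s f = sym (ℚₚ.+-identityʳ _)
∑-sub-++ (x ∷ e) s f = trans (∑-sub-∷ x (e ++ s) f) (trans (∑<-cong′ (suc x) (λ y → ∑-sub-++ e s (λ l → f (y ∷ l)))) (sym (∑-sub-∷ x e (λ e′ → ∑ (sub s) (λ s′ → f (e′ ++ s′))))))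

hopL-hop : ∀ ℓ g e s → hopL ℓ g (e ++ s) ≡ hop ℓ (λ e′ s′ → g (e′ ++ s′)) e s
hopL-hop ℓ g e s = trans (∑-sub-++ e s (λ l → when (sum l + ℓ ≡ᵇ sum (e ++ s)) (g l)))
  (∑-cong′ (sub e) (λ e′ → ∑-cong′ (sub s) (λ s′ → cong₂ (λ x y → when (x + ℓ ≡ᵇ y) (g (e′ ++ s′))) (sum-++ e′ s′) (sum-++ e s))))

hop-cong : ∀ ℓ {G G′ : List ℕ → List ℕ → ℚ} e s → (∀ e′ s′ → length e′ ≡ length e → sum e′ + sum s′ ≤ sum e + sum s → G e′ s′ ≡ G′ e′ s′) → hop ℓ G e s ≡ hop ℓ G′ e s
hop-cong ℓ e s h = ∑-cong (sub e) (λ e′ p → ∑-cong (sub s) (λ s′ q → cong (when ((sum e′ + sum s′) + ℓ ≡ᵇ sum e + sum s)) (h e′ s′ (sub-length e p) (+-mono-≤ (sub-sum e p) (sub-sum s q)))))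

hop-∑ : ∀ {A : Set} ℓ (xs : List A) (c : A → ℚ) (G : A → List ℕ → List ℕ → ℚ) e s →
  hop ℓ (λ e′ s′ → ∑ xs (λ x → c x *ℚ G x e′ s′)) e s ≡ ∑ xs (λ x → c x *ℚ hop ℓ (G x) e s)
hop-∑ ℓ xs c G e s = trans
  (∑-cong′ (sub e) (λ e′ → trans (∑-cong′ (sub s) (λ s′ → trans (sym (∑-when (t e′ s′) xs (λ x → c x *ℚ G x e′ s′))) (∑-cong′ xs (λ x → sym (when-*ˡ (t e′ s′) (c x) (G x e′ s′))))))
    (trans (∑-swap (sub s) xs (λ s′ x → c x *ℚ when (t e′ s′) (G x e′ s′))) (∑-cong′ xs (λ x → sym (∑-*ˡ (c x) (sub s) (λ s′ → when (t e′ s′) (G x e′ s′))))))))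
  (trans (∑-swap (sub e) xs (λ e′ x → c x *ℚ ∑ (sub s) (λ s′ → when (t e′ s′) (G x e′ s′))))
    (∑-cong′ xs (λ x → sym (∑-*ˡ (c x) (sub e) (λ e′ → ∑ (sub s) (λ s′ → when (t e′ s′) (G x e′ s′)))))))
  where
  t : List ℕ → List ℕ → Bool
  t e′ s′ = (sum e′ + sum s′) + ℓ ≡ᵇ sum e + sum s

record SchurExpansion (M : ℕ) (a μ : List ℕ) : Set where
  field
    K : SPart → ℚ
    expands : ∀ e s → length e ≡ length a → sum e + sum s < M → opH μ (base a) (e ++ s) ≡ ∑ (sector (sum a + sum μ) (length a)) (λ Γ → K Γ *ℚ FS M Γ e s)
    dominates : ∀ Γ → Γ ∈ sector (sum a + sum μ) (length a) → K Γ ≢ 0ℚ → Dominates Γ a μ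

-- The Pieri rule is applied once for each part of μ, starting from the superpartition without
-- bosonic parts. The coefficients thus count chains of admissible superpartitions.
schurExpansion : ∀ M a μ → Strict a → sum a + sum μ < M → SchurExpansion M a μ
schurExpansion M a [] st lt = record
  { K = λ Γ → when (eq Γ) 1ℚ
  ; expands = λ e s q _ → sym (trans (∑-single (a , []) (sector-Unique (sum a + 0) (length a)) (→sector i)
      (λ Γ _ ne → trans (cong (λ b → when b 1ℚ *ℚ FS M Γ e s) (dec-false (Γ ≟SP (a , [])) ne)) (ℚₚ.*-zeroˡ (FS M Γ e s))) (_≟SP (a , [])))
      (trans (cong (λ b → when b 1ℚ *ℚ FS M (a , []) e s) (dec-true ((a , []) ≟SP (a , [])) refl))
        (trans (ℚₚ.*-identityˡ (FS M (a , []) e s)) (FS-base M a e s st (≤-<-trans (m≤m+n (sum a) 0) lt) q))))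
  ; dominates = λ Γ _ h → dom Γ (Γ ≟SP (a , [])) (proj₁ (when-nonzero (eq Γ) h))
  }
  where
  eq : SPart → Bool
  eq Γ = Dec.does (Γ ≟SP (a , []))
  i : IsSP (a , [])
  i = mkSP st [] (λ _ ())
  dom : ∀ Γ (d : Dec (Γ ≡ (a , []))) → Dec.does d ≡ true → Dominates Γ a []
  dom Γ (yes refl) _ = ⊑-refl (star (a , [])) , ⊑-refl (circ (a , []))
schurExpansion M a (ℓ ∷ μ) st lt = record { K = K′ ; expands = ex ; dominates = dom }
  where
  rec : SchurExpansion M a μ
  rec = schurExpansion M a μ st (≤-<-trans (+-monoʳ-≤ (sum a) (m≤n+m (sum μ) ℓ)) lt)
  open SchurExpansion rec
  m = length a
  n = sum a + sum μ
  n′ = sum a + (ℓ + sum μ)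
  deg : n′ ≡ n + ℓ
  deg = +-rotate (sum a) ℓ (sum μ)
  adm : ∀ {Γ Ω} → Γ ∈ sector n m → Ω ∈ sector n′ m → (admᵇ ℓ Γ Ω ≡ true → Admissible Γ ℓ Ω) × (Admissible Γ ℓ Ω → admᵇ ℓ Γ Ω ≡ true)
  adm {Γ} {Ω} Γ∈ Ω∈ = let iΓ , bΓ , _ = sector→ {n} {m} Γ∈ ; iΩ , bΩ , _ = sector→ {n′} {m} Ω∈ in
    admᵇ-⇔ iΓ iΩ (trans bΩ (trans deg (cong (_+ ℓ) (sym bΓ))))
  above-Γ : SPart → List SPart
  above-Γ Γ = filterᵇ (admᵇ ℓ Γ) (sector n′ m)
  list : ∀ {Γ} → Γ ∈ sector n m → ∀ Ω → (Ω ∈ above-Γ Γ → Admissible Γ ℓ Ω) × (Admissible Γ ℓ Ω → Ω ∈ above-Γ Γ)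
  list {Γ} Γ∈ Ω = (λ h → let p , q = ∈ₚ.∈-filter⁻ (λ Ω → Boolₚ.T? (admᵇ ℓ Γ Ω)) {xs = sector n′ m} h in proj₁ (adm Γ∈ p) (T→≡ q)) ,
    (λ ad → let iΓ , bΓ , fΓ = sector→ {n} {m} Γ∈
                Ω∈ = →sector′ {n′} {m} (isSPart→ Ω (proj₁ ad)) (trans (admissible-bdeg Γ ℓ Ω ad) (trans (cong (_+ ℓ) bΓ) (sym deg))) (trans (proj₁ (proj₂ ad)) fΓ)
            in ∈ₚ.∈-filter⁺ (λ Ω → Boolₚ.T? (admᵇ ℓ Γ Ω)) Ω∈ (≡→T (proj₂ (adm Γ∈ Ω∈) ad)))
  K′ : SPart → ℚ
  K′ Ω = ∑ (sector n m) (λ Γ → when (admᵇ ℓ Γ Ω) (K Γ))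
  ex : ∀ e s → length e ≡ m → sum e + sum s < M → hopL ℓ (opH μ (base a)) (e ++ s) ≡ ∑ (sector n′ m) (λ Ω → K′ Ω *ℚ FS M Ω e s)
  ex e s q lt′ = begin
    hopL ℓ (opH μ (base a)) (e ++ s)
      ≡⟨ hopL-hop ℓ (opH μ (base a)) e s ⟩
    hop ℓ (λ e′ s′ → opH μ (base a) (e′ ++ s′)) e s
      ≡⟨ hop-cong ℓ e s (λ e′ s′ p le → expands e′ s′ (trans p q) (≤-<-trans le lt′)) ⟩
    hop ℓ (λ e′ s′ → ∑ (sector n m) (λ Γ → K Γ *ℚ FS M Γ e′ s′)) e s
      ≡⟨ hop-∑ ℓ (sector n m) K (FS M) e s ⟩
    ∑ (sector n m) (λ Γ → K Γ *ℚ hop ℓ (FS M Γ) e s)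
      ≡⟨ ∑-cong (sector n m) (λ Γ Γ∈ → trans (cong (K Γ *ℚ_) (trans (pieriSP M Γ ℓ (above-Γ Γ) (proj₁ (sector→ {n} {m} Γ∈)) (Uniqueₚ.filter⁺ (λ Ω → Boolₚ.T? (admᵇ ℓ Γ Ω)) (sector-Unique n′ m)) (list Γ∈) e s lt′)
           (∑-filter (admᵇ ℓ Γ) (sector n′ m) (λ Ω → FS M Ω e s)))) (trans (∑-*ˡ (K Γ) (sector n′ m) (λ Ω → when (admᵇ ℓ Γ Ω) (FS M Ω e s)))
           (∑-cong′ (sector n′ m) (λ Ω → trans (when-*ˡ (admᵇ ℓ Γ Ω) (K Γ) (FS M Ω e s)) (sym (when-*ʳ (admᵇ ℓ Γ Ω) (K Γ) (FS M Ω e s))))))) ⟩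
    ∑ (sector n m) (λ Γ → ∑ (sector n′ m) (λ Ω → when (admᵇ ℓ Γ Ω) (K Γ) *ℚ FS M Ω e s))
      ≡⟨ ∑-swap (sector n m) (sector n′ m) (λ Γ Ω → when (admᵇ ℓ Γ Ω) (K Γ) *ℚ FS M Ω e s) ⟩
    ∑ (sector n′ m) (λ Ω → ∑ (sector n m) (λ Γ → when (admᵇ ℓ Γ Ω) (K Γ) *ℚ FS M Ω e s))
      ≡⟨ ∑-cong′ (sector n′ m) (λ Ω → sym (∑-*ʳ (FS M Ω e s) (sector n m) (λ Γ → when (admᵇ ℓ Γ Ω) (K Γ)))) ⟩
    ∑ (sector n′ m) (λ Ω → K′ Ω *ℚ FS M Ω e s) ∎
  dom : ∀ Ω → Ω ∈ sector n′ m → K′ Ω ≢ 0ℚ → Dominates Ω a (ℓ ∷ μ)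
  dom Ω Ω∈ h with ∑-nonzero (sector n m) (λ Γ → when (admᵇ ℓ Γ Ω) (K Γ)) h
  ... | Γ , Γ∈ , h₁ with when-nonzero (admᵇ ℓ Γ Ω) h₁
  ...   | ad , h₂ = admissible-dominant Γ Ω ℓ a μ (proj₁ (sector→ {n} {m} Γ∈)) (proj₁ (sector→ {n′} {m} Ω∈)) (proj₁ (adm Γ∈ Ω∈) ad) (dominates Γ Γ∈ h₂)

-- Products of superpolynomials, one variable at a time

sumℚ-∑ : ∀ {A : Set} (xs : List A) f → sumℚ (map f xs) ≡ ∑ xs f
sumℚ-∑ []       f = refl
sumℚ-∑ (x ∷ xs) f = cong (f x +ℚ_) (sumℚ-∑ xs f)

sumℚ-concatMap : ∀ {A B : Set} (xs : List A) (ys : List B) (h : A → B → ℚ) → sumℚ (concatMap (λ x → map (h x) ys) xs) ≡ ∑ xs (λ x → ∑ ys (h x))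
sumℚ-concatMap xs ys h = trans (trans (cong sumℚ (sym (Listₚ.map-id (concatMap (λ x → map (h x) ys) xs)))) (sumℚ-∑ (concatMap (λ x → map (h x) ys) xs) id))
  (trans (∑-concatMap (λ x → map (h x) ys) xs id) (∑-cong′ xs (λ x → ∑-map (h x) ys id)))

ΣP-∑ : ∀ {N} {A : Set} (xs : List A) (f : A → Poly N) μ → ΣP xs f μ ≡ ∑ xs (λ x → f x μ)
ΣP-∑ []       f μ = refl
ΣP-∑ (x ∷ xs) f μ = cong (f x μ +ℚ_) (ΣP-∑ xs f μ)

slice : ∀ {N} → Poly (suc N) → ℕ → Bool → Poly N
slice f i b (a , S) = f (i ∷ a , b ∷ S)

-- The sign for moving the first θ, when it comes from the second factor, past all θ of the first
-- factor.
twist : ∀ {N} → Poly N → Poly N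
twist f (a , S) = sgn (countT S) *ℚ f (a , S)

term : ∀ {N} → Poly N → Poly N → Vec ℕ N × Vec ℕ N → Vec Bool N × Vec Bool N → ℚ
term f g bc TU = sgn (inv (proj₁ TU) (proj₂ TU)) *ℚ f (proj₁ bc , proj₁ TU) *ℚ g (proj₂ bc , proj₂ TU)

⊗-∑ : ∀ {N} (f g : Poly N) a S → (f ⊗ g) (a , S) ≡ ∑ (splitsV a) (λ bc → ∑ (splitsB S) (term f g bc))
⊗-∑ f g a S = sumℚ-concatMap (splitsV a) (splitsB S) (term f g)

splits-∑ : ∀ {N} x (a : Vec ℕ N) (F : Vec ℕ (suc N) × Vec ℕ (suc N) → ℚ) →
  ∑ (splitsV (x ∷ a)) F ≡ ∑< (suc x) (λ i → ∑ (splitsV a) (λ p → F ((i ∷ proj₁ p) , (x ∸ i ∷ proj₂ p))))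
splits-∑ x a F = trans (∑-concatMap (λ i → map (put i) (splitsV a)) (upTo (suc x)) F)
  (trans (∑-upTo (suc x) (λ i → ∑ (map (put i) (splitsV a)) F)) (∑<-cong′ (suc x) (λ i → ∑-map (put i) (splitsV a) F)))
  where
  put : ℕ → Vec ℕ _ × Vec ℕ _ → Vec ℕ (suc _) × Vec ℕ (suc _)
  put i p = (i ∷ proj₁ p) , (x ∸ i ∷ proj₂ p)

splits-false : ∀ {N} (S : Vec Bool N) (F : Vec Bool (suc N) × Vec Bool (suc N) → ℚ) →
  ∑ (splitsB (false ∷ S)) F ≡ ∑ (splitsB S) (λ q → F ((false ∷ proj₁ q) , (false ∷ proj₂ q)))
splits-false S F = ∑-map (λ q → (false ∷ proj₁ q) , (false ∷ proj₂ q)) (splitsB S) F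

splits-true : ∀ {N} (S : Vec Bool N) (F : Vec Bool (suc N) × Vec Bool (suc N) → ℚ) →
  ∑ (splitsB (true ∷ S)) F ≡ ∑ (splitsB S) (λ q → F ((true ∷ proj₁ q) , (false ∷ proj₂ q))) +ℚ ∑ (splitsB S) (λ q → F ((false ∷ proj₁ q) , (true ∷ proj₂ q)))
splits-true S F = trans (∑-++ (map l (splitsB S)) (map r (splitsB S)) F) (cong₂ _+ℚ_ (∑-map l (splitsB S) F) (∑-map r (splitsB S) F))
  where
  l r : Vec Bool _ × Vec Bool _ → Vec Bool (suc _) × Vec Bool (suc _)
  l q = (true ∷ proj₁ q) , (false ∷ proj₂ q)
  r q = (false ∷ proj₁ q) , (true ∷ proj₂ q)

⊗-false : ∀ {N} (f g : Poly (suc N)) x a S → (f ⊗ g) (x ∷ a , false ∷ S) ≡ ∑< (suc x) (λ i → (slice f i false ⊗ slice g (x ∸ i) false) (a , S))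
⊗-false f g x a S = trans (⊗-∑ f g (x ∷ a) (false ∷ S)) (trans (splits-∑ x a (λ bc → ∑ (splitsB (false ∷ S)) (term f g bc))) (∑<-cong′ (suc x) (λ i →
  trans (∑-cong′ (splitsV a) (λ p → splits-false S (term f g ((i ∷ proj₁ p) , (x ∸ i ∷ proj₂ p))))) (sym (⊗-∑ (slice f i false) (slice g (x ∸ i) false) a S)))))

⊗-true : ∀ {N} (f g : Poly (suc N)) x a S → (f ⊗ g) (x ∷ a , true ∷ S) ≡
  ∑< (suc x) (λ i → (slice f i true ⊗ slice g (x ∸ i) false) (a , S) +ℚ (twist (slice f i false) ⊗ slice g (x ∸ i) true) (a , S))
⊗-true f g x a S = trans (⊗-∑ f g (x ∷ a) (true ∷ S)) (trans (splits-∑ x a (λ bc → ∑ (splitsB (true ∷ S)) (term f g bc))) (∑<-cong′ (suc x) (λ i →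
  trans (∑-cong′ (splitsV a) (λ p → trans (splits-true S (term f g ((i ∷ proj₁ p) , (x ∸ i ∷ proj₂ p))))
    (cong (∑ (splitsB S) (term (slice f i true) (slice g (x ∸ i) false) p) +ℚ_) (∑-cong′ (splitsB S) (sign i p)))))
  (trans (∑-+ (splitsV a) (λ p → ∑ (splitsB S) (term (slice f i true) (slice g (x ∸ i) false) p)) (λ p → ∑ (splitsB S) (term (twist (slice f i false)) (slice g (x ∸ i) true) p)))
    (sym (cong₂ _+ℚ_ (⊗-∑ (slice f i true) (slice g (x ∸ i) false) a S) (⊗-∑ (twist (slice f i false)) (slice g (x ∸ i) true) a S)))))))
  where
  sign : ∀ i (p : Vec ℕ _ × Vec ℕ _) (q : Vec Bool _ × Vec Bool _) →
    term f g ((i ∷ proj₁ p) , (x ∸ i ∷ proj₂ p)) ((false ∷ proj₁ q) , (true ∷ proj₂ q)) ≡ term (twist (slice f i false)) (slice g (x ∸ i) true) p q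
  sign i (b , c) (T , U) = trans (cong (λ s → s *ℚ f (i ∷ b , false ∷ T) *ℚ g (x ∸ i ∷ c , true ∷ U)) (sgn-+ (countT T) (inv T U)))
    (solve 4 (λ k n f g → (k :* n) :* f :* g := n :* (k :* f) :* g) refl (sgn (countT T)) (sgn (inv T U)) (f (i ∷ b , false ∷ T)) (g (x ∸ i ∷ c , true ∷ U)))

⊗-congˡ : ∀ {N} {f f′ : Poly N} (g : Poly N) → (∀ μ → f μ ≡ f′ μ) → ∀ μ → (f ⊗ g) μ ≡ (f′ ⊗ g) μ
⊗-congˡ {f = f} {f′} g h (a , S) = trans (⊗-∑ f g a S) (trans (∑-cong′ (splitsV a) (λ bc → ∑-cong′ (splitsB S) (λ TU →
  cong (λ y → sgn (inv (proj₁ TU) (proj₂ TU)) *ℚ y *ℚ g (proj₂ bc , proj₂ TU)) (h (proj₁ bc , proj₁ TU))))) (sym (⊗-∑ f′ g a S)))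

⊗-congʳ : ∀ {N} (f : Poly N) {g g′ : Poly N} → (∀ μ → g μ ≡ g′ μ) → ∀ μ → (f ⊗ g) μ ≡ (f ⊗ g′) μ
⊗-congʳ f {g} {g′} h (a , S) = trans (⊗-∑ f g a S) (trans (∑-cong′ (splitsV a) (λ bc → ∑-cong′ (splitsB S) (λ TU →
  cong (λ y → sgn (inv (proj₁ TU) (proj₂ TU)) *ℚ f (proj₁ bc , proj₁ TU) *ℚ y) (h (proj₂ bc , proj₂ TU))))) (sym (⊗-∑ f g′ a S)))

⊗-zeroʳ : ∀ {N} (f : Poly N) μ → (f ⊗ zeroP) μ ≡ 0ℚ
⊗-zeroʳ f (a , S) = trans (⊗-∑ f zeroP a S) (∑-zero (splitsV a) (λ bc _ → ∑-zero (splitsB S) (λ TU _ → ℚₚ.*-zeroʳ (sgn (inv (proj₁ TU) (proj₂ TU)) *ℚ f (proj₁ bc , proj₁ TU)))))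

⊗-+ˡ : ∀ {N} (f f′ g : Poly N) μ → ((f ⊕ f′) ⊗ g) μ ≡ (f ⊗ g) μ +ℚ (f′ ⊗ g) μ
⊗-+ˡ f f′ g (a , S) = trans (⊗-∑ (f ⊕ f′) g a S) (trans (∑-cong′ (splitsV a) (λ bc → trans (∑-cong′ (splitsB S) (λ TU →
    solve 4 (λ s p q g → s :* (p :+ q) :* g := s :* p :* g :+ s :* q :* g) refl (sgn (inv (proj₁ TU) (proj₂ TU))) (f (proj₁ bc , proj₁ TU)) (f′ (proj₁ bc , proj₁ TU)) (g (proj₂ bc , proj₂ TU))))
    (∑-+ (splitsB S) (term f g bc) (term f′ g bc))))
  (trans (∑-+ (splitsV a) _ _) (sym (cong₂ _+ℚ_ (⊗-∑ f g a S) (⊗-∑ f′ g a S)))))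

⊗-⊙ˡ : ∀ {N} c (f g : Poly N) μ → ((c ⊙ f) ⊗ g) μ ≡ c *ℚ (f ⊗ g) μ
⊗-⊙ˡ c f g (a , S) = trans (⊗-∑ (c ⊙ f) g a S) (trans (∑-cong′ (splitsV a) (λ bc → trans (∑-cong′ (splitsB S) (λ TU →
    solve 4 (λ c s p g → s :* (c :* p) :* g := c :* (s :* p :* g)) refl c (sgn (inv (proj₁ TU) (proj₂ TU))) (f (proj₁ bc , proj₁ TU)) (g (proj₂ bc , proj₂ TU))))
    (sym (∑-*ˡ c (splitsB S) (term f g bc)))))
  (trans (sym (∑-*ˡ c (splitsV a) _)) (cong (c *ℚ_) (sym (⊗-∑ f g a S)))))

gate : ∀ {N} → Bool → Poly N → Poly N
gate b f μ = when b (f μ)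

⊗-gate : ∀ {N} b (f g : Poly N) μ → (gate b f ⊗ g) μ ≡ when b ((f ⊗ g) μ)
⊗-gate true  f g μ = refl
⊗-gate false f g μ = trans (⊗-congˡ g (λ ν → sym (ℚₚ.*-zeroˡ (f ν))) μ) (trans (⊗-⊙ˡ 0ℚ f g μ) (ℚₚ.*-zeroˡ ((f ⊗ g) μ)))

∑<-pick : ∀ x k (F : ℕ → ℚ) → ∑< (suc x) (λ i → when (i ≡ᵇ k) (F i)) ≡ when (k ≤ᵇ x) (F k)
∑<-pick x k F = trans (∑<-cong′ (suc x) (λ i → when-cong (i ≡ᵇ k) (λ e → cong F (≡ᵇ→≡ {i} e)))) (trans (∑<-delta (suc x) k (F k)) (when-≡ (F k) (≤ᵇ-<ᵇ-suc k x)))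

-- The sum over the splittings of the first exponent collapses when the first factor lives at a
-- single exponent `k`.
pick : ∀ {N} x k (f : ℕ → Poly N) (P : Poly N) (g : ℕ → Poly N) μ → (∀ i ν → f i ν ≡ gate (i ≡ᵇ k) P ν) → ∑< (suc x) (λ i → (f i ⊗ g i) μ) ≡ when (k ≤ᵇ x) ((P ⊗ g k) μ)
pick x k f P g μ h = trans (∑<-cong′ (suc x) (λ i → trans (⊗-congˡ (g i) (h i) μ) (⊗-gate (i ≡ᵇ k) P (g i) μ))) (∑<-pick x k (λ i → (P ⊗ g i) μ))

-- The constant 1, written with the predicates that occur in `ptC` and `prC`, so that slices of
-- power sums become gated copies of it.
unit : ∀ {N} → Poly N
unit (a , S) = bool2ℚ (allZero a ∧ allFalse S)

bool2ℚ-∧ : ∀ p q → bool2ℚ (p ∧ q) ≡ when p (bool2ℚ q)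
bool2ℚ-∧ true  q = refl
bool2ℚ-∧ false q = refl

unit-false : ∀ {N} i (ν : Mon N) → slice unit i false ν ≡ gate (i ≡ᵇ 0) unit ν
unit-false i (a , S) = trans (cong bool2ℚ (Boolₚ.∧-assoc (i ≡ᵇ 0) (allZero a) (allFalse S))) (bool2ℚ-∧ (i ≡ᵇ 0) (allZero a ∧ allFalse S))

countT-false : ∀ {N} (S : Vec Bool N) → allFalse S ≡ true → countT S ≡ 0
countT-false [] h = refl
countT-false (false ∷ S) h = countT-false S h

⊗-0 : ∀ {N} (f g : Poly N) μ → (∀ ν → f ν ≡ 0ℚ) → (f ⊗ g) μ ≡ 0ℚ
⊗-0 f g μ h = trans (⊗-congˡ {f = f} {gate false f} g h μ) (⊗-gate false f g μ)

twist-even : ∀ {N} (f : Poly N) a S → (allFalse S ≡ false → f (a , S) ≡ 0ℚ) → twist f (a , S) ≡ f (a , S)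
twist-even f a S h with allFalse S in e
... | false = trans (cong (sgn (countT S) *ℚ_) (h refl)) (trans (ℚₚ.*-zeroʳ (sgn (countT S))) (sym (h refl)))
... | true  = trans (cong (λ c → sgn c *ℚ f (a , S)) (countT-false S e)) (ℚₚ.*-identityˡ (f (a , S)))

unit-⊗ : ∀ {N} (g : Poly N) μ → (unit ⊗ g) μ ≡ g μ
unit-⊗ g ([] , []) = trans (ℚₚ.+-identityʳ _) (*-1ˡ (g ([] , [])) (ℚₚ.*-identityˡ 1ℚ))
unit-⊗ g (x ∷ a , false ∷ S) = trans (⊗-false unit g x a S) (trans (pick x 0 (λ i → slice unit i false) unit (λ i → slice g (x ∸ i) false) (a , S) unit-false) (unit-⊗ (slice g x false) (a , S)))
unit-⊗ g (x ∷ a , true ∷ S) = trans (⊗-true unit g x a S) (trans (∑<-cong′ (suc x) (λ i → trans (cong₂ _+ℚ_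
    (⊗-0 (slice unit i true) (slice g (x ∸ i) false) (a , S) (λ ν → cong bool2ℚ (Boolₚ.∧-zeroʳ ((i ≡ᵇ 0) ∧ allZero (proj₁ ν)))))
    (⊗-congˡ (slice g (x ∸ i) true) (λ { (b , T) → twist-even (slice unit i false) b T (λ e → cong bool2ℚ (trans (cong (((i ≡ᵇ 0) ∧ allZero b) ∧_) e) (Boolₚ.∧-zeroʳ ((i ≡ᵇ 0) ∧ allZero b)))) }) (a , S)))
    (ℚₚ.+-identityˡ ((slice unit i false ⊗ slice g (x ∸ i) true) (a , S)))))
  (trans (pick x 0 (λ i → slice unit i false) unit (λ i → slice g (x ∸ i) true) (a , S) unit-false) (unit-⊗ (slice g x true) (a , S))))

popV : ∀ {N} → ℕ → Poly N → Poly N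
popV r g ([] , [])        = 0ℚ
popV r g (x ∷ a , b ∷ S)  = when (r ≤ᵇ x) (g (x ∸ r ∷ a , b ∷ S)) +ℚ popV r (slice g x b) (a , S)

pr-false : ∀ {N} r i (ν : Mon N) → slice (prP (suc r)) i false ν ≡ (gate (i ≡ᵇ suc r) unit ⊕ gate (i ≡ᵇ 0) (prP (suc r))) ν
pr-false r zero    (a , S) = sym (ℚₚ.+-identityˡ _)
pr-false r (suc i) (a , S) = trans (cong (λ b → bool2ℚ (allFalse S ∧ b)) (Boolₚ.∨-identityʳ ((i ≡ᵇ r) ∧ allZero a)))
  (trans (cong bool2ℚ (trans (Boolₚ.∧-comm (allFalse S) ((i ≡ᵇ r) ∧ allZero a)) (Boolₚ.∧-assoc (i ≡ᵇ r) (allZero a) (allFalse S))))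
    (trans (bool2ℚ-∧ (i ≡ᵇ r) (allZero a ∧ allFalse S)) (sym (ℚₚ.+-identityʳ _))))

pr-⊗ : ∀ {N} r (g : Poly N) μ → (prP (suc r) ⊗ g) μ ≡ popV (suc r) g μ
pr-pick : ∀ {N} r x (f g : ℕ → Poly N) μ → (∀ i ν → f i ν ≡ (gate (i ≡ᵇ suc r) unit ⊕ gate (i ≡ᵇ 0) (prP (suc r))) ν) →
  ∑< (suc x) (λ i → (f i ⊗ g i) μ) ≡ when (suc r ≤ᵇ x) (g (suc r) μ) +ℚ popV (suc r) (g 0) μ
pr-⊗ r g ([] , []) = trans (ℚₚ.+-identityʳ _) (*-0ˡ (g ([] , [])) (ℚₚ.*-zeroʳ 1ℚ))
pr-⊗ r g (x ∷ a , false ∷ S) = trans (⊗-false (prP (suc r)) g x a S) (pr-pick r x (λ i → slice (prP (suc r)) i false) (λ i → slice g (x ∸ i) false) (a , S) (pr-false r))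
pr-⊗ r g (x ∷ a , true ∷ S) = trans (⊗-true (prP (suc r)) g x a S) (trans (∑<-cong′ (suc x) (λ i → trans
    (cong (_+ℚ (twist (slice (prP (suc r)) i false) ⊗ slice g (x ∸ i) true) (a , S)) (⊗-0 (slice (prP (suc r)) i true) (slice g (x ∸ i) false) (a , S) (λ ν → refl)))
    (ℚₚ.+-identityˡ ((twist (slice (prP (suc r)) i false) ⊗ slice g (x ∸ i) true) (a , S)))))
  (pr-pick r x (λ i → twist (slice (prP (suc r)) i false)) (λ i → slice g (x ∸ i) true) (a , S)
    (λ { i (b , T) → trans (twist-even (slice (prP (suc r)) i false) b T (λ e → cong (λ c → bool2ℚ (c ∧ prC (suc r) (i ∷ b))) e)) (pr-false r i (b , T)) })))
pr-pick r x f g μ h = begin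
  ∑< (suc x) (λ i → (f i ⊗ g i) μ)
    ≡⟨ ∑<-cong′ (suc x) (λ i → trans (⊗-congˡ (g i) (h i) μ) (⊗-+ˡ (gate (i ≡ᵇ suc r) unit) (gate (i ≡ᵇ 0) (prP (suc r))) (g i) μ)) ⟩
  ∑< (suc x) (λ i → (gate (i ≡ᵇ suc r) unit ⊗ g i) μ +ℚ (gate (i ≡ᵇ 0) (prP (suc r)) ⊗ g i) μ)
    ≡⟨ ∑<-+ (suc x) (λ i → (gate (i ≡ᵇ suc r) unit ⊗ g i) μ) (λ i → (gate (i ≡ᵇ 0) (prP (suc r)) ⊗ g i) μ) ⟩
  ∑< (suc x) (λ i → (gate (i ≡ᵇ suc r) unit ⊗ g i) μ) +ℚ ∑< (suc x) (λ i → (gate (i ≡ᵇ 0) (prP (suc r)) ⊗ g i) μ)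
    ≡⟨ cong₂ _+ℚ_ (trans (pick x (suc r) (λ i → gate (i ≡ᵇ suc r) unit) unit g μ (λ i ν → refl)) (cong (when (suc r ≤ᵇ x)) (unit-⊗ (g (suc r)) μ)))
         (trans (pick x 0 (λ i → gate (i ≡ᵇ 0) (prP (suc r))) (prP (suc r)) g μ (λ i ν → refl)) (pr-⊗ r (g 0) μ)) ⟩
  when (suc r ≤ᵇ x) (g (suc r) μ) +ℚ popV (suc r) (g 0) μ ∎

-- Multiplication by an odd power sum from the left; passing over a variable that carries a θ costs
-- a sign.
ptV : ∀ {N} → ℕ → Poly N → Poly N
ptV k g ([] , [])            = 0ℚ
ptV k g (x ∷ a , false ∷ S)  = ptV k (slice g x false) (a , S)
ptV k g (x ∷ a , true ∷ S)   = when (k ≤ᵇ x) (g (x ∸ k ∷ a , false ∷ S)) +ℚ (-ℚ ptV k (slice g x true) (a , S))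

ptC-countT : ∀ {N} k (a : Vec ℕ N) S → ptC k a S ≡ true → countT S ≡ 1
ptC-countT k [] [] ()
ptC-countT k (x ∷ a) (true ∷ S)  h = cong suc (countT-false S (proj₂ (∧-split {allZero a} (proj₂ (∧-split {x ≡ᵇ k} h)))))
ptC-countT k (x ∷ a) (false ∷ S) h = ptC-countT k a S (proj₂ (∧-split {x ≡ᵇ 0} h))

pt-⊗ : ∀ {N} k (g : Poly N) μ → (ptP k ⊗ g) μ ≡ ptV k g μ
pt-⊗ k g ([] , []) = trans (ℚₚ.+-identityʳ _) (*-0ˡ (g ([] , [])) (ℚₚ.*-zeroʳ 1ℚ))
pt-⊗ k g (x ∷ a , false ∷ S) = trans (⊗-false (ptP k) g x a S)
  (trans (pick x 0 (λ i → slice (ptP k) i false) (ptP k) (λ i → slice g (x ∸ i) false) (a , S) (λ i ν → bool2ℚ-∧ (i ≡ᵇ 0) (ptC k (proj₁ ν) (proj₂ ν)))) (pt-⊗ k (slice g x false) (a , S)))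
pt-⊗ k g (x ∷ a , true ∷ S) = trans (⊗-true (ptP k) g x a S) (trans (∑<-+ (suc x) (λ i → (slice (ptP k) i true ⊗ slice g (x ∸ i) false) (a , S)) (λ i → (twist (slice (ptP k) i false) ⊗ slice g (x ∸ i) true) (a , S))) (cong₂ _+ℚ_
  (trans (pick x k (λ i → slice (ptP k) i true) unit (λ i → slice g (x ∸ i) false) (a , S) (λ i ν → bool2ℚ-∧ (i ≡ᵇ k) (allZero (proj₁ ν) ∧ allFalse (proj₂ ν))))
    (cong (when (k ≤ᵇ x)) (unit-⊗ (slice g (x ∸ k) false) (a , S))))
  (trans (pick x 0 (λ i → twist (slice (ptP k) i false)) ((-ℚ 1ℚ) ⊙ ptP k) (λ i → slice g (x ∸ i) true) (a , S) odd)
    (trans (⊗-⊙ˡ (-ℚ 1ℚ) (ptP k) (slice g x true) (a , S)) (trans (neg-one _) (cong -ℚ_ (pt-⊗ k (slice g x true) (a , S))))))))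
  where
  odd : ∀ i ν → twist (slice (ptP k) i false) ν ≡ gate (i ≡ᵇ 0) ((-ℚ 1ℚ) ⊙ ptP k) ν
  odd i (b , T) with i ≡ᵇ 0
  ... | false = ℚₚ.*-zeroʳ (sgn (countT T))
  ... | true with ptC k b T in e
  ...   | false = trans (ℚₚ.*-zeroʳ (sgn (countT T))) (sym (ℚₚ.*-zeroʳ (-ℚ 1ℚ)))
  ...   | true  = cong (λ c → sgn c *ℚ 1ℚ) (ptC-countT k b T e)

-- An even power sum leaves the θ part alone, so agreement is required for one `S` only. This is
-- what permits a hypothesis on the number of θ in `pP-pL`.
popV-cong : ∀ {N} r {g g′ : Poly N} S → (∀ a → g (a , S) ≡ g′ (a , S)) → ∀ a → popV r g (a , S) ≡ popV r g′ (a , S)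
popV-cong r []      h []      = refl
popV-cong r (b ∷ S) h (x ∷ a) = cong₂ _+ℚ_ (cong (when (r ≤ᵇ x)) (h (x ∸ r ∷ a))) (popV-cong r S (λ a′ → h (x ∷ a′)) a)

popV-0 : ∀ {N} r S (a : Vec ℕ N) → popV r (λ _ → 0ℚ) (a , S) ≡ 0ℚ
popV-0 r []      []      = refl
popV-0 r (b ∷ S) (x ∷ a) = cong₂ _+ℚ_ (when-zero (r ≤ᵇ x)) (popV-0 r S a)

ptV-cong : ∀ {N} k {g g′ : Poly N} → (∀ μ → g μ ≡ g′ μ) → ∀ μ → ptV k g μ ≡ ptV k g′ μ
ptV-cong k h ([] , [])           = refl
ptV-cong k h (x ∷ a , false ∷ S) = ptV-cong k (λ { (b , T) → h (x ∷ b , false ∷ T) }) (a , S)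
ptV-cong k h (x ∷ a , true ∷ S)  = cong₂ (λ p q → when (k ≤ᵇ x) p +ℚ (-ℚ q)) (h (x ∸ k ∷ a , false ∷ S)) (ptV-cong k (λ { (b , T) → h (x ∷ b , true ∷ T) }) (a , S))

popV-when+ : ∀ {N} r b (g g′ : Poly N) μ → popV r (λ ν → when b (g ν) +ℚ (-ℚ g′ ν)) μ ≡ when b (popV r g μ) +ℚ (-ℚ popV r g′ μ)
popV-when+ r b g g′ ([] , []) = cong (_+ℚ (-ℚ 0ℚ)) (sym (when-zero b))
popV-when+ r b g g′ (x ∷ a , c ∷ S) = trans (cong₂ _+ℚ_ (trans (when-+ p _ _) (cong₂ _+ℚ_ (when-comm p b _) (when-neg p _))) (popV-when+ r b (slice g x c) (slice g′ x c) (a , S)))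
  (trans (solve 4 (λ u v w y → (u :+ (:- v)) :+ (w :+ (:- y)) := (u :+ w) :+ (:- (v :+ y))) refl (when b (when p (g _))) (when p (g′ _)) (when b (popV r (slice g x c) (a , S))) (popV r (slice g′ x c) (a , S)))
    (cong (_+ℚ (-ℚ (when p (g′ _) +ℚ popV r (slice g′ x c) (a , S)))) (sym (when-+ b _ _))))
  where p = r ≤ᵇ x

ptV-when+ : ∀ {N} k b (g g′ : Poly N) μ → ptV k (λ ν → when b (g ν) +ℚ g′ ν) μ ≡ when b (ptV k g μ) +ℚ ptV k g′ μ
ptV-when+ k b g g′ ([] , []) = cong (_+ℚ 0ℚ) (sym (when-zero b))
ptV-when+ k b g g′ (x ∷ a , false ∷ S) = ptV-when+ k b (slice g x false) (slice g′ x false) (a , S)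
ptV-when+ k b g g′ (x ∷ a , true ∷ S) = trans (cong₂ (λ u v → u +ℚ (-ℚ v)) (trans (when-+ p _ _) (cong (_+ℚ when p (g′ _)) (when-comm p b _))) (ptV-when+ k b (slice g x true) (slice g′ x true) (a , S)))
  (trans (solve 4 (λ u v w y → (u :+ v) :+ (:- (w :+ y)) := (u :+ (:- w)) :+ (v :+ (:- y))) refl (when b (when p (g _))) (when p (g′ _)) (when b (ptV k (slice g x true) (a , S))) (ptV k (slice g′ x true) (a , S)))
    (cong (_+ℚ (when p (g′ _) +ℚ (-ℚ ptV k (slice g′ x true) (a , S)))) (trans (cong (when b (when p (g _)) +ℚ_) (sym (when-neg b _))) (sym (when-+ b _ _)))))
  where p = k ≤ᵇ x

-- In `pP` the odd factors are multiplied on last, whereas `pL` starts from their alternant; this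
-- commutation reverses the order.
ptV-popV : ∀ {N} k r (g : Poly N) μ → ptV k (popV r g) μ ≡ popV r (ptV k g) μ
ptV-popV k r g ([] , []) = refl
ptV-popV k r g (x ∷ a , false ∷ S) = trans (ptV-when+ k (r ≤ᵇ x) (slice g (x ∸ r) false) (popV r (slice g x false)) (a , S))
  (cong (when (r ≤ᵇ x) (ptV k (slice g (x ∸ r) false) (a , S)) +ℚ_) (trans (ptV-popV k r (slice g x false) (a , S)) (popV-cong r S (λ _ → refl) a)))
ptV-popV k r g (x ∷ a , true ∷ S) = begin
  when p (when (r ≤ᵇ x ∸ k) u +ℚ v) +ℚ (-ℚ ptV k (λ { (b , T) → when q (g (x ∸ r ∷ b , true ∷ T)) +ℚ popV r (slice g x true) (b , T) }) (a , S))
    ≡⟨ cong₂ (λ y z → y +ℚ (-ℚ z)) (when-+ p _ v) (trans (ptV-cong k (λ _ → refl) (a , S)) (trans (ptV-when+ k q (slice g (x ∸ r) true) (popV r (slice g x true)) (a , S)) (cong (w′ +ℚ_) (ptV-popV k r (slice g x true) (a , S))))) ⟩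
  (when p (when (r ≤ᵇ x ∸ k) u) +ℚ when p v) +ℚ (-ℚ (w′ +ℚ y))
    ≡⟨ cong (λ z → (z +ℚ when p v) +ℚ (-ℚ (w′ +ℚ y))) (when-∸-swap x k r (λ j → g (j ∷ a , false ∷ S))) ⟩
  (when q (when (k ≤ᵇ x ∸ r) u′) +ℚ when p v) +ℚ (-ℚ (w′ +ℚ y))
    ≡⟨ solve 4 (λ u v w y → (u :+ v) :+ (:- (w :+ y)) := (u :+ (:- w)) :+ (v :+ (:- y))) refl (when q (when (k ≤ᵇ x ∸ r) u′)) (when p v) w′ y ⟩
  (when q (when (k ≤ᵇ x ∸ r) u′) +ℚ (-ℚ w′)) +ℚ (when p v +ℚ (-ℚ y))
    ≡⟨ cong₂ _+ℚ_ (trans (cong (when q (when (k ≤ᵇ x ∸ r) u′) +ℚ_) (sym (when-neg q w))) (sym (when-+ q _ _)))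
         (sym (trans (popV-cong r S (λ _ → refl) a) (popV-when+ r p (slice g (x ∸ k) false) (ptV k (slice g x true)) (a , S)))) ⟩
  when q (when (k ≤ᵇ x ∸ r) u′ +ℚ (-ℚ w)) +ℚ popV r (slice (ptV k g) x true) (a , S) ∎
  where
  p = k ≤ᵇ x
  q = r ≤ᵇ x
  u = g (x ∸ k ∸ r ∷ a , false ∷ S)
  u′ = g (x ∸ r ∸ k ∷ a , false ∷ S)
  v = popV r (slice g (x ∸ k) false) (a , S)
  w = ptV k (slice g (x ∸ r) true) (a , S)
  w′ = when q w
  y = popV r (ptV k (slice g x true)) (a , S)

-- Superpolynomials as functions of their fermionic and bosonic exponents

bos : ∀ {N} → Vec ℕ N → Vec Bool N → List ℕ
bos []      []          = []
bos (x ∷ a) (true ∷ S)  = bos a S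
bos (x ∷ a) (false ∷ S) = x ∷ bos a S

onExps : ∀ {N} → (List ℕ → List ℕ → ℚ) → Poly N
onExps G (a , S) = G (antiExps a S) (bos a S)

length-antiExps : ∀ {N} (a : Vec ℕ N) S → length (antiExps a S) ≡ countT S
length-antiExps []      []          = refl
length-antiExps (x ∷ a) (true ∷ S)  = cong suc (length-antiExps a S)
length-antiExps (x ∷ a) (false ∷ S) = length-antiExps a S

ptV-0 : ∀ {N} k (μ : Mon N) → ptV k (λ _ → 0ℚ) μ ≡ 0ℚ
ptV-0 k ([] , [])           = refl
ptV-0 k (x ∷ a , false ∷ S) = ptV-0 k (a , S)
ptV-0 k (x ∷ a , true ∷ S)  = cong₂ (λ p q → p +ℚ (-ℚ q)) (when-zero (k ≤ᵇ x)) (ptV-0 k (a , S))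

oneP-onExps : ∀ {N} (μ : Mon N) → oneP μ ≡ onExps (λ e s → when (zeroL s) (alt [] e)) μ
oneP-onExps ([] , [])               = refl
oneP-onExps (zero ∷ a , false ∷ S)  = oneP-onExps (a , S)
oneP-onExps (suc x ∷ a , false ∷ S) = refl
oneP-onExps (x ∷ a , true ∷ S)      = trans (cong bool2ℚ (Boolₚ.∧-zeroʳ _)) (sym (when-zero (zeroL (bos a S))))

ptV-onExps : ∀ {N} k h (μ : Mon N) → ptV k (onExps (λ e s → when (zeroL s) (h e))) μ ≡ onExps (λ e s → when (zeroL s) (lap k h e)) μ
ptV-onExps k h ([] , [])               = refl
ptV-onExps k h (zero ∷ a , false ∷ S)  = ptV-onExps k h (a , S)
ptV-onExps k h (suc x ∷ a , false ∷ S) = ptV-0 k (a , S)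
ptV-onExps k h (x ∷ a , true ∷ S) = trans (cong₂ (λ u v → u +ℚ (-ℚ v)) (exact (h (antiExps a S))) (ptV-onExps k (λ e → h (x ∷ e)) (a , S)))
  (trans (cong (when z (when (x ≡ᵇ k) (h (antiExps a S))) +ℚ_) (sym (when-neg z _))) (sym (when-+ z _ _)))
  where
  z = zeroL (bos a S)
  exact : ∀ y → when (k ≤ᵇ x) (when ((x ∸ k ≡ᵇ 0) ∧ z) y) ≡ when z (when (x ≡ᵇ k) y)
  exact y = trans (cong (when (k ≤ᵇ x)) (when-∧ (x ∸ k ≡ᵇ 0) z y)) (trans (sym (when-∧ (k ≤ᵇ x) (x ∸ k ≡ᵇ 0) (when z y)))
    (trans (when-≡ (when z y) (bool-ext {(k ≤ᵇ x) ∧ (x ∸ k ≡ᵇ 0)}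
      (λ e → let p , q = ∧-split {k ≤ᵇ x} e in ≡→≡ᵇ {x} (≤-antisym (m∸n≡0⇒m≤n (≡ᵇ→≡ {x ∸ k} q)) (≤ᵇ→≤ {k} p)))
      (λ e → let p = ≡ᵇ→≡ {x} e in ∧-intro (≤→≤ᵇ {k} (≤-reflexive (sym p))) (≡→≡ᵇ {x ∸ k} (trans (cong (_∸ k) p) (n∸n≡0 k))))))
      (when-comm (x ≡ᵇ k) z y)))

popV-onExps : ∀ {N} r G (μ : Mon N) → popV r (onExps G) μ ≡ onExps (λ e s → popL r (λ e′ → G e′ s) e +ℚ popL r (λ s′ → G e s′) s) μ
popV-onExps r G ([] , [])           = refl
popV-onExps r G (x ∷ a , true ∷ S)  = trans (cong (when (r ≤ᵇ x) (G (x ∸ r ∷ antiExps a S) (bos a S)) +ℚ_) (popV-onExps r (λ e → G (x ∷ e)) (a , S)))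
  (sym (ℚₚ.+-assoc (when (r ≤ᵇ x) (G (x ∸ r ∷ antiExps a S) (bos a S))) (popL r (λ e′ → G (x ∷ e′) (bos a S)) (antiExps a S)) (popL r (λ s′ → G (x ∷ antiExps a S) s′) (bos a S))))
popV-onExps r G (x ∷ a , false ∷ S) = trans (cong (when (r ≤ᵇ x) (G (antiExps a S) (x ∸ r ∷ bos a S)) +ℚ_) (popV-onExps r (λ e s → G e (x ∷ s)) (a , S)))
  (solve 3 (λ u v w → u :+ (v :+ w) := v :+ (u :+ w)) refl (when (r ≤ᵇ x) (G (antiExps a S) (x ∸ r ∷ bos a S)))
    (popL r (λ e′ → G e′ (x ∷ bos a S)) (antiExps a S)) (popL r (λ s′ → G (antiExps a S) (x ∷ s′)) (bos a S)))

foldr-ptV : ∀ {N} a (μ : Mon N) → foldr ptV oneP a μ ≡ onExps (λ e s → when (zeroL s) (alt a e)) μ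
foldr-ptV []      μ = oneP-onExps μ
foldr-ptV (k ∷ a) μ = trans (ptV-cong k (foldr-ptV a) μ) (ptV-onExps k (alt a) μ)

foldr-popV-ptV : ∀ {N} a s (μ : Mon N) → foldr ptV (foldr popV oneP s) a μ ≡ foldr popV (foldr ptV oneP a) s μ
foldr-popV-ptV a []      μ = refl
foldr-popV-ptV a (r ∷ s) (xs , S) = trans (past a (xs , S)) (popV-cong r S (λ ys → foldr-popV-ptV a s (ys , S)) xs)
  where
  past : ∀ a μ → foldr ptV (popV r (foldr popV oneP s)) a μ ≡ popV r (foldr ptV (foldr popV oneP s) a) μ
  past []      μ = refl
  past (k ∷ a) μ = trans (ptV-cong k (past a) μ) (ptV-popV k r (foldr ptV (foldr popV oneP s) a) μ)

pP-foldr : ∀ {N} a s (μ : Mon N) → (∀ z → z ∈ s → 1 ≤ z) → pP (a , s) μ ≡ foldr ptV (foldr popV oneP s) a μ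
pP-foldr (k ∷ a) s μ h = trans (⊗-congʳ (ptP k) (λ ν → pP-foldr a s ν h) μ) (pt-⊗ k (foldr ptV (foldr popV oneP s) a) μ)
pP-foldr [] [] μ h = refl
pP-foldr [] (zero ∷ s) μ h = case h 0 (here refl) of λ ()
pP-foldr [] (suc r ∷ s) μ h = trans (⊗-congʳ (prP (suc r)) (λ ν → pP-foldr [] s ν (λ z m → h z (there m))) μ) (pr-⊗ r (foldr popV oneP s) μ)

alt-length : ∀ a e → length a ≢ length e → alt a e ≡ 0ℚ
alt-length []      []      h = ⊥-elim (h refl)
alt-length []      (_ ∷ _) h = refl
alt-length (k ∷ a) e       h = lap-zero k (alt a) e (λ { p q refl → alt-length a (p ++ q) (λ z → h (trans (cong suc z) (sym (length-mid p k q)))) })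

pP-pL : ∀ {N} Γ (xs : Vec ℕ N) S → IsSP Γ → countT S ≡ fdeg Γ → pP Γ (xs , S) ≡ pL Γ (antiExps xs S ++ bos xs S)
pP-pL (a , s) xs S i q = trans (pP-foldr a s (xs , S) (IsSP.pos i)) (trans (foldr-popV-ptV a s (xs , S)) (go s xs))
  where
  go : ∀ s xs → foldr popV (foldr ptV oneP a) s (xs , S) ≡ opP s (base a) (antiExps xs S ++ bos xs S)
  go []      xs = trans (foldr-ptV a (xs , S)) (sym (base-++ a (antiExps xs S) (bos xs S) (trans (length-antiExps xs S) q)))
  go (r ∷ s) xs = trans (popV-cong r {g′ = onExps (λ e t → opP s (base a) (e ++ t))} S (go s) xs) (trans (popV-onExps r (λ e t → opP s (base a) (e ++ t)) (xs , S))
    (sym (popL-++ r (opP s (base a)) (antiExps xs S) (bos xs S))))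

pP-0 : ∀ {N} Γ (xs : Vec ℕ N) S → IsSP Γ → countT S ≢ fdeg Γ → pP Γ (xs , S) ≡ 0ℚ
pP-0 (a , s) xs S i ne = trans (pP-foldr a s (xs , S) (IsSP.pos i)) (trans (foldr-popV-ptV a s (xs , S)) (go s xs))
  where
  go : ∀ s xs → foldr popV (foldr ptV oneP a) s (xs , S) ≡ 0ℚ
  go []      xs = trans (foldr-ptV a (xs , S)) (trans (cong (when (zeroL (bos xs S))) (alt-length a (antiExps xs S) (λ z → ne (trans (sym (length-antiExps xs S)) (sym z))))) (when-zero (zeroL (bos xs S))))
  go (r ∷ s) xs = trans (popV-cong r S (go s) xs) (popV-0 r S xs)

mP-onExps : ∀ {N} Ω (μ : Mon N) → mP Ω μ ≡ onExps (mL Ω) μ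
mP-onExps (la , ls) (a , S) = trans (cong (λ t → if eqL (sortDesc e) la ∧ eqL (sortDesc t) ls then sgn (ascPairs e) else 0ℚ) (sym (nz-bos a S))) (if-when _)
  where
  e = antiExps a S
  nz-bos : ∀ {N} (a : Vec ℕ N) S → nz (bos a S) ≡ symExps a S
  nz-bos []          []          = refl
  nz-bos (x ∷ a)     (true ∷ S)  = nz-bos a S
  nz-bos (zero ∷ a)  (false ∷ S) = nz-bos a S
  nz-bos (suc x ∷ a) (false ∷ S) = cong (suc x ∷_) (nz-bos a S)
  if-when : ∀ b → (if b then sgn (ascPairs e) else 0ℚ) ≡ when b (sgn (ascPairs e))
  if-when true  = refl
  if-when false = refl

mL-0 : ∀ Ω e s → length e ≢ fdeg Ω → mL Ω e s ≡ 0ℚ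
mL-0 Ω e s ne with mL Ω e s ℚₚ.≟ 0ℚ
... | yes z = z
... | no h = ⊥-elim (ne (sym (trans (cong fdeg (mL-≢0 Ω e s h)) (sortDesc-length e))))

realizeL : (SPart → SPart → ℚ) → SPart → List ℕ → List ℕ → ℚ
realizeL c Λ e s = ∑ (sector (bdeg Λ) (fdeg Λ)) (λ Ω → c Λ Ω *ℚ mL Ω e s)

realize-onExps : ∀ N c Λ (μ : Mon N) → realize N c Λ μ ≡ onExps (realizeL c Λ) μ
realize-onExps N c Λ μ = trans (ΣP-∑ (sector (bdeg Λ) (fdeg Λ)) (λ Ω → c Λ Ω ⊙ mP Ω) μ) (∑-cong′ (sector (bdeg Λ) (fdeg Λ)) (λ Ω → cong (c Λ Ω *ℚ_) (mP-onExps Ω μ)))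

-- hP ℓ after u of its degree has been used up
hU : ∀ {N} → ℕ → ℕ → Poly N
hU u ℓ (a , S) = bool2ℚ (allFalse S ∧ (u + sumV a ≡ᵇ ℓ))

hopU : ℕ → ℕ → (List ℕ → List ℕ → ℚ) → List ℕ → List ℕ → ℚ
hopU u ℓ G e s = ∑ (sub e) (λ e′ → ∑ (sub s) (λ s′ → when ((sum e′ + sum s′) + ℓ ≡ᵇ u + (sum e + sum s)) (G e′ s′)))

hU-slice : ∀ {N} u ℓ j (ν : Mon N) → slice (hU u ℓ) j false ν ≡ hU (u + j) ℓ ν
hU-slice u ℓ j (a , S) = cong (λ k → bool2ℚ (allFalse S ∧ (k ≡ᵇ ℓ))) (sym (ℕₚ.+-assoc u j (sumV a)))

carry : ∀ {x i A A′ B B′ u ℓ} → i ≤ x → A′ ≡ i + A → B′ ≡ x + B → (A + ℓ ≡ᵇ (u + (x ∸ i)) + B) ≡ (A′ + ℓ ≡ᵇ u + B′)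
carry {x} {i} {A} {_} {B} {_} {u} {ℓ} h refl refl = ≡ᵇ-cong {A + ℓ}
  (λ e → trans (ℕₚ.+-assoc i A ℓ) (trans (cong (i +_) e) key))
  (λ e → +-cancelˡ-≡ i (A + ℓ) ((u + (x ∸ i)) + B) (trans (sym (ℕₚ.+-assoc i A ℓ)) (trans e (sym key))))
  where
  ar : ∀ i u d B → i + ((u + d) + B) ≡ u + ((i + d) + B)
  ar = solve-∀
  key : i + ((u + (x ∸ i)) + B) ≡ u + (x + B)
  key = trans (ar i u (x ∸ i) B) (cong (λ y → u + (y + B)) (m+[n∸m]≡n h))

⊗-hU : ∀ {N} u ℓ G (μ : Mon N) → (onExps G ⊗ hU u ℓ) μ ≡ onExps (hopU u ℓ G) μ
⊗-hU u ℓ G ([] , []) = begin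
  1ℚ *ℚ G [] [] *ℚ bool2ℚ (u + 0 ≡ᵇ ℓ) +ℚ 0ℚ
    ≡⟨ trans (ℚₚ.+-identityʳ _) (cong (_*ℚ bool2ℚ (u + 0 ≡ᵇ ℓ)) (ℚₚ.*-identityˡ (G [] []))) ⟩
  G [] [] *ℚ bool2ℚ (u + 0 ≡ᵇ ℓ)
    ≡⟨ cong (λ b → G [] [] *ℚ bool2ℚ b) (≡ᵇ-cong {u + 0} {ℓ} {ℓ} {u + 0} sym sym) ⟩
  G [] [] *ℚ bool2ℚ (ℓ ≡ᵇ u + 0)
    ≡⟨ one (ℓ ≡ᵇ u + 0) ⟩
  when (ℓ ≡ᵇ u + 0) (G [] [])
    ≡⟨ sym (trans (ℚₚ.+-identityʳ _) (ℚₚ.+-identityʳ _)) ⟩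
  hopU u ℓ G [] [] ∎
  where
  one : ∀ b → G [] [] *ℚ bool2ℚ b ≡ when b (G [] [])
  one true  = ℚₚ.*-identityʳ (G [] [])
  one false = ℚₚ.*-zeroʳ (G [] [])
⊗-hU u ℓ G (x ∷ a , false ∷ S) = begin
  (onExps G ⊗ hU u ℓ) (x ∷ a , false ∷ S)
    ≡⟨ ⊗-false (onExps G) (hU u ℓ) x a S ⟩
  ∑< (suc x) (λ i → (slice (onExps G) i false ⊗ slice (hU u ℓ) (x ∸ i) false) (a , S))
    ≡⟨ ∑<-cong (suc x) (λ i i< → trans (⊗-congʳ (slice (onExps G) i false) (hU-slice u ℓ (x ∸ i)) (a , S)) (trans (⊗-congˡ (hU (u + (x ∸ i)) ℓ) (λ _ → refl) (a , S)) (trans (⊗-hU (u + (x ∸ i)) ℓ (λ e s → G e (i ∷ s)) (a , S))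
         (∑-cong′ (sub e) (λ e′ → ∑-cong′ (sub s) (λ s′ → when-≡ (G e′ (i ∷ s′)) (carry {x} {i} {u = u} (≤-pred i<) (+-exchange (sum e′) i (sum s′)) (+-exchange (sum e) x (sum s))))))))) ⟩
  ∑< (suc x) (λ i → ∑ (sub e) (λ e′ → ∑ (sub s) (λ s′ → F e′ (i ∷ s′))))
    ≡⟨ ∑<-∑-swap (suc x) (sub e) (λ i e′ → ∑ (sub s) (λ s′ → F e′ (i ∷ s′))) ⟩
  ∑ (sub e) (λ e′ → ∑< (suc x) (λ i → ∑ (sub s) (λ s′ → F e′ (i ∷ s′))))
    ≡⟨ ∑-cong′ (sub e) (λ e′ → sym (∑-sub-∷ x s (F e′))) ⟩
  hopU u ℓ G e (x ∷ s) ∎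
  where
  e = antiExps a S
  s = bos a S
  F : List ℕ → List ℕ → ℚ
  F e′ s′ = when ((sum e′ + sum s′) + ℓ ≡ᵇ u + (sum e + (x + sum s))) (G e′ s′)
⊗-hU u ℓ G (x ∷ a , true ∷ S) = begin
  (onExps G ⊗ hU u ℓ) (x ∷ a , true ∷ S)
    ≡⟨ ⊗-true (onExps G) (hU u ℓ) x a S ⟩
  ∑< (suc x) (λ i → (slice (onExps G) i true ⊗ slice (hU u ℓ) (x ∸ i) false) (a , S) +ℚ (twist (slice (onExps G) i false) ⊗ slice (hU u ℓ) (x ∸ i) true) (a , S))
    ≡⟨ ∑<-cong (suc x) (λ i i< → trans (cong ((slice (onExps G) i true ⊗ slice (hU u ℓ) (x ∸ i) false) (a , S) +ℚ_)
           (trans (⊗-congʳ (twist (slice (onExps G) i false)) {slice (hU u ℓ) (x ∸ i) true} {zeroP} (λ _ → refl) (a , S)) (⊗-zeroʳ (twist (slice (onExps G) i false)) (a , S))))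
         (trans (ℚₚ.+-identityʳ _) (trans (⊗-congʳ (slice (onExps G) i true) (hU-slice u ℓ (x ∸ i)) (a , S)) (trans (⊗-congˡ (hU (u + (x ∸ i)) ℓ) (λ _ → refl) (a , S)) (trans (⊗-hU (u + (x ∸ i)) ℓ (λ e → G (i ∷ e)) (a , S))
         (∑-cong′ (sub e) (λ e′ → ∑-cong′ (sub s) (λ s′ → when-≡ (G (i ∷ e′) s′) (carry {x} {i} {u = u} (≤-pred i<) (ℕₚ.+-assoc i (sum e′) (sum s′)) (ℕₚ.+-assoc x (sum e) (sum s)))))))))) ) ⟩
  ∑< (suc x) (λ i → ∑ (sub e) (λ e′ → ∑ (sub s) (λ s′ → F (i ∷ e′) s′)))
    ≡⟨ sym (∑-sub-∷ x e (λ e′ → ∑ (sub s) (F e′))) ⟩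
  hopU u ℓ G (x ∷ e) s ∎
  where
  e = antiExps a S
  s = bos a S
  F : List ℕ → List ℕ → ℚ
  F e′ s′ = when ((sum e′ + sum s′) + ℓ ≡ᵇ u + ((x + sum e) + sum s)) (G e′ s′)

realize-⊗-hP : ∀ N c Λ ℓ (μ : Mon N) → (realize N c Λ ⊗ hP ℓ) μ ≡ onExps (hop ℓ (realizeL c Λ)) μ
realize-⊗-hP N c Λ ℓ μ = trans (⊗-congˡ (hP ℓ) (realize-onExps N c Λ) μ) (trans (⊗-congʳ (onExps (realizeL c Λ)) (λ _ → refl) μ) (⊗-hU 0 ℓ (realizeL c Λ) μ))

-- Limits as q tends to 0, uniformly in a parameter c restricted to Good q c

module Limit {C : Set} (Good : ℚ → C → Set) where

  Null : (ℚ → C → ℚ) → Set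
  Null f = ∀ ε → 0ℚ <ℚ ε → ∃[ d ] (0ℚ <ℚ d × (∀ q c → 0ℚ <ℚ ∣ q ∣ℚ → ∣ q ∣ℚ <ℚ d → Good q c → ∣ f q c ∣ℚ <ℚ ε))

  Tends : (ℚ → C → ℚ) → ℚ → Set
  Tends f v = Null (λ q c → f q c -ℚ v)

  lesser : ∀ {d d′} → 0ℚ <ℚ d → 0ℚ <ℚ d′ → ∃[ e ] (0ℚ <ℚ e × e ≤ℚ d × e ≤ℚ d′)
  lesser {d} {d′} p p′ with ℚₚ.≤-total d d′
  ... | inj₁ h = d , p , ℚₚ.≤-refl , h
  ... | inj₂ h = d′ , p′ , h , ℚₚ.≤-refl

  null-cong : ∀ {f g} → (∀ q c → f q c ≡ g q c) → Null f → Null g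
  null-cong e n ε ε>0 = let d , d>0 , h = n ε ε>0 in d , d>0 , λ q c a b y → subst (λ z → ∣ z ∣ℚ <ℚ ε) (e q c) (h q c a b y)

  null-0 : Null (λ _ _ → 0ℚ)
  null-0 ε ε>0 = 1ℚ , ℚₚ.positive⁻¹ 1ℚ , λ _ _ _ _ _ → ε>0

  null-+ : ∀ {f g} → Null f → Null g → Null (λ q c → f q c +ℚ g q c)
  null-+ {f} {g} nf ng ε ε>0 =
    let η , η>0 , η<ε = ℚₚ.<-dense ε>0
        d , d>0 , h = nf η η>0
        d′ , d′>0 , h′ = ng (ε -ℚ η) (subst (_<ℚ ε -ℚ η) (ℚₚ.+-inverseʳ η) (ℚₚ.+-mono-<-≤ {η} {ε} η<ε (ℚₚ.≤-refl { -ℚ η})))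
        e , e>0 , e≤d , e≤d′ = lesser d>0 d′>0
    in e , e>0 , λ q c a b y → ℚₚ.≤-<-trans (ℚₚ.∣p+q∣≤∣p∣+∣q∣ (f q c) (g q c))
      (subst (∣ f q c ∣ℚ +ℚ ∣ g q c ∣ℚ <ℚ_) (solve 2 (λ η ε → η :+ (ε :+ (:- η)) := ε) refl η ε)
        (ℚₚ.+-mono-< (h q c a (ℚₚ.<-≤-trans b e≤d) y) (h′ q c a (ℚₚ.<-≤-trans b e≤d′) y)))

  null-*ˡ : ∀ k {f} → Null f → Null (λ q c → k *ℚ f q c)
  null-*ˡ k {f} nf ε ε>0 =
    let d , d>0 , h = nf (ε *ℚ inverse K) η>0
    in d , d>0 , λ q c a b y → ℚₚ.≤-<-trans (scaled (f q c)) (subst (K *ℚ ∣ f q c ∣ℚ <ℚ_) back (ℚₚ.*-monoʳ-<-pos K {{Rat.positive K>0}} (h q c a b y)))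
    where
    K = ∣ k ∣ℚ +ℚ 1ℚ
    K>0 : 0ℚ <ℚ K
    K>0 = ℚₚ.+-mono-≤-< {0ℚ} {∣ k ∣ℚ} {0ℚ} {1ℚ} (ℚₚ.0≤∣p∣ k) (ℚₚ.positive⁻¹ 1ℚ)
    K≢0 : K ≢ 0ℚ
    K≢0 z = ℚₚ.<-irrefl (sym z) K>0
    back : K *ℚ (ε *ℚ inverse K) ≡ ε
    back = trans (solve 3 (λ K ε i → K :* (ε :* i) := ε :* (K :* i)) refl K ε (inverse K)) (*-1ʳ ε (inverse-* K≢0))
    η>0 : 0ℚ <ℚ ε *ℚ inverse K
    η>0 = ℚₚ.*-cancelˡ-<-nonNeg K {{ℚₚ.pos⇒nonNeg K {{Rat.positive K>0}}}} (subst₂ _<ℚ_ (sym (ℚₚ.*-zeroʳ K)) (sym back) ε>0)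
    scaled : ∀ x → ∣ k *ℚ x ∣ℚ ≤ℚ K *ℚ ∣ x ∣ℚ
    scaled x = subst (_≤ℚ K *ℚ ∣ x ∣ℚ) (sym (ℚₚ.∣p*q∣≡∣p∣*∣q∣ k x)) (ℚₚ.*-monoʳ-≤-nonNeg ∣ x ∣ℚ {{ℚₚ.∣-∣-nonNeg x}}
      (subst (_≤ℚ K) (ℚₚ.+-identityʳ ∣ k ∣ℚ) (ℚₚ.+-mono-≤ {∣ k ∣ℚ} {∣ k ∣ℚ} ℚₚ.≤-refl (ℚₚ.<⇒≤ (ℚₚ.positive⁻¹ 1ℚ)))))

  null-* : ∀ {f g} → Null f → Null g → Null (λ q c → f q c *ℚ g q c)
  null-* {f} {g} nf ng ε ε>0 =
    let d , d>0 , h = nf ε ε>0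
        d′ , d′>0 , h′ = ng 1ℚ (ℚₚ.positive⁻¹ 1ℚ)
        e , e>0 , e≤d , e≤d′ = lesser d>0 d′>0
    in e , e>0 , λ q c a b y → ℚₚ.≤-<-trans (subst₂ _≤ℚ_ (sym (ℚₚ.∣p*q∣≡∣p∣*∣q∣ (f q c) (g q c))) (ℚₚ.*-identityʳ ∣ f q c ∣ℚ)
        (ℚₚ.*-monoˡ-≤-nonNeg ∣ f q c ∣ℚ {{ℚₚ.∣-∣-nonNeg (f q c)}} (ℚₚ.<⇒≤ (h′ q c a (ℚₚ.<-≤-trans b e≤d′) y)))) (h q c a (ℚₚ.<-≤-trans b e≤d) y)

  tends-const : ∀ v → Tends (λ _ _ → v) v
  tends-const v = null-cong (λ _ _ → sym (ℚₚ.+-inverseʳ v)) null-0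

  tends-q : Tends (λ q _ → q) 0ℚ
  tends-q = null-cong (λ q _ → sym (ℚₚ.+-identityʳ q)) (λ ε ε>0 → ε , ε>0 , λ _ _ _ b _ → b)

  tends-+ : ∀ {f g v w} → Tends f v → Tends g w → Tends (λ q c → f q c +ℚ g q c) (v +ℚ w)
  tends-+ {f} {g} {v} {w} tf tg = null-cong
    (λ q c → solve 4 (λ f g v w → (f :+ (:- v)) :+ (g :+ (:- w)) := (f :+ g) :+ (:- (v :+ w))) refl (f q c) (g q c) v w) (null-+ tf tg)

  tends-* : ∀ {f g v w} → Tends f v → Tends g w → Tends (λ q c → f q c *ℚ g q c) (v *ℚ w)
  tends-* {f} {g} {v} {w} tf tg = null-cong
    (λ q c → solve 4 (λ f g v w → (f :+ (:- v)) :* (g :+ (:- w)) :+ (v :* (g :+ (:- w)) :+ w :* (f :+ (:- v))) := f :* g :+ (:- (v :* w))) refl (f q c) (g q c) v w)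
    (null-+ (null-* tf tg) (null-+ (null-*ˡ v tg) (null-*ˡ w tf)))

  tends-∑ : ∀ {A : Set} (xs : List A) {f : A → ℚ → C → ℚ} {v : A → ℚ} → (∀ x → x ∈ xs → Tends (f x) (v x)) → Tends (λ q c → ∑ xs (λ x → f x q c)) (∑ xs v)
  tends-∑ []       h = tends-const 0ℚ
  tends-∑ (x ∷ xs) {f} h = tends-+ {f x} {λ q c → ∑ xs (λ y → f y q c)} (h x (here refl)) (tends-∑ xs {f} (λ y m → h y (there m)))

  tends-pow : ∀ k → Tends (λ q _ → powℚ q k) (powℚ 0ℚ k)
  tends-pow zero    = tends-const 1ℚ
  tends-pow (suc k) = tends-* {λ q _ → q} {λ q _ → powℚ q k} {0ℚ} {powℚ 0ℚ k} tends-q (tends-pow k)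

  -- If v and w differed, a positive q below both radii with a good parameter would give a value
  -- equal to w at distance less than |w - v| from v.
  tends-unique : ∀ {f v} w → (∃[ d ] (0ℚ <ℚ d × (∀ q → 0ℚ <ℚ ∣ q ∣ℚ → ∣ q ∣ℚ <ℚ d → ∃[ c ] Good q c))) →
    (∀ q c → 0ℚ <ℚ ∣ q ∣ℚ → Good q c → f q c ≡ w) → Tends f v → v ≡ w
  tends-unique {f} {v} w (d , d>0 , ex) h tf with v ℚₚ.≟ w
  ... | yes e = e
  ... | no ne = ⊥-elim (ℚₚ.<-irrefl refl (subst (λ z → ∣ z -ℚ v ∣ℚ <ℚ ∣ w -ℚ v ∣ℚ) (h q c q>0 good) (h′ q c q>0 (subst (_<ℚ d′) (sym ∣q∣) (ℚₚ.<-≤-trans q<e e≤d′)) good)))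
    where
    gap : 0ℚ <ℚ ∣ w -ℚ v ∣ℚ
    gap = ℚₚ.≰⇒> (λ le → ne (sym (trans (solve 2 (λ v w → w := (w :+ (:- v)) :+ v) refl v w)
      (trans (cong (_+ℚ v) (ℚₚ.∣p∣≡0⇒p≡0 (w -ℚ v) (ℚₚ.≤-antisym le (ℚₚ.0≤∣p∣ (w -ℚ v))))) (ℚₚ.+-identityˡ v)))))
    lim = tf ∣ w -ℚ v ∣ℚ gap
    d′ = proj₁ lim
    h′ = proj₂ (proj₂ lim)
    ls = lesser d>0 (proj₁ (proj₂ lim))
    e≤d = proj₁ (proj₂ (proj₂ ls))
    e≤d′ = proj₂ (proj₂ (proj₂ ls))
    mid = ℚₚ.<-dense (proj₁ (proj₂ ls))
    q = proj₁ mid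
    q<e = proj₂ (proj₂ mid)
    ∣q∣ : ∣ q ∣ℚ ≡ q
    ∣q∣ = ℚₚ.0≤p⇒∣p∣≡p (ℚₚ.<⇒≤ (proj₁ (proj₂ mid)))
    q>0 : 0ℚ <ℚ ∣ q ∣ℚ
    q>0 = subst (0ℚ <ℚ_) (sym ∣q∣) (proj₁ (proj₂ mid))
    fam = ex q q>0 (subst (_<ℚ d) (sym ∣q∣) (ℚₚ.<-≤-trans q<e e≤d))
    c = proj₁ fam
    good = proj₂ fam

-- Dominance order on a sector

_⊴_ : SPart → SPart → Set
Ω ⊴ Λ = Dominates Λ (proj₁ Ω) (proj₂ Ω)

⊴-refl : ∀ Λ → Λ ⊴ Λ
⊴-refl Λ = ⊑-refl (star Λ) , ⊑-refl (circ Λ)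

⊴-trans : ∀ {Λ Γ Ω} → Λ ⊴ Γ → Γ ⊴ Ω → Λ ⊴ Ω
⊴-trans {Λ} {Γ} {Ω} (p , q) (r , s) = ⊑-trans {star Λ} {star Γ} {star Ω} p r , ⊑-trans {circ Λ} {circ Γ} {circ Ω} q s

-- Limit arguments only refute the failure of a dominance relation. Comparisons of natural numbers
-- are decidable, so the double negation can be removed.
⊴-stable : ∀ Λ Ω → ¬ ¬ (Λ ⊴ Ω) → Λ ⊴ Ω
⊴-stable Λ Ω h = (λ k → st (λ z → h (λ d → z (proj₁ d k)))) , (λ k → st (λ z → h (λ d → z (proj₂ d k))))
  where
  st : ∀ {a b} → ¬ ¬ (a ≤ b) → a ≤ b
  st {a} {b} nn with a ≤? b
  ... | yes le = le
  ... | no gt = ⊥-elim (nn gt)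

ΣN : ℕ → (ℕ → ℕ) → ℕ
ΣN zero    f = 0
ΣN (suc k) f = f k + ΣN k f

ΣN-mono : ∀ K {f g : ℕ → ℕ} → (∀ k → f k ≤ g k) → ΣN K f < ΣN K g ⊎ (∀ k → k < K → f k ≡ g k)
ΣN-mono zero h = inj₂ (λ _ ())
ΣN-mono (suc K) {f} {g} h with ΣN-mono K h
... | inj₁ lt = inj₁ (+-mono-≤-< (h K) lt)
... | inj₂ eq with f K ≟ g K
...   | no ne = inj₁ (+-mono-<-≤ (≤∧≢⇒< (h K) ne) (le K (λ k _ → h k)))
  where
  le : ∀ K {f g : ℕ → ℕ} → (∀ k → k < K → f k ≤ g k) → ΣN K f ≤ ΣN K g
  le zero    h = z≤n
  le (suc K) h = +-mono-≤ (h K ≤-refl) (le K (λ k lt → h k (m≤n⇒m≤1+n lt)))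
...   | yes e = inj₂ (λ k k< → at-k k (ℕₚ.m≤n⇒m<n∨m≡n (≤-pred k<)))
  where
  at-k : ∀ k → k < K ⊎ k ≡ K → f k ≡ g k
  at-k k (inj₁ lt)   = eq k lt
  at-k k (inj₂ refl) = e

psum-injective : ∀ x y → length x ≡ length y → (∀ k → k ≤ length x → psum k x ≡ psum k y) → x ≡ y
psum-injective []      []      _ _ = refl
psum-injective (a ∷ x) (b ∷ y) l h = cong₂ _∷_ a≡b (psum-injective x y (suc-injective l)
  (λ k k≤ → +-cancelˡ-≡ a (psum k x) (psum k y) (trans (h (suc k) (s≤s k≤)) (cong (_+ psum k y) (sym a≡b)))))
  where
  a≡b : a ≡ b
  a≡b = trans (sym (ℕₚ.+-identityʳ a)) (trans (h 1 (s≤s z≤n)) (ℕₚ.+-identityʳ b))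

module Dominance (n m : ℕ) where
  open Sector n m

  -- Strictly increasing along dominance, so that inductions along the order become inductions on
  -- natural numbers; every diagram of the sector has at most m + n rows.
  height : SPart → ℕ
  height Λ = ΣN (suc (m + n)) (λ k → psum k (star Λ) + psum k (circ Λ))

  rows-fit : ∀ {Λ} → Λ ∈ I → length (rows Λ) ≤ m + n
  rows-fit {a , s} Λ∈ = ≤-trans (≤-reflexive (trans (length-rows a s) (cong (_+ length s) (fd Λ∈))))
    (+-monoʳ-≤ m (≤-trans (pos-length s (IsSP.pos (sp Λ∈))) (≤-trans (m≤n+m (sum s) (sum a)) (≤-reflexive (bd Λ∈)))))

  height-< : ∀ {Λ Ω} → Λ ∈ I → Ω ∈ I → Λ ⊴ Ω → Λ ≢ Ω → height Λ < height Ω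
  height-< {Λ} {Ω} Λ∈ Ω∈ (p , q) ne with ΣN-mono (suc (m + n)) (λ k → +-mono-≤ (p k) (q k))
  ... | inj₁ lt = lt
  ... | inj₂ eq = ⊥-elim (ne (trans (sym (toSP-padTo (m + n) (sp Λ∈))) (trans (cong toSP (rows-determined u v
      (psum-injective (lens u) (lens v) (trans (len proj₁ Λ∈) (sym (len proj₁ Ω∈))) (λ k k≤ → trans (star-psum (sp Λ∈) _ k) (trans (proj₁ (both k (k< proj₁ Λ∈ k≤))) (sym (star-psum (sp Ω∈) _ k)))))
      (psum-injective (circs u) (circs v) (trans (len clen Λ∈) (sym (len clen Ω∈))) (λ k k≤ → trans (circ-psum (sp Λ∈) _ k) (trans (proj₂ (both k (k< clen Λ∈ k≤))) (sym (circ-psum (sp Ω∈) _ k)))))))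
      (toSP-padTo (m + n) (sp Ω∈)))))
    where
    u = padTo (m + n) (rows Λ)
    v = padTo (m + n) (rows Ω)
    len : ∀ (f : Row → ℕ) {Γ} → Γ ∈ I → length (map f (padTo (m + n) (rows Γ))) ≡ m + n
    len f {Γ} Γ∈ = trans (Listₚ.length-map f (padTo (m + n) (rows Γ))) (padTo-length {m + n} {rows Γ} (rows-fit Γ∈))
    k< : ∀ (f : Row → ℕ) {Γ k} → Γ ∈ I → k ≤ length (map f (padTo (m + n) (rows Γ))) → k < suc (m + n)
    k< f Γ∈ k≤ = s≤s (≤-trans k≤ (≤-reflexive (len f Γ∈)))
    both : ∀ k → k < suc (m + n) → psum k (star Λ) ≡ psum k (star Ω) × psum k (circ Λ) ≡ psum k (circ Ω)
    both k lt = squeeze≡ (p k) (q k) (eq k lt)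
      where
      squeeze≡ : ∀ {a b c d} → a ≤ b → c ≤ d → a + c ≡ b + d → a ≡ b × c ≡ d
      squeeze≡ {a} {b} {c} {d} h h′ e with a ≟ b
      ... | yes refl = refl , +-cancelˡ-≡ a c d e
      ... | no z = ⊥-elim (<-irrefl e (+-mono-<-≤ (≤∧≢⇒< h z) h′))

  ⊴-antisym : ∀ {Λ Ω} → Λ ∈ I → Ω ∈ I → Λ ⊴ Ω → Ω ⊴ Λ → Λ ≡ Ω
  ⊴-antisym {Λ} {Ω} Λ∈ Ω∈ h h′ with Λ ≟SP Ω
  ... | yes e = e
  ... | no ne = ⊥-elim (ℕₚ.<-asym (height-< Λ∈ Ω∈ h ne) (height-< Ω∈ Λ∈ h′ (ne ∘ sym)))

-- The family s_Λ and its identification with F_Λ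

*-nonzero : ∀ {x y} → x *ℚ y ≢ 0ℚ → x ≢ 0ℚ × y ≢ 0ℚ
*-nonzero {x} {y} h = (λ { refl → h (ℚₚ.*-zeroˡ y) }) , (λ { refl → h (ℚₚ.*-zeroʳ x) })

*-vanish : ∀ {x y} → (x ≢ 0ℚ → y ≡ 0ℚ) → x *ℚ y ≡ 0ℚ
*-vanish {x} {y} h with x ℚₚ.≟ 0ℚ
... | yes refl = ℚₚ.*-zeroˡ y
... | no ne = *-0ʳ x (h ne)

*-congʳ-≢0 : ∀ {x y z} → (x ≢ 0ℚ → y ≡ z) → x *ℚ y ≡ x *ℚ z
*-congʳ-≢0 {x} {y} {z} h with x ℚₚ.≟ 0ℚ
... | yes refl = trans (ℚₚ.*-zeroˡ y) (sym (ℚₚ.*-zeroˡ z))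
... | no ne = cong (x *ℚ_) (h ne)

≡0-stable : ∀ {x} → (x ≢ 0ℚ → ⊥) → x ≡ 0ℚ
≡0-stable {x} h with x ℚₚ.≟ 0ℚ
... | yes e = e
... | no ne = ⊥-elim (h ne)

powℚ-+ : ∀ q j k → powℚ q (j + k) ≡ powℚ q j *ℚ powℚ q k
powℚ-+ q zero    k = sym (ℚₚ.*-identityˡ (powℚ q k))
powℚ-+ q (suc j) k = trans (cong (q *ℚ_) (powℚ-+ q j k)) (sym (ℚₚ.*-assoc q (powℚ q j) (powℚ q k)))

powℚ-≢0 : ∀ {q} → q ≢ 0ℚ → ∀ k → powℚ q k ≢ 0ℚ
powℚ-≢0 h zero    = λ ()
powℚ-≢0 {q} h (suc k) z = powℚ-≢0 h k (*-cancel h (trans z (sym (ℚₚ.*-zeroʳ q))))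

powℚ-0 : ∀ {i j} x → i ≤ j → powℚ 0ℚ (j ∸ i) *ℚ x ≡ when (j ≡ᵇ i) x
powℚ-0 {i} {j} x h with j ≟ i
... | yes refl = trans (cong (λ k → powℚ 0ℚ k *ℚ x) (n∸n≡0 i)) (trans (ℚₚ.*-identityˡ x) (sym (when-≡ x (≡→≡ᵇ {i} refl))))
... | no ne with j ∸ i in eq
...   | zero  = ⊥-elim (ne (≤-antisym (m∸n≡0⇒m≤n eq) h))
...   | suc k = trans (*-0ˡ x (ℚₚ.*-zeroˡ (powℚ 0ℚ k))) (sym (when-≡ x (≢→≡ᵇ {j} ne)))

realizeL-0 : ∀ c Λ e s → length e ≢ fdeg Λ → realizeL c Λ e s ≡ 0ℚ
realizeL-0 c Λ e s ne = ∑-zero (sector (bdeg Λ) (fdeg Λ)) (λ Ω Ω∈ → trans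
  (cong (c Λ Ω *ℚ_) (mL-0 Ω e s (λ q → ne (trans q (proj₂ (proj₂ (sector→ {bdeg Λ} {fdeg Λ} Ω∈))))))) (ℚₚ.*-zeroʳ (c Λ Ω)))

module Family (n m : ℕ) (S : SPart → SPart → ℚ) (schurS : IsSchur S) where
  open Sector n m
  open Dominance n m
  open Limit (λ q c → IsPSector q n m c)

  c-tends : ∀ {Λ Ω} → Λ ∈ I → Ω ∈ I → Tends (λ _ c → c Λ Ω) (S Λ Ω)
  c-tends {Λ} {Ω} Λ∈ Ω∈ ε ε>0 = let d , d>0 , h = schurS n m Λ Ω Λ∈ Ω∈ ε ε>0 in d , d>0 , λ q c a b good → proj₂ (h q a b) c good

  exist : ∀ {Λ} → Λ ∈ I → ∃[ d ] (0ℚ <ℚ d × (∀ q → 0ℚ <ℚ ∣ q ∣ℚ → ∣ q ∣ℚ <ℚ d → ∃[ c ] IsPSector q n m c))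
  exist {Λ} Λ∈ = let d , d>0 , h = schurS n m Λ Λ Λ∈ Λ∈ 1ℚ (ℚₚ.positive⁻¹ 1ℚ) in d , d>0 , λ q a b → proj₁ (h q a b)

  c-lower : ∀ {q c Λ Ω} → IsPSector q n m c → Λ ∈ I → Ω ∈ I → c Λ Ω ≢ 0ℚ → Ω ⊴ Λ
  c-lower {q} {c} {Λ} {Ω} good Λ∈ Ω∈ h = from (Ω ≟SP Λ)
    where
    from : Dec (Ω ≡ Λ) → Ω ⊴ Λ
    from (yes e) = subst (Ω ⊴_) e (⊴-refl Ω)
    from (no ne) = let le = proj₁ (proj₂ good) Λ Ω Λ∈ Ω∈ ne h in proj₂ (proj₁ (proj₂ le)) , proj₂ (proj₂ (proj₂ le))

  S-diag : ∀ {Λ} → Λ ∈ I → S Λ Λ ≡ 1ℚ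
  S-diag {Λ} Λ∈ = tends-unique {λ _ c → c Λ Λ} 1ℚ (exist Λ∈) (λ _ _ _ good → proj₁ good Λ Λ∈) (c-tends Λ∈ Λ∈)

  S-lower : ∀ {Λ Ω} → Λ ∈ I → Ω ∈ I → S Λ Ω ≢ 0ℚ → Ω ⊴ Λ
  S-lower {Λ} {Ω} Λ∈ Ω∈ h = ⊴-stable Ω Λ (λ ¬d → h (tends-unique {λ _ c → c Λ Ω} 0ℚ (exist Λ∈) (λ _ _ _ good → ≡0-stable (λ ne → ¬d (c-lower good Λ∈ Ω∈ ne))) (c-tends Λ∈ Ω∈)))

  -- The power-sum coefficients of the Λ-th member, through the inverse transition matrix.
  coefs : (SPart → SPart → ℚ) → SPart → SPart → ℚ
  coefs c Λ Γ = ∑ I (λ Ω → c Λ Ω *ℚ inv-matrix Ω Γ)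

  realizeL-I : ∀ c {Λ} e s → Λ ∈ I → realizeL c Λ e s ≡ ∑ I (λ Ω → c Λ Ω *ℚ mL Ω e s)
  realizeL-I c {Λ} e s Λ∈ = cong₂ (λ n m → ∑ (sector n m) (λ Ω → c Λ Ω *ℚ mL Ω e s)) (bd Λ∈) (fd Λ∈)

  realizeL-power : ∀ c {Λ} e s → Λ ∈ I → length e ≡ m → realizeL c Λ e s ≡ ∑ I (λ Γ → coefs c Λ Γ *ℚ pL Γ (e ++ s))
  realizeL-power c {Λ} e s Λ∈ q = trans (realizeL-I c e s Λ∈) (trans (∑-cong I (λ Ω Ω∈ → cong (c Λ Ω *ℚ_) (mL-expand Ω e s Ω∈ q))) (∑-assoc I I (c Λ) inv-matrix (λ Γ → pL Γ (e ++ s))))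

  realize-power : ∀ N c {Λ} → Λ ∈ I → realize N c Λ ≐ ΣP I (λ Γ → coefs c Λ Γ ⊙ pP Γ)
  realize-power N c {Λ} Λ∈ (xs , T) = trans (realize-onExps N c Λ (xs , T)) (trans (from (countT T ≟ m)) (sym (ΣP-∑ I (λ Γ → coefs c Λ Γ ⊙ pP Γ) (xs , T))))
    where
    e = antiExps xs T
    s = bos xs T
    from : Dec (countT T ≡ m) → realizeL c Λ e s ≡ ∑ I (λ Γ → coefs c Λ Γ *ℚ pP Γ (xs , T))
    from (yes q) = trans (realizeL-power c e s Λ∈ (trans (length-antiExps xs T) q)) (∑-cong I (λ Γ Γ∈ → cong (coefs c Λ Γ *ℚ_) (sym (pP-pL Γ xs T (sp Γ∈) (trans q (sym (fd Γ∈)))))))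
    from (no ne) = trans (realizeL-0 c Λ e s (λ z → ne (trans (sym (length-antiExps xs T)) (trans z (fd Λ∈)))))
      (sym (∑-zero I (λ Γ Γ∈ → *-0ʳ (coefs c Λ Γ) (pP-0 Γ xs T (sp Γ∈) (λ z → ne (trans z (fd Γ∈)))))))

  -- ⟨⟨P_Λ, m_Ω⟩⟩
  pair : ℚ → (SPart → SPart → ℚ) → SPart → SPart → ℚ
  pair q c Λ Ω = ∑ I (λ Γ → coefs c Λ Γ *ℚ (inv-matrix Ω Γ *ℚ weight q Γ))

  -- By linearity the left side is the pairing of P_Λ with P_Ω, computed from the expansions that
  -- `realize-power` supplies to `Orth`.
  pair-P : ∀ {q c Λ Ω} → IsPSector q n m c → Λ ∈ I → Ω ∈ I → Ω ≢ Λ → ∑ I (λ Ω′ → c Ω Ω′ *ℚ pair q c Λ Ω′) ≡ 0ℚ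
  pair-P {q} {c} {Λ} {Ω} (_ , _ , orth) Λ∈ Ω∈ ne = begin
    ∑ I (λ Ω′ → c Ω Ω′ *ℚ pair q c Λ Ω′)
      ≡⟨ ∑-cong′ I (λ Ω′ → cong (c Ω Ω′ *ℚ_) (∑-cong′ I (λ Γ → solve 3 (λ x i w → x :* (i :* w) := i :* (x :* w)) refl (coefs c Λ Γ) (inv-matrix Ω′ Γ) (weight q Γ)))) ⟩
    ∑ I (λ Ω′ → c Ω Ω′ *ℚ ∑ I (λ Γ → inv-matrix Ω′ Γ *ℚ (coefs c Λ Γ *ℚ weight q Γ)))
      ≡⟨ ∑-assoc I I (c Ω) inv-matrix (λ Γ → coefs c Λ Γ *ℚ weight q Γ) ⟩
    ∑ I (λ Γ → coefs c Ω Γ *ℚ (coefs c Λ Γ *ℚ weight q Γ))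
      ≡⟨ ∑-cong′ I (λ Γ → solve 3 (λ y x w → y :* (x :* w) := x :* y :* w) refl (coefs c Ω Γ) (coefs c Λ Γ) (weight q Γ)) ⟩
    ∑ I (λ Γ → coefs c Λ Γ *ℚ coefs c Ω Γ *ℚ weight q Γ)
      ≡⟨ sym (sumℚ-∑ I (λ Γ → coefs c Λ Γ *ℚ coefs c Ω Γ *ℚ weight q Γ)) ⟩
    sumℚ (map (λ Γ → coefs c Λ Γ *ℚ coefs c Ω Γ *ℚ weight q Γ) I)
      ≡⟨ orth Λ Ω Λ∈ Ω∈ ne (coefs c Λ) (coefs c Ω) (realize-power (n + m) c Λ∈) (realize-power (n + m) c Ω∈) ⟩
    0ℚ ∎

  -- m_Ω lies in the span of the P_Ω′ with Ω′ ⊴ Ω.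
  pair-upper : ∀ {q c Λ Ω} → IsPSector q n m c → Λ ∈ I → Ω ∈ I → ¬ (Λ ⊴ Ω) → pair q c Λ Ω ≡ 0ℚ
  pair-upper {q} {c} {Λ} {Ω} good Λ∈ Ω∈ = go (suc (height Ω)) Ω∈ ≤-refl
    where
    go : ∀ k {Ω} → Ω ∈ I → height Ω < k → ¬ (Λ ⊴ Ω) → pair q c Λ Ω ≡ 0ℚ
    go (suc k) {Ω} Ω∈ (s≤s h) ¬d = trans (sym (trans
        (∑-single Ω (sector-Unique n m) Ω∈ (λ Ω′ Ω′∈ ne → *-vanish {c Ω Ω′} (λ nz → let le = c-lower good Ω∈ Ω′∈ nz in
          go k Ω′∈ (<-≤-trans (height-< Ω′∈ Ω∈ le ne) h) (λ d → ¬d (⊴-trans {Λ} {Ω′} {Ω} d le)))) (_≟SP Ω))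
        (*-1ˡ (pair q c Λ Ω) (proj₁ good Ω Ω∈))))
      (pair-P good Λ∈ Ω∈ (λ { refl → ¬d (⊴-refl Ω) }))

  -- ⟨⟨P_Λ, m_Ω⟩⟩ divided by q^{|Ω^a|}
  reduced : ℚ → (SPart → SPart → ℚ) → SPart → SPart → ℚ
  reduced q c Λ Ω = ∑ I (λ Γ → coefs c Λ Γ *ℚ (inv-matrix Ω Γ *ℚ (powℚ q (sum (proj₁ Γ) ∸ sum (proj₁ Ω)) *ℚ ℕtoℚ (zee (proj₂ Γ)))))

  -- The truncated difference in the exponent is a true one wherever it matters: if p_Γ occurs in
  -- m_Ω, then `inv-support` gives |Ω^a| ≤ |Γ^a|.
  reduced-pair : ∀ q c Λ Ω → Ω ∈ I → powℚ q (sum (proj₁ Ω)) *ℚ reduced q c Λ Ω ≡ pair q c Λ Ω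
  reduced-pair q c Λ Ω Ω∈ = trans (∑-*ˡ (powℚ q (sum (proj₁ Ω))) I (λ Γ → coefs c Λ Γ *ℚ (inv-matrix Ω Γ *ℚ (powℚ q (sum (proj₁ Γ) ∸ sum (proj₁ Ω)) *ℚ ℕtoℚ (zee (proj₂ Γ))))))
    (∑-cong I (λ Γ Γ∈ → trans
      (solve 5 (λ p x i r z → p :* (x :* (i :* (r :* z))) := x :* (i :* (p :* r :* z))) refl (powℚ q (sum (proj₁ Ω))) (coefs c Λ Γ) (inv-matrix Ω Γ) (powℚ q (sum (proj₁ Γ) ∸ sum (proj₁ Ω))) (ℕtoℚ (zee (proj₂ Γ))))
      (cong (coefs c Λ Γ *ℚ_) (*-congʳ-≢0 {inv-matrix Ω Γ} (λ nz → cong (_*ℚ ℕtoℚ (zee (proj₂ Γ)))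
        (trans (sym (powℚ-+ q (sum (proj₁ Ω)) (sum (proj₁ Γ) ∸ sum (proj₁ Ω)))) (cong (powℚ q) (m+[n∸m]≡n (inv-support Ω Γ Ω∈ Γ∈ nz)))))))))

  -- The limit of reduced: only the Γ with |Γ^a| = |Ω^a| survive.
  D : SPart → SPart → ℚ
  D Λ Ω = ∑ I (λ Γ → coefs S Λ Γ *ℚ (inv-matrix Ω Γ *ℚ when (sum (proj₁ Γ) ≡ᵇ sum (proj₁ Ω)) (ℕtoℚ (zee (proj₂ Γ)))))

  reduced-tends : ∀ {Λ Ω} → Λ ∈ I → Ω ∈ I → Tends (λ q c → reduced q c Λ Ω) (D Λ Ω)
  reduced-tends {Λ} {Ω} Λ∈ Ω∈ = subst (Tends (λ q c → reduced q c Λ Ω))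
    (∑-cong I (λ Γ Γ∈ → cong (coefs S Λ Γ *ℚ_) (*-congʳ-≢0 {inv-matrix Ω Γ} (λ nz → powℚ-0 (ℕtoℚ (zee (proj₂ Γ))) (inv-support Ω Γ Ω∈ Γ∈ nz)))))
    (tends-∑ I {λ Γ q c → coefs c Λ Γ *ℚ (inv-matrix Ω Γ *ℚ (powℚ q (ex Γ) *ℚ ℕtoℚ (zee (proj₂ Γ))))} (λ Γ _ →
      tends-* {λ q c → coefs c Λ Γ} {λ q c → inv-matrix Ω Γ *ℚ (powℚ q (ex Γ) *ℚ ℕtoℚ (zee (proj₂ Γ)))}
        (tends-∑ I {λ Ω′ q c → c Λ Ω′ *ℚ inv-matrix Ω′ Γ} (λ Ω′ Ω′∈ → tends-* {λ q c → c Λ Ω′} {λ _ _ → inv-matrix Ω′ Γ} (c-tends Λ∈ Ω′∈) (tends-const (inv-matrix Ω′ Γ))))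
        (tends-* {λ _ _ → inv-matrix Ω Γ} {λ q _ → powℚ q (ex Γ) *ℚ ℕtoℚ (zee (proj₂ Γ))} (tends-const (inv-matrix Ω Γ))
          (tends-* {λ q _ → powℚ q (ex Γ)} {λ _ _ → ℕtoℚ (zee (proj₂ Γ))} (tends-pow (ex Γ)) (tends-const (ℕtoℚ (zee (proj₂ Γ))))))))
    where
    ex : SPart → ℕ
    ex Γ = sum (proj₁ Γ) ∸ sum (proj₁ Ω)

  -- For q ≠ 0 the power of q can be cancelled, so `pair-upper` makes `reduced` vanish, and zero
  -- passes to the limit.
  D-upper : ∀ {Λ Ω} → Λ ∈ I → Ω ∈ I → D Λ Ω ≢ 0ℚ → Λ ⊴ Ω
  D-upper {Λ} {Ω} Λ∈ Ω∈ h = ⊴-stable Λ Ω (λ ¬d → h (tends-unique {λ q c → reduced q c Λ Ω} 0ℚ (exist Λ∈)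
    (λ q c q>0 good → *-cancel (powℚ-≢0 {q} (λ z → ℚₚ.<-irrefl refl (subst (λ y → 0ℚ <ℚ ∣ y ∣ℚ) z q>0)) (sum (proj₁ Ω)))
      (trans (reduced-pair q c Λ Ω Ω∈) (trans (pair-upper good Λ∈ Ω∈ ¬d) (sym (ℚₚ.*-zeroʳ (powℚ q (sum (proj₁ Ω)))))))) (reduced-tends Λ∈ Ω∈)))

  -- Duality of the m_Ω and the `HL Ω` for the limit pairing. If |Δ^a| = |Γ^a|, the supports of R
  -- and of its inverse squeeze |Ω^a| to the same value, so the gates drop out and R times its
  -- inverse remains, with z and 1 / z cancelling on the diagonal. Otherwise the two gates exclude
  -- each other.
  block : ∀ Γ Δ → Γ ∈ I → Δ ∈ I →
    ∑ I (λ Ω → (inv-matrix Ω Δ *ℚ when (sum (proj₁ Δ) ≡ᵇ sum (proj₁ Ω)) (ℕtoℚ (zee (proj₂ Δ)))) *ℚ η Ω Γ) ≡ δ Γ Δ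
  block Γ Δ Γ∈ Δ∈ = from (sum (proj₁ Δ) ≟ sum (proj₁ Γ))
    where
    w = wz (proj₂ Γ)
    z = ℕtoℚ (zee (proj₂ Δ))
    term′ : SPart → ℚ
    term′ Ω = (inv-matrix Ω Δ *ℚ when (sum (proj₁ Δ) ≡ᵇ sum (proj₁ Ω)) z) *ℚ η Ω Γ
    left-0 : ∀ Ω → sum (proj₁ Δ) ≢ sum (proj₁ Ω) → term′ Ω ≡ 0ℚ
    left-0 Ω ne = trans (cong (λ b → (inv-matrix Ω Δ *ℚ when b z) *ℚ η Ω Γ) (≢→≡ᵇ {sum (proj₁ Δ)} ne)) (*-0ˡ (η Ω Γ) (ℚₚ.*-zeroʳ (inv-matrix Ω Δ)))
    right-0 : ∀ Ω → sum (proj₁ Γ) ≢ sum (proj₁ Ω) → term′ Ω ≡ 0ℚ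
    right-0 Ω ne = trans (cong (λ b → (inv-matrix Ω Δ *ℚ when (sum (proj₁ Δ) ≡ᵇ sum (proj₁ Ω)) z) *ℚ when b (w *ℚ R Γ Ω)) (≢→≡ᵇ {sum (proj₁ Γ)} ne))
      (ℚₚ.*-zeroʳ (inv-matrix Ω Δ *ℚ when (sum (proj₁ Δ) ≡ᵇ sum (proj₁ Ω)) z))
    R-≤ : ∀ Ω → Ω ∈ I → R Γ Ω ≢ 0ℚ → Dec (Γ ≡ Ω) → sum (proj₁ Γ) ≤ sum (proj₁ Ω)
    R-≤ Ω Ω∈ nz (yes q) = ≤-reflexive (cong (sum ∘ proj₁) q)
    R-≤ Ω Ω∈ nz (no ne) = proj₂ (R-support Γ Ω Γ∈ Ω∈ ne nz)
    on-block : sum (proj₁ Δ) ≡ sum (proj₁ Γ) → ∀ Ω → Ω ∈ I → Dec (sum (proj₁ Δ) ≡ sum (proj₁ Ω)) → term′ Ω ≡ (w *ℚ z) *ℚ (R Γ Ω *ℚ inv-matrix Ω Δ)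
    on-block e Ω Ω∈ (yes q) = trans (cong₂ (λ b b′ → (inv-matrix Ω Δ *ℚ when b z) *ℚ when b′ (w *ℚ R Γ Ω)) (≡→≡ᵇ {sum (proj₁ Δ)} q) (≡→≡ᵇ {sum (proj₁ Γ)} (trans (sym e) q)))
      (solve 4 (λ i z w r → (i :* z) :* (w :* r) := (w :* z) :* (r :* i)) refl (inv-matrix Ω Δ) z w (R Γ Ω))
    on-block e Ω Ω∈ (no q) = trans (left-0 Ω q) (sym (*-0ʳ (w *ℚ z) (*-vanish {R Γ Ω} (λ nz → ≡0-stable (λ nz′ →
      q (≤-antisym (≤-trans (≤-reflexive e) (R-≤ Ω Ω∈ nz (Γ ≟SP Ω))) (inv-support Ω Δ Ω∈ Δ∈ nz′)))))))
    unit-δ : Dec (Γ ≡ Δ) → (w *ℚ z) *ℚ δ Γ Δ ≡ δ Γ Δ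
    unit-δ (yes e) = *-1ˡ (δ Γ Δ) (trans (cong (λ Λ → w *ℚ ℕtoℚ (zee (proj₂ Λ))) (sym e)) (trans (ℚₚ.*-comm w (ℕtoℚ (zee (proj₂ Γ)))) (wz-* (proj₂ Γ))))
    unit-δ (no ne) = trans (cong ((w *ℚ z) *ℚ_) (δ-≢ ne)) (trans (ℚₚ.*-zeroʳ (w *ℚ z)) (sym (δ-≢ ne)))
    off-block : sum (proj₁ Δ) ≢ sum (proj₁ Γ) → ∀ Ω → Dec (sum (proj₁ Δ) ≡ sum (proj₁ Ω)) → term′ Ω ≡ 0ℚ
    off-block ne Ω (yes e) = right-0 Ω (λ q → ne (trans e (sym q)))
    off-block ne Ω (no q)  = left-0 Ω q
    from : Dec (sum (proj₁ Δ) ≡ sum (proj₁ Γ)) → ∑ I term′ ≡ δ Γ Δ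
    from (no ne) = trans (∑-zero I (λ Ω _ → off-block ne Ω (sum (proj₁ Δ) ≟ sum (proj₁ Ω)))) (sym (δ-≢ {Γ} {Δ} (λ e → ne (cong (sum ∘ proj₁) (sym e)))))
    from (yes e) = trans (∑-cong I (λ Ω Ω∈ → on-block e Ω Ω∈ (sum (proj₁ Δ) ≟ sum (proj₁ Ω)))) (trans (sym (∑-*ˡ (w *ℚ z) I (λ Ω → R Γ Ω *ℚ inv-matrix Ω Δ)))
      (trans (cong ((w *ℚ z) *ℚ_) (T-inv Γ Δ Γ∈)) (unit-δ (Γ ≟SP Δ))))

  -- The expansion of s_Λ in the dual basis; its coefficients are the limit pairings `D` with the
  -- m_Ω.
  coefs-D : ∀ Λ Γ → Γ ∈ I → coefs S Λ Γ ≡ ∑ I (λ Ω → D Λ Ω *ℚ η Ω Γ)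
  coefs-D Λ Γ Γ∈ = sym (begin
    ∑ I (λ Ω → D Λ Ω *ℚ η Ω Γ)
      ≡⟨ sym (∑-assoc I I (coefs S Λ) (λ Δ Ω → inv-matrix Ω Δ *ℚ when (sum (proj₁ Δ) ≡ᵇ sum (proj₁ Ω)) (ℕtoℚ (zee (proj₂ Δ)))) (λ Ω → η Ω Γ)) ⟩
    ∑ I (λ Δ → coefs S Λ Δ *ℚ ∑ I (λ Ω → (inv-matrix Ω Δ *ℚ when (sum (proj₁ Δ) ≡ᵇ sum (proj₁ Ω)) (ℕtoℚ (zee (proj₂ Δ)))) *ℚ η Ω Γ))
      ≡⟨ ∑-cong I (λ Δ Δ∈ → trans (cong (coefs S Λ Δ *ℚ_) (block Γ Δ Γ∈ Δ∈)) (ℚₚ.*-comm (coefs S Λ Δ) (δ Γ Δ))) ⟩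
    ∑ I (λ Δ → δ Γ Δ *ℚ coefs S Λ Δ)
      ≡⟨ ∑-δˡ Γ (coefs S Λ) Γ∈ ⟩
    coefs S Λ Γ ∎)

  module _ (M : ℕ) (n<M : n < M) where

    expansion : ∀ Ω → Ω ∈ I → SchurExpansion M (proj₁ Ω) (proj₂ Ω)
    expansion (a , s) Ω∈ = schurExpansion M a s (IsSP.strict (sp Ω∈)) (subst (_< M) (sym (bd Ω∈)) n<M)

    -- `expansion` takes membership in the sector as an argument. Deciding it, with 0 as default,
    -- makes the coefficients a matrix on all superpartitions.
    K-at : ∀ Ω → Dec (Ω ∈ I) → SPart → ℚ
    K-at Ω (yes Ω∈) = SchurExpansion.K (expansion Ω Ω∈)
    K-at Ω (no _)   = λ _ → 0ℚ

    K-at-expands : ∀ Ω d e s → Ω ∈ I → length e ≡ m → sum e + sum s < M → HL Ω (e ++ s) ≡ ∑ I (λ Γ → K-at Ω d Γ *ℚ FS M Γ e s)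
    K-at-expands Ω (no h)  e s Ω∈ q lt = ⊥-elim (h Ω∈)
    K-at-expands Ω (yes h) e s Ω∈ q lt = trans (SchurExpansion.expands (expansion Ω h) e s (trans q (sym (fd h))) lt)
      (cong₂ (λ n m → ∑ (sector n m) (λ Γ → SchurExpansion.K (expansion Ω h) Γ *ℚ FS M Γ e s)) (bd h) (fd h))

    K-at-upper : ∀ Ω d Γ → Γ ∈ I → K-at Ω d Γ ≢ 0ℚ → Ω ⊴ Γ
    K-at-upper Ω (yes h) Γ Γ∈ nz = SchurExpansion.dominates (expansion Ω h) Γ (subst₂ (λ n m → Γ ∈ sector n m) (sym (bd h)) (sym (fd h)) Γ∈) nz
    K-at-upper Ω (no h)  Γ Γ∈ nz = ⊥-elim (nz refl)

    _∈I? : ∀ Ω → Dec (Ω ∈ I)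
    Ω ∈I? = DecMembership._∈?_ _≟SP_ Ω I

    K : SPart → SPart → ℚ
    K Ω = K-at Ω (Ω ∈I?)

    E : SPart → SPart → ℚ
    E Λ Γ = ∑ I (λ Ω → D Λ Ω *ℚ K Ω Γ)

    E-upper : ∀ {Λ Γ} → Λ ∈ I → Γ ∈ I → E Λ Γ ≢ 0ℚ → Λ ⊴ Γ
    E-upper {Λ} {Γ} Λ∈ Γ∈ nz =
      let Ω , Ω∈ , h = ∑-nonzero I (λ Ω → D Λ Ω *ℚ K Ω Γ) nz
          d , k = *-nonzero {D Λ Ω} h
      in ⊴-trans {Λ} {Ω} {Γ} (D-upper Λ∈ Ω∈ d) (K-at-upper Ω (Ω ∈I?) Γ Γ∈ k)

    S-expand : ∀ {Λ} e s → Λ ∈ I → length e ≡ m → sum e + sum s < M → realizeL S Λ e s ≡ ∑ I (λ Γ → E Λ Γ *ℚ FS M Γ e s)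
    S-expand {Λ} e s Λ∈ q lt = begin
      realizeL S Λ e s
        ≡⟨ realizeL-power S e s Λ∈ q ⟩
      ∑ I (λ Γ → coefs S Λ Γ *ℚ pL Γ (e ++ s))
        ≡⟨ ∑-cong I (λ Γ Γ∈ → cong (_*ℚ pL Γ (e ++ s)) (coefs-D Λ Γ Γ∈)) ⟩
      ∑ I (λ Γ → ∑ I (λ Ω → D Λ Ω *ℚ η Ω Γ) *ℚ pL Γ (e ++ s))
        ≡⟨ sym (∑-assoc I I (D Λ) η (λ Γ → pL Γ (e ++ s))) ⟩
      ∑ I (λ Ω → D Λ Ω *ℚ ∑ I (λ Γ → η Ω Γ *ℚ pL Γ (e ++ s)))
        ≡⟨ ∑-cong I (λ Ω Ω∈ → cong (D Λ Ω *ℚ_) (trans (sym (HL-power Ω (e ++ s) Ω∈)) (K-at-expands Ω (Ω ∈I?) e s Ω∈ q lt))) ⟩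
      ∑ I (λ Ω → D Λ Ω *ℚ ∑ I (λ Γ → K Ω Γ *ℚ FS M Γ e s))
        ≡⟨ ∑-assoc I I (D Λ) K (λ Γ → FS M Γ e s) ⟩
      ∑ I (λ Γ → E Λ Γ *ℚ FS M Γ e s) ∎

    c : SPart → SPart → ℚ
    c Γ Ω = FS M Γ (proj₁ Ω) (proj₂ Ω)

    S-E : ∀ {Λ Ω} → Λ ∈ I → Ω ∈ I → S Λ Ω ≡ ∑ I (λ Γ → E Λ Γ *ℚ c Γ Ω)
    S-E {Λ} {Ω} Λ∈ Ω∈ = trans (sym (trans (realizeL-I S (proj₁ Ω) (proj₂ Ω) Λ∈) (trans
        (∑-single Ω (sector-Unique n m) Ω∈ (λ Γ _ ne → *-0ʳ (S Λ Γ) (mL-off Γ (sp Ω∈) ne)) (_≟SP Ω))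
        (*-1ʳ (S Λ Ω) (mL-diag (sp Ω∈))))))
      (S-expand (proj₁ Ω) (proj₂ Ω) Λ∈ (fd Ω∈) (subst (_< M) (sym (bd Ω∈)) n<M))

    S-E-single : ∀ {Λ Ω} → Λ ∈ I → Ω ∈ I → (∀ Γ → Γ ∈ I → Γ ≢ Ω → Ω ⊴ Γ → E Λ Γ ≡ 0ℚ) → S Λ Ω ≡ E Λ Ω
    S-E-single {Λ} {Ω} Λ∈ Ω∈ h = trans (S-E Λ∈ Ω∈) (trans
      (∑-single Ω (sector-Unique n m) Ω∈ (λ Γ Γ∈ ne → trans (ℚₚ.*-comm (E Λ Γ) (c Γ Ω)) (*-vanish {c Γ Ω} (λ nz → h Γ Γ∈ ne (FS-dominant M Γ (proj₁ Ω) (proj₂ Ω) (sp Γ∈) (subst (_< M) (sym (bd Γ∈)) n<M) nz)))) (_≟SP Ω))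
      (*-1ʳ (E Λ Ω) (FS-leading M Ω (sp Ω∈) (subst (_< M) (sym (bd Ω∈)) n<M))))

    -- Downward induction along dominance. If E Λ Γ were nonzero, Γ would dominate Λ; the
    -- coefficients strictly above Γ vanish already, so E Λ Γ would equal S Λ Γ, and then Γ would
    -- also be dominated by Λ.
    E-off : ∀ {Λ Γ} → Λ ∈ I → Γ ∈ I → Γ ≢ Λ → E Λ Γ ≡ 0ℚ
    E-off {Λ} {Γ} Λ∈ Γ∈ = go (suc (top ∸ height Γ)) Γ∈ ≤-refl
      where
      -- A convenient upper bound for all heights in the sector.
      top = sum (map height I)
      go : ∀ k {Γ} → Γ ∈ I → top ∸ height Γ < k → Γ ≢ Λ → E Λ Γ ≡ 0ℚ
      go (suc k) {Γ} Γ∈ (s≤s h) ne = ≡0-stable (λ nz → let le = E-upper Λ∈ Γ∈ nz in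
        nz (trans (sym (S-E-single Λ∈ Γ∈ (λ Γ′ Γ′∈ ne′ le′ →
            go k Γ′∈ (<-≤-trans (ℕₚ.∸-monoʳ-< (height-< Γ∈ Γ′∈ le′ (ne′ ∘ sym)) (∈-sum (map height I) (∈ₚ.∈-map⁺ height Γ′∈))) h)
              (λ { refl → ne (⊴-antisym Γ∈ Λ∈ le′ le) }))))
          (≡0-stable (λ s → ne (⊴-antisym Γ∈ Λ∈ (S-lower Λ∈ Γ∈ s) le)))))

    S-FS : ∀ {Λ} e s → Λ ∈ I → length e ≡ m → sum e + sum s < M → realizeL S Λ e s ≡ FS M Λ e s
    S-FS {Λ} e s Λ∈ q lt = trans (S-expand e s Λ∈ q lt) (trans
      (∑-single Λ (sector-Unique n m) Λ∈ (λ Γ Γ∈ ne → *-0ˡ (FS M Γ e s) (E-off Λ∈ Γ∈ ne)) (_≟SP Λ))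
      (*-1ˡ (FS M Λ e s) (trans (sym (S-E-single Λ∈ Λ∈ (λ Γ Γ∈ ne _ → E-off Λ∈ Γ∈ ne))) (S-diag Λ∈))))

theorem6p1 : (S : SPart → SPart → ℚ) → IsSchur S →
    (Λ : SPart) → isSPart Λ ≡ true → (ℓ : ℕ) → 1 ≤ ℓ →
    (L : List SPart) → Unique L →
    (∀ Ω → (Ω ∈S L → Admissible Λ ℓ Ω) × (Admissible Λ ℓ Ω → Ω ∈S L)) →
    (N : ℕ) → (realize N S Λ ⊗ hP ℓ) ≐ ΣP L (realize N S)
theorem6p1 S schurS Λ spΛ ℓ _ L uL adm N (xs , T) = begin
  (realize N S Λ ⊗ hP ℓ) (xs , T)         ≡⟨ realize-⊗-hP N S Λ ℓ (xs , T) ⟩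
  hop ℓ (realizeL S Λ) e s                ≡⟨ main (length e ≟ fdeg Λ) ⟩
  ∑ L (λ Ω → realizeL S Ω e s)            ≡⟨ sym (trans (ΣP-∑ L (realize N S) (xs , T)) (∑-cong′ L (λ Ω → realize-onExps N S Ω (xs , T)))) ⟩
  ΣP L (realize N S) (xs , T) ∎
  where
  e = antiExps xs T
  s = bos xs T
  iΛ = isSPart→ Λ spΛ
  -- It exceeds the degree of the monomial and of every superpartition involved. One coefficient is
  -- compared at a time, so `M` may depend on it.
  M = suc ((sum e + sum s) + (bdeg Λ + ℓ))
  iΩ : ∀ {Ω} → Ω ∈ L → IsSP Ω
  iΩ {Ω} h = isSPart→ Ω (proj₁ (proj₁ (adm Ω) h))
  fΩ : ∀ {Ω} → Ω ∈ L → fdeg Ω ≡ fdeg Λ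
  fΩ {Ω} h = proj₁ (proj₂ (proj₁ (adm Ω) h))
  deg<M : sum e + sum s < M
  deg<M = s≤s (m≤m+n (sum e + sum s) (bdeg Λ + ℓ))
  Ω<M : ∀ {Ω} → Ω ∈ L → bdeg Ω < M
  Ω<M {Ω} h = s≤s (≤-trans (≤-reflexive (admissible-bdeg Λ ℓ Ω (proj₁ (adm Ω) h))) (m≤n+m (bdeg Λ + ℓ) (sum e + sum s)))
  Λ<M : bdeg Λ < M
  Λ<M = s≤s (≤-trans (m≤m+n (bdeg Λ) ℓ) (m≤n+m (bdeg Λ + ℓ) (sum e + sum s)))
  main : Dec (length e ≡ fdeg Λ) → hop ℓ (realizeL S Λ) e s ≡ ∑ L (λ Ω → realizeL S Ω e s)
  main (yes q) = begin
    hop ℓ (realizeL S Λ) e s      ≡⟨ hop-cong ℓ e s (λ e′ s′ p le → Family.S-FS (bdeg Λ) (fdeg Λ) S schurS M Λ<M e′ s′ (→sector iΛ) (trans p q) (≤-<-trans le deg<M)) ⟩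
    hop ℓ (FS M Λ) e s            ≡⟨ pieriSP M Λ ℓ L iΛ uL adm e s deg<M ⟩
    ∑ L (λ Ω → FS M Ω e s)        ≡⟨ ∑-cong L (λ Ω h → sym (Family.S-FS (bdeg Ω) (fdeg Ω) S schurS M (Ω<M h) e s (→sector (iΩ h)) (trans q (sym (fΩ h))) deg<M)) ⟩
    ∑ L (λ Ω → realizeL S Ω e s) ∎
  -- The number of θ in the monomial differs from the fermionic degree, so both sides are zero.
  main (no ne) = trans
    (trans (hop-cong ℓ {realizeL S Λ} {λ _ _ → 0ℚ} e s (λ e′ s′ p _ → realizeL-0 S Λ e′ s′ (λ z → ne (trans (sym p) z))))
      (∑-zero (sub e) (λ e′ _ → ∑-zero (sub s) (λ s′ _ → when-zero ((sum e′ + sum s′) + ℓ ≡ᵇ sum e + sum s)))))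
    (sym (∑-zero L (λ Ω h → realizeL-0 S Ω e s (λ z → ne (trans z (fΩ h))))))
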